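{- Fix a permutation $\pi$ and a mixed $k$-chain $\mathbf{c}$ for $\pi$. Then the Schubert polynomial satisfies \[\mathfrak{S}_\pi=\sum_{Q}\operatorname{wt}(Q),\] the sum over all biwords $Q$ whose recording chain for right insertion is $\mathbf{c}$, i.e. such that $\mathcal{R}(Q)=(D,\mathbf c)$ for some BPD $D$.
   Context: Permutations are in one-line notation, $\ell$ is length, $\pi t_{ab}$ swaps the entries of $\pi$ in positions $a,b$; $\rho\lessdot_k\pi$ means $\pi=\rho t_{ab}$ with $a\le k<b$ and $\ell(\pi)=\ell(\rho)+1$. A mixed $k$-chain for $\pi$ is a chain $\mathrm{id}\lessdot_{k_1}\pi_1\lessdot_{k_2}\cdots\lessdot_{k_\ell}\pi_\ell=\pi$ together with its labels $k_i$. Bumpless pipe dreams. Cells $(i,j)$ of the $n\times n$ grid (row $i$ from the top, column $j$ from the left) carry tiles recording which cell edges are joined by pipe segments: blank (none), horizontal (W–E), vertical (S–N), cross (W–E and S–N, two pipes), r-elbow (S–E), j-elbow (W–N), and, in intermediate stages only, bump (a W–N elbow and an S–E elbow carried by two different pipes). A bumpless pipe dream (BPD) of $\pi\in S_n$ is a tiling by the first six tiles whose segments form pipes such that for each $c$ the pipe $c$ enters at the bottom of column $c$, moves only north and east, and exits at the right end of row $\pi^{ -1}(c)$ ("pipe $c$ exits from row $\pi^{ -1}(c)$"), any two pipes crossing at most once; $\mathrm{BPD}(\pi)$ is the set of these, $\mathrm{perm}(D)=\pi$, and $I$ is the unique BPD of the identity. The weight of $D$ is $\prod x_i$ over the blank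 tiles $(i,j)$, and $\mathfrak S_\pi=\sum_{D\in\mathrm{BPD}(\pi)}\operatorname{wt}(D)$. During the algorithm one cell may be a bump; pipes, exits and crossings are traced the same way. A pipe has an r-turn at a cell where it enters from the south and leaves east (r-elbow or SE part of a bump). Moves. min-droop at $(a,b)$, where pipe $p$ has an r-turn: let $x>0$ be smallest with $(a+x,b)$ not a cross and $y>0$ smallest with $(a,b+y)$ not a cross. Within the rectangle with corners $(a,b)$ and $(a+x,b+y)$, $p$ runs up the left column from $(a+x,b)$ to $(a,b)$ and then along the top row to $(a,b+y)$; replace this by the route along the bottom row from $(a+x,b)$ to $(a+x,b+y)$ and up the right column to $(a,b+y)$, other pipes unchanged, tiles redetermined by the segments (so $p$ gets a W–N turn at $(a+x,b+y)$, which becomes a j-elbow if it was blank and a bump if it was an r-elbow). Set $\operatorname{min-droop}(a,b)=(a+x,b+y)$. cross-bump-swap at a bump $(a,b)$ whose two pipes also cross at $(a',b')$: $(a,b)$ becomes a cross and $(a',b')$ a bump; $\operatorname{cross-bump-swap}(a,b)=(a',b')$. A biletter $b_k$ is a pair of positive integers with $b\le k$; a biword is a word of biletters; its weight is $\operatorname{wt}((b_1)_{k_1}\cdots(b_\ell)_{k_\ell})=\prod_i x_{b_i}$. Right insertion $D\leftarrow b_k$: let $(i,j)$ be the r-elbow in row $b$ with $j$ maximal. (1) min-droop at $(i,j)$; $(i_1,j_1)=\operatorname{min-droop}(i,j)$. (2) If $(i_1,j_1)$ is a j-elbow, let $(i_1,j_2)$ be the r-elbow in row $i_1$ with $j_2<j_1$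 maximal, set $(i,j)=(i_1,j_2)$, go to (1). (3) If it is a bump: (a) if its two pipes cross somewhere, perform cross-bump-swap, set $(i,j)=\operatorname{cross-bump-swap}(i_1,j_1)$, go to (1); (b) otherwise let $p$ be the pipe with the r-turn there; if $p$ exits from a row $r\le k$, set $(i,j)=(i_1,j_1)$ and go to (1); otherwise replace the bump by a cross and stop. For $D\in\mathrm{BPD}(\pi)$ the output lies in $\mathrm{BPD}(\pi t_{\alpha\beta})$ for some $\alpha\le k<\beta$ with $\pi\lessdot_k\pi t_{\alpha\beta}$. Recording chain for right insertion: $\mathcal R(\emptyset)=(I,\mathrm{id})$, and if $Q=Q'b_k$ with $\mathcal R(Q')=(D,\mathbf c')$ then $\mathcal R(Q)=(D\leftarrow b_k,\ \mathbf c'\lessdot_k\mathrm{perm}(D\leftarrow b_k))$ (the chain $\mathbf c'$ extended by one step labelled $k$). The second component is the recording chain for right insertion of $Q$. -}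

module Defs where

-- Bumpless pipe dreams, right insertion, recording chains (Theorem 3.11 setup).
-- Conventions: rows/columns/values are 1-indexed natural numbers.

open import Data.Nat using (ℕ; zero; suc; _+_; _*_; _∸_; _≤_; _<_; _≡ᵇ_; _<ᵇ_; _≤ᵇ_)
open import Data.Bool using (Bool; true; false; _∧_; _∨_; not; if_then_else_)
open import Data.List using (List; []; _∷_; map; length; applyUpTo; filterᵇ; _++_; concatMap)
open import Data.Bool.ListAction using (any)
open import Data.Maybe using (Maybe; just; nothing)
open import Data.Product using (Σ; _×_; _,_; proj₁; proj₂; ∃)
open import Relation.Binary.PropositionalEquality using (_≡_)
open import Relation.Nullary using (¬_)
open import Data.List.Relation.Binary.Permutation.Propositional using (_↭_)

range1 : ℕ → List ℕ
range1 n = applyUpTo suc n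

-- 1-indexed lookup with default 0
nth : List ℕ → ℕ → ℕ
nth []       _             = 0
nth (x ∷ xs) zero          = 0
nth (x ∷ xs) (suc zero)    = x
nth (x ∷ xs) (suc (suc i)) = nth xs (suc i)

countᵇ : {A : Set} → (A → Bool) → List A → ℕ
countᵇ p xs = length (filterᵇ p xs)

-- the sublist of xs of elements satisfying P (relational filter; no decidability needed)
data Filtered {A : Set} (P : A → Set) : List A → List A → Set where
  f-nil  : Filtered P [] []
  f-keep : ∀ {x xs ys} → P x → Filtered P xs ys → Filtered P (x ∷ xs) (x ∷ ys)
  f-drop : ∀ {x xs ys} → ¬ P x → Filtered P xs ys → Filtered P (x ∷ xs) ys

-- Permutations in one-line notation (lists of length n)

IsPerm : ℕ → List ℕ → Set
IsPerm n w = w ↭ range1 n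

idPerm : ℕ → List ℕ
idPerm n = range1 n

swapAt : List ℕ → ℕ → ℕ → List ℕ
swapAt w a b = map (λ i → nth w (if i ≡ᵇ a then b else (if i ≡ᵇ b then a else i)))
                   (range1 (length w))

inv : List ℕ → ℕ
inv []       = 0
inv (x ∷ xs) = countᵇ (λ y → y <ᵇ x) xs + inv xs

Cover : ℕ → ℕ → List ℕ → List ℕ → Set
Cover n k ρ σ = Σ ℕ λ a → Σ ℕ λ b →
  (1 ≤ a) × (a ≤ k) × (k < b) × (b ≤ n) × (σ ≡ swapAt ρ a b) × (inv σ ≡ suc (inv ρ))

-- A chain is recorded as the list of its steps (k_i , π_i), i = 1..ℓ; π_0 = id is implicit.
Chain : Set
Chain = List (ℕ × List ℕ)

data ChainFrom (n : ℕ) : List ℕ → Chain → List ℕ → Set where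
  ch-nil  : ∀ {ρ} → ChainFrom n ρ [] ρ
  ch-cons : ∀ {ρ σ k c π} → Cover n k ρ σ → ChainFrom n σ c π → ChainFrom n ρ ((k , σ) ∷ c) π

MixedKChain : ℕ → List ℕ → Chain → Set
MixedKChain n π c = ChainFrom n (idPerm n) c π

-- Tiles, recorded by which pipe connections are present:
-- we = W–E, sn = S–N, wn = W–N, se = S–E.

record Tile : Set where
  constructor tile
  field
    we sn wn se : Bool
open Tile public

tBlank tHor tVer tCross tR tJ tBump : Tile
tBlank = tile false false false false
tHor   = tile true  false false false
tVer   = tile false true  false false
tCross = tile true  true  false false
tR     = tile false false false true
tJ     = tile false false true  false
tBump  = tile false false true  true

eqBool : Bool → Bool → Bool
eqBool true  b = b
eqBool false b = not b

eqTile : Tile → Tile → Bool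
eqTile (tile a b c d) (tile a' b' c' d') = eqBool a a' ∧ eqBool b b' ∧ eqBool c c' ∧ eqBool d d'

bpdTiles : List Tile
bpdTiles = tBlank ∷ tHor ∷ tVer ∷ tCross ∷ tR ∷ tJ ∷ []

segW segE segS segN : Tile → Bool
segW t = we t ∨ wn t
segE t = we t ∨ se t
segS t = sn t ∨ se t
segN t = sn t ∨ wn t

-- A grid: cell (i , j), row i from the top, column j from the left (1-indexed)
Grid : Set
Grid = ℕ → ℕ → Tile

inGrid : ℕ → ℕ → ℕ → Bool
inGrid n i j = (1 ≤ᵇ i) ∧ (i ≤ᵇ n) ∧ (1 ≤ᵇ j) ∧ (j ≤ᵇ n)

setCell : Grid → ℕ → ℕ → Tile → Grid
setCell G a b t i j = if (i ≡ᵇ a) ∧ (j ≡ᵇ b) then t else G i j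

data Conn : Set where
  cWE cSN cWN cSE : Conn

eqConn : Conn → Conn → Bool
eqConn cWE cWE = true
eqConn cSN cSN = true
eqConn cWN cWN = true
eqConn cSE cSE = true
eqConn _   _   = false

Step : Set
Step = ℕ × ℕ × Conn

TraceResult : Set
TraceResult = List Step × Maybe ℕ   -- visited (cell, connection), exit row on the right

consStep : Step → TraceResult → TraceResult
consStep s (p , e) = (s ∷ p , e)

mutual
  -- trace n G fuel i j fromS : the pipe is at cell (i,j), having entered from the
  -- south (fromS = true) or from the west (fromS = false)
  trace : ℕ → Grid → ℕ → ℕ → ℕ → Bool → TraceResult
  trace n G zero    i j s     = ([] , nothing)
  trace n G (suc f) i j true  =
    if sn (G i j) then goN n G f i j cSN
    else (if se (G i j) then goE n G f i j cSE else ([] , nothing))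
  trace n G (suc f) i j false =
    if we (G i j) then goE n G f i j cWE
    else (if wn (G i j) then goN n G f i j cWN else ([] , nothing))

  goN : ℕ → Grid → ℕ → ℕ → ℕ → Conn → TraceResult
  goN n G f i j c = if i ≤ᵇ 1 then ((i , j , c) ∷ [] , nothing)
                    else consStep (i , j , c) (trace n G f (i ∸ 1) j true)

  goE : ℕ → Grid → ℕ → ℕ → ℕ → Conn → TraceResult
  goE n G f i j c = if n ≤ᵇ j then ((i , j , c) ∷ [] , just i)
                    else consStep (i , j , c) (trace n G f i (suc j) false)

pipeTrace : ℕ → Grid → ℕ → TraceResult
pipeTrace n G c = trace n G (2 * n) n c true

pipePath : ℕ → Grid → ℕ → List Step
pipePath n G c = proj₁ (pipeTrace n G c)

exitRow : ℕ → Grid → ℕ → Maybe ℕ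
exitRow n G c = proj₂ (pipeTrace n G c)

eqStep : Step → Step → Bool
eqStep (i , j , c) (i' , j' , c') = (i ≡ᵇ i') ∧ (j ≡ᵇ j') ∧ eqConn c c'

passes : List Step → ℕ → ℕ → Bool
passes p i j = any (λ { (i' , j' , _) → (i ≡ᵇ i') ∧ (j ≡ᵇ j') }) p

crossings : ℕ → Grid → ℕ → ℕ → ℕ
crossings n G c d =
  countᵇ (λ { (i , j , _) → eqTile (G i j) tCross ∧ passes (pipePath n G d) i j })
         (pipePath n G c)

firstWith : (ℕ → Bool) → List ℕ → Maybe ℕ
firstWith p []       = nothing
firstWith p (x ∷ xs) = if p x then just x else firstWith p xs

pipeAt : ℕ → Grid → ℕ → ℕ → Conn → Maybe ℕ
pipeAt n G i j κ = firstWith (λ c → any (eqStep (i , j , κ)) (pipePath n G c)) (range1 n)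

permOf : ℕ → Grid → List ℕ
permOf n G = map (λ r → pick (firstWith (λ c → isRow (exitRow n G c) r) (range1 n))) (range1 n)
  where
  isRow : Maybe ℕ → ℕ → Bool
  isRow (just r') r = r' ≡ᵇ r
  isRow nothing   r = false
  pick : Maybe ℕ → ℕ
  pick (just c) = c
  pick nothing  = 0

record IsBPD (n : ℕ) (π : List ℕ) (G : Grid) : Set where
  field
    sixTiles   : ∀ i j → inGrid n i j ≡ true → any (eqTile (G i j)) bpdTiles ≡ true
    matchEW    : ∀ i j → 1 ≤ i → i ≤ n → 1 ≤ j → j < n → segE (G i j) ≡ segW (G i (suc j))
    matchSN    : ∀ i j → 1 ≤ i → i < n → 1 ≤ j → j ≤ n → segS (G i j) ≡ segN (G (suc i) j)
    leftBdry   : ∀ i → 1 ≤ i → i ≤ n → segW (G i 1) ≡ false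
    rightBdry  : ∀ i → 1 ≤ i → i ≤ n → segE (G i n) ≡ true
    topBdry    : ∀ j → 1 ≤ j → j ≤ n → segN (G 1 j) ≡ false
    bottomBdry : ∀ j → 1 ≤ j → j ≤ n → segS (G n j) ≡ true
    exits      : ∀ c → 1 ≤ c → c ≤ n → Σ ℕ λ r → (exitRow n G c ≡ just r) × (nth π r ≡ c)
    crossOnce  : ∀ c d → 1 ≤ c → c < d → d ≤ n → crossings n G c d ≤ 1

allTileLists : ℕ → List (List Tile)
allTileLists zero    = [] ∷ []
allTileLists (suc m) = concatMap (λ t → map (t ∷_) (allTileLists m)) bpdTiles

nthT : List Tile → ℕ → Tile
nthT []       _       = tBlank
nthT (t ∷ ts) zero    = t
nthT (t ∷ ts) (suc k) = nthT ts k

toGrid : ℕ → List Tile → Grid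
toGrid n ts i j = if inGrid n i j then nthT ts ((i ∸ 1) * n + (j ∸ 1)) else tBlank

allGrids : ℕ → List Grid
allGrids n = map (toGrid n) (allTileLists (n * n))

-- weight as exponent vector (e_1,…,e_n) of x_1^{e_1}⋯x_n^{e_n}
wtD : ℕ → Grid → List ℕ
wtD n G = map (λ i → countᵇ (λ j → eqTile (G i j) tBlank) (range1 n)) (range1 n)

gridI : Grid
gridI i j = if i ≡ᵇ j then tR else (if j <ᵇ i then tVer else tHor)

idBPD : ℕ → Grid
idBPD n i j = if inGrid n i j then gridI i j else tBlank

smallest : (ℕ → Bool) → ℕ → Maybe ℕ
smallest p bound = firstWith p (range1 bound)

minDroop : ℕ → Grid → ℕ → ℕ → Maybe (Grid × ℕ × ℕ)
minDroop n G a b with se (G a b)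
... | false = nothing
... | true with smallest (λ x → not (eqTile (G (a + x) b) tCross)) (n ∸ a)
                | smallest (λ y → not (eqTile (G a (b + y)) tCross)) (n ∸ b)
... | just x | just y = just (G' , a + x , b + y)
  where
  modify : ℕ → ℕ → Tile → Tile
  modify i j t =
    if (i ≡ᵇ a) ∧ (j ≡ᵇ b) then record t { se = false }
    else if (j ≡ᵇ b) ∧ (a <ᵇ i) ∧ (i <ᵇ a + x) then record t { sn = false }
    else if (i ≡ᵇ a) ∧ (b <ᵇ j) ∧ (j <ᵇ b + y) then record t { we = false }
    else if (i ≡ᵇ a + x) ∧ (j ≡ᵇ b) then
      (if wn t then record t { wn = false ; we = true } else record t { sn = false ; se = true })
    else if (i ≡ᵇ a) ∧ (j ≡ᵇ b + y) then
      (if wn t then record t { wn = false ; sn = true } else record t { we = false ; se = true })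
    else if (i ≡ᵇ a + x) ∧ (b <ᵇ j) ∧ (j <ᵇ b + y) then record t { we = true }
    else if (j ≡ᵇ b + y) ∧ (a <ᵇ i) ∧ (i <ᵇ a + x) then record t { sn = true }
    else if (i ≡ᵇ a + x) ∧ (j ≡ᵇ b + y) then record t { wn = true }
    else t
  G' : Grid
  G' i j = modify i j (G i j)
... | _ | _ = nothing

bumpCross : ℕ → Grid → ℕ → ℕ → Maybe (ℕ × ℕ)
bumpCross n G i j with pipeAt n G i j cSE | pipeAt n G i j cWN
... | just p | just q = firstCross (pipePath n G p)
  where
  firstCross : List Step → Maybe (ℕ × ℕ)
  firstCross [] = nothing
  firstCross ((i' , j' , _) ∷ s) =
    if eqTile (G i' j') tCross ∧ passes (pipePath n G q) i' j' then just (i' , j') else firstCross s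
... | _ | _ = nothing

seExit : ℕ → Grid → ℕ → ℕ → Maybe ℕ
seExit n G i j with pipeAt n G i j cSE
... | just p  = exitRow n G p
... | nothing = nothing

crossBumpSwap : Grid → ℕ → ℕ → ℕ → ℕ → Grid
crossBumpSwap G a b a' b' = setCell (setCell G a b tCross) a' b' tBump

maxRElbow : Grid → ℕ → ℕ → Maybe ℕ
maxRElbow G i bound = go bound
  where
  go : ℕ → Maybe ℕ
  go zero          = nothing
  go (suc zero)    = nothing
  go (suc (suc m)) = if eqTile (G i (suc m)) tR then just (suc m) else go (suc m)

-- Right insertion (big-step semantics of the loop (1)–(3))

-- InsLoop n k G i j G' : starting step (1) at (i,j) in G, the algorithm stops with G'
data InsLoop (n k : ℕ) : Grid → ℕ → ℕ → Grid → Set where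
  jelbow : ∀ {G i j G1 i1 j1 j2 G'} →
    minDroop n G i j ≡ just (G1 , i1 , j1) → eqTile (G1 i1 j1) tJ ≡ true →
    maxRElbow G1 i1 j1 ≡ just j2 → InsLoop n k G1 i1 j2 G' → InsLoop n k G i j G'
  bumpSwap : ∀ {G i j G1 i1 j1 a' b' G'} →
    minDroop n G i j ≡ just (G1 , i1 , j1) → eqTile (G1 i1 j1) tBump ≡ true →
    bumpCross n G1 i1 j1 ≡ just (a' , b') →
    InsLoop n k (crossBumpSwap G1 i1 j1 a' b') a' b' G' → InsLoop n k G i j G'
  bumpGo : ∀ {G i j G1 i1 j1 r G'} →
    minDroop n G i j ≡ just (G1 , i1 , j1) → eqTile (G1 i1 j1) tBump ≡ true →
    bumpCross n G1 i1 j1 ≡ nothing → seExit n G1 i1 j1 ≡ just r → r ≤ k →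
    InsLoop n k G1 i1 j1 G' → InsLoop n k G i j G'
  bumpStop : ∀ {G i j G1 i1 j1 r} →
    minDroop n G i j ≡ just (G1 , i1 , j1) → eqTile (G1 i1 j1) tBump ≡ true →
    bumpCross n G1 i1 j1 ≡ nothing → seExit n G1 i1 j1 ≡ just r → k < r →
    InsLoop n k G i j (setCell G1 i1 j1 tCross)

Insert : ℕ → Grid → ℕ → ℕ → Grid → Set
Insert n G b k G' = Σ ℕ λ j → (maxRElbow G b (suc n) ≡ just j) × InsLoop n k G b j G'

-- a biletter b_k is the pair (b , k)
Biword : Set
Biword = List (ℕ × ℕ)

data RecFrom (n : ℕ) : Grid → Biword → Grid → Chain → Set where
  rec-nil  : ∀ {D} → RecFrom n D [] D []
  rec-cons : ∀ {D b k D1 Q D' c} → Insert n D b k D1 → RecFrom n D1 Q D' c →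
             RecFrom n D ((b , k) ∷ Q) D' ((k , permOf n D1) ∷ c)

Recording : ℕ → Biword → Grid → Chain → Set
Recording n Q D c = RecFrom n (idBPD n) Q D c

-- all biwords whose labels are k_1,…,k_ℓ (any Q with R(Q) = (D,c) must have these labels)
allBiwords : List ℕ → List Biword
allBiwords []       = [] ∷ []
allBiwords (k ∷ ks) = concatMap (λ b → map ((b , k) ∷_) (allBiwords ks)) (range1 k)

wtQ : ℕ → Biword → List ℕ
wtQ n Q = map (λ i → countᵇ (λ bk → proj₁ bk ≡ᵇ i) Q) (range1 n)

{-# OPTIONS --safe #-}
module Submission where

-- Label every edge of the grid by the pipe running along it. Reading the labels along a frontier that
-- sweeps the grid from its south-west corner, a cell either keeps the two labels it meets or exchanges
-- them, so a grid is a word of adjacent transpositions. It is reduced iff every cross has a smaller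
-- label on its west than on its south edge, and also iff its number of crosses is the number of
-- inversions of its permutation; the second form shows that cross-bump-swaps, and replacing a bump by a
-- cross along a cover, preserve reducedness.
--
-- A min-droop is determined by the corner where it ends, and each intermediate grid of an insertion
-- has exactly one predecessor: an r-elbow followed by a j-elbow in its row comes from that j-elbow, a
-- bump whose two pipes cross comes from a cross-bump-swap, and any other bump from the bump itself. Running
-- backwards from a BPD E of σ, starting at the unique crossing of the two pipes exchanged by ρ ⋖ₖ σ,
-- moves horizontal edges up, hence ends, and it ends at the last r-elbow of a row b ≤ k of a BPD of ρ.
-- So every step of the chain contributes a bijection, which adds one blank in row b.

open import Defs
open import Data.Bool using (Bool; true; false; _∧_; _∨_; not; if_then_else_)
open import Data.Bool.ListAction using (any)
open import Data.Empty using (⊥; ⊥-elim)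
open import Data.List using (List; []; _∷_; map; length; applyUpTo; _++_; concatMap; cartesianProductWith)
open import Data.List.Membership.Propositional using (_∈_)
open import Data.List.Membership.Propositional.Properties using (∈-++⁺ˡ; ∈-++⁺ʳ; ∈-++⁻; ∈-∃++; ∈-cartesianProductWith⁺; ∈-cartesianProductWith⁻; ∈-applyUpTo⁺; ∈-applyUpTo⁻)
open import Data.List.Properties using (map-∘; map-++)
open import Data.List.Relation.Binary.Permutation.Propositional using (_↭_; prep; ↭-refl; ↭-sym; ↭-trans; ↭-reflexive)
open import Data.List.Relation.Binary.Permutation.Propositional.Properties using (↭-length) renaming (shift to ↭-shift)
open import Data.List.Relation.Unary.All as All using (All)
open import Data.List.Relation.Unary.AllPairs using ([]; _∷_)
open import Data.List.Relation.Unary.Any using (here; there)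
open import Data.List.Relation.Unary.Unique.Propositional using (Unique)
open import Data.List.Relation.Unary.Unique.Propositional.Properties using (cartesianProductWith⁺; applyUpTo⁺₁)
open import Data.Maybe using (Maybe; just; nothing)
open import Data.Nat using (ℕ; zero; suc; _+_; _*_; _∸_; _≤_; _<_; _≡ᵇ_; _<ᵇ_; _≤ᵇ_; z≤n; s≤s; pred)
open import Data.Nat.DivMod using (_/_; _%_; m≡m%n+[m/n]*n; [m+kn]%n≡m%n; m<n⇒m%n≡m; m%n<n; m/n*n≤m)
open import Data.Nat.Induction using (<-wellFounded)
open import Data.Nat.Properties
open import Data.Nat.Tactic.RingSolver using (solve-∀)
open import Data.Product using (Σ; _×_; _,_; proj₁; proj₂)
open import Data.Sum using (_⊎_; inj₁; inj₂)
open import Function using (_∘_; case_of_)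
open import Induction.WellFounded using (Acc; acc)
open import Relation.Binary.Definitions using (tri<; tri≈; tri>)
open import Relation.Binary.PropositionalEquality using (_≡_; _≢_; refl; sym; trans; cong; cong₂; subst; subst₂)
open import Relation.Nullary using (¬_; Dec; yes; no)

-- Reducedness is what makes a min-droop rigid. If the drooping pipe is `p`, a pipe that it meets on
-- the left column comes from the west and has a smaller label, a pipe that it meets on the top row
-- comes from the south and has a larger one. Inside the rectangle a pipe of the first kind always
-- faces one of the second, and two different labels on the west and north edges force a cross; the
-- same argument from the opposite corner applies when a droop is undone. A backward run must also
-- satisfy the exit tests of the algorithm. Its invariant is that the drooping pipe leaves from a
-- row at most `k`: of two pipes that touch and do not cross, the one turning north leaves above the
-- one turning east, so the pipe found one step earlier leaves even higher. When the run stops, the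
-- pipe leaves along its present row, which is therefore a row `b ≤ k`. Grids are functions on all
-- pairs of numbers, so statements about runs are made up to equality on the square.

-- Words of adjacent transpositions and the strands they move.

swap : ℕ → ℕ → ℕ
swap zero    zero          = 1
swap zero    (suc zero)    = 0
swap zero    (suc (suc x)) = suc (suc x)
swap (suc m) zero          = zero
swap (suc m) (suc x)       = suc (swap m x)

swap-lower : ∀ m → swap m m ≡ suc m
swap-lower zero    = refl
swap-lower (suc m) = cong suc (swap-lower m)

swap-upper : ∀ m → swap m (suc m) ≡ m
swap-upper zero    = refl
swap-upper (suc m) = cong suc (swap-upper m)

swap-other : ∀ m x → x ≢ m → x ≢ suc m → swap m x ≡ x
swap-other zero    zero          p q = ⊥-elim (p refl)
swap-other zero    (suc zero)    p q = ⊥-elim (q refl)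
swap-other zero    (suc (suc x)) p q = refl
swap-other (suc m) zero          p q = refl
swap-other (suc m) (suc x)       p q = cong suc (swap-other m x (p ∘ cong suc) (q ∘ cong suc))

swap-involutive : ∀ m x → swap m (swap m x) ≡ x
swap-involutive zero    zero          = refl
swap-involutive zero    (suc zero)    = refl
swap-involutive zero    (suc (suc x)) = refl
swap-involutive (suc m) zero          = refl
swap-involutive (suc m) (suc x)       = cong suc (swap-involutive m x)

swap-mono : ∀ m x y → x < y → ¬ (x ≡ m × y ≡ suc m) → swap m x < swap m y
swap-mono zero    zero          (suc zero)    _       h = ⊥-elim (h (refl , refl))
swap-mono zero    zero          (suc (suc y)) _       _ = s≤s (s≤s z≤n)
swap-mono zero    (suc zero)    (suc zero)    (s≤s ()) _
swap-mono zero    (suc zero)    (suc (suc y)) _       _ = s≤s z≤n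
swap-mono zero    (suc (suc x)) (suc zero)    (s≤s ()) _
swap-mono zero    (suc (suc x)) (suc (suc y)) p       _ = p
swap-mono (suc m) zero          (suc y)       _       _ = s≤s z≤n
swap-mono (suc m) (suc x)       (suc y)       (s≤s p) h =
  s≤s (swap-mono m x y p λ { (a , b) → h (cong suc a , cong suc b) })

swapIf : Bool → ℕ → ℕ → ℕ
swapIf false _ x = x
swapIf true  m x = swap m x

swapIf-injective : ∀ b m x y → swapIf b m x ≡ swapIf b m y → x ≡ y
swapIf-injective false m x y e = e
swapIf-injective true  m x y e =
  trans (sym (swap-involutive m x)) (trans (cong (swap m) e) (swap-involutive m y))

swapIf-other : ∀ b m x → x ≢ m → x ≢ suc m → swapIf b m x ≡ x
swapIf-other false m x _ _ = refl
swapIf-other true  m x p q = swap-other m x p q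

swapIf-not-lower : ∀ b m → swapIf (not b) m m ≡ swapIf b m (suc m)
swapIf-not-lower false m = swap-lower m
swapIf-not-lower true  m = sym (swap-upper m)

swapIf-not-upper : ∀ b m → swapIf (not b) m (suc m) ≡ swapIf b m m
swapIf-not-upper false m = swap-upper m
swapIf-not-upper true  m = sym (swap-lower m)

-- The position at time t of the strand starting at position x, when at time t
-- the adjacent positions m t and suc (m t) are exchanged if B t holds.
pos : (ℕ → Bool) → (ℕ → ℕ) → ℕ → ℕ → ℕ
pos B m zero    x = x
pos B m (suc t) x = swapIf (B t) (m t) (pos B m t x)

pos-injective : ∀ B m t x y → pos B m t x ≡ pos B m t y → x ≡ y
pos-injective B m zero    x y e = e
pos-injective B m (suc t) x y e = pos-injective B m t x y (swapIf-injective (B t) (m t) _ _ e)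

-- The pair is ordered: `u` is the strand at the lower position, `v` the one just above it. In the
-- grid these are the pipes entering a cell from the west and from the south.
Exchange : (ℕ → Bool) → (ℕ → ℕ) → ℕ → ℕ → ℕ → Set
Exchange B m t u v = B t ≡ true × pos B m t u ≡ m t × pos B m t v ≡ suc (m t)

swapIf-flip : ∀ b m x y → x < y → swapIf b m y < swapIf b m x → b ≡ true × x ≡ m × y ≡ suc m
swapIf-flip false m x y p q = ⊥-elim (<-asym p q)
swapIf-flip true  m x y p q with x ≟ m | y ≟ suc m
... | yes a | yes b = refl , a , b
... | no  a | _     = ⊥-elim (<-asym q (swap-mono m x y p (a ∘ proj₁)))
... | yes _ | no  b = ⊥-elim (<-asym q (swap-mono m x y p (b ∘ proj₂)))

-- A single step reverses two positions only if it exchanges exactly these two (`swapIf-flip`). The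
-- interval is shortened from its end until the original order still holds before its last step.
exchange-between′ : ∀ B m s t u v → pos B m t u < pos B m t v → pos B m (s + t) v < pos B m (s + t) u →
  Σ ℕ λ r → t ≤ r × r < s + t × Exchange B m r u v
exchange-between′ B m zero    t u v p q = ⊥-elim (<-asym p q)
exchange-between′ B m (suc s) t u v p q with <-cmp (pos B m (s + t) u) (pos B m (s + t) v)
... | tri< a _ _ = s + t , m≤n+m t s , ≤-refl , swapIf-flip (B (s + t)) (m (s + t)) _ _ a q
... | tri≈ _ e _ = ⊥-elim (<-irrefl (cong (pos B m t) (pos-injective B m (s + t) u v e)) p)
... | tri> _ _ c with exchange-between′ B m s t u v p c
...   | r , x , y , z = r , x , m≤n⇒m≤1+n y , z

exchange-between : ∀ B m {t₁ t₂} u v → t₁ ≤ t₂ → pos B m t₁ u < pos B m t₁ v →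
  pos B m t₂ v < pos B m t₂ u → Σ ℕ λ r → t₁ ≤ r × r < t₂ × Exchange B m r u v
exchange-between B m {t₁} {t₂} u v l p q with exchange-between′ B m (t₂ ∸ t₁) t₁ u v p
    (subst (λ t → pos B m t v < pos B m t u) (sym (m∸n+n≡m l)) q)
... | r , x , y , z = r , x , subst (r <_) (m∸n+n≡m l) y , z

-- Flipping the decision at one time exchanges the two strands meeting there from then on.
module Flip (B B' : ℕ → Bool) (m : ℕ → ℕ) (t₀ T : ℕ) (t₀<T : t₀ < T)
            (same : ∀ r → r < T → r ≢ t₀ → B' r ≡ B r) (flipped : B' t₀ ≡ not (B t₀)) where

  flip-before : ∀ t x → t ≤ t₀ → pos B' m t x ≡ pos B m t x
  flip-before zero    x l = refl
  flip-before (suc t) x l =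
    cong₂ (λ b y → swapIf b (m t) y) (same t (<-trans l t₀<T) (<⇒≢ l)) (flip-before t x (<⇒≤ l))

  module _ {u v : ℕ} (pu : pos B m t₀ u ≡ m t₀) (pv : pos B m t₀ v ≡ suc (m t₀)) where

    private
      step : ∀ t x y → t₀ < t → t < T → pos B' m t x ≡ pos B m t y → pos B' m (suc t) x ≡ pos B m (suc t) y
      step t x y l k e = cong₂ (λ b z → swapIf b (m t) z) (same t k (<⇒≢ l ∘ sym)) e

    flip-after₁ : ∀ t → t₀ < t → t ≤ T → pos B' m t u ≡ pos B m t v
    flip-after₁ (suc t) (s≤s l) q with m≤n⇒m<n∨m≡n l
    ... | inj₁ k = step t u v k q (flip-after₁ t k (<⇒≤ q))
    ... | inj₂ refl rewrite flipped | flip-before t u ≤-refl | pu | pv = swapIf-not-lower (B t) (m t)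

    flip-after₂ : ∀ t → t₀ < t → t ≤ T → pos B' m t v ≡ pos B m t u
    flip-after₂ (suc t) (s≤s l) q with m≤n⇒m<n∨m≡n l
    ... | inj₁ k = step t v u k q (flip-after₂ t k (<⇒≤ q))
    ... | inj₂ refl rewrite flipped | flip-before t v ≤-refl | pu | pv = swapIf-not-upper (B t) (m t)

    flip-other : ∀ t x → t ≤ T → x ≢ u → x ≢ v → pos B' m t x ≡ pos B m t x
    flip-other zero    x l _ _ = refl
    flip-other (suc t) x l p q with t ≟ t₀
    ... | no  k = cong₂ (λ b z → swapIf b (m t) z) (same t l k) (flip-other t x (<⇒≤ l) p q)
    ... | yes refl = trans (cong (swapIf (B' t) (m t)) (flip-other t x (<⇒≤ l) p q))
                    (trans (away (B' t)) (sym (away (B t))))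
      where
      away : ∀ b → swapIf b (m t) (pos B m t x) ≡ pos B m t x
      away b = swapIf-other b (m t) _ (λ e → p (pos-injective B m t _ _ (trans e (sym pu))))
                                      (λ e → q (pos-injective B m t _ _ (trans e (sym pv))))

≡ᵇ-true : ∀ {m n} → m ≡ n → (m ≡ᵇ n) ≡ true
≡ᵇ-true {zero}  refl = refl
≡ᵇ-true {suc m} refl = ≡ᵇ-true {m} refl

≡ᵇ-false : ∀ {m n} → m ≢ n → (m ≡ᵇ n) ≡ false
≡ᵇ-false {zero}  {zero}  p = ⊥-elim (p refl)
≡ᵇ-false {zero}  {suc n} p = refl
≡ᵇ-false {suc m} {zero}  p = refl
≡ᵇ-false {suc m} {suc n} p = ≡ᵇ-false (p ∘ cong suc)

-- Two flips at times when the same two strands meet cancel: the paths of `u` and `v` are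
-- interchanged between `t₀` and `t₁` only. This is the effect of a cross-bump-swap, where one
-- flipped decision belongs to a cross and the other to a bump, in either order.
module Flip2 (B B' : ℕ → Bool) (m : ℕ → ℕ) (t₀ t₁ T : ℕ) (t₀<t₁ : t₀ < t₁) (t₁<T : t₁ < T)
             (same : ∀ r → r < T → r ≢ t₀ → r ≢ t₁ → B' r ≡ B r)
             (flipped₀ : B' t₀ ≡ not (B t₀)) (flipped₁ : B' t₁ ≡ not (B t₁))
             {u v : ℕ} (pu : pos B m t₀ u ≡ m t₀) (pv : pos B m t₀ v ≡ suc (m t₀))
             (meet : (pos B m t₁ u ≡ m t₁ × pos B m t₁ v ≡ suc (m t₁)) ⊎
                     (pos B m t₁ v ≡ m t₁ × pos B m t₁ u ≡ suc (m t₁))) where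

  private
    -- Only the first flip is made in `C`, so that `Flip` applies once from `B` to `C` and once from
    -- `C` to `B'`.
    C : ℕ → Bool
    C r = if r ≡ᵇ t₀ then not (B r) else B r

    C₀ : C t₀ ≡ not (B t₀)
    C₀ rewrite ≡ᵇ-true {t₀} refl = refl

    C-other : ∀ r → r ≢ t₀ → C r ≡ B r
    C-other r p rewrite ≡ᵇ-false p = refl

    same′ : ∀ r → r < T → r ≢ t₁ → B' r ≡ C r
    same′ r l q with r ≟ t₀
    ... | yes refl = trans flipped₀ (sym C₀)
    ... | no  p    = trans (same r l p q) (sym (C-other r p))

    module F = Flip B C m t₀ T (<-trans t₀<t₁ t₁<T) (λ r _ p → C-other r p) C₀
    module S = Flip C B' m t₁ T t₁<T same′ (trans flipped₁ (cong not (sym (C-other t₁ (<⇒≢ t₀<t₁ ∘ sym)))))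

    mu : pos C m t₁ u ≡ pos B m t₁ v
    mu = F.flip-after₁ pu pv t₁ t₀<t₁ (<⇒≤ t₁<T)
    mv : pos C m t₁ v ≡ pos B m t₁ u
    mv = F.flip-after₂ pu pv t₁ t₀<t₁ (<⇒≤ t₁<T)

  flip2-before : ∀ t x → t ≤ t₀ → pos B' m t x ≡ pos B m t x
  flip2-before t x l = trans (S.flip-before t x (≤-trans l (<⇒≤ t₀<t₁))) (F.flip-before t x l)

  flip2-mid₁ : ∀ t → t₀ < t → t ≤ t₁ → pos B' m t u ≡ pos B m t v
  flip2-mid₁ t l k = trans (S.flip-before t u k) (F.flip-after₁ pu pv t l (≤-trans k (<⇒≤ t₁<T)))

  flip2-mid₂ : ∀ t → t₀ < t → t ≤ t₁ → pos B' m t v ≡ pos B m t u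
  flip2-mid₂ t l k = trans (S.flip-before t v k) (F.flip-after₂ pu pv t l (≤-trans k (<⇒≤ t₁<T)))

  private
    after : ∀ t x → t₁ < t → t ≤ T → (pos B m t₁ u ≡ m t₁ × pos B m t₁ v ≡ suc (m t₁)) ⊎
              (pos B m t₁ v ≡ m t₁ × pos B m t₁ u ≡ suc (m t₁)) → pos B' m t x ≡ pos B m t x
    after t x l k (inj₁ (a , b)) with x ≟ u | x ≟ v
    ... | yes refl | _ =
      trans (S.flip-after₂ (trans mv a) (trans mu b) t l k) (F.flip-after₂ pu pv t (<-trans t₀<t₁ l) k)
    ... | no _ | yes refl =
      trans (S.flip-after₁ (trans mv a) (trans mu b) t l k) (F.flip-after₁ pu pv t (<-trans t₀<t₁ l) k)
    ... | no p | no q =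
      trans (S.flip-other (trans mv a) (trans mu b) t x k q p) (F.flip-other pu pv t x k p q)
    after t x l k (inj₂ (a , b)) with x ≟ u | x ≟ v
    ... | yes refl | _ =
      trans (S.flip-after₁ (trans mu a) (trans mv b) t l k) (F.flip-after₂ pu pv t (<-trans t₀<t₁ l) k)
    ... | no _ | yes refl =
      trans (S.flip-after₂ (trans mu a) (trans mv b) t l k) (F.flip-after₁ pu pv t (<-trans t₀<t₁ l) k)
    ... | no p | no q =
      trans (S.flip-other (trans mu a) (trans mv b) t x k p q) (F.flip-other pu pv t x k p q)

  flip2-after : ∀ t x → t₁ < t → t ≤ T → pos B' m t x ≡ pos B m t x
  flip2-after t x l k = after t x l k meet

-- Edge labels of a grid.

-- Cells are indexed from 0: cell (i , j) is G (suc i) (suc j). Its west, east, north and south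
-- edges carry the labels H i j, H i (suc j), V i j and V (suc i) j, where 0 is an empty edge
-- and suc c stands for pipe suc c.
data Cell : Tile → ℕ → ℕ → ℕ → ℕ → Set where
  blank : Cell tBlank 0 0 0 0
  hor   : ∀ {u} → Cell tHor (suc u) 0 0 (suc u)
  ver   : ∀ {v} → Cell tVer 0 (suc v) (suc v) 0
  cross : ∀ {u v} → Cell tCross (suc u) (suc v) (suc v) (suc u)
  relb  : ∀ {v} → Cell tR 0 (suc v) 0 (suc v)
  jelb  : ∀ {u} → Cell tJ (suc u) 0 (suc u) 0
  bump  : ∀ {u v} → Cell tBump (suc u) (suc v) (suc u) (suc v)

Labels : Set
Labels = ℕ → ℕ → ℕ

record Valid (n : ℕ) (G : Grid) (H V : Labels) : Set where
  field
    cell   : ∀ {i j} → i < n → j < n →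
             Cell (G (suc i) (suc j)) (H i j) (V (suc i) j) (V i j) (H i (suc j))
    left   : ∀ {i} → i < n → H i 0 ≡ 0
    bottom : ∀ {j} → j < n → V n j ≡ suc j
    top    : ∀ {j} → j < n → V 0 j ≡ 0
    right  : ∀ {i} → i < n → Σ ℕ λ c → H i n ≡ suc c
open Valid public

data Seven : Tile → Set where
  blank : Seven tBlank
  hor   : Seven tHor
  ver   : Seven tVer
  cross : Seven tCross
  relb  : Seven tR
  jelb  : Seven tJ
  bump  : Seven tBump

record Matched (n : ℕ) (G : Grid) : Set where
  field
    seven   : ∀ {i j} → i < n → j < n → Seven (G (suc i) (suc j))
    matchH  : ∀ {i j} → i < n → suc j < n → segE (G (suc i) (suc j)) ≡ segW (G (suc i) (suc (suc j)))
    matchV  : ∀ {i j} → suc i < n → j < n → segS (G (suc i) (suc j)) ≡ segN (G (suc (suc i)) (suc j))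
    leftM   : ∀ {i} → i < n → segW (G (suc i) 1) ≡ false
    rightM  : ∀ {i} → i < n → segE (G (suc i) n) ≡ true
    topM    : ∀ {j} → j < n → segN (G 1 (suc j)) ≡ false
    bottomM : ∀ {j} → j < n → segS (G n (suc j)) ≡ true
open Matched public

occupied : ℕ → Bool
occupied zero    = false
occupied (suc _) = true

northLabel eastLabel : Tile → ℕ → ℕ → ℕ
northLabel t W S = if sn t then S else (if wn t then W else 0)
eastLabel  t W S = if we t then W else (if se t then S else 0)

-- The first number counts the rows below the edge, `n ∸ i` for `V i j` and `n ∸ suc i` for `H i j`;
-- it makes the sweep from the south-west structurally recursive. When it runs out in `vLabel`, the
-- edge lies on the bottom border and belongs to pipe `suc j`.
mutual
  vLabel : Grid → ℕ → ℕ → ℕ → ℕ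
  vLabel G zero    i j = suc j
  vLabel G (suc d) i j = northLabel (G (suc i) (suc j)) (hLabel G d i j) (vLabel G d (suc i) j)

  hLabel : Grid → ℕ → ℕ → ℕ → ℕ
  hLabel G d i zero    = 0
  hLabel G d i (suc j) = eastLabel (G (suc i) (suc j)) (hLabel G d i j) (vLabel G d (suc i) j)

cell-labels : ∀ {t} W S → Seven t → occupied W ≡ segW t → occupied S ≡ segS t →
  Cell t W S (northLabel t W S) (eastLabel t W S)
cell-labels zero    zero    blank _ _ = blank
cell-labels (suc _) zero    hor   _ _ = hor
cell-labels zero    (suc _) ver   _ _ = ver
cell-labels (suc _) (suc _) cross _ _ = cross
cell-labels zero    (suc _) relb  _ _ = relb
cell-labels (suc _) zero    jelb  _ _ = jelb
cell-labels (suc _) (suc _) bump  _ _ = bump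

cell-segW : ∀ {t W S N E} → Cell t W S N E → segW t ≡ occupied W
cell-segW blank = refl
cell-segW hor   = refl
cell-segW ver   = refl
cell-segW cross = refl
cell-segW relb  = refl
cell-segW jelb  = refl
cell-segW bump  = refl

cell-segS : ∀ {t W S N E} → Cell t W S N E → segS t ≡ occupied S
cell-segS blank = refl
cell-segS hor   = refl
cell-segS ver   = refl
cell-segS cross = refl
cell-segS relb  = refl
cell-segS jelb  = refl
cell-segS bump  = refl

cell-segN : ∀ {t W S N E} → Cell t W S N E → segN t ≡ occupied N
cell-segN blank = refl
cell-segN hor   = refl
cell-segN ver   = refl
cell-segN cross = refl
cell-segN relb  = refl
cell-segN jelb  = refl
cell-segN bump  = refl

cell-segE : ∀ {t W S N E} → Cell t W S N E → segE t ≡ occupied E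
cell-segE blank = refl
cell-segE hor   = refl
cell-segE ver   = refl
cell-segE cross = refl
cell-segE relb  = refl
cell-segE jelb  = refl
cell-segE bump  = refl

cell-seven : ∀ {t W S N E} → Cell t W S N E → Seven t
cell-seven blank = blank
cell-seven hor   = hor
cell-seven ver   = ver
cell-seven cross = cross
cell-seven relb  = relb
cell-seven jelb  = jelb
cell-seven bump  = bump

m∸n≡1+m∸1+n : ∀ {m n} → n < m → m ∸ n ≡ suc (m ∸ suc n)
m∸n≡1+m∸1+n {suc m} {zero}  _       = refl
m∸n≡1+m∸1+n {suc m} {suc n} (s≤s l) = m∸n≡1+m∸1+n l

occupied-false : ∀ {x} → occupied x ≡ false → x ≡ 0
occupied-false {zero} _ = refl

occupied-true : ∀ {x} → occupied x ≡ true → Σ ℕ λ c → x ≡ suc c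
occupied-true {suc c} _ = c , refl

module _ {n : ℕ} {G : Grid} (M : Matched n G) where
  private
    H V : Labels
    H i j = hLabel G (n ∸ suc i) i j
    V i j = vLabel G (n ∸ i) i j

    V-step : ∀ {i} j → i < n →
      V i j ≡ northLabel (G (suc i) (suc j)) (H i j) (V (suc i) j)
    V-step {i} j l rewrite m∸n≡1+m∸1+n l = refl

    OkS OkW : ℕ → Set
    OkS i = ∀ {j} → j < n → occupied (V (suc i) j) ≡ segS (G (suc i) (suc j))
    OkW i = ∀ {j} → j < n → occupied (H i j) ≡ segW (G (suc i) (suc j))

    okCell : ∀ {i} j → i < n → OkS i → OkW i → j < n →
      Cell (G (suc i) (suc j)) (H i j) (V (suc i) j)
           (northLabel (G (suc i) (suc j)) (H i j) (V (suc i) j)) (H i (suc j))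
    okCell j i<n s w j<n = cell-labels _ _ (seven M i<n j<n) (w j<n) (s j<n)

    okW : ∀ {i} → i < n → OkS i → OkW i
    okW i<n s {zero}  _ = sym (leftM M i<n)
    okW {i} i<n s {suc j} l =
      trans (sym (cell-segE (cell-labels (H i j) (V (suc i) j) (seven M i<n (<⇒≤ l))
                              (okW i<n s (<⇒≤ l)) (s (<⇒≤ l)))))
            (matchH M i<n l)

    -- Induction from the bottom row: the south edges of a row are the north edges of the row below,
    -- and inside that row `okW` moves from left to right. So matching segments make a label
    -- non-zero exactly where the tile has a segment.
    okS : ∀ d {i} → d + suc i ≡ n → OkS i
    okS zero {i} refl {j} j<n rewrite n∸n≡0 i = sym (bottomM M j<n)
    okS (suc d) {i} e {j} j<n =
      trans (cong occupied (V-step j i<n))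
     (trans (sym (cell-segN (okCell j i<n s (okW i<n s) j<n))) (sym (matchV M i<n j<n)))
      where
      e' : d + suc (suc i) ≡ n
      e' = trans (+-suc d (suc i)) e
      i<n : suc i < n
      i<n = subst (suc (suc i) ≤_) e' (m≤n+m _ d)
      s : OkS (suc i)
      s = okS d e'

    okS′ : ∀ {i} → i < n → OkS i
    okS′ i<n = okS _ (m∸n+n≡m i<n)

    theCell : ∀ {i j} → i < n → j < n →
      Cell (G (suc i) (suc j)) (H i j) (V (suc i) j) (V i j) (H i (suc j))
    theCell {i} {j} i<n j<n = subst (λ N → Cell (G (suc i) (suc j)) (H i j) (V (suc i) j) N (H i (suc j))) (sym (V-step j i<n))
      (okCell j i<n (okS′ i<n) (okW i<n (okS′ i<n)) j<n)

    lastColumn : ∀ m → suc m ≡ n → ∀ {i} → i < n → occupied (H i n) ≡ true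
    lastColumn m refl i<n = trans (sym (cell-segE (theCell {j = m} i<n ≤-refl))) (rightM M i<n)

  matched⇒valid : Σ Labels λ H → Σ Labels λ V → Valid n G H V
  matched⇒valid = H , V , record
    { cell   = theCell
    ; left   = λ _ → refl
    ; bottom = λ {j} _ → cong (λ d → vLabel G d n j) (n∸n≡0 n)
    ; top    = λ l → occupied-false (trans (sym (cell-segN (theCell (≤-trans (s≤s z≤n) l) l))) (topM M l))
    ; right  = λ {i} l → occupied-true (lastColumn (pred n) (suc-pred′ l) l)
    }
    where
    suc-pred′ : ∀ {i m} → i < m → suc (pred m) ≡ m
    suc-pred′ (s≤s _) = refl

valid⇒matched : ∀ {n G H V} → Valid n G H V → Matched n G
valid⇒matched {n} {G} {H} {V} W = record
  { seven   = λ p q → cell-seven (cell W p q)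
  ; matchH  = λ p q → trans (cell-segE (cell W p (<⇒≤ q))) (sym (cell-segW (cell W p q)))
  ; matchV  = λ p q → trans (cell-segS (cell W (<⇒≤ p) q)) (sym (cell-segN (cell W p q)))
  ; leftM   = λ p → trans (cell-segW (cell W p (≤-trans (s≤s z≤n) p))) (cong occupied (left W p))
  ; rightM  = λ p → rightCase p W
  ; topM    = λ p → trans (cell-segN (cell W (≤-trans (s≤s z≤n) p) p)) (cong occupied (top W p))
  ; bottomM = λ p → bottomCase p W
  }
  where
  rightCase : ∀ {n i} → i < n → Valid n G H V → segE (G (suc i) n) ≡ true
  rightCase {suc m} p W = trans (cell-segE (cell W p ≤-refl)) (cong occupied (proj₂ (right W p)))
  bottomCase : ∀ {n j} → j < n → Valid n G H V → segS (G n (suc j)) ≡ true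
  bottomCase {suc m} p W = trans (cell-segS (cell W ≤-refl p)) (cong occupied (bottom W p))

-- The sweep: times, cells and positions on the frontier.

-- Straight tiles exchange the two positions on which a cell acts, turns and blanks keep them. Empty
-- edges occupy positions too, so `tHor` and `tVer` are exchanges of a pipe with an empty edge.
bit : Tile → Bool
bit t = we t ∨ sn t

cell-N : ∀ {t W S N E c} → Cell t W S N E → N ≡ suc c →
  (bit t ≡ true × S ≡ suc c) ⊎ (bit t ≡ false × W ≡ suc c)
cell-N ver   e = inj₁ (refl , e)
cell-N cross e = inj₁ (refl , e)
cell-N jelb  e = inj₂ (refl , e)
cell-N bump  e = inj₂ (refl , e)

cell-E : ∀ {t W S N E c} → Cell t W S N E → E ≡ suc c →
  (bit t ≡ true × W ≡ suc c) ⊎ (bit t ≡ false × S ≡ suc c)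
cell-E hor   e = inj₁ (refl , e)
cell-E cross e = inj₁ (refl , e)
cell-E relb  e = inj₂ (refl , e)
cell-E bump  e = inj₂ (refl , e)

cell-W : ∀ {t W S N E c} → Cell t W S N E → W ≡ suc c →
  (bit t ≡ true × E ≡ suc c) ⊎ (bit t ≡ false × N ≡ suc c)
cell-W hor   e = inj₁ (refl , e)
cell-W cross e = inj₁ (refl , e)
cell-W jelb  e = inj₂ (refl , e)
cell-W bump  e = inj₂ (refl , e)

cell-S : ∀ {t W S N E c} → Cell t W S N E → S ≡ suc c →
  (bit t ≡ true × N ≡ suc c) ⊎ (bit t ≡ false × E ≡ suc c)
cell-S ver   e = inj₁ (refl , e)
cell-S cross e = inj₁ (refl , e)
cell-S relb  e = inj₂ (refl , e)
cell-S bump  e = inj₂ (refl , e)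

cell-cross : ∀ {t W S N E u v} → Cell t W S N E → bit t ≡ true → W ≡ suc u → S ≡ suc v → t ≡ tCross
cell-cross hor   _ _ ()
cell-cross ver   _ () _
cell-cross cross _ _ _ = refl
cell-cross blank () _ _
cell-cross relb  () _ _
cell-cross jelb  () _ _
cell-cross bump  () _ _

-- Cells are processed row by row from the bottom, each row from the left.
cellAt : ℕ → ℕ → ℕ × ℕ
cellAt n zero    = n ∸ 1 , 0
cellAt n (suc t) with cellAt n t
... | i , j = if suc j ≡ᵇ n then (i ∸ 1 , 0) else (i , suc j)

bits : ℕ → Grid → ℕ → Bool
bits n G t = bit (G (suc (proj₁ (cellAt n t))) (suc (proj₂ (cellAt n t))))

-- Every edge `H i j` or `V i j` has position `i + j`. So the west and north edges of cell `(i , j)`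
-- share position `i + j`, its south and east edges share `i + j + 1`, and the cell exchanges these
-- two positions or keeps them.
place : ℕ → ℕ → ℕ
place n t = proj₁ (cellAt n t) + proj₂ (cellAt n t)

-- At time t the rows below i and the first j cells of row i have been processed.
data At (n : ℕ) : ℕ → ℕ → ℕ → Set where
  at0 : At n 0 (n ∸ 1) 0
  atC : ∀ {t i j} → j < n → At n t i j → At n (suc t) i (suc j)
  atR : ∀ {t i} → At n t (suc i) n → At n t i 0

-- `At` has two names for the moment between two rows, `(suc i , n)` and `(i , 0)`, while `cellAt`
-- already points at the next cell. The second component treats the first of these names.
at-cell′ : ∀ {n t i j} → 0 < n → At n t i j →
  (j < n → cellAt n t ≡ (i , j)) × (j ≡ n → cellAt n t ≡ (i ∸ 1 , 0))
at-cell′ p at0 = (λ _ → refl) , λ { refl → ⊥-elim (<-irrefl refl p) }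
at-cell′ {n} p (atC {t} {i} {j} l a) = f , g
  where
  e : cellAt n t ≡ (i , j)
  e = proj₁ (at-cell′ p a) l
  f : suc j < n → cellAt n (suc t) ≡ (i , suc j)
  f k rewrite e | ≡ᵇ-false (<⇒≢ k) = refl
  g : suc j ≡ n → cellAt n (suc t) ≡ (i ∸ 1 , 0)
  g k rewrite e | ≡ᵇ-true k = refl
at-cell′ p (atR a) = (λ _ → proj₂ (at-cell′ p a) refl) , λ { refl → ⊥-elim (<-irrefl refl p) }

at-cell : ∀ {n t i j} → At n t i j → j < n → cellAt n t ≡ (i , j)
at-cell a l = proj₁ (at-cell′ (≤-trans (s≤s z≤n) l) a) l

at-row : ∀ {n t i j} → 0 < n → At n t i j → i < n
at-row {suc n} p at0 = ≤-refl
at-row p (atC _ a)   = at-row p a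
at-row p (atR a)     = <⇒≤ (at-row p a)

at-rowEnd : ∀ {n t i j} d → d + j ≡ n → At n t i j → Σ ℕ λ t' → At n t' i n × d + t ≡ t'
at-rowEnd zero    refl a = _ , a , refl
at-rowEnd {n} {t} {i} {j} (suc d) e a with at-rowEnd d (trans (+-suc d j) e) (atC (subst (j <_) e (s≤s (m≤n+m j d))) a)
... | t' , a' , q = t' , a' , trans (sym (+-suc d t)) q

at-exists : ∀ {n} d {i j} → d + suc i ≡ n → j ≤ n → Σ ℕ λ t → At n t i j
at-exists {n} d {i} {zero} e _ with d
... | zero  = 0 , subst (λ m → At n 0 m 0) (cong pred (sym e)) at0
... | suc d' with at-exists d' {suc i} {n} (trans (+-suc d' (suc i)) e) ≤-refl
...   | t , a = t , atR a
at-exists d {i} {suc j} e l with at-exists d {i} {j} e (<⇒≤ l)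
... | t , a = suc t , atC l a

abstract
  time : ∀ {n i j} → i < n → j < n → Σ ℕ λ t → At n t i j
  time p q = at-exists _ (m∸n+n≡m p) (<⇒≤ q)

at-end′ : ∀ {n t} i → At n t i n → Σ ℕ λ T → At n T 0 n × t ≤ T
at-end′ zero    a = _ , a , ≤-refl
at-end′ {n} {t} (suc i) a with at-rowEnd n (+-identityʳ n) (atR a)
... | t' , a' , refl with at-end′ i a'
...   | T , b , l = T , b , ≤-trans (m≤n+m t n) l

at-end : ∀ {n t i j} → j < n → At n t i j → Σ ℕ λ T → At n T 0 n × t < T
at-end {n} {t} {i} {j} l a with at-rowEnd (n ∸ suc j) (m∸n+n≡m l) (atC l a)
... | t' , a' , refl with at-end′ i a'
...   | T , b , k = T , b , ≤-trans (m≤n+m (suc t) (n ∸ suc j)) k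

at-earlier : ∀ {n T i j r} → At n T i j → r < T → Σ ℕ λ i' → Σ ℕ λ j' → At n r i' j' × j' < n
at-earlier (atC l a) (s≤s p) with m≤n⇒m<n∨m≡n p
... | inj₁ k    = at-earlier a k
... | inj₂ refl = _ , _ , a , l
at-earlier (atR a) p = at-earlier a p

at-time : ∀ {n t i j} → 0 < n → At n t i j → t ≡ (n ∸ suc i) * n + j
at-time {suc n} p at0 rewrite n∸n≡0 n = refl
at-time {n} p (atC {t} {i} {j} l a) = trans (cong suc (at-time p a)) (sym (+-suc _ j))
at-time {n} p (atR {t} {i} a) rewrite m∸n≡1+m∸1+n (at-row p a) =
  trans (at-time p a) (trans (+-comm _ n) (sym (+-identityʳ _)))

at-unique : ∀ {n t t' i j} → j < n → At n t i j → At n t' i j → t ≡ t'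
at-unique l a b = trans (at-time (≤-trans (s≤s z≤n) l) a) (sym (at-time (≤-trans (s≤s z≤n) l) b))

at-same : ∀ {n t i j i' j'} → j < n → j' < n → At n t i j → At n t i' j' → i ≡ i' × j ≡ j'
at-same l l' a b with trans (sym (at-cell a l)) (at-cell b l')
... | refl = refl , refl

-- Pipe `suc c` starts on the edge `V n c`, whose position is `n + c`.
pipePos : ℕ → Grid → ℕ → ℕ → ℕ
pipePos n G t c = pos (bits n G) (place n) t (n + c)

module Frontier {n : ℕ} {G : Grid} {H V : Labels} (W : Valid n G H V) where

  private
    P : ℕ → ℕ → ℕ
    P = pipePos n G

    P-step : ∀ {t i j} → At n t i j → j < n → ∀ c →
      P (suc t) c ≡ swapIf (bit (G (suc i) (suc j))) (i + j) (P t c)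
    P-step a l c rewrite at-cell a l = refl

  -- The four fields are the pieces of the frontier: north edges of the finished part of row `i`,
  -- the west edge of the next cell, south edges of the rest of the row, and the exits of the rows
  -- below.
  record Positions (t i j : ℕ) : Set where
    field
      posN : ∀ {j' c} → j' < j → V i j' ≡ suc c → P t c ≡ i + j'
      posW : ∀ {c} → H i j ≡ suc c → P t c ≡ i + j
      posS : ∀ {j' c} → j ≤ j' → j' < n → V (suc i) j' ≡ suc c → P t c ≡ suc i + j'
      posX : ∀ {i' c} → i < i' → i' < n → H i' n ≡ suc c → P t c ≡ i' + n
  open Positions public

  private
    keep : ∀ {t i j} → At n t i j → j < n → ∀ {c x} → P t c ≡ x → x ≢ i + j → x ≢ suc (i + j) → P (suc t) c ≡ x
    keep {i = i} {j} a l {c} refl p q = trans (P-step a l c) (swapIf-other (bit (G (suc i) (suc j))) _ _ p q)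

    low : ∀ {t i j} → At n t i j → j < n → ∀ {c b} → bit (G (suc i) (suc j)) ≡ b → P t c ≡ i + j →
      P (suc t) c ≡ swapIf b (i + j) (i + j)
    low {i = i} {j} a l {c} refl q = trans (P-step a l c) (cong (swapIf (bit (G (suc i) (suc j))) (i + j)) q)

    high : ∀ {t i j} → At n t i j → j < n → ∀ {c b} → bit (G (suc i) (suc j)) ≡ b → P t c ≡ suc (i + j) →
      P (suc t) c ≡ swapIf b (i + j) (suc (i + j))
    high {i = i} {j} a l {c} refl q = trans (P-step a l c) (cong (swapIf (bit (G (suc i) (suc j))) (i + j)) q)

    positions-step : ∀ {t i j} → At n t i j → j < n → Positions t i j → Positions (suc t) i (suc j)
    positions-step {t} {i} {j} a l I = record
      { posN = sN ; posW = sW ; posS = sS ; posX = sX }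
      where
      i<n : i < n
      i<n = at-row (≤-trans (s≤s z≤n) l) a
      sN : ∀ {j' c} → j' < suc j → V i j' ≡ suc c → P (suc t) c ≡ i + j'
      sN {j'} (s≤s p) e with m≤n⇒m<n∨m≡n p
      ... | inj₁ k = keep a l (posN I k e) (<⇒≢ (+-monoʳ-< i k)) (<⇒≢ (m≤n⇒m≤1+n (+-monoʳ-< i k)))
      ... | inj₂ refl with cell-N (cell W i<n l) e
      ...   | inj₁ (b , e') = trans (high a l b (posS I ≤-refl l e')) (swap-upper _)
      ...   | inj₂ (b , e') = low a l b (posW I e')
      sW : ∀ {c} → H i (suc j) ≡ suc c → P (suc t) c ≡ i + suc j
      sW e with cell-E (cell W i<n l) e
      ... | inj₁ (b , e') = trans (low a l b (posW I e')) (trans (swap-lower _) (sym (+-suc i j)))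
      ... | inj₂ (b , e') = trans (high a l b (posS I ≤-refl l e')) (sym (+-suc i j))
      sS : ∀ {j' c} → suc j ≤ j' → j' < n → V (suc i) j' ≡ suc c → P (suc t) c ≡ suc i + j'
      sS p q e = keep a l (posS I (<⇒≤ p) q e)
        (λ z → <⇒≢ (m≤n⇒m≤1+n (+-monoʳ-< i p)) (sym z)) (λ z → <⇒≢ (s≤s (+-monoʳ-< i p)) (sym z))
      sX : ∀ {i' c} → i < i' → i' < n → H i' n ≡ suc c → P (suc t) c ≡ i' + n
      sX p q e = keep a l (posX I p q e)
        (λ z → <⇒≢ (+-mono-<-≤ p (<⇒≤ l)) (sym z)) (λ z → <⇒≢ (≤-trans (s≤s (+-monoʳ-< i l)) (+-monoˡ-≤ n p)) (sym z))

    positions-row : ∀ {t i} → 0 < n → At n t (suc i) n → Positions t (suc i) n → Positions t i 0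
    positions-row {t} {i} z a I = record
      { posN = λ ()
      ; posW = λ e → ⊥-elim (0≢1+n (trans (sym (left W (<⇒≤ (at-row z a)))) e))
      ; posS = λ _ q e → posN I q e
      ; posX = sX
      }
      where
      sX : ∀ {i' c} → i < i' → i' < n → H i' n ≡ suc c → P t c ≡ i' + n
      sX p q e with m≤n⇒m<n∨m≡n p
      ... | inj₁ k = posX I k q e
      ... | inj₂ refl = posW I e

  positions : ∀ {t i j} → 0 < n → At n t i j → Positions t i j
  positions {j = j} z at0 = record
    { posN = λ ()
    ; posW = λ e → ⊥-elim (0≢1+n (trans (sym (left W (at-row z at0))) e))
    ; posS = λ {j'} {c} _ q e → trans (cong (n +_) (suc-injective (trans (sym e)
               (trans (cong (λ m → V m j') (suc∸1 z)) (bottom W q))))) (cong (_+ j') (sym (suc∸1 z)))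
    ; posX = λ p q → ⊥-elim (<-irrefl refl (≤-trans q (subst (_≤ _) (suc∸1 z) p)))
    }
    where
    suc∸1 : ∀ {m} → 0 < m → suc (m ∸ 1) ≡ m
    suc∸1 (s≤s _) = refl
  positions z (atC l a) = positions-step a l (positions z a)
  positions z (atR a)   = positions-row z a (positions z a)

  -- The other half of the invariant: a pipe is never lost, so at each moment it lies on one of the
  -- four pieces of the frontier. `Positions` leads from an edge to a position, `Location` allows
  -- the way back.
  data Location (i j c : ℕ) : Set where
    locN : ∀ {j'} → j' < j → V i j' ≡ suc c → Location i j c
    locW : H i j ≡ suc c → Location i j c
    locS : ∀ {j'} → j ≤ j' → j' < n → V (suc i) j' ≡ suc c → Location i j c
    locX : ∀ {i'} → i < i' → i' < n → H i' n ≡ suc c → Location i j c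

  location : ∀ {t i j c} → c < n → At n t i j → Location i j c
  location {c = c} p at0 = locS {j' = c} z≤n p (trans (cong (λ m → V m c) (suc∸1 p)) (bottom W p))
    where
    suc∸1 : ∀ {m c} → c < m → suc (m ∸ 1) ≡ m
    suc∸1 (s≤s _) = refl
  location p (atC {t} {i} {j} l a) with location p a
  ... | locN q e = locN (m≤n⇒m≤1+n q) e
  ... | locX q r e = locX q r e
  ... | locW e with cell-W (cell W (at-row (≤-trans (s≤s z≤n) l) a) l) e
  ...   | inj₁ (_ , e') = locW e'
  ...   | inj₂ (_ , e') = locN ≤-refl e'
  location p (atC {t} {i} {j} l a) | locS q r e with m≤n⇒m<n∨m≡n q
  ... | inj₁ k = locS k r e
  ... | inj₂ refl with cell-S (cell W (at-row (≤-trans (s≤s z≤n) l) a) l) e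
  ...   | inj₁ (_ , e') = locN ≤-refl e'
  ...   | inj₂ (_ , e') = locW e'
  location p (atR a) with location p a
  ... | locN q e   = locS z≤n q e
  ... | locW e     = locX ≤-refl (at-row (≤-trans (s≤s z≤n) p) a) e
  ... | locS q r e = ⊥-elim (<-irrefl refl (≤-trans r q))
  ... | locX q r e = locX (<⇒≤ q) r e

  mutual
    vRange : ∀ {i j c} d → d + i ≡ n → j < n → V i j ≡ suc c → c < n
    vRange {i} {j} zero refl q e = subst (_< i) (suc-injective (trans (sym (bottom W q)) e)) q
    vRange {i} (suc d) s q e with cell-N (cell W (subst (i <_) s (s≤s (m≤n+m i d))) q) e
    ... | inj₁ (_ , e') = vRange d (trans (+-suc d i) s) q e'
    ... | inj₂ (_ , e') = hRange d (trans (+-suc d i) s) (<⇒≤ q) e'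

    hRange : ∀ {i j c} d → d + suc i ≡ n → j ≤ n → H i j ≡ suc c → c < n
    hRange {i} {zero} d s q e = ⊥-elim (0≢1+n (trans (sym (left W (subst (suc i ≤_) s (m≤n+m (suc i) d)))) e))
    hRange {i} {suc j} d s q e with cell-E (cell W (subst (suc i ≤_) s (m≤n+m (suc i) d)) q) e
    ... | inj₁ (_ , e') = hRange d s (<⇒≤ q) e'
    ... | inj₂ (_ , e') = vRange d s q e'

  V-range : ∀ {i j c} → i ≤ n → j < n → V i j ≡ suc c → c < n
  V-range p = vRange _ (m∸n+n≡m p)

  H-range : ∀ {i j c} → i < n → j ≤ n → H i j ≡ suc c → c < n
  H-range p = hRange _ (m∸n+n≡m p)

  -- `location` puts the pipe on some edge of the frontier, and every frontier edge other than the
  -- west edge has a position different from `i + j`.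
  west-of-pos : ∀ {t i j c} → j < n → At n t i j → c < n → P t c ≡ i + j → H i j ≡ suc c
  west-of-pos {t} {i} {j} l a p e with location p a | positions (≤-trans (s≤s z≤n) l) a
  ... | locN q f   | I = ⊥-elim (<⇒≢ (+-monoʳ-< i q) (trans (sym (posN I q f)) e))
  ... | locW f     | I = f
  ... | locS q r f | I = ⊥-elim (<⇒≢ (s≤s (+-monoʳ-≤ i q)) (trans (sym e) (posS I q r f)))
  ... | locX q r f | I = ⊥-elim (<⇒≢ (+-mono-<-≤ q (<⇒≤ l)) (trans (sym e) (posX I q r f)))

  south-of-pos : ∀ {t i j c} → j < n → At n t i j → c < n → P t c ≡ suc (i + j) → V (suc i) j ≡ suc c
  south-of-pos {t} {i} {j} l a p e with location p a | positions (≤-trans (s≤s z≤n) l) a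
  ... | locN q f   | I = ⊥-elim (<⇒≢ (m≤n⇒m≤1+n (+-monoʳ-< i q)) (trans (sym (posN I q f)) e))
  ... | locW f     | I = ⊥-elim (<⇒≢ ≤-refl (trans (sym (posW I f)) e))
  ... | locX q r f | I = ⊥-elim (<⇒≢ (≤-trans (s≤s (+-monoʳ-< i l)) (+-monoˡ-≤ n q)) (trans (sym e) (posX I q r f)))
  ... | locS q r f | I with m≤n⇒m<n∨m≡n q
  ...   | inj₁ k = ⊥-elim (<⇒≢ (s≤s (+-monoʳ-< i k)) (trans (sym e) (posS I q r f)))
  ...   | inj₂ refl = f

  pos-west : ∀ {t i j c} → j < n → At n t i j → H i j ≡ suc c → P t c ≡ i + j
  pos-west l a e = posW (positions (≤-trans (s≤s z≤n) l) a) e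

  pos-south : ∀ {t i j c} → j < n → At n t i j → V (suc i) j ≡ suc c → P t c ≡ suc (i + j)
  pos-south l a e = posS (positions (≤-trans (s≤s z≤n) l) a) ≤-refl l e

  pos-exit : ∀ {T r c} → At n T 0 n → r < n → H r n ≡ suc c → P T c ≡ r + n
  pos-exit {r = zero}  a l e = posW (positions l a) e
  pos-exit {r = suc r} a l e = posX (positions (≤-trans (s≤s z≤n) l) a) (s≤s z≤n) l e

  endTime : 0 < n → Σ ℕ λ T → At n T 0 n
  endTime p with at-end p (proj₂ (time {n} {0} {0} p p))
  ... | T , a , _ = T , a

  exit-exists : ∀ {c} → c < n → Σ ℕ λ r → r < n × H r n ≡ suc c
  exit-exists {c} p with location {c = c} p (proj₂ (endTime (≤-trans (s≤s z≤n) p)))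
  ... | locN q f   = ⊥-elim (0≢1+n (trans (sym (top W q)) f))
  ... | locW f     = 0 , ≤-trans (s≤s z≤n) p , f
  ... | locS q r f = ⊥-elim (<-irrefl refl (≤-trans r q))
  ... | locX q r f = _ , r , f

  exit-of-pos : ∀ {T r c} → At n T 0 n → c < n → P T c ≡ r + n → r < n × H r n ≡ suc c
  exit-of-pos {T} {r} a p e with exit-exists p
  ... | r' , l , f with +-cancelʳ-≡ n r' r (trans (sym (pos-exit a l f)) e)
  ...   | refl = l , f

  exit-injective : ∀ {r r' c} → r < n → r' < n → H r n ≡ suc c → H r' n ≡ suc c → r ≡ r'
  exit-injective {r} {r'} l l' e e' with endTime (≤-trans (s≤s z≤n) l)
  ... | T , a = +-cancelʳ-≡ n r r' (trans (sym (pos-exit a l e)) (pos-exit a l' e'))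

  distinct : ∀ {i j u v} → i < n → j < n → H i j ≡ suc u → V (suc i) j ≡ suc v → u ≢ v
  distinct p q e f refl with time p q
  ... | t , a = <⇒≢ ≤-refl (trans (sym (pos-west q a e)) (pos-south q a f))

-- Crossings, their direction, and inversions.

record CrossAt (n : ℕ) (G : Grid) (H V : Labels) (i j u v : ℕ) : Set where
  constructor crossAt
  field
    row<   : i < n
    col<   : j < n
    isX    : G (suc i) (suc j) ≡ tCross
    fromW  : H i j ≡ suc u
    fromS  : V (suc i) j ≡ suc v
open CrossAt public

-- Every crossing takes place in the direction that creates an inversion.
Good : ℕ → Grid → Labels → Labels → Set
Good n G H V = ∀ {i j} → i < n → j < n → G (suc i) (suc j) ≡ tCross → H i j < V (suc i) j

module Order {n : ℕ} {G : Grid} {H V : Labels} (W : Valid n G H V) where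
  open Frontier W

  private
    P : ℕ → ℕ → ℕ
    P = pipePos n G

  -- A reversal of order needs an exchange, and an exchange in which both strands are pipes is a
  -- cross: at a `tHor` or `tVer` one of the two edges is empty. `At n T i j` supplies a cell for
  -- every time below `T`.
  crossing-between : ∀ {t₁ t₂ T i j u v} → At n T i j → t₂ ≤ T → t₁ ≤ t₂ → u < n → v < n →
    P t₁ u < P t₁ v → P t₂ v < P t₂ u →
    Σ ℕ λ i' → Σ ℕ λ j' → CrossAt n G H V i' j' u v
  crossing-between {u = u} {v} a l k pu pv x y
    with exchange-between (bits n G) (place n) (n + u) (n + v) k x y
  ... | r , t₁≤r , r<t₂ , e₁ , e₂ , e₃ with at-earlier a (<-≤-trans r<t₂ l)
  ...   | i' , j' , b , j'<n with at-cell b j'<n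
  ...     | c = i' , j' , crossAt i'<n j'<n
                  (cell-cross (cell W i'<n j'<n) (subst Bit c e₁) w s) w s
    where
    Bit : ℕ × ℕ → Set
    Bit p = bit (G (suc (proj₁ p)) (suc (proj₂ p))) ≡ true
    i'<n : i' < n
    i'<n = at-row (≤-trans (s≤s z≤n) j'<n) b
    w : H i' j' ≡ suc u
    w = west-of-pos j'<n b pu (trans e₂ (cong (λ p → proj₁ p + proj₂ p) c))
    s : V (suc i') j' ≡ suc v
    s = south-of-pos j'<n b pv (trans e₃ (cong (λ p → suc (proj₁ p + proj₂ p)) c))

  module _ {i j u v : ℕ} (p : i < n) (q : j < n) (eu : H i j ≡ suc u) (ev : V (suc i) j ≡ suc v) where

    private
      u<n : u < n
      u<n = H-range p (<⇒≤ q) eu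
      v<n : v < n
      v<n = V-range p q ev

    meet-order : ∀ {t} → At n t i j → P t u < P t v
    meet-order a = subst₂ _<_ (sym (pos-west q a eu)) (sym (pos-south q a ev)) ≤-refl

    -- Pipe `v` starts at the lower position, but `meet-order` has `u` lower at the cell, so they
    -- have changed order before reaching it. `crossed-after` is the mirror image, comparing the
    -- cell with the exits.
    crossed-before : v < u → Σ ℕ λ i' → Σ ℕ λ j' → CrossAt n G H V i' j' v u
    crossed-before v<u = crossing-between a ≤-refl z≤n v<n u<n (+-monoʳ-< n v<u) (meet-order a)
      where a = proj₂ (time p q)

    crossed-after : ∀ {r r'} → r < n → r' < n → H r n ≡ suc u → H r' n ≡ suc v → r' < r →
      Σ ℕ λ i' → Σ ℕ λ j' → CrossAt n G H V i' j' u v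
    crossed-after l l' x y k with time p q
    ... | t , a with at-end q a
    ...   | T , b , t<T = crossing-between b ≤-refl (<⇒≤ t<T) u<n v<n (meet-order a)
                 (subst₂ _<_ (sym (pos-exit b l' y)) (sym (pos-exit b l x)) (+-monoˡ-< n k))

  inversion-crosses : ∀ {u v r r'} → u < v → r < n → r' < n → H r n ≡ suc u → H r' n ≡ suc v → r' < r →
    Σ ℕ λ i → Σ ℕ λ j → CrossAt n G H V i j u v
  inversion-crosses u<v l l' x y k with endTime (≤-trans (s≤s z≤n) l)
  ... | T , b = crossing-between b ≤-refl z≤n (H-range l ≤-refl x) (H-range l' ≤-refl y) (+-monoʳ-< n u<v)
                 (subst₂ _<_ (sym (pos-exit b l' y)) (sym (pos-exit b l x)) (+-monoˡ-< n k))

  after-cross : ∀ {i j u v t} → CrossAt n G H V i j u v → At n t i j → P (suc t) u ≡ suc (i + j) × P (suc t) v ≡ i + j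
  after-cross {i} {j} {u} {v} {t} (crossAt p q x e f) a =
    trans (posW I (proj₂ (outs cellX))) (+-suc i j) , posN I ≤-refl (proj₁ (outs cellX))
    where
    I : Positions (suc t) i (suc j)
    I = positions (≤-trans (s≤s z≤n) q) (atC q a)
    cellX : Cell tCross (suc u) (suc v) (V i j) (H i (suc j))
    cellX = subst₂ (λ w s → Cell tCross w s (V i j) (H i (suc j))) e f
              (subst (λ c → Cell c (H i j) (V (suc i) j) (V i j) (H i (suc j))) x (cell W p q))
    outs : ∀ {w s N E} → Cell tCross w s N E → N ≡ s × E ≡ w
    outs cross = refl , refl

  module _ (good : Good n G H V) where

    good-< : ∀ {i j u v} → CrossAt n G H V i j u v → u < v
    good-< (crossAt p q x e f) with subst₂ _<_ e f (good p q x)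
    ... | s≤s l = l

    -- After a crossing the two pipes are exchanged, and a bad crossing would be needed to undo this.
    no-meet-after : ∀ {i j i' j' u v t t'} → CrossAt n G H V i j u v → At n t i j → t < t' → At n t' i' j' →
      i' < n → j' < n → H i' j' ≡ suc u → V (suc i') j' ≡ suc v → ⊥
    no-meet-after {i} {j} {u = u} {v} {t} X@(crossAt p q x e f) a l a' p' q' e' f' =
      contra (crossing-between a' ≤-refl l (V-range p q f) (H-range p (<⇒≤ q) e)
             (subst₂ _<_ (sym (proj₂ (after-cross X a))) (sym (proj₁ (after-cross X a))) ≤-refl) (meet-order p' q' e' f' a'))
      where
      contra : (Σ ℕ λ i' → Σ ℕ λ j' → CrossAt n G H V i' j' v u) → ⊥
      contra (_ , _ , Y) = <-asym (good-< X) (good-< Y)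

    -- The cross leaves `v` at the lower position. Exits in the other order would require a second
    -- crossing, with `v` entering from the west, and goodness would then give both `u < v` and
    -- `v < u`.
    crossing-inverts : ∀ {i j u v r r'} → CrossAt n G H V i j u v → r < n → r' < n →
      H r n ≡ suc u → H r' n ≡ suc v → r' < r
    crossing-inverts {i} {j} {u} {v} {r} {r'} X@(crossAt p q _ e f) l l' x y with <-cmp r r'
    ... | tri> _ _ k = k
    ... | tri≈ _ refl _ = ⊥-elim (distinct p q e f (suc-injective (trans (sym x) y)))
    ... | tri< k _ _ = ⊥-elim (contra (time p q))
      where
      contra : (Σ ℕ λ t → At n t i j) → ⊥
      contra (t , a) with at-end q a
      ... | T , b , t<T = bad (crossing-between b ≤-refl t<T (V-range p q f) (H-range p (<⇒≤ q) e)
              (subst₂ _<_ (sym (proj₂ (after-cross X a))) (sym (proj₁ (after-cross X a))) ≤-refl)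
              (subst₂ _<_ (sym (pos-exit b l x)) (sym (pos-exit b l' y)) (+-monoˡ-< n k)))
        where
        bad : (Σ ℕ λ i' → Σ ℕ λ j' → CrossAt n G H V i' j' v u) → ⊥
        bad (_ , _ , Y) = <-asym (good-< X) (good-< Y)

    crossing-unique : ∀ {i j i' j' u v} → CrossAt n G H V i j u v → CrossAt n G H V i' j' u v → i ≡ i' × j ≡ j'
    crossing-unique X@(crossAt p q _ e f) Y@(crossAt p' q' _ e' f') with time p q | time p' q'
    ... | t , a | t' , a' with <-cmp t t'
    ...   | tri< l _ _ = ⊥-elim (no-meet-after X a l a' p' q' e' f')
    ...   | tri≈ _ refl _ = at-same q q' a a'
    ...   | tri> _ _ l = ⊥-elim (no-meet-after Y a' l a p q e f)

-- Changing cells between cross and bump.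

bits-at : ∀ G {n t i j} → At n t i j → j < n → bits n G t ≡ bit (G (suc i) (suc j))
bits-at G a l rewrite at-cell a l = refl

place-at : ∀ {n t i j} → At n t i j → j < n → place n t ≡ i + j
place-at a l rewrite at-cell a l = refl

-- Replacing a cross by a bump, or conversely, flips one decision of the word. The labels on the
-- west and south edges of that cell are settled before it and stay; from there on the two pipes are
-- interchanged, and so are their exits.
module Toggle {n : ℕ} {G G' : Grid} {H V H' V' : Labels} (W : Valid n G H V) (W' : Valid n G' H' V')
  {i j u v : ℕ} (p : i < n) (q : j < n) (eu : H i j ≡ suc u) (ev : V (suc i) j ≡ suc v)
  (same : ∀ {i' j'} → i' < n → j' < n → ¬ (i' ≡ i × j' ≡ j) →
          bit (G' (suc i') (suc j')) ≡ bit (G (suc i') (suc j')))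
  (flipped : bit (G' (suc i) (suc j)) ≡ not (bit (G (suc i) (suc j)))) where

  private
    module A = Frontier W
    module A' = Frontier W'
    t : ℕ
    t = proj₁ (time p q)
    a : At n t i j
    a = proj₂ (time p q)
    T : ℕ
    T = proj₁ (at-end q a)
    b : At n T 0 n
    b = proj₁ (proj₂ (at-end q a))
    t<T : t < T
    t<T = proj₂ (proj₂ (at-end q a))

    same′ : ∀ r → r < T → r ≢ t → bits n G' r ≡ bits n G r
    same′ r l k with at-earlier b l
    ... | i' , j' , c , l' = trans (bits-at G' c l') (trans
            (same (at-row (≤-trans (s≤s z≤n) l') c) l' (λ { (refl , refl) → k (at-unique q c a) }))
            (sym (bits-at G c l')))

    module F = Flip (bits n G) (bits n G') (place n) t T t<T same′
      (trans (bits-at G' a q) (trans flipped (cong not (sym (bits-at G a q)))))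

    pu : pos (bits n G) (place n) t (n + u) ≡ place n t
    pu = trans (A.pos-west q a eu) (sym (place-at a q))
    pv : pos (bits n G) (place n) t (n + v) ≡ suc (place n t)
    pv = trans (A.pos-south q a ev) (cong suc (sym (place-at a q)))

  toggle-west : H' i j ≡ suc u
  toggle-west = A'.west-of-pos q a (A.H-range p (<⇒≤ q) eu) (trans (F.flip-before t (n + u) ≤-refl) (A.pos-west q a eu))

  toggle-south : V' (suc i) j ≡ suc v
  toggle-south = A'.south-of-pos q a (A.V-range p q ev) (trans (F.flip-before t (n + v) ≤-refl) (A.pos-south q a ev))

  toggle-exit₁ : ∀ {r} → r < n → H r n ≡ suc u → H' r n ≡ suc v
  toggle-exit₁ l e = proj₂ (A'.exit-of-pos b (A.V-range p q ev)
    (trans (F.flip-after₂ pu pv T t<T ≤-refl) (A.pos-exit b l e)))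

  toggle-exit₂ : ∀ {r} → r < n → H r n ≡ suc v → H' r n ≡ suc u
  toggle-exit₂ l e = proj₂ (A'.exit-of-pos b (A.H-range p (<⇒≤ q) eu)
    (trans (F.flip-after₁ pu pv T t<T ≤-refl) (A.pos-exit b l e)))

  toggle-exit-other : ∀ {r c} → r < n → c ≢ u → c ≢ v → H r n ≡ suc c → H' r n ≡ suc c
  toggle-exit-other {r} {c} l x y e = proj₂ (A'.exit-of-pos b (A.H-range l ≤-refl e)
    (trans (F.flip-other pu pv T (n + c) ≤-refl (x ∘ +-cancelˡ-≡ n c u) (y ∘ +-cancelˡ-≡ n c v)) (A.pos-exit b l e)))

-- Two decisions are flipped at cells where the same pipes meet, so `Flip2` applies. Goodness of the
-- old grid decides how the pipes enter the cross: as at the bump if the bump is processed first,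
-- the other way round if the cross is first.
module CrossBumpSwap {n : ℕ} {G G' : Grid} {H V H' V' : Labels} (W : Valid n G H V) (W' : Valid n G' H' V')
  (good : Good n G H V)
  {i j u v : ℕ} (p : i < n) (q : j < n) (isB : G (suc i) (suc j) ≡ tBump)
  (eu : H i j ≡ suc u) (ev : V (suc i) j ≡ suc v)
  {x y : ℕ} (X : CrossAt n G H V x y u v ⊎ CrossAt n G H V x y v u)
  (newX : G' (suc i) (suc j) ≡ tCross) (newB : G' (suc x) (suc y) ≡ tBump)
  (same : ∀ {i' j'} → i' < n → j' < n → ¬ (i' ≡ i × j' ≡ j) → ¬ (i' ≡ x × j' ≡ y) →
          G' (suc i') (suc j') ≡ G (suc i') (suc j')) where

  private
    module A = Frontier W
    module A' = Frontier W'
    open Order W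

    u<n : u < n
    u<n = A.H-range p (<⇒≤ q) eu
    v<n : v < n
    v<n = A.V-range p q ev
    x<n : x < n
    x<n = case X of λ { (inj₁ c) → row< c ; (inj₂ c) → row< c }
    y<n : y < n
    y<n = case X of λ { (inj₁ c) → col< c ; (inj₂ c) → col< c }
    isX′ : G (suc x) (suc y) ≡ tCross
    isX′ = case X of λ { (inj₁ c) → isX c ; (inj₂ c) → isX c }

    tB tX : ℕ
    tB = proj₁ (time p q)
    tX = proj₁ (time x<n y<n)
    aB : At n tB i j
    aB = proj₂ (time p q)
    aX : At n tX x y
    aX = proj₂ (time x<n y<n)

    T : ℕ
    T = proj₁ (A.endTime (≤-trans (s≤s z≤n) p))
    b : At n T 0 n
    b = proj₂ (A.endTime (≤-trans (s≤s z≤n) p))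
    before-end : ∀ {t i j} → At n t i j → j < n → t < T
    before-end a l with at-end l a
    ... | T' , b' , k = subst (_ <_) (trans (at-time z b') (sym (at-time z b))) k
      where z = ≤-trans (s≤s z≤n) p

    same′ : ∀ r → r < T → r ≢ tB → r ≢ tX → bits n G' r ≡ bits n G r
    same′ r l k k' with at-earlier b l
    ... | i' , j' , c , l' = trans (bits-at G' c l') (trans
            (cong bit (same (at-row (≤-trans (s≤s z≤n) l') c) l' (λ { (refl , refl) → k (at-unique q c aB) })
                                                               (λ { (refl , refl) → k' (at-unique y<n c aX) })))
            (sym (bits-at G c l')))

    flippedB : bits n G' tB ≡ not (bits n G tB)
    flippedB = trans (trans (bits-at G' aB q) (cong bit newX))
                     (cong not (sym (trans (bits-at G aB q) (cong bit isB))))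
    flippedX : bits n G' tX ≡ not (bits n G tX)
    flippedX = trans (trans (bits-at G' aX y<n) (cong bit newB))
                     (cong not (sym (trans (bits-at G aX y<n) (cong bit isX′))))

    lowAt : ∀ {t i j c} → At n t i j → j < n → H i j ≡ suc c → pos (bits n G) (place n) t (n + c) ≡ place n t
    lowAt a l e = trans (A.pos-west l a e) (sym (place-at a l))
    highAt : ∀ {t i j c} → At n t i j → j < n → V (suc i) j ≡ suc c → pos (bits n G) (place n) t (n + c) ≡ suc (place n t)
    highAt a l e = trans (A.pos-south l a e) (cong suc (sym (place-at a l)))

    Result : Set
    -- At the new bump `v`, which had the r-turn at the old one, enters from the west. The pipe from
    -- the south, which droops next, is thus `u`, the one with the W-N turn at the old bump.
    Result = (∀ {r} → r < n → H' r n ≡ H r n) × (H' x y ≡ suc v × V' (suc x) y ≡ suc u) ×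
             ((H' i j ≡ suc u × V' (suc i) j ≡ suc v) ⊎ (H' i j ≡ suc v × V' (suc i) j ≡ suc u))

    exits-from : (∀ c → pos (bits n G') (place n) T c ≡ pos (bits n G) (place n) T c) → ∀ {r} → r < n → H' r n ≡ H r n
    exits-from h l with right W l
    ... | c , e = trans (proj₂ (A'.exit-of-pos b (A.H-range l ≤-refl e) (trans (h _) (A.pos-exit b l e)))) (sym e)

    bump-first : tB < tX → CrossAt n G H V x y u v → Result
    bump-first l (crossAt _ _ _ ex ey) =
      exits-from (λ c → flip2-after T c (before-end aX y<n) ≤-refl) ,
      (A'.west-of-pos y<n aX v<n (trans (flip2-mid₂ tX l ≤-refl) (A.pos-west y<n aX ex)) ,
       A'.south-of-pos y<n aX u<n (trans (flip2-mid₁ tX l ≤-refl) (A.pos-south y<n aX ey))) ,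
      inj₁ (A'.west-of-pos q aB u<n (trans (flip2-before tB _ ≤-refl) (A.pos-west q aB eu)) ,
            A'.south-of-pos q aB v<n (trans (flip2-before tB _ ≤-refl) (A.pos-south q aB ev)))
      where
      open Flip2 (bits n G) (bits n G') (place n) tB tX T l (before-end aX y<n) same′ flippedB flippedX
             (lowAt aB q eu) (highAt aB q ev) (inj₁ (lowAt aX y<n ex , highAt aX y<n ey))

    cross-first : tX < tB → CrossAt n G H V x y v u → Result
    cross-first l (crossAt _ _ _ ex ey) =
      exits-from (λ c → flip2-after T c (before-end aB q) ≤-refl) ,
      (A'.west-of-pos y<n aX v<n (trans (flip2-before tX _ ≤-refl) (A.pos-west y<n aX ex)) ,
       A'.south-of-pos y<n aX u<n (trans (flip2-before tX _ ≤-refl) (A.pos-south y<n aX ey))) ,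
      inj₂ (A'.west-of-pos q aB v<n (trans (flip2-mid₁ tB l ≤-refl) (A.pos-west q aB eu)) ,
            A'.south-of-pos q aB u<n (trans (flip2-mid₂ tB l ≤-refl) (A.pos-south q aB ev)))
      where
      open Flip2 (bits n G) (bits n G') (place n) tX tB T l (before-end aB q)
             (λ r k y z → same′ r k z y) flippedX flippedB
             (lowAt aX y<n ex) (highAt aX y<n ey) (inj₂ (lowAt aB q eu , highAt aB q ev))

    result′ : CrossAt n G H V x y u v ⊎ CrossAt n G H V x y v u → Result
    result′ Y with <-cmp tB tX
    result′ (inj₁ c) | tri< l _ _ = bump-first l c
    -- The bump has `u` at the lower position and the cross `v`. The crossing needed in between
    -- would give `u < v` against `v < u`.
    result′ (inj₂ c) | tri< l _ _ = contra (crossing-between aX ≤-refl (<⇒≤ l) u<n v<n (meet-order p q eu ev aB)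
                                         (meet-order x<n y<n (fromW c) (fromS c) aX))
      where
      contra : (Σ ℕ λ i' → Σ ℕ λ j' → CrossAt n G H V i' j' u v) → Result
      contra (_ , _ , Y) = ⊥-elim (<-asym (good-< good c) (good-< good Y))
    result′ _ | tri≈ _ e _ with at-same q y<n aB (subst (λ t → At n t x y) (sym e) aX)
    ... | refl , refl = case trans (sym isB) isX′ of λ ()
    result′ (inj₂ c) | tri> _ _ l = cross-first l c
    result′ (inj₁ c) | tri> _ _ l = ⊥-elim (no-meet-after good c aX l aB p q eu ev)

    result : Result
    result = result′ X

  swap-exits : ∀ {r} → r < n → H' r n ≡ H r n
  swap-exits = proj₁ result

  swap-bump : H' x y ≡ suc v × V' (suc x) y ≡ suc u
  swap-bump = proj₁ (proj₂ result)

  swap-cross : CrossAt n G' H' V' i j u v ⊎ CrossAt n G' H' V' i j v u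
  swap-cross with proj₂ (proj₂ result)
  ... | inj₁ (e , f) = inj₁ (crossAt p q newX e f)
  ... | inj₂ (e , f) = inj₂ (crossAt p q newX e f)

-- Counting crosses against inversions.

ind : Bool → ℕ
ind b = if b then 1 else 0

sumFrom : ℕ → ℕ → (ℕ → ℕ) → ℕ
sumFrom j zero    f = 0
sumFrom j (suc k) f = f j + sumFrom (suc j) k f

listFrom : {A : Set} → ℕ → ℕ → (ℕ → A) → List A
listFrom j zero    f = []
listFrom j (suc k) f = f j ∷ listFrom (suc j) k f

sumFrom-cong : ∀ j k {f g} → (∀ x → j ≤ x → x < j + k → f x ≡ g x) → sumFrom j k f ≡ sumFrom j k g
sumFrom-cong j zero    h = refl
sumFrom-cong j (suc k) h = cong₂ _+_ (h j ≤-refl (m<m+n j (s≤s z≤n)))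
  (sumFrom-cong (suc j) k λ x p q → h x (<⇒≤ p) (subst (x <_) (sym (+-suc j k)) q))

listFrom-cong : ∀ {A : Set} j k {f g : ℕ → A} → (∀ x → j ≤ x → x < j + k → f x ≡ g x) → listFrom j k f ≡ listFrom j k g
listFrom-cong j zero    h = refl
listFrom-cong j (suc k) h = cong₂ _∷_ (h j ≤-refl (m<m+n j (s≤s z≤n)))
  (listFrom-cong (suc j) k λ x p q → h x (<⇒≤ p) (subst (x <_) (sym (+-suc j k)) q))

sumFrom-0 : ∀ j k {f} → (∀ x → j ≤ x → x < j + k → f x ≡ 0) → sumFrom j k f ≡ 0
sumFrom-0 j zero    h = refl
sumFrom-0 j (suc k) h = cong₂ _+_ (h j ≤-refl (m<m+n j (s≤s z≤n)))
  (sumFrom-0 (suc j) k λ x p q → h x (<⇒≤ p) (subst (x <_) (sym (+-suc j k)) q))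

sumFrom-0⁻¹ : ∀ j k {f} → sumFrom j k f ≡ 0 → ∀ x → j ≤ x → x < j + k → f x ≡ 0
sumFrom-0⁻¹ j zero    e x p q = ⊥-elim (<-irrefl refl (<-≤-trans q (subst (_≤ x) (sym (+-identityʳ j)) p)))
sumFrom-0⁻¹ j (suc k) {f} e x p q with m≤n⇒m<n∨m≡n p
... | inj₁ l = sumFrom-0⁻¹ (suc j) k (m+n≡0⇒n≡0 (f j) e) x l (subst (x <_) (+-suc j k) q)
... | inj₂ refl = m+n≡0⇒m≡0 (f j) e

count-∷ : ∀ {A : Set} (p : A → Bool) x xs → countᵇ p (x ∷ xs) ≡ ind (p x) + countᵇ p xs
count-∷ p x xs with p x
... | true  = refl
... | false = refl

below : ℕ → ℕ → Bool
below x y = occupied y ∧ (y <ᵇ x)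

-- Inversions among the pipes on the frontier: an empty edge, labelled 0, counts neither as the
-- larger nor as the smaller entry of a pair.
frontierInv : List ℕ → ℕ
frontierInv []       = 0
frontierInv (x ∷ xs) = countᵇ (below x) xs + frontierInv xs

frontierInv-swap : ∀ x y R →
  frontierInv (x ∷ y ∷ R) + ind (below y x) ≡ frontierInv (y ∷ x ∷ R) + ind (below x y)
frontierInv-swap x y R rewrite count-∷ (below x) y R | count-∷ (below y) x R =
  lemma (ind (below x y)) (ind (below y x)) (countᵇ (below x) R) (countᵇ (below y) R) (frontierInv R)
  where
  lemma : ∀ a b c d w → a + c + (d + w) + b ≡ b + d + (c + w) + a
  lemma = solve-∀

below-0 : ∀ y → below 0 y ≡ false
below-0 zero    = refl
below-0 (suc y) = refl

frontierInv-0 : ∀ xs → frontierInv (0 ∷ xs) ≡ frontierInv xs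
frontierInv-0 xs = cong (_+ frontierInv xs) (none xs)
  where
  none : ∀ xs → countᵇ (below 0) xs ≡ 0
  none []       = refl
  none (x ∷ xs) = trans (count-∷ (below 0) x xs) (cong₂ _+_ (cong ind (below-0 x)) (none xs))

isCross : Tile → Bool
isCross t = eqTile t tCross

isBad : Tile → ℕ → ℕ → Bool
isBad t w s = isCross t ∧ (s <ᵇ w)

<ᵇ-true : ∀ {m n} → m < n → (m <ᵇ n) ≡ true
<ᵇ-true {zero}  (s≤s _) = refl
<ᵇ-true {suc m} (s≤s p) = <ᵇ-true p

<ᵇ-false : ∀ {m n} → n ≤ m → (m <ᵇ n) ≡ false
<ᵇ-false {m}     z≤n     = <0 m
  where
  <0 : ∀ m → (m <ᵇ 0) ≡ false
  <0 zero    = refl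
  <0 (suc m) = refl
<ᵇ-false {suc m} (s≤s p) = <ᵇ-false p

<ᵇ-either : ∀ {m n} → m ≢ n → ind (m <ᵇ n) + ind (n <ᵇ m) ≡ 1
<ᵇ-either {m} {n} p with <-cmp m n
... | tri< l _ _ rewrite <ᵇ-true l | <ᵇ-false (<⇒≤ l) = refl
... | tri≈ _ e _ = ⊥-elim (p e)
... | tri> _ _ l rewrite <ᵇ-true l | <ᵇ-false (<⇒≤ l) = refl

-- A cross with the smaller label on its west edge creates an inversion, a bad one destroys an
-- inversion, and moving an empty edge past a pipe is free. The factor 2 is the difference between
-- gaining and losing one, written without subtraction.
cell-inv : ∀ {t w s N E} → Cell t w s N E → (∀ {u v} → w ≡ suc u → s ≡ suc v → u ≢ v) → ∀ R →
  frontierInv (w ∷ s ∷ R) + ind (isCross t) ≡ frontierInv (N ∷ E ∷ R) + 2 * ind (isBad t w s)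
cell-inv blank _ R = refl
cell-inv (hor {u}) _ R = frontierInv-swap (suc u) 0 R
cell-inv (ver {v}) _ R = frontierInv-swap 0 (suc v) R
cell-inv relb  _ R = refl
cell-inv jelb  _ R = refl
cell-inv bump  _ R = refl
cell-inv (cross {u} {v}) d R =
  trans (cong (frontierInv (suc u ∷ suc v ∷ R) +_) (sym (<ᵇ-either (d refl refl))))
 (trans (sym (+-assoc (frontierInv (suc u ∷ suc v ∷ R)) (ind (u <ᵇ v)) (ind (v <ᵇ u))))
 (trans (cong (_+ ind (v <ᵇ u)) (frontierInv-swap (suc u) (suc v) R))
 (trans (+-assoc (frontierInv (suc v ∷ suc u ∷ R)) _ _)
        (cong (frontierInv (suc v ∷ suc u ∷ R) +_) (double (ind (v <ᵇ u)))))))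
  where
  double : ∀ a → a + a ≡ 2 * a
  double = solve-∀

cell-count : ∀ {t w s N E} → Cell t w s N E → (p : ℕ → Bool) → ind (p w) + ind (p s) ≡ ind (p N) + ind (p E)
cell-count blank p = refl
cell-count hor   p = +-comm (ind (p _)) (ind (p _))
cell-count ver   p = +-comm (ind (p _)) (ind (p _))
cell-count cross p = +-comm (ind (p _)) (ind (p _))
cell-count relb  p = refl
cell-count jelb  p = refl
cell-count bump  p = refl

crossCount : ℕ → Grid → ℕ
crossCount n G = sumFrom 0 n λ i → sumFrom 0 n λ j → ind (isCross (G (suc i) (suc j)))

exitList : ℕ → Labels → List ℕ
exitList n H = listFrom 0 n λ r → H r n

module Inversions {n : ℕ} {G : Grid} {H V : Labels} (W : Valid n G H V) where
  open Frontier W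

  private
    crossRow badRow : ℕ → ℕ → ℕ → ℕ
    crossRow i j k = sumFrom j k λ j → ind (isCross (G (suc i) (suc j)))
    badRow   i j k = sumFrom j k λ j → ind (isBad (G (suc i) (suc j)) (H i j) (V (suc i) j))

    before after : ℕ → ℕ → ℕ → List ℕ → List ℕ
    before i j k X = H i j ∷ listFrom j k (V (suc i)) ++ X
    after  i j k X = listFrom j k (V i) ++ H i n ∷ X

    -- The north label just produced stays in front of the unprocessed part of the row and
    -- contributes the smaller labels behind it. Their number survives the rest of the row because
    -- cells only permute labels.
    row-count : ∀ {i} → i < n → ∀ p k j X → k + j ≡ n → countᵇ p (before i j k X) ≡ countᵇ p (after i j k X)
    row-count l p zero    j X refl = refl
    row-count {i} l p (suc k) j X e =
      trans (count-∷ p (H i j) _) (trans (cong (ind (p (H i j)) +_) (count-∷ p (V (suc i) j) R))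
     (trans (sym (+-assoc (ind (p (H i j))) _ _))
     (trans (cong (_+ countᵇ p R) (cell-count (cell W l j<n) p))
     (trans (+-assoc (ind (p (V i j))) _ _) (trans (cong (ind (p (V i j)) +_) (sym (count-∷ p (H i (suc j)) R)))
     (trans (cong (ind (p (V i j)) +_) (row-count l p k (suc j) X (trans (+-suc k j) e)))
            (sym (count-∷ p (V i j) _))))))))
      where
      R : List ℕ
      R = listFrom (suc j) k (V (suc i)) ++ X
      j<n : j < n
      j<n = subst (j <_) e (s≤s (m≤n+m j k))

    row-inv : ∀ {i} → i < n → ∀ k j X → k + j ≡ n →
      frontierInv (before i j k X) + crossRow i j k ≡ frontierInv (after i j k X) + 2 * badRow i j k
    row-inv l zero    j X refl = refl
    row-inv {i} l (suc k) j X e =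
      combine (frontierInv (H i j ∷ V (suc i) j ∷ R)) (ind (isCross (G (suc i) (suc j))))
              (countᵇ (below (V i j)) (H i (suc j) ∷ R)) (frontierInv (H i (suc j) ∷ R))
              (ind (isBad (G (suc i) (suc j)) (H i j) (V (suc i) j)))
              (crossRow i (suc j) k) (countᵇ (below (V i j)) (after i (suc j) k X))
              (frontierInv (after i (suc j) k X)) (badRow i (suc j) k)
              (cell-inv (cell W l j<n) (distinct l j<n) R)
              (row-inv l k (suc j) X (trans (+-suc k j) e))
              (row-count l (below (V i j)) k (suc j) X (trans (+-suc k j) e))
      where
      R : List ℕ
      R = listFrom (suc j) k (V (suc i)) ++ X
      j<n : j < n
      j<n = subst (j <_) e (s≤s (m≤n+m j k))
      combine : ∀ a x c f b xs c' f' bs → a + x ≡ c + f + 2 * b → f + xs ≡ f' + 2 * bs → c ≡ c' →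
        a + (x + xs) ≡ c' + f' + 2 * (b + bs)
      combine a x c f b xs c' f' bs p q refl =
        trans (sym (+-assoc a x xs)) (trans (cong (_+ xs) p) (trans (r1 c f b xs)
        (trans (cong (λ z → c + z + 2 * b) q) (r2 c f' b bs))))
        where
        r1 : ∀ c f b xs → c + f + 2 * b + xs ≡ c + (f + xs) + 2 * b
        r1 = solve-∀
        r2 : ∀ c f' b bs → c + (f' + 2 * bs) + 2 * b ≡ c + f' + 2 * (b + bs)
        r2 = solve-∀

    state : ℕ → ℕ → List ℕ
    state i k = listFrom 0 n (V i) ++ listFrom i k λ r → H r n

    crossRows badRows : ℕ → ℕ → ℕ
    crossRows i k = sumFrom i k λ i → crossRow i 0 n
    badRows   i k = sumFrom i k λ i → badRow i 0 n

    rows-inv : ∀ k i → k + i ≡ n → frontierInv (state i k) + 2 * badRows i k ≡ frontierInv (state n 0) + crossRows i k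
    rows-inv zero    i refl = refl
    rows-inv (suc k) i e =
      combine (frontierInv (state i (suc k))) (badRow i 0 n) (frontierInv (state (suc i) k)) (crossRow i 0 n)
              (badRows (suc i) k) (frontierInv (state n 0)) (crossRows (suc i) k)
              (trans (cong (_+ crossRow i 0 n) (sym (trans (cong (λ z → frontierInv (z ∷ state (suc i) k)) (left W i<n))
                                                           (frontierInv-0 (state (suc i) k)))))
                     (row-inv i<n n 0 (listFrom (suc i) k λ r → H r n) (+-identityʳ n)))
              (rows-inv k (suc i) (trans (+-suc k i) e))
      where
      i<n : i < n
      i<n = subst (i <_) e (s≤s (m≤n+m i k))
      combine : ∀ a b c x bs f xs → c + x ≡ a + 2 * b → c + 2 * bs ≡ f + xs → a + 2 * (b + bs) ≡ f + (x + xs)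
      combine a b c x bs f xs p q = trans (r1 a b bs) (trans (cong (_+ 2 * bs) (sym p))
        (trans (r2 c x bs) (trans (cong (_+ x) q) (r3 f xs x))))
        where
        r1 : ∀ a b bs → a + 2 * (b + bs) ≡ a + 2 * b + 2 * bs
        r1 = solve-∀
        r2 : ∀ c x bs → c + x + 2 * bs ≡ c + 2 * bs + x
        r2 = solve-∀
        r3 : ∀ f xs x → f + xs + x ≡ f + (x + xs)
        r3 = solve-∀

    increasing : ∀ k j → frontierInv (listFrom j k suc ++ []) ≡ 0
    increasing zero    j = refl
    increasing (suc k) j = cong₂ _+_ (none k (suc j) j ≤-refl) (increasing k (suc j))
      where
      none : ∀ k j x → x < j → countᵇ (below (suc x)) (listFrom j k suc ++ []) ≡ 0
      none zero    j x l = refl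
      none (suc k) j x l = trans (count-∷ (below (suc x)) (suc j) _)
        (cong₂ _+_ (cong ind (<ᵇ-false (<⇒≤ l))) (none k (suc j) x (m≤n⇒m≤1+n l)))

    initial : frontierInv (state n 0) ≡ 0
    initial = trans (cong (λ xs → frontierInv (xs ++ [])) (listFrom-cong 0 n λ x _ q → bottom W q)) (increasing n 0)

    zeros : ∀ j k X → j + k ≡ n → frontierInv (listFrom j k (V 0) ++ X) ≡ frontierInv X
    zeros j zero    X e = refl
    zeros j (suc k) X e rewrite top W {j} (subst (j <_) e (m<m+n j (s≤s z≤n))) =
      trans (frontierInv-0 (listFrom (suc j) k (V 0) ++ X)) (zeros (suc j) k X (trans (sym (+-suc j k)) e))

    exits-inv : ∀ k j → j + k ≡ n → frontierInv (listFrom j k λ r → H r n) ≡ inv (listFrom j k λ r → H r n)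
    exits-inv zero    j e = refl
    exits-inv (suc k) j e = cong₂ _+_ (counts k (suc j) (H j n) (trans (sym (+-suc j k)) e))
                                      (exits-inv k (suc j) (trans (sym (+-suc j k)) e))
      where
      counts : ∀ k j x → j + k ≡ n → countᵇ (below x) (listFrom j k λ r → H r n) ≡ countᵇ (λ y → y <ᵇ x) (listFrom j k λ r → H r n)
      counts zero    j x e = refl
      counts (suc k) j x e = trans (count-∷ (below x) (H j n) (listFrom (suc j) k λ r → H r n)) (trans
        (cong₂ _+_ (cong ind (same (H j n) (right W (subst (j <_) e (m<m+n j (s≤s z≤n))))))
                   (counts k (suc j) x (trans (sym (+-suc j k)) e)))
        (sym (count-∷ (λ y → y <ᵇ x) (H j n) (listFrom (suc j) k λ r → H r n))))
        where
        same : ∀ y → (Σ ℕ λ c → y ≡ suc c) → below x y ≡ (y <ᵇ x)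
        same _ (c , refl) = refl

  badCount : ℕ
  badCount = badRows 0 n

  -- The sweep starts from an increasing word and ends with the exits behind an empty top border.
  -- Hence every grid has at least as many crosses as inversions, with equality exactly when no
  -- cross is bad, which gives both directions of the criterion.
  crossCount-inv : inv (exitList n H) + 2 * badCount ≡ crossCount n G
  crossCount-inv = trans (cong (_+ 2 * badCount) (sym (trans (zeros 0 n _ refl) (exits-inv n 0 refl))))
    (trans (rows-inv n 0 (+-identityʳ n)) (cong (_+ crossCount n G) initial))

  good⇒count : Good n G H V → crossCount n G ≡ inv (exitList n H)
  good⇒count good = trans (sym crossCount-inv) (trans (cong (λ b → inv (exitList n H) + 2 * b) noBad) (+-identityʳ _))
    where
    noBad : badCount ≡ 0
    noBad = sumFrom-0 0 n λ i _ p → sumFrom-0 0 n λ j _ q → cellOk (G (suc i) (suc j)) (good p q)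
      where
      cellOk : ∀ t {w s} → (t ≡ tCross → w < s) → ind (isBad t w s) ≡ 0
      cellOk (tile true true false false) h = cong ind (<ᵇ-false (<⇒≤ (h refl)))
      cellOk (tile true true true d) h = refl
      cellOk (tile true true false true) h = refl
      cellOk (tile true false c d) h = refl
      cellOk (tile false b c d) h = refl

  count⇒good : crossCount n G ≡ inv (exitList n H) → Good n G H V
  count⇒good e {i} {j} p q x = ≰⇒> λ l → notBad (≤∧≢⇒< l (neq l))
    where
    noBad : badCount ≡ 0
    noBad = m+n≡0⇒m≡0 _ (+-cancelˡ-≡ (inv (exitList n H)) _ 0 (trans crossCount-inv (trans e (sym (+-identityʳ _)))))
    thisCell : ind (isBad (G (suc i) (suc j)) (H i j) (V (suc i) j)) ≡ 0
    thisCell = sumFrom-0⁻¹ 0 n (sumFrom-0⁻¹ 0 n noBad i z≤n p) j z≤n q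
    notBad : V (suc i) j < H i j → ⊥
    notBad l = 1+n≢0 (trans (cong ind (sym (trans (cong (λ t → isBad t (H i j) (V (suc i) j)) x) (<ᵇ-true l)))) thisCell)
    labels : ∀ {w s N E} → Cell tCross w s N E → (Σ ℕ λ u → w ≡ suc u) × (Σ ℕ λ v → s ≡ suc v)
    labels cross = (_ , refl) , (_ , refl)
    neq : V (suc i) j ≤ H i j → V (suc i) j ≢ H i j
    neq _ f with labels (subst (λ t → Cell t (H i j) (V (suc i) j) (V i j) (H i (suc j))) x (cell W p q))
    ... | (u , eu) , (v , ev) = distinct p q eu ev (suc-injective (trans (sym eu) (trans (sym f) ev)))

-- Tracing pipes along their labels.

false≢true : false ≢ true
false≢true ()

∧-true : ∀ {a b} → a ∧ b ≡ true → a ≡ true × b ≡ true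
∧-true {true} {true} _ = refl , refl

≡ᵇ-sound : ∀ {m n} → (m ≡ᵇ n) ≡ true → m ≡ n
≡ᵇ-sound {zero}  {zero}  _ = refl
≡ᵇ-sound {suc m} {suc n} e = cong suc (≡ᵇ-sound e)

≤ᵇ-true : ∀ {m n} → m ≤ n → (m ≤ᵇ n) ≡ true
≤ᵇ-true {zero}  _ = refl
≤ᵇ-true {suc m} p = <ᵇ-true p

≤ᵇ-false : ∀ {m n} → n < m → (m ≤ᵇ n) ≡ false
≤ᵇ-false {suc m} (s≤s p) = <ᵇ-false p

any-true : ∀ {A : Set} (p : A → Bool) {x xs} → x ∈ xs → p x ≡ true → any p xs ≡ true
any-true p (here refl) e rewrite e = refl
any-true p {xs = y ∷ xs} (there l) e with p y
... | true  = refl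
... | false = any-true p l e

any-true⁻¹ : ∀ {A : Set} (p : A → Bool) xs → any p xs ≡ true → Σ A λ x → x ∈ xs × p x ≡ true
any-true⁻¹ p (x ∷ xs) e with p x in eq
... | true  = x , here refl , eq
... | false with any-true⁻¹ p xs e
...   | y , l , q = y , there l , q

applyUpTo≡listFrom : ∀ {A : Set} (f g : ℕ → A) n j → (∀ x → f x ≡ g (x + j)) → applyUpTo f n ≡ listFrom j n g
applyUpTo≡listFrom f g zero    j h = refl
applyUpTo≡listFrom f g (suc n) j h =
  cong₂ _∷_ (h 0) (applyUpTo≡listFrom (f ∘ suc) g n (suc j) λ x → trans (h (suc x)) (cong g (sym (+-suc x j))))

range1≡ : ∀ n → range1 n ≡ listFrom 1 n (λ x → x)
range1≡ n = applyUpTo≡listFrom suc (λ x → x) n 1 λ x → sym (+-comm x 1)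

map-range1 : ∀ {A : Set} (f : ℕ → A) n → map f (range1 n) ≡ listFrom 0 n (f ∘ suc)
map-range1 f n = trans (cong (map f) (range1≡ n)) (shift n 0)
  where
  shift : ∀ n j → map f (listFrom (suc j) n (λ x → x)) ≡ listFrom j n (f ∘ suc)
  shift zero    j = refl
  shift (suc n) j = cong (_ ∷_) (shift n (suc j))

first-spec : ∀ p k j m → firstWith p (listFrom j k (λ x → x)) ≡ just m →
  j ≤ m × m < j + k × p m ≡ true × (∀ x → j ≤ x → x < m → p x ≡ false)
first-spec p (suc k) j m e with p j in eq
first-spec p (suc k) j m refl | true = ≤-refl , m<m+n j (s≤s z≤n) , eq , λ x a b → ⊥-elim (<-irrefl refl (<-≤-trans b a))
first-spec p (suc k) j m e | false with first-spec p k (suc j) m e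
... | a , b , c , d = <⇒≤ a , subst (m <_) (sym (+-suc j k)) b , c , earlier
  where
  earlier : ∀ x → j ≤ x → x < m → p x ≡ false
  earlier x u v with m≤n⇒m<n∨m≡n u
  ... | inj₁ l    = d x l v
  ... | inj₂ refl = eq

first-intro : ∀ p k j m → j ≤ m → m < j + k → p m ≡ true → (∀ x → j ≤ x → x < m → p x ≡ false) →
  firstWith p (listFrom j k (λ x → x)) ≡ just m
first-intro p zero    j m a b c d = ⊥-elim (<-irrefl refl (<-≤-trans b (subst (_≤ m) (sym (+-identityʳ j)) a)))
first-intro p (suc k) j m a b c d with m≤n⇒m<n∨m≡n a
... | inj₂ refl rewrite c = refl
... | inj₁ l rewrite d j ≤-refl l =
  first-intro p k (suc j) m l (subst (m <_) (+-suc j k) b) c λ x u v → d x (<⇒≤ u) v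

count-≥1 : ∀ {A : Set} (p : A → Bool) {x xs} → x ∈ xs → p x ≡ true → 1 ≤ countᵇ p xs
count-≥1 p {x} {_ ∷ xs} (here refl) e rewrite count-∷ p x xs | e = s≤s z≤n
count-≥1 p {xs = y ∷ xs} (there l) e rewrite count-∷ p y xs = ≤-trans (count-≥1 p l e) (m≤n+m _ (ind (p y)))

count-≥2 : ∀ {A : Set} (p : A → Bool) {x y xs} → x ∈ xs → y ∈ xs → x ≢ y → p x ≡ true → p y ≡ true → 2 ≤ countᵇ p xs
count-≥2 p (here refl) (here refl) d _ _ = ⊥-elim (d refl)
count-≥2 p {x} {xs = _ ∷ xs} (here refl) (there l) d e f rewrite count-∷ p x xs | e = s≤s (count-≥1 p l f)
count-≥2 p {y = y} {_ ∷ xs} (there l) (here refl) d e f rewrite count-∷ p y xs | f = s≤s (count-≥1 p l e)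
count-≥2 p {xs = z ∷ xs} (there l) (there k) d e f rewrite count-∷ p z xs =
  ≤-trans (count-≥2 p l k d e f) (m≤n+m _ (ind (p z)))

count-0 : ∀ {A : Set} (p : A → Bool) xs → (∀ x → x ∈ xs → p x ≡ false) → countᵇ p xs ≡ 0
count-0 p []       h = refl
count-0 p (x ∷ xs) h rewrite count-∷ p x xs | h x (here refl) = count-0 p xs λ y l → h y (there l)

goesN goesE : Bool → Tile → Bool
goesN s t = if s then sn t else wn t
goesE s t = if s then se t else we t

connN connE : Bool → Conn
connN s = if s then cSN else cWN
connE s = if s then cSE else cWE

cell-out : ∀ {t W S N E c} → Cell t W S N E → ∀ s → (if s then S else W) ≡ suc c →
  (goesN s t ≡ true × goesE s t ≡ false × N ≡ suc c) ⊎ (goesN s t ≡ false × goesE s t ≡ true × E ≡ suc c)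
cell-out hor   false e = inj₂ (refl , refl , e)
cell-out ver   true  e = inj₁ (refl , refl , e)
cell-out cross false e = inj₂ (refl , refl , e)
cell-out cross true  e = inj₁ (refl , refl , e)
cell-out relb  true  e = inj₂ (refl , refl , e)
cell-out jelb  false e = inj₁ (refl , refl , e)
cell-out bump  false e = inj₁ (refl , refl , e)
cell-out bump  true  e = inj₂ (refl , refl , e)

cell-inN : ∀ {t W S N E c} → Cell t W S N E → N ≡ suc c →
  Σ Bool λ s → goesN s t ≡ true × (if s then S else W) ≡ suc c
cell-inN ver   e = true  , refl , e
cell-inN cross e = true  , refl , e
cell-inN jelb  e = false , refl , e
cell-inN bump  e = false , refl , e

cell-inE : ∀ {t W S N E c} → Cell t W S N E → E ≡ suc c →
  Σ Bool λ s → goesE s t ≡ true × (if s then S else W) ≡ suc c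
cell-inE hor   e = false , refl , e
cell-inE cross e = false , refl , e
cell-inE relb  e = true  , refl , e
cell-inE bump  e = true  , refl , e

seven-exclusive : ∀ {t} → Seven t → ∀ s → goesN s t ≡ true → goesE s t ≡ true → ⊥
seven-exclusive cross true  _ ()
seven-exclusive cross false () _
seven-exclusive bump  true  () _
seven-exclusive bump  false _ ()
seven-exclusive hor   true  () _
seven-exclusive hor   false () _
seven-exclusive ver   true  _ ()
seven-exclusive ver   false () _
seven-exclusive relb  true  () _
seven-exclusive relb  false () _
seven-exclusive jelb  true  () _
seven-exclusive jelb  false _ ()
seven-exclusive blank true  () _
seven-exclusive blank false () _

trace-N : ∀ n G f i j s → goesN s (G i j) ≡ true → goesE s (G i j) ≡ false →
  trace n G (suc f) i j s ≡ goN n G f i j (connN s)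
trace-N n G f i j true  e _ rewrite e = refl
trace-N n G f i j false e g rewrite g | e = refl

trace-E : ∀ n G f i j s → goesN s (G i j) ≡ false → goesE s (G i j) ≡ true →
  trace n G (suc f) i j s ≡ goE n G f i j (connE s)
trace-E n G f i j true  e g rewrite e | g = refl
trace-E n G f i j false e g rewrite g = refl

stepCell : Step → ℕ × ℕ
stepCell (a , b , _) = a , b

-- The underscores in these mutual blocks are solved by the equation that follows; this gives names to the
-- local functions inside permOf, bumpCross and (below) maxRElbow.
mutual
  permEntry : ℕ → Grid → List ℕ → ℕ → ℕ
  permEntry = _

  permOf-entries : ∀ n G → permOf n G ≡ map (permEntry n G (range1 n)) (range1 n)
  permOf-entries n G with range1 n
  ... | xs = refl

permEntry-∷ : ∀ n G x xs r y → exitRow n G x ≡ just y →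
  permEntry n G (x ∷ xs) r ≡ (if y ≡ᵇ r then x else permEntry n G xs r)
permEntry-∷ n G x xs r y e with exitRow n G x
permEntry-∷ n G x xs r y refl | .(just y) with y ≡ᵇ r
... | true  = refl
... | false = refl

mutual
  firstCross : ℕ → Grid → ℕ → ℕ → ℕ → ℕ → List Step → Maybe (ℕ × ℕ)
  firstCross = _

  bumpCross-first : ∀ n G i j p q → pipeAt n G i j cSE ≡ just p → pipeAt n G i j cWN ≡ just q →
    bumpCross n G i j ≡ firstCross n G i j p q (pipePath n G p)
  bumpCross-first n G i j p q e e' with pipeAt n G i j cSE | pipeAt n G i j cWN
  bumpCross-first n G i j p q refl refl | .(just p) | .(just q) with pipePath n G p
  ... | ps = refl

module Trace {n : ℕ} {G : Grid} {H V : Labels} (W : Valid n G H V) where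
  open Frontier W
  open Order W

  inLabel : Bool → ℕ → ℕ → ℕ
  inLabel s i j = if s then V (suc i) j else H i j

  -- The list produced by `trace`, without fuel and with the label of the edge entered at each step.
  -- `pathX` is the last step, through the right border.
  data Path (c : ℕ) : ℕ → ℕ → Bool → List Step → ℕ → Set where
    pathN : ∀ {i j s L r} → suc i < n → j < n → inLabel s (suc i) j ≡ suc c →
      goesN s (G (suc (suc i)) (suc j)) ≡ true → Path c i j true L r →
      Path c (suc i) j s ((suc (suc i) , suc j , connN s) ∷ L) r
    pathE : ∀ {i j s L r} → i < n → suc j < n → inLabel s i j ≡ suc c →
      goesE s (G (suc i) (suc j)) ≡ true → Path c i (suc j) false L r →
      Path c i j s ((suc i , suc j , connE s) ∷ L) r
    pathX : ∀ {i j s} → i < n → suc j ≡ n → inLabel s i j ≡ suc c →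
      goesE s (G (suc i) (suc j)) ≡ true → H i n ≡ suc c →
      Path c i j s ((suc i , suc j , connE s) ∷ []) (suc i)

  record Traced (c i j : ℕ) (s : Bool) (R : TraceResult) : Set where
    constructor traced
    field
      steps : List Step
      row   : ℕ
      isR   : R ≡ (steps , just row)
      path  : Path c i j s steps row
  open Traced

  private
    consN : ∀ {c i j s R} → suc i < n → j < n → inLabel s (suc i) j ≡ suc c →
      goesN s (G (suc (suc i)) (suc j)) ≡ true → Traced c i j true R →
      Traced c (suc i) j s (consStep (suc (suc i) , suc j , connN s) R)
    consN p q e g (traced L r refl P) = traced _ r refl (pathN p q e g P)

    consE : ∀ {c i j s R} → i < n → suc j < n → inLabel s i j ≡ suc c →
      goesE s (G (suc i) (suc j)) ≡ true → Traced c i (suc j) false R →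
      Traced c i j s (consStep (suc i , suc j , connE s) R)
    consE p q e g (traced L r refl P) = traced _ r refl (pathE p q e g P)

  mutual
    -- Each step lowers `i + (n ∸ j)`, and a pipe cannot leave through the top border, whose labels
    -- are 0. The fuel `2 * n` of `pipeTrace` is large enough for this bound at the bottom of every
    -- column.
    trace-path : ∀ f {c i j} s → i < n → j < n → inLabel s i j ≡ suc c → i + (n ∸ j) ≤ f →
      Traced c i j s (trace n G f (suc i) (suc j) s)
    trace-path zero {i = i} {j} s p q e l = ⊥-elim (m>n⇒m∸n≢0 q (n≤0⇒n≡0 (≤-trans (m≤n+m (n ∸ j) i) l)))
    trace-path (suc f) {c} {i} {j} s p q e l =
      trace-cell f s p q e l (cell-out (cell W p q) s e)

    trace-cell : ∀ f {c i j} s → i < n → j < n → inLabel s i j ≡ suc c → i + (n ∸ j) ≤ suc f →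
      (goesN s (G (suc i) (suc j)) ≡ true × goesE s (G (suc i) (suc j)) ≡ false × V i j ≡ suc c) ⊎
      (goesN s (G (suc i) (suc j)) ≡ false × goesE s (G (suc i) (suc j)) ≡ true × H i (suc j) ≡ suc c) →
      Traced c i j s (trace n G (suc f) (suc i) (suc j) s)
    trace-cell f {i = zero} s p q e l (inj₁ (a , b , o)) = ⊥-elim (0≢1+n (trans (sym (top W q)) o))
    trace-cell f {i = suc i} {j} s p q e (s≤s l) (inj₁ (a , b , o)) =
      subst (Traced _ (suc i) j s) (sym (trace-N n G f (suc (suc i)) (suc j) s a b))
        (consN p q e a (trace-path f true (<⇒≤ p) q o l))
    trace-cell f {c} {i} {j} s p q e l (inj₂ (a , b , o)) with m≤n⇒m<n∨m≡n q
    ... | inj₁ k = subst (Traced c i j s) (sym (trans (trace-E n G f (suc i) (suc j) s a b) next))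
                     (consE p k e b (trace-path f false p k o less))
      where
      next : goE n G f (suc i) (suc j) (connE s) ≡ consStep (suc i , suc j , connE s) (trace n G f (suc i) (suc (suc j)) false)
      next rewrite ≤ᵇ-false k = refl
      less : i + (n ∸ suc j) ≤ f
      less = ≤-pred (subst (_≤ suc f) (trans (cong (i +_) (m∸n≡1+m∸1+n q)) (+-suc i _)) l)
    ... | inj₂ k = subst (Traced c i j s) (sym (trans (trace-E n G f (suc i) (suc j) s a b) last))
                     (traced _ (suc i) refl (pathX p k e b (subst (λ m → H i m ≡ suc c) k o)))
      where
      last : goE n G f (suc i) (suc j) (connE s) ≡ ((suc i , suc j , connE s) ∷ [] , just (suc i))
      last rewrite ≤ᵇ-true (≤-reflexive (sym k)) = refl

  pipe : ∀ {c} → c < n → Traced c (pred n) c true (pipeTrace n G (suc c))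
  pipe {c} p = start p (subst (λ m → V m c ≡ suc c) (sym (suc-pred′ p)) (bottom W p))
    where
    suc-pred′ : ∀ {c m} → c < m → suc (pred m) ≡ m
    suc-pred′ (s≤s _) = refl
    start : c < n → V (suc (pred n)) c ≡ suc c → Traced c (pred n) c true (pipeTrace n G (suc c))
    start p e = subst (λ m → Traced c (pred n) c true (trace n G (2 * n) m (suc c) true)) (suc-pred′ p)
      (trace-path (2 * n) true (≤-reflexive (suc-pred′ p)) p e
        (+-mono-≤ (pred[n]≤n {n}) (≤-trans (m∸n≤m n c) (m≤m+n n 0))))

  path-exit : ∀ {c i j s L r} → Path c i j s L r → Σ ℕ λ r' → r ≡ suc r' × r' < n × H r' n ≡ suc c
  path-exit (pathN _ _ _ _ P) = path-exit P
  path-exit (pathE _ _ _ _ P) = path-exit P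
  path-exit (pathX p _ _ _ e) = _ , refl , p , e

  exitRow-label : ∀ {r c} → r < n → H r n ≡ suc c → exitRow n G (suc c) ≡ just (suc r)
  exitRow-label {r} p e with pipe (H-range p ≤-refl e)
  ... | traced L r' eq P with path-exit P
  ...   | r'' , refl , q , e' rewrite eq = cong (just ∘ suc) (exit-injective q p e' e)

  record Entry (c : ℕ) (x : Step) : Set where
    constructor entry
    field
      {ei ej} : ℕ
      es      : Bool
      conn    : Conn
      isx     : x ≡ (suc ei , suc ej , conn)
      ei<     : ei < n
      ej<     : ej < n
      isIn    : inLabel es ei ej ≡ suc c
      isConn  : conn ≡ connN es ⊎ conn ≡ connE es

  path-sound : ∀ {c i j s L r x} → Path c i j s L r → x ∈ L → Entry c x
  path-sound {s = s} (pathN p q e _ P) (here refl) = entry s _ refl p q e (inj₁ refl)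
  path-sound {s = s} (pathE p q e _ P) (here refl) = entry s _ refl p (<⇒≤ q) e (inj₂ refl)
  path-sound {s = s} (pathX p q e _ _) (here refl) = entry s _ refl p (≤-reflexive q) e (inj₂ refl)
  path-sound (pathN _ _ _ _ P) (there l) = path-sound P l
  path-sound (pathE _ _ _ _ P) (there l) = path-sound P l

  path-NE : ∀ {c i j s L r a b κ} → Path c i j s L r → (a , b , κ) ∈ L → a ≤ suc i × suc j ≤ b
  path-NE (pathN _ _ _ _ P) (here refl) = ≤-refl , ≤-refl
  path-NE (pathE _ _ _ _ P) (here refl) = ≤-refl , ≤-refl
  path-NE (pathX _ _ _ _ _) (here refl) = ≤-refl , ≤-refl
  path-NE (pathN _ _ _ _ P) (there l) with path-NE P l
  ... | p , q = m≤n⇒m≤1+n p , q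
  path-NE (pathE _ _ _ _ P) (there l) with path-NE P l
  ... | p , q = p , <⇒≤ q

  -- A step goes strictly north or strictly east, so no cell is visited twice; counted steps that
  -- all lie in one cell are therefore at most one.
  path-count : ∀ {c i j s L r} → Path c i j s L r → (p : Step → Bool) →
    (∀ x y → x ∈ L → y ∈ L → p x ≡ true → p y ≡ true → stepCell x ≡ stepCell y) → countᵇ p L ≤ 1
  path-count {L = x ∷ L} P p h rewrite count-∷ p x L with p x in eq
  ... | false = rest P h
    where
    rest : ∀ {c i j s x L r} → Path c i j s (x ∷ L) r →
      (∀ y z → y ∈ x ∷ L → z ∈ x ∷ L → p y ≡ true → p z ≡ true → stepCell y ≡ stepCell z) → countᵇ p L ≤ 1
    rest (pathN _ _ _ _ P) h = path-count P p λ y z l k → h y z (there l) (there k)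
    rest (pathE _ _ _ _ P) h = path-count P p λ y z l k → h y z (there l) (there k)
    rest (pathX _ _ _ _ _) h = z≤n
  ... | true = s≤s (≤-reflexive (count-0 p L λ y l → none y l (p y) refl))
    where
    differ : ∀ {c i j s x L r y} → Path c i j s (x ∷ L) r → y ∈ L → stepCell x ≢ stepCell y
    differ (pathN _ _ _ _ P) l refl = <-irrefl refl (proj₁ (path-NE P l))
    differ (pathE _ _ _ _ P) l refl = <-irrefl refl (proj₂ (path-NE P l))
    none : ∀ y → y ∈ L → ∀ b → p y ≡ b → p y ≡ false
    none y l true  e = ⊥-elim (differ P l (h x y (here refl) (there l) eq e))
    none y l false e = e

  private
    Visited : ℕ → ℕ → List Step → ℕ → ℕ → Bool → Set
    Visited c r L i j s = Σ (List Step) λ L' → Path c i j s L' r × (∀ {x} → x ∈ L' → x ∈ L)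

    nextN : ∀ {c r L i j s} → Visited c r L (suc i) j s → goesN s (G (suc (suc i)) (suc j)) ≡ true → Visited c r L i j true
    nextN (_ , pathN _ _ _ _ P , h) g = _ , P , h ∘ there
    nextN {s = s} (_ , pathE p q _ g' _ , _) g = ⊥-elim (seven-exclusive (cell-seven (cell W p (<⇒≤ q))) s g g')
    nextN {s = s} (_ , pathX p q _ g' _ , _) g = ⊥-elim (seven-exclusive (cell-seven (cell W p (≤-reflexive q))) s g g')

    nextE : ∀ {c r L i j s} → suc j < n → Visited c r L i j s → goesE s (G (suc i) (suc j)) ≡ true → Visited c r L i (suc j) false
    nextE l (_ , pathE _ _ _ _ P , h) g = _ , P , h ∘ there
    nextE {s = s} l (_ , pathN p q _ g' _ , _) g = ⊥-elim (seven-exclusive (cell-seven (cell W p q)) s g' g)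
    nextE l (_ , pathX _ q _ _ _ , _) g = ⊥-elim (<⇒≢ l q)

    -- Completeness of tracing: an edge with label `suc c` is followed back, down and to the left,
    -- to the bottom of a column, which the label forces to be column `c`; from there the path is
    -- replayed. `d` counts the rows below.
    visit : ∀ {c r L} → Path c (pred n) c true L r → ∀ d i j s → d + suc i ≡ n → j < n → inLabel s i j ≡ suc c →
      Visited c r L i j s
    visit {c} {r} {L} P zero i j true refl q e with suc-injective (trans (sym (bottom W q)) e)
    ... | refl = _ , P , λ x → x
    visit P (suc d) i j true f q e with cell-inN (cell W (subst (suc (suc i) ≤_) (trans (+-suc d (suc i)) f) (m≤n+m _ d)) q) e
    ... | s , g , e' = nextN (visit P d (suc i) j s (trans (+-suc d (suc i)) f) q e') g
    visit P d i zero false f q e = ⊥-elim (0≢1+n (trans (sym (left W (subst (suc i ≤_) f (m≤n+m _ d)))) e))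
    visit P d i (suc j) false f q e with cell-inE (cell W (subst (suc i ≤_) f (m≤n+m _ d)) (<⇒≤ q)) e
    ... | s , g , e' = nextE q (visit P d i j s f (<⇒≤ q) e') g

    headN : ∀ {c r L i j s} → Visited c r L i j s → goesN s (G (suc i) (suc j)) ≡ true → (suc i , suc j , connN s) ∈ L
    headN (_ , pathN _ _ _ _ _ , h) g = h (here refl)
    headN {s = s} (_ , pathE p q _ g' _ , _) g = ⊥-elim (seven-exclusive (cell-seven (cell W p (<⇒≤ q))) s g g')
    headN {s = s} (_ , pathX p q _ g' _ , _) g = ⊥-elim (seven-exclusive (cell-seven (cell W p (≤-reflexive q))) s g g')

    headE : ∀ {c r L i j s} → Visited c r L i j s → goesE s (G (suc i) (suc j)) ≡ true → (suc i , suc j , connE s) ∈ L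
    headE (_ , pathE _ _ _ _ _ , h) g = h (here refl)
    headE (_ , pathX _ _ _ _ _ , h) g = h (here refl)
    headE {s = s} (_ , pathN p q _ g' _ , _) g = ⊥-elim (seven-exclusive (cell-seven (cell W p q)) s g' g)

  in-range : ∀ {i j c} s → i < n → j < n → inLabel s i j ≡ suc c → c < n
  in-range true  p q e = V-range p q e
  in-range false p q e = H-range p (<⇒≤ q) e

  path-N : ∀ {i j c} s → i < n → j < n → inLabel s i j ≡ suc c → goesN s (G (suc i) (suc j)) ≡ true →
    (suc i , suc j , connN s) ∈ pipePath n G (suc c)
  path-N s p q e g with pipe (in-range s p q e)
  ... | traced L r eq P rewrite eq = headN (visit P _ _ _ s (m∸n+n≡m p) q e) g

  path-E : ∀ {i j c} s → i < n → j < n → inLabel s i j ≡ suc c → goesE s (G (suc i) (suc j)) ≡ true →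
    (suc i , suc j , connE s) ∈ pipePath n G (suc c)
  path-E s p q e g with pipe (in-range s p q e)
  ... | traced L r eq P rewrite eq = headE (visit P _ _ _ s (m∸n+n≡m p) q e) g

  path-entry : ∀ {c x} → c < n → x ∈ pipePath n G (suc c) → Entry c x
  path-entry p l with pipe p
  ... | traced L r eq P rewrite eq = path-sound P l

-- Crossings, exits and bumps expressed by labels.

eqConn-refl : ∀ κ → eqConn κ κ ≡ true
eqConn-refl cWE = refl
eqConn-refl cSN = refl
eqConn-refl cWN = refl
eqConn-refl cSE = refl

eqConn-sound : ∀ κ κ' → eqConn κ κ' ≡ true → κ ≡ κ'
eqConn-sound cWE cWE _ = refl
eqConn-sound cSN cSN _ = refl
eqConn-sound cWN cWN _ = refl
eqConn-sound cSE cSE _ = refl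

eqStep-refl : ∀ x → eqStep x x ≡ true
eqStep-refl (a , b , κ) rewrite ≡ᵇ-true {a} refl | ≡ᵇ-true {b} refl = eqConn-refl κ

eqStep-sound : ∀ x y → eqStep x y ≡ true → x ≡ y
eqStep-sound (a , b , κ) (a' , b' , κ') e with ∧-true {a ≡ᵇ a'} e
... | p , q with ∧-true {b ≡ᵇ b'} q
...   | r , s = cong₂ _,_ (≡ᵇ-sound p) (cong₂ _,_ (≡ᵇ-sound r) (eqConn-sound κ κ' s))

eqBool-sound : ∀ a b → eqBool a b ≡ true → a ≡ b
eqBool-sound true  true  _ = refl
eqBool-sound false false _ = refl

eqTile-sound : ∀ s t → eqTile s t ≡ true → s ≡ t
eqTile-sound (tile a b c d) (tile a' b' c' d') e with ∧-true {eqBool a a'} e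
... | p , e₁ with ∧-true {eqBool b b'} e₁
...   | q , e₂ with ∧-true {eqBool c c'} e₂
...     | r , s rewrite eqBool-sound a a' p | eqBool-sound b b' q | eqBool-sound c c' r | eqBool-sound d d' s = refl

eqTile-refl : ∀ t → eqTile t t ≡ true
eqTile-refl (tile true  true  true  true ) = refl
eqTile-refl (tile true  true  true  false) = refl
eqTile-refl (tile true  true  false true ) = refl
eqTile-refl (tile true  true  false false) = refl
eqTile-refl (tile true  false true  true ) = refl
eqTile-refl (tile true  false true  false) = refl
eqTile-refl (tile true  false false true ) = refl
eqTile-refl (tile true  false false false) = refl
eqTile-refl (tile false true  true  true ) = refl
eqTile-refl (tile false true  true  false) = refl
eqTile-refl (tile false true  false true ) = refl
eqTile-refl (tile false true  false false) = refl
eqTile-refl (tile false false true  true ) = refl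
eqTile-refl (tile false false true  false) = refl
eqTile-refl (tile false false false true ) = refl
eqTile-refl (tile false false false false) = refl

eqTile-≡ : ∀ {s t} → s ≡ t → eqTile s t ≡ true
eqTile-≡ {s} refl = eqTile-refl s

not-true : ∀ {b} → b ≢ true → b ≡ false
not-true {true}  h = ⊥-elim (h refl)
not-true {false} h = refl

module Pipes {n : ℕ} {G : Grid} {H V : Labels} (W : Valid n G H V) where
  open Frontier W
  open Order W
  open Trace W

  private
    Dir : Conn → Bool
    Dir cWE = false
    Dir cSN = true
    Dir cWN = false
    Dir cSE = true

    dir : ∀ {κ s} → κ ≡ connN s ⊎ κ ≡ connE s → s ≡ Dir κ
    dir {s = true}  (inj₁ refl) = refl
    dir {s = true}  (inj₂ refl) = refl
    dir {s = false} (inj₁ refl) = refl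
    dir {s = false} (inj₂ refl) = refl

    entry-label : ∀ {c i j κ} → Entry c (suc i , suc j , κ) → inLabel (Dir κ) i j ≡ suc c
    entry-label (entry s κ refl _ _ e d) with dir d
    ... | refl = e

    pipeAt-label : ∀ {i j κ c} → c < n → (suc i , suc j , κ) ∈ pipePath n G (suc c) →
      pipeAt n G (suc i) (suc j) κ ≡ just (suc c)
    pipeAt-label {i} {j} {κ} {c} p l = trans (cong (firstWith at) (range1≡ n))
      (first-intro at n 1 (suc c) (s≤s z≤n) (s≤s p) (any-true (eqStep x) l (eqStep-refl x)) earlier)
      where
      x : Step
      x = suc i , suc j , κ
      at : ℕ → Bool
      at d = any (eqStep x) (pipePath n G d)
      none : ∀ {d} → d < c → at (suc d) ≢ true
      none {d} k e with any-true⁻¹ (eqStep x) (pipePath n G (suc d)) e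
      ... | y , l' , q with eqStep-sound x y q
      ...   | refl = <⇒≢ k (suc-injective (trans (sym (entry-label (path-entry (<-trans k p) l')))
                                                  (entry-label (path-entry p l))))
      earlier : ∀ d → 1 ≤ d → d < suc c → at d ≡ false
      earlier (suc d) _ (s≤s k) = not-true (none k)

  pipeAt-SE : ∀ {i j c} → i < n → j < n → se (G (suc i) (suc j)) ≡ true → V (suc i) j ≡ suc c →
    pipeAt n G (suc i) (suc j) cSE ≡ just (suc c)
  pipeAt-SE p q g e = pipeAt-label (V-range p q e) (path-E true p q e g)

  pipeAt-WN : ∀ {i j c} → i < n → j < n → wn (G (suc i) (suc j)) ≡ true → H i j ≡ suc c →
    pipeAt n G (suc i) (suc j) cWN ≡ just (suc c)
  pipeAt-WN p q g e = pipeAt-label (H-range p (<⇒≤ q) e) (path-N false p q e g)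

  seExit-label : ∀ {i j c r} → i < n → j < n → se (G (suc i) (suc j)) ≡ true → V (suc i) j ≡ suc c →
    r < n → H r n ≡ suc c → seExit n G (suc i) (suc j) ≡ just (suc r)
  seExit-label {i} {j} p q g e l x rewrite pipeAt-SE p q g e = exitRow-label l x

  passes-label : ∀ {i j c} → c < n → passes (pipePath n G (suc c)) (suc i) (suc j) ≡ true →
    H i j ≡ suc c ⊎ V (suc i) j ≡ suc c
  passes-label {i} {j} {c} p e with any-true⁻¹ _ (pipePath n G (suc c)) e
  ... | (a , b , κ) , l , q with ∧-true {suc i ≡ᵇ a} q
  ...   | q₁ , q₂ with ≡ᵇ-sound {suc i} {a} q₁ | ≡ᵇ-sound {suc j} {b} q₂
  ...     | refl | refl with path-entry p l
  ...       | entry true  _ refl _ _ f _ = inj₂ f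
  ...       | entry false _ refl _ _ f _ = inj₁ f

  private
    visits : ∀ {i j c} s → i < n → j < n → inLabel s i j ≡ suc c →
      Σ Conn λ κ → (suc i , suc j , κ) ∈ pipePath n G (suc c)
    visits s p q e with cell-out (cell W p q) s e
    ... | inj₁ (g , _) = _ , path-N s p q e g
    ... | inj₂ (_ , g , _) = _ , path-E s p q e g

    passes-in : ∀ {i j c} s → i < n → j < n → inLabel s i j ≡ suc c →
      passes (pipePath n G (suc c)) (suc i) (suc j) ≡ true
    passes-in {i} {j} s p q e with visits s p q e
    ... | κ , l = any-true _ l (same i j)
      where
      same : ∀ i j → (i ≡ᵇ i) ∧ (j ≡ᵇ j) ≡ true
      same i j rewrite ≡ᵇ-true {i} refl | ≡ᵇ-true {j} refl = refl

  Crossing : ℕ → ℕ → ℕ → ℕ → Set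
  Crossing i j u v = CrossAt n G H V i j u v ⊎ CrossAt n G H V i j v u

  private
    crossing-of : ∀ {c d x} → c < n → d < n → c ≢ d → x ∈ pipePath n G (suc c) →
      isCross (G (proj₁ (stepCell x)) (proj₂ (stepCell x))) ∧ passes (pipePath n G (suc d)) (proj₁ (stepCell x)) (proj₂ (stepCell x)) ≡ true →
      Σ ℕ λ i → Σ ℕ λ j → stepCell x ≡ (suc i , suc j) × Crossing i j c d
    crossing-of {c} {d} p q c≢d l e with path-entry p l
    ... | entry {i} {j} s κ refl i<n j<n f _ with ∧-true {isCross (G (suc i) (suc j))} e
    ...   | t , u = i , j , refl , which s f (passes-label q u)
      where
      t≡ : G (suc i) (suc j) ≡ tCross
      t≡ = eqTile-sound _ _ t
      which : ∀ s → inLabel s i j ≡ suc c → H i j ≡ suc d ⊎ V (suc i) j ≡ suc d → Crossing i j c d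
      which true  f (inj₁ g) = inj₂ (crossAt i<n j<n t≡ g f)
      which true  f (inj₂ g) = ⊥-elim (c≢d (suc-injective (trans (sym f) g)))
      which false f (inj₁ g) = ⊥-elim (c≢d (suc-injective (trans (sym f) g)))
      which false f (inj₂ g) = inj₁ (crossAt i<n j<n t≡ f g)

    of-crossing : ∀ {c d i j} → Crossing i j c d → Σ Conn λ κ → (suc i , suc j , κ) ∈ pipePath n G (suc c) ×
      isCross (G (suc i) (suc j)) ∧ passes (pipePath n G (suc d)) (suc i) (suc j) ≡ true
    of-crossing (inj₁ (crossAt p q x e f)) with visits false p q e
    ... | κ , l = κ , l , cong₂ _∧_ (eqTile-≡ x) (passes-in true p q f)
    of-crossing (inj₂ (crossAt p q x e f)) with visits true p q f
    ... | κ , l = κ , l , cong₂ _∧_ (eqTile-≡ x) (passes-in false p q e)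

  crossings-unique : Good n G H V → ∀ {i j i' j' u v} → Crossing i j u v → Crossing i' j' u v → i ≡ i' × j ≡ j'
  crossings-unique g (inj₁ X) (inj₁ Y) = crossing-unique g X Y
  crossings-unique g (inj₂ X) (inj₂ Y) = crossing-unique g X Y
  crossings-unique g (inj₁ X) (inj₂ Y) = ⊥-elim (<-asym (good-< g X) (good-< g Y))
  crossings-unique g (inj₂ X) (inj₁ Y) = ⊥-elim (<-asym (good-< g X) (good-< g Y))

  good⇒crossOnce : Good n G H V → ∀ c d → 1 ≤ c → c < d → d ≤ n → crossings n G c d ≤ 1
  good⇒crossOnce g (suc c) (suc d) _ (s≤s c<d) d≤n = bound (pipe c<n)
    where
    c<n : c < n
    c<n = <-trans c<d d≤n
    once : ∀ x y → x ∈ pipePath n G (suc c) → y ∈ pipePath n G (suc c) →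
      isCross (G (proj₁ (stepCell x)) (proj₂ (stepCell x))) ∧ passes (pipePath n G (suc d)) (proj₁ (stepCell x)) (proj₂ (stepCell x)) ≡ true →
      isCross (G (proj₁ (stepCell y)) (proj₂ (stepCell y))) ∧ passes (pipePath n G (suc d)) (proj₁ (stepCell y)) (proj₂ (stepCell y)) ≡ true →
      stepCell x ≡ stepCell y
    once x y l k e f with crossing-of c<n d≤n (<⇒≢ c<d) l e | crossing-of c<n d≤n (<⇒≢ c<d) k f
    ... | i , j , p , X | i' , j' , q , Y with crossings-unique g X Y
    ...   | refl , refl = trans p (sym q)
    bound : Traced c (pred n) c true (pipeTrace n G (suc c)) → crossings n G (suc c) (suc d) ≤ 1
    bound (traced L r eq P) = subst (λ R → countᵇ _ (proj₁ R) ≤ 1) (sym eq)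
      (path-count P _ λ { x@(_ , _ , _) y@(_ , _ , _) l k e f →
        once x y (subst (λ R → x ∈ proj₁ R) (sym eq) l) (subst (λ R → y ∈ proj₁ R) (sym eq) k) e f })

  -- At a cross whose west label is the larger one, the two pipes have already crossed, in the
  -- opposite direction. These are two different cells lying on both pipes, which the count forbids.
  crossOnce⇒good : (∀ c d → 1 ≤ c → c < d → d ≤ n → crossings n G c d ≤ 1) → Good n G H V
  crossOnce⇒good once {i} {j} p q x = labels (subst (λ t → Cell t (H i j) (V (suc i) j) (V i j) (H i (suc j))) x (cell W p q)) refl refl
    where
    labels : ∀ {w s N E} → Cell tCross w s N E → H i j ≡ w → V (suc i) j ≡ s → H i j < V (suc i) j
    labels (cross {u} {v}) eu ev with <-cmp u v
    ... | tri< l _ _ = subst₂ _<_ (sym eu) (sym ev) (s≤s l)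
    ... | tri≈ _ e _ = ⊥-elim (distinct p q eu ev e)
    ... | tri> _ _ l with crossed-before p q eu ev l
    ...   | i' , j' , Y = ⊥-elim (<⇒≱ (two (of-crossing (inj₂ (crossAt p q x eu ev))) (of-crossing (inj₁ Y)))
                                       (once (suc v) (suc u) (s≤s z≤n) (s≤s l) (H-range p (<⇒≤ q) eu)))
      where
      two : (Σ Conn λ κ → (suc i , suc j , κ) ∈ pipePath n G (suc v) ×
              isCross (G (suc i) (suc j)) ∧ passes (pipePath n G (suc u)) (suc i) (suc j) ≡ true) →
            (Σ Conn λ κ → (suc i' , suc j' , κ) ∈ pipePath n G (suc v) ×
              isCross (G (suc i') (suc j')) ∧ passes (pipePath n G (suc u)) (suc i') (suc j') ≡ true) →
            2 ≤ crossings n G (suc v) (suc u)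
      two (κ , m , e) (κ' , m' , e') = count-≥2 _ m m' differ e e'
        where
        differ : (suc i , suc j , κ) ≢ (suc i' , suc j' , κ')
        differ refl = <⇒≢ l (suc-injective (trans (sym (fromW Y)) eu))

  module _ {i j u v : ℕ} (p : i < n) (q : j < n) (isB : G (suc i) (suc j) ≡ tBump)
           (eu : H i j ≡ suc u) (ev : V (suc i) j ≡ suc v) where

    private
      at : bumpCross n G (suc i) (suc j) ≡ firstCross n G (suc i) (suc j) (suc v) (suc u) (pipePath n G (suc v))
      at = bumpCross-first n G (suc i) (suc j) (suc v) (suc u)
             (pipeAt-SE p q (cong se isB) ev) (pipeAt-WN p q (cong wn isB) eu)

      v≢u : v ≢ u
      v≢u = distinct p q eu ev ∘ sym

      scan : ∀ L → (∀ {x} → x ∈ L → x ∈ pipePath n G (suc v)) → ∀ {z} →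
        firstCross n G (suc i) (suc j) (suc v) (suc u) L ≡ just z →
        Σ ℕ λ x → Σ ℕ λ y → z ≡ (suc x , suc y) × Crossing x y v u
      scan ((a , b , κ) ∷ L) h e with isCross (G a b) ∧ passes (pipePath n G (suc u)) a b in eq
      ... | false = scan L (h ∘ there) e
      scan ((a , b , κ) ∷ L) h refl | true =
        crossing-of (V-range p q ev) (H-range p (<⇒≤ q) eu) v≢u (h (here refl)) eq

      scan-none : ∀ L {x} → firstCross n G (suc i) (suc j) (suc v) (suc u) L ≡ nothing → x ∈ L →
        isCross (G (proj₁ (stepCell x)) (proj₂ (stepCell x))) ∧ passes (pipePath n G (suc u)) (proj₁ (stepCell x)) (proj₂ (stepCell x)) ≡ true → ⊥
      scan-none ((a , b , κ) ∷ L) e l f with isCross (G a b) ∧ passes (pipePath n G (suc u)) a b in eq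
      scan-none ((a , b , κ) ∷ L) e (here refl) f | false = false≢true (trans (sym eq) f)
      scan-none ((a , b , κ) ∷ L) e (there l) f | false = scan-none L e l f

    bumpCross-just : ∀ {z} → bumpCross n G (suc i) (suc j) ≡ just z →
      Σ ℕ λ x → Σ ℕ λ y → z ≡ (suc x , suc y) × Crossing x y v u
    bumpCross-just e = scan _ (λ l → l) (trans (sym at) e)

    bumpCross-nothing : bumpCross n G (suc i) (suc j) ≡ nothing → ∀ {x y} → ¬ Crossing x y v u
    bumpCross-nothing e X with of-crossing X
    ... | κ , l , f = scan-none _ (trans (sym at) e) l f

    -- The scan along the pipe from the south cannot fail by `bumpCross-nothing`, and what it
    -- returns is the given crossing because a good grid has only one.
    bumpCross-crossing : Good n G H V → ∀ {x y} → Crossing x y v u → bumpCross n G (suc i) (suc j) ≡ just (suc x , suc y)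
    bumpCross-crossing g {x} {y} X = find (bumpCross n G (suc i) (suc j)) refl
      where
      find : ∀ m → bumpCross n G (suc i) (suc j) ≡ m → bumpCross n G (suc i) (suc j) ≡ just (suc x , suc y)
      find nothing  e = ⊥-elim (bumpCross-nothing e X)
      find (just z) e with bumpCross-just e
      ... | x' , y' , refl , Y with crossings-unique g X Y
      ...   | refl , refl = e

  permOf-exits : permOf n G ≡ exitList n H
  permOf-exits = trans (permOf-entries n G) (trans (map-range1 (permEntry n G (range1 n)) n)
    (listFrom-cong 0 n λ r _ l → trans (cong (λ xs → permEntry n G xs (suc r)) (range1≡ n)) (entryAt l (right W l))))
    where
    search : ∀ {r c} k j → r < n → H r n ≡ suc c → j ≤ c → c < j + k → j + k ≡ n →
      permEntry n G (listFrom (suc j) k (λ x → x)) (suc r) ≡ suc c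
    search zero j l e a b s = ⊥-elim (<-irrefl refl (<-≤-trans b (subst (_≤ _) (sym (+-identityʳ j)) a)))
    search {r} {c} (suc k) j l e a b s with exit-exists {j} (subst (j <_) s (m<m+n j (s≤s z≤n)))
    ... | r' , l' , e' with m≤n⇒m<n∨m≡n a
    ...   | inj₁ j<c = trans (permEntry-∷ n G (suc j) (listFrom (suc (suc j)) k (λ x → x)) (suc r) (suc r') (exitRow-label l' e'))
              (trans (cong (λ b → if b then suc j else permEntry n G (listFrom (suc (suc j)) k (λ x → x)) (suc r)) (≡ᵇ-false {r'} {r} differ))
                     (search k (suc j) l e j<c (subst (c <_) (+-suc j k) b) (trans (sym (+-suc j k)) s)))
      where
      differ : r' ≢ r
      differ refl = <⇒≢ j<c (suc-injective (trans (sym e') e))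
    ...   | inj₂ refl = trans (permEntry-∷ n G (suc j) (listFrom (suc (suc j)) k (λ x → x)) (suc r) (suc r') (exitRow-label l' e'))
              (cong (λ b → if b then suc j else permEntry n G (listFrom (suc (suc j)) k (λ x → x)) (suc r))
                    (≡ᵇ-true {r'} {r} (exit-injective l' l e' e)))
    entryAt : ∀ {r} → r < n → (Σ ℕ λ c → H r n ≡ suc c) → permEntry n G (listFrom 1 n (λ x → x)) (suc r) ≡ H r n
    entryAt l (c , e) = trans (search n 0 l e z≤n (H-range l ≤-refl e) refl) (sym e)

-- Min-droops as a relation between two grids.

-- The tiles at the four corners of a min-droop rectangle, before and after.
data TL : Tile → Tile → Set where
  relb : TL tR tBlank
  bump : TL tBump tJ

data TR : Tile → Tile → Set where
  hor  : TR tHor tR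
  jelb : TR tJ tVer

data BL : Tile → Tile → Set where
  ver  : BL tVer tR
  jelb : BL tJ tHor

data BR : Tile → Tile → Set where
  blank : BR tBlank tJ
  relb  : BR tR tBump

TL-tiles : ∀ {t t₁} → TL t t₁ → t ≢ tCross × t₁ ≢ tCross × t₁ ≢ tBump
TL-tiles relb = (λ ()) , (λ ()) , (λ ())
TL-tiles bump = (λ ()) , (λ ()) , (λ ())

TR-tiles : ∀ {t t₁} → TR t t₁ → t ≢ tCross × t₁ ≢ tCross × t ≢ tBump × t₁ ≢ tBump
TR-tiles hor  = (λ ()) , (λ ()) , (λ ()) , (λ ())
TR-tiles jelb = (λ ()) , (λ ()) , (λ ()) , (λ ())

BL-tiles : ∀ {t t₁} → BL t t₁ → t ≢ tCross × t₁ ≢ tCross × t ≢ tBump × t₁ ≢ tBump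
BL-tiles ver  = (λ ()) , (λ ()) , (λ ()) , (λ ())
BL-tiles jelb = (λ ()) , (λ ()) , (λ ()) , (λ ())

BR-tiles : ∀ {t t₁} → BR t t₁ → t ≢ tCross × t₁ ≢ tCross × t ≢ tBump
BR-tiles blank = (λ ()) , (λ ()) , (λ ())
BR-tiles relb  = (λ ()) , (λ ()) , (λ ())

data Zone (a b c d i j : ℕ) : Set where
  zTL    : i ≡ a → j ≡ b → Zone a b c d i j
  zTop   : i ≡ a → b < j → j < d → Zone a b c d i j
  zTR    : i ≡ a → j ≡ d → Zone a b c d i j
  zLeft  : a < i → i < c → j ≡ b → Zone a b c d i j
  zInner : a < i → i < c → b < j → j < d → Zone a b c d i j
  zRight : a < i → i < c → j ≡ d → Zone a b c d i j
  zBL    : i ≡ c → j ≡ b → Zone a b c d i j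
  zBot   : i ≡ c → b < j → j < d → Zone a b c d i j
  zBR    : i ≡ c → j ≡ d → Zone a b c d i j
  zRow   : i < a ⊎ c < i → Zone a b c d i j
  zCol   : j < b ⊎ d < j → Zone a b c d i j

data Slot (a c i : ℕ) : Set where
  first : i ≡ a → Slot a c i
  mid   : a < i → i < c → Slot a c i
  last  : i ≡ c → Slot a c i
  off   : i < a ⊎ c < i → Slot a c i

slot : ∀ a c i → Slot a c i
slot a c i with <-cmp i a | <-cmp i c
... | tri< l _ _ | _ = off (inj₁ l)
... | tri≈ _ e _ | _ = first e
... | tri> _ _ _ | tri> _ _ l = off (inj₂ l)
... | tri> _ _ _ | tri≈ _ e _ = last e
... | tri> _ _ l | tri< k _ _ = mid l k

zone : ∀ a b c d i j → Zone a b c d i j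
zone a b c d i j with slot a c i | slot b d j
... | off x   | _       = zRow x
... | first _ | off x   = zCol x
... | mid _ _ | off x   = zCol x
... | last _  | off x   = zCol x
... | first e | first f = zTL e f
... | first e | mid p q = zTop e p q
... | first e | last f  = zTR e f
... | mid p q | first f = zLeft p q f
... | mid p q | mid r s = zInner p q r s
... | mid p q | last f  = zRight p q f
... | last e  | first f = zBL e f
... | last e  | mid p q = zBot e p q
... | last e  | last f  = zBR e f

-- Both grids are described tile by tile, so the record can be read forwards and backwards. The pipe
-- changes sides: crosses on the top row and left column lose it, straight tiles on the bottom row
-- and right column gain it. Cells strictly inside are crosses before and after.
record Droop (n : ℕ) (G G₁ : Grid) (a b c d : ℕ) : Set where
  field
    a<c    : a < c
    c<n    : c < n
    b<d    : b < d
    d<n    : d < n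
    tl     : TL (G (suc a) (suc b)) (G₁ (suc a) (suc b))
    tr     : TR (G (suc a) (suc d)) (G₁ (suc a) (suc d))
    bl     : BL (G (suc c) (suc b)) (G₁ (suc c) (suc b))
    br     : BR (G (suc c) (suc d)) (G₁ (suc c) (suc d))
    topT   : ∀ {j} → b < j → j < d → G (suc a) (suc j) ≡ tCross × G₁ (suc a) (suc j) ≡ tVer
    leftT  : ∀ {i} → a < i → i < c → G (suc i) (suc b) ≡ tCross × G₁ (suc i) (suc b) ≡ tHor
    botT   : ∀ {j} → b < j → j < d → G (suc c) (suc j) ≡ tVer × G₁ (suc c) (suc j) ≡ tCross
    rightT : ∀ {i} → a < i → i < c → G (suc i) (suc d) ≡ tHor × G₁ (suc i) (suc d) ≡ tCross
    innerT : ∀ {i j} → a < i → i < c → b < j → j < d →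
             G (suc i) (suc j) ≡ tCross × G₁ (suc i) (suc j) ≡ tCross
    rowT   : ∀ {i j} → i < n → j < n → i < a ⊎ c < i → G (suc i) (suc j) ≡ G₁ (suc i) (suc j)
    colT   : ∀ {i j} → i < n → j < n → j < b ⊎ d < j → G (suc i) (suc j) ≡ G₁ (suc i) (suc j)

  a<n : a < n
  a<n = <-trans a<c c<n
  b<n : b < n
  b<n = <-trans b<d d<n

-- The edges of the rectangle traversed before the droop carry P, those traversed afterwards carry Q.
record Strips (a b c d P Q : ℕ) (H V : Labels) : Set where
  field
    hTop   : ∀ {j} → b < j → j ≤ d → H a j ≡ P
    hBot   : ∀ {j} → b < j → j ≤ d → H c j ≡ Q
    vLeft  : ∀ {i} → a < i → i ≤ c → V i b ≡ P
    vRight : ∀ {i} → a < i → i ≤ c → V i d ≡ Q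

-- On the segment `lo < t ≤ hi`, line `x` is set to `P` and line `y` to `Q`. It serves for `H` with
-- `s` the row and `t` the column, and for `V` with the two exchanged.
override : (lo hi x y P Q old s t : ℕ) → ℕ
override lo hi x y P Q old s t with lo <? t | t ≤? hi | s ≟ x | s ≟ y
... | yes _ | yes _ | yes _ | _     = P
... | yes _ | yes _ | no _  | yes _ = Q
... | yes _ | yes _ | no _  | no _  = old
... | yes _ | no _  | _     | _     = old
... | no _  | _     | _     | _     = old

override-x : ∀ lo hi x y P Q old t → lo < t → t ≤ hi → override lo hi x y P Q old x t ≡ P
override-x lo hi x y P Q old t p q with lo <? t | t ≤? hi | x ≟ x | x ≟ y
... | yes _ | yes _ | yes _ | _ = refl
... | yes _ | yes _ | no r  | _ = ⊥-elim (r refl)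
... | yes _ | no r  | _     | _ = ⊥-elim (r q)
... | no r  | _     | _     | _ = ⊥-elim (r p)

override-y : ∀ lo hi x y P Q old t → x ≢ y → lo < t → t ≤ hi → override lo hi x y P Q old y t ≡ Q
override-y lo hi x y P Q old t x≢y p q with lo <? t | t ≤? hi | y ≟ x | y ≟ y
... | yes _ | yes _ | yes e | _     = ⊥-elim (x≢y (sym e))
... | yes _ | yes _ | no _  | yes _ = refl
... | yes _ | yes _ | no _  | no r  = ⊥-elim (r refl)
... | yes _ | no r  | _     | _     = ⊥-elim (r q)
... | no r  | _     | _     | _     = ⊥-elim (r p)

override-off : ∀ lo hi x y P Q old s t → (lo < t → t ≤ hi → s ≢ x × s ≢ y) → override lo hi x y P Q old s t ≡ old
override-off lo hi x y P Q old s t h with lo <? t | t ≤? hi | s ≟ x | s ≟ y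
... | yes p | yes q | yes e | _     = ⊥-elim (proj₁ (h p q) e)
... | yes p | yes q | no _  | yes e = ⊥-elim (proj₂ (h p q) e)
... | yes _ | yes _ | no _  | no _  = refl
... | yes _ | no _  | _     | _     = refl
... | no _  | _     | _     | _     = refl

-- One table for both directions: tile and four edge labels of a cell before and after the droop of
-- pipe `suc p`. `zoneCell⇒` and `zoneCell⇐` read it from either side.
data ZoneCell (p : ℕ) : Tile → Tile → (W S N E W₁ S₁ N₁ E₁ : ℕ) → Set where
  cTL    : ∀ {t t₁ W N} → TL t t₁ → ZoneCell p t t₁ W (suc p) N (suc p) W 0 N 0
  cTop   : ∀ {S N} → ZoneCell p tCross tVer (suc p) S N (suc p) 0 S N 0
  cLeft  : ∀ {W E} → ZoneCell p tCross tHor W (suc p) (suc p) E W 0 0 E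
  cTR    : ∀ {t t₁ N E} → TR t t₁ → ZoneCell p t t₁ (suc p) 0 N E 0 (suc p) N E
  cBL    : ∀ {t t₁ W S} → BL t t₁ → ZoneCell p t t₁ W S (suc p) 0 W S 0 (suc p)
  cBot   : ∀ {S N} → ZoneCell p tVer tCross 0 S N 0 (suc p) S N (suc p)
  cRight : ∀ {W E} → ZoneCell p tHor tCross W 0 0 E W (suc p) (suc p) E
  cBR    : ∀ {t t₁ S E} → BR t t₁ → ZoneCell p t t₁ 0 S 0 E (suc p) S (suc p) E
  cSame  : ∀ {t W S N E} → ZoneCell p t t W S N E W S N E

zoneCell⇒ : ∀ {p t t₁ W S N E W₁ S₁ N₁ E₁} → ZoneCell p t t₁ W S N E W₁ S₁ N₁ E₁ → Cell t W S N E → Cell t₁ W₁ S₁ N₁ E₁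
zoneCell⇒ (cTL relb)  relb  = blank
zoneCell⇒ (cTL bump)  bump  = jelb
zoneCell⇒ cTop        cross = ver
zoneCell⇒ cLeft       cross = hor
zoneCell⇒ (cTR hor)   hor   = relb
zoneCell⇒ (cTR jelb)  jelb  = ver
zoneCell⇒ (cBL ver)   ver   = relb
zoneCell⇒ (cBL jelb)  jelb  = hor
zoneCell⇒ cBot        ver   = cross
zoneCell⇒ cRight      hor   = cross
zoneCell⇒ (cBR blank) blank = jelb
zoneCell⇒ (cBR relb)  relb  = bump
zoneCell⇒ cSame       c     = c

zoneCell⇐ : ∀ {p t t₁ W S N E W₁ S₁ N₁ E₁} → ZoneCell p t t₁ W S N E W₁ S₁ N₁ E₁ → Cell t₁ W₁ S₁ N₁ E₁ → Cell t W S N E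
zoneCell⇐ (cTL relb)  blank = relb
zoneCell⇐ (cTL bump)  jelb  = bump
zoneCell⇐ cTop        ver   = cross
zoneCell⇐ cLeft       hor   = cross
zoneCell⇐ (cTR hor)   relb  = hor
zoneCell⇐ (cTR jelb)  ver   = jelb
zoneCell⇐ (cBL ver)   relb  = ver
zoneCell⇐ (cBL jelb)  hor   = jelb
zoneCell⇐ cBot        cross = ver
zoneCell⇐ cRight      cross = hor
zoneCell⇐ (cBR blank) jelb  = blank
zoneCell⇐ (cBR relb)  bump  = relb
zoneCell⇐ cSame       c     = c

record Relabelled (n : ℕ) (G G₁ : Grid) (a b c d p : ℕ) (H V H₁ V₁ : Labels) : Set where
  field
    droop   : Droop n G G₁ a b c d
    strips  : Strips a b c d (suc p) 0 H V
    strips₁ : Strips a b c d 0 (suc p) H₁ V₁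
    hOff    : ∀ {i j} → (b < j → j ≤ d → i ≢ a × i ≢ c) → H₁ i j ≡ H i j
    vOff    : ∀ {i j} → (a < i → i ≤ c → j ≢ b × j ≢ d) → V₁ i j ≡ V i j

private
  newH newV : (a b c d P Q : ℕ) → Labels → Labels
  newH a b c d P Q H i j = override b d a c P Q (H i j) i j
  newV a b c d P Q V i j = override a c b d P Q (V i j) j i

  newStrips : ∀ {a b c d} P Q H V → a < c → b < d → Strips a b c d P Q (newH a b c d P Q H) (newV a b c d P Q V)
  newStrips {a} {b} {c} {d} P Q H V a<c b<d = record
    { hTop   = λ {j} → override-x b d a c P Q (H a j) j
    ; hBot   = λ {j} → override-y b d a c P Q (H c j) j (<⇒≢ a<c)
    ; vLeft  = λ {i} → override-x a c b d P Q (V i b) i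
    ; vRight = λ {i} → override-y a c b d P Q (V i d) i (<⇒≢ b<d)
    }

relabel⇒ : ∀ {n G G₁ a b c d p H V} → Droop n G G₁ a b c d → Strips a b c d (suc p) 0 H V →
  Σ Labels λ H₁ → Σ Labels λ V₁ → Relabelled n G G₁ a b c d p H V H₁ V₁
relabel⇒ {a = a} {b} {c} {d} {p} {H} {V} D S = newH a b c d 0 (suc p) H , newV a b c d 0 (suc p) V , record
  { droop   = D
  ; strips  = S
  ; strips₁ = newStrips 0 (suc p) H V (Droop.a<c D) (Droop.b<d D)
  ; hOff    = λ {i} {j} → override-off b d a c 0 (suc p) (H i j) i j
  ; vOff    = λ {i} {j} → override-off a c b d 0 (suc p) (V i j) j i
  }

relabel⇐ : ∀ {n G G₁ a b c d p H₁ V₁} → Droop n G G₁ a b c d → Strips a b c d 0 (suc p) H₁ V₁ →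
  Σ Labels λ H → Σ Labels λ V → Relabelled n G G₁ a b c d p H V H₁ V₁
relabel⇐ {a = a} {b} {c} {d} {p} {H} {V} D S = newH a b c d (suc p) 0 H , newV a b c d (suc p) 0 V , record
  { droop   = D
  ; strips  = newStrips (suc p) 0 H V (Droop.a<c D) (Droop.b<d D)
  ; strips₁ = S
  ; hOff    = λ {i} {j} h → sym (override-off b d a c (suc p) 0 (H i j) i j h)
  ; vOff    = λ {i} {j} h → sym (override-off a c b d (suc p) 0 (V i j) j i h)
  }

OnlyBump : ℕ → Grid → ℕ → ℕ → Set
OnlyBump n G i j = ∀ {i' j'} → i' < n → j' < n → G (suc i') (suc j') ≡ tBump → i' ≡ i × j' ≡ j

cell-cross-N : ∀ {t W S N E} → t ≡ tCross → Cell t W S N E → N ≡ S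
cell-cross-N refl cross = refl

cell-cross-E : ∀ {t W S N E} → t ≡ tCross → Cell t W S N E → E ≡ W
cell-cross-E refl cross = refl

cell-ver-N : ∀ {t W S N E} → t ≡ tVer → Cell t W S N E → N ≡ S
cell-ver-N refl ver = refl

module _ {n G G₁ a b c d p H V H₁ V₁} (R : Relabelled n G G₁ a b c d p H V H₁ V₁) where
  open Relabelled R
  open Droop droop
  open Strips strips
  private module S₁ = Strips strips₁

  private
    offRow : ∀ {i} → a < i → i < c → ∀ j → H₁ i j ≡ H i j
    offRow l k j = hOff λ _ _ → <⇒≢ l ∘ sym , <⇒≢ k

    offCol : ∀ {j} → b < j → j < d → ∀ i → V₁ i j ≡ V i j
    offCol l k i = vOff λ _ _ → <⇒≢ l ∘ sym , <⇒≢ k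

    rowH : ∀ {i} → i < a ⊎ c < i → ∀ j → H₁ i j ≡ H i j
    rowH (inj₁ l) j = hOff λ _ _ → <⇒≢ l , <⇒≢ (<-trans l a<c)
    rowH (inj₂ l) j = hOff λ _ _ → <⇒≢ (<-trans a<c l) ∘ sym , <⇒≢ l ∘ sym

    rowN : ∀ {i} → i ≤ a ⊎ c < i → ∀ j → V₁ i j ≡ V i j
    rowN (inj₁ l) j = vOff λ p _ → ⊥-elim (<⇒≱ p l)
    rowN (inj₂ l) j = vOff λ _ q → ⊥-elim (<⇒≱ l q)

    colW : ∀ {j} → j ≤ b ⊎ d < j → ∀ i → H₁ i j ≡ H i j
    colW (inj₁ l) i = hOff λ p _ → ⊥-elim (<⇒≱ p l)
    colW (inj₂ l) i = hOff λ _ q → ⊥-elim (<⇒≱ l q)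

    colV : ∀ {j} → j < b ⊎ d < j → ∀ i → V₁ i j ≡ V i j
    colV (inj₁ l) i = vOff λ _ _ → <⇒≢ l , <⇒≢ (<-trans l b<d)
    colV (inj₂ l) i = vOff λ _ _ → <⇒≢ (<-trans b<d l) ∘ sym , <⇒≢ l ∘ sym

    weaken : ∀ {x y z : ℕ} → x < y ⊎ z < x → x ≤ y ⊎ z < x
    weaken (inj₁ l) = inj₁ (<⇒≤ l)
    weaken (inj₂ l) = inj₂ l

    shift : ∀ {x y z : ℕ} → x < y ⊎ z < x → suc x ≤ y ⊎ z < suc x
    shift (inj₁ l) = inj₁ l
    shift (inj₂ l) = inj₂ (m≤n⇒m≤1+n l)

  zoneCell : ∀ {i j} → i < n → j < n → ZoneCell p (G (suc i) (suc j)) (G₁ (suc i) (suc j))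
    (H i j) (V (suc i) j) (V i j) (H i (suc j)) (H₁ i j) (V₁ (suc i) j) (V₁ i j) (H₁ i (suc j))
  zoneCell {i} {j} i<n j<n with zone a b c d i j
  ... | zTL refl refl
    rewrite vLeft ≤-refl a<c | hTop ≤-refl b<d | S₁.vLeft ≤-refl a<c | S₁.hTop ≤-refl b<d
          | colW (inj₁ ≤-refl) a | rowN (inj₁ ≤-refl) b = cTL (Droop.tl droop)
  ... | zTop refl l k
    rewrite hTop l (<⇒≤ k) | hTop (m≤n⇒m≤1+n l) k | S₁.hTop l (<⇒≤ k) | S₁.hTop (m≤n⇒m≤1+n l) k
          | offCol l k (suc a) | offCol l k a | proj₁ (topT l k) | proj₂ (topT l k) = cTop
  ... | zTR refl refl
    rewrite hTop b<d ≤-refl | S₁.hTop b<d ≤-refl | vRight ≤-refl a<c | S₁.vRight ≤-refl a<c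
          | rowN (inj₁ ≤-refl) d | colW (inj₂ (≤-refl {suc d})) a = cTR (Droop.tr droop)
  ... | zLeft l k refl
    rewrite vLeft l (<⇒≤ k) | vLeft (m≤n⇒m≤1+n l) k | S₁.vLeft l (<⇒≤ k) | S₁.vLeft (m≤n⇒m≤1+n l) k
          | offRow l k b | offRow l k (suc b) | proj₁ (leftT l k) | proj₂ (leftT l k) = cLeft
  ... | zInner l k m o
    rewrite offRow l k j | offRow l k (suc j) | offCol m o i | offCol m o (suc i)
          | proj₁ (innerT l k m o) | proj₂ (innerT l k m o) = cSame
  ... | zRight l k refl
    rewrite vRight l (<⇒≤ k) | vRight (m≤n⇒m≤1+n l) k | S₁.vRight l (<⇒≤ k) | S₁.vRight (m≤n⇒m≤1+n l) k
          | offRow l k d | offRow l k (suc d) | proj₁ (rightT l k) | proj₂ (rightT l k) = cRight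
  ... | zBL refl refl
    rewrite vLeft a<c ≤-refl | S₁.vLeft a<c ≤-refl | hBot ≤-refl b<d | S₁.hBot ≤-refl b<d
          | colW (inj₁ ≤-refl) c | rowN (inj₂ (≤-refl {suc c})) b = cBL (Droop.bl droop)
  ... | zBot refl l k
    rewrite hBot l (<⇒≤ k) | hBot (m≤n⇒m≤1+n l) k | S₁.hBot l (<⇒≤ k) | S₁.hBot (m≤n⇒m≤1+n l) k
          | offCol l k (suc c) | offCol l k c | proj₁ (botT l k) | proj₂ (botT l k) = cBot
  ... | zBR refl refl
    rewrite hBot b<d ≤-refl | S₁.hBot b<d ≤-refl | vRight a<c ≤-refl | S₁.vRight a<c ≤-refl
          | rowN (inj₂ (≤-refl {suc c})) d | colW (inj₂ (≤-refl {suc d})) c = cBR (Droop.br droop)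
  ... | zRow x rewrite rowH x j | rowH x (suc j) | rowN (weaken x) j | rowN (shift x) j | rowT i<n j<n x = cSame
  ... | zCol x rewrite colV x i | colV x (suc i) | colW (weaken x) i | colW (shift x) i | colT i<n j<n x = cSame

  exits-same : ∀ i → H₁ i n ≡ H i n
  exits-same i = colW (inj₂ d<n) i

  valid⇒ : Valid n G H V → Valid n G₁ H₁ V₁
  valid⇒ W = record
    { cell   = λ i<n j<n → zoneCell⇒ (zoneCell i<n j<n) (cell W i<n j<n)
    ; left   = λ {i} l → trans (colW (inj₁ z≤n) i) (Valid.left W l)
    ; bottom = λ {j} l → trans (rowN (inj₂ c<n) j) (bottom W l)
    ; top    = λ {j} l → trans (rowN (inj₁ z≤n) j) (Valid.top W l)
    ; right  = λ {i} l → proj₁ (Valid.right W l) , trans (exits-same i) (proj₂ (Valid.right W l))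
    }

  valid⇐ : Valid n G₁ H₁ V₁ → Valid n G H V
  valid⇐ W = record
    { cell   = λ i<n j<n → zoneCell⇐ (zoneCell i<n j<n) (cell W i<n j<n)
    ; left   = λ {i} l → trans (sym (colW (inj₁ z≤n) i)) (Valid.left W l)
    ; bottom = λ {j} l → trans (sym (rowN (inj₂ c<n) j)) (bottom W l)
    ; top    = λ {j} l → trans (sym (rowN (inj₁ z≤n) j)) (Valid.top W l)
    ; right  = λ {i} l → proj₁ (Valid.right W l) , trans (sym (exits-same i)) (proj₂ (Valid.right W l))
    }

  module _ (W : Valid n G H V) where
    private
      column : ∀ {i j} → b < j → j < d → a < i → i ≤ c → V (suc a) j ≡ V i j
      column {suc i} l k (s≤s u) w with m≤n⇒m<n∨m≡n u
      ... | inj₂ refl = refl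
      ... | inj₁ v = trans (column l k v (<⇒≤ w))
                           (cell-cross-N (proj₁ (innerT v w l k)) (cell W (<-trans w c<n) (<-trans k d<n)))

      column-end : ∀ {j} → b < j → j < d → V (suc a) j ≡ V (suc c) j
      column-end l k = trans (column l k a<c ≤-refl) (cell-ver-N (proj₁ (botT l k)) (cell W c<n (<-trans k d<n)))

      row : ∀ {i j} → a < i → i < c → b ≤ j → j ≤ d → H i j ≡ H i b
      row {i} {j} l k u w with m≤n⇒m<n∨m≡n u
      ... | inj₂ refl = refl
      row {i} {suc j} l k u w | inj₁ (s≤s v) = trans (cell-cross-E (isX′ (m≤n⇒m<n∨m≡n v)) (cell W (<-trans k c<n) (<-trans w d<n)))
                                                     (row l k v (<⇒≤ w))
        where
        isX′ : b < j ⊎ b ≡ j → G (suc i) (suc j) ≡ tCross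
        isX′ (inj₁ v) = proj₁ (innerT l k v w)
        isX′ (inj₂ refl) = proj₁ (leftT l k)

    -- The new crosses on the bottom row and right column involve the same pairs of pipes, with the
    -- same orientation, as the lost crosses on the top row and left column, because all cells in
    -- between are straight.
    good⇒ : Good n G H V → Good n G₁ H₁ V₁
    good⇒ g {i} {j} i<n j<n x with zone a b c d i j
    ... | zTL refl refl = ⊥-elim (proj₁ (proj₂ (TL-tiles (Droop.tl droop))) x)
    ... | zTop refl l k = ⊥-elim (case trans (sym (proj₂ (topT l k))) x of λ ())
    ... | zTR refl refl = ⊥-elim (proj₁ (proj₂ (TR-tiles (Droop.tr droop))) x)
    ... | zLeft l k refl = ⊥-elim (case trans (sym (proj₂ (leftT l k))) x of λ ())
    ... | zBL refl refl = ⊥-elim (proj₁ (proj₂ (BL-tiles (Droop.bl droop))) x)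
    ... | zBR refl refl = ⊥-elim (proj₁ (proj₂ (BR-tiles (Droop.br droop))) x)
    ... | zInner l k m o = subst₂ _<_ (sym (offRow l k j)) (sym (offCol m o (suc i))) (g i<n j<n (proj₁ (innerT l k m o)))
    ... | zRow y = subst₂ _<_ (sym (rowH y j)) (sym (rowN (shift y) j)) (g i<n j<n (trans (rowT i<n j<n y) x))
    ... | zCol y = subst₂ _<_ (sym (colW (weaken y) i)) (sym (colV y (suc i))) (g i<n j<n (trans (colT i<n j<n y) x))
    ... | zBot refl l k = subst₂ _<_ (trans (hTop l (<⇒≤ k)) (sym (S₁.hBot l (<⇒≤ k))))
                            (trans (column-end l k) (sym (offCol l k (suc c)))) (g a<n j<n (proj₁ (topT l k)))
    ... | zRight l k refl = subst₂ _<_ (trans (sym (row l k (<⇒≤ b<d) ≤-refl)) (sym (offRow l k d)))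
                              (trans (vLeft (m≤n⇒m≤1+n l) k) (sym (S₁.vRight (m≤n⇒m≤1+n l) k))) (g i<n b<n (proj₁ (leftT l k)))

    good⇐ : Good n G₁ H₁ V₁ → Good n G H V
    good⇐ g {i} {j} i<n j<n x with zone a b c d i j
    ... | zTL refl refl = ⊥-elim (proj₁ (TL-tiles (Droop.tl droop)) x)
    ... | zBot refl l k = ⊥-elim (case trans (sym (proj₁ (botT l k))) x of λ ())
    ... | zTR refl refl = ⊥-elim (proj₁ (TR-tiles (Droop.tr droop)) x)
    ... | zRight l k refl = ⊥-elim (case trans (sym (proj₁ (rightT l k))) x of λ ())
    ... | zBL refl refl = ⊥-elim (proj₁ (BL-tiles (Droop.bl droop)) x)
    ... | zBR refl refl = ⊥-elim (proj₁ (BR-tiles (Droop.br droop)) x)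
    ... | zInner l k m o = subst₂ _<_ (offRow l k j) (offCol m o (suc i)) (g i<n j<n (proj₂ (innerT l k m o)))
    ... | zRow y = subst₂ _<_ (rowH y j) (rowN (shift y) j) (g i<n j<n (trans (sym (rowT i<n j<n y)) x))
    ... | zCol y = subst₂ _<_ (colW (weaken y) i) (colV y (suc i)) (g i<n j<n (trans (sym (colT i<n j<n y)) x))
    ... | zTop refl l k = subst₂ _<_ (trans (S₁.hBot l (<⇒≤ k)) (sym (hTop l (<⇒≤ k))))
                            (trans (offCol l k (suc c)) (sym (column-end l k))) (g c<n j<n (proj₂ (botT l k)))
    ... | zLeft l k refl = subst₂ _<_ (trans (offRow l k d) (row l k (<⇒≤ b<d) ≤-refl))
                              (trans (S₁.vRight (m≤n⇒m≤1+n l) k) (sym (vLeft (m≤n⇒m≤1+n l) k))) (g i<n d<n (proj₂ (rightT l k)))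

module _ {n G G₁ a b c d} (D : Droop n G G₁ a b c d) where
  open Droop D

  onlyBump⇒ : OnlyBump n G a b → OnlyBump n G₁ c d
  onlyBump⇒ o {i} {j} i<n j<n x with zone a b c d i j
  ... | zTL refl refl = ⊥-elim (proj₂ (proj₂ (TL-tiles (Droop.tl D))) x)
  ... | zTR refl refl = ⊥-elim (proj₂ (proj₂ (proj₂ (TR-tiles (Droop.tr D)))) x)
  ... | zBL refl refl = ⊥-elim (proj₂ (proj₂ (proj₂ (BL-tiles (Droop.bl D)))) x)
  onlyBump⇒ o i<n j<n x | zBR refl refl = refl , refl
  onlyBump⇒ o i<n j<n x | zTop refl l k = ⊥-elim (case trans (sym (proj₂ (topT l k))) x of λ ())
  onlyBump⇒ o i<n j<n x | zLeft l k refl = ⊥-elim (case trans (sym (proj₂ (leftT l k))) x of λ ())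
  onlyBump⇒ o i<n j<n x | zBot refl l k = ⊥-elim (case trans (sym (proj₂ (botT l k))) x of λ ())
  onlyBump⇒ o i<n j<n x | zRight l k refl = ⊥-elim (case trans (sym (proj₂ (rightT l k))) x of λ ())
  onlyBump⇒ o i<n j<n x | zInner l k m q = ⊥-elim (case trans (sym (proj₂ (innerT l k m q))) x of λ ())
  onlyBump⇒ o i<n j<n x | zRow y with o i<n j<n (trans (rowT i<n j<n y) x) | y
  ... | refl , refl | inj₁ l = ⊥-elim (<-irrefl refl l)
  ... | refl , refl | inj₂ l = ⊥-elim (<-asym l a<c)
  onlyBump⇒ o i<n j<n x | zCol y with o i<n j<n (trans (colT i<n j<n y) x) | y
  ... | refl , refl | inj₁ l = ⊥-elim (<-irrefl refl l)
  ... | refl , refl | inj₂ l = ⊥-elim (<-asym l b<d)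

  onlyBump⇐ : OnlyBump n G₁ c d → OnlyBump n G a b
  onlyBump⇐ o {i} {j} i<n j<n x with zone a b c d i j
  ... | zTL refl refl = refl , refl
  ... | zTR refl refl = ⊥-elim (proj₁ (proj₂ (proj₂ (TR-tiles (Droop.tr D)))) x)
  ... | zBL refl refl = ⊥-elim (proj₁ (proj₂ (proj₂ (BL-tiles (Droop.bl D)))) x)
  ... | zBR refl refl = ⊥-elim (proj₂ (proj₂ (BR-tiles (Droop.br D))) x)
  onlyBump⇐ o i<n j<n x | zTop refl l k = ⊥-elim (case trans (sym (proj₁ (topT l k))) x of λ ())
  onlyBump⇐ o i<n j<n x | zLeft l k refl = ⊥-elim (case trans (sym (proj₁ (leftT l k))) x of λ ())
  onlyBump⇐ o i<n j<n x | zBot refl l k = ⊥-elim (case trans (sym (proj₁ (botT l k))) x of λ ())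
  onlyBump⇐ o i<n j<n x | zRight l k refl = ⊥-elim (case trans (sym (proj₁ (rightT l k))) x of λ ())
  onlyBump⇐ o i<n j<n x | zInner l k m q = ⊥-elim (case trans (sym (proj₁ (innerT l k m q))) x of λ ())
  onlyBump⇐ o i<n j<n x | zRow y with o i<n j<n (trans (sym (rowT i<n j<n y)) x) | y
  ... | refl , refl | inj₁ l = ⊥-elim (<-asym l a<c)
  ... | refl , refl | inj₂ l = ⊥-elim (<-irrefl refl l)
  onlyBump⇐ o i<n j<n x | zCol y with o i<n j<n (trans (sym (colT i<n j<n y)) x) | y
  ... | refl , refl | inj₁ l = ⊥-elim (<-asym l b<d)
  ... | refl , refl | inj₂ l = ⊥-elim (<-irrefl refl l)

-- The min-droop computed by the algorithm.

Bits : Set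
Bits = Bool × Bool × Bool

bitsOf : ℕ → ℕ → ℕ → Bits
bitsOf a c i = (i ≡ᵇ a) , (i ≡ᵇ c) , (a <ᵇ i) ∧ (i <ᵇ c)

-- The function `modify` inside `minDroop` with its comparisons replaced by Boolean arguments. After
-- the shift to indices from 0 the two are equal by computation, hence the `refl` in
-- `minDroop-just`; the new tile then depends only on the row slot, the column slot and the old
-- tile.
drooped : Bits → Bits → Tile → Tile
drooped (iA , iC , iM) (jB , jD , jM) t =
  if iA ∧ jB then record t { se = false }
  else if jB ∧ iM then record t { sn = false }
  else if iA ∧ jM then record t { we = false }
  else if iC ∧ jB then
    (if wn t then record t { wn = false ; we = true } else record t { sn = false ; se = true })
  else if iA ∧ jD then
    (if wn t then record t { wn = false ; sn = true } else record t { we = false ; se = true })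
  else if iC ∧ jM then record t { we = true }
  else if jD ∧ iM then record t { sn = true }
  else if iC ∧ jD then record t { wn = true }
  else t

slotBits : ∀ {a c i} → Slot a c i → Bits
slotBits (first _) = true  , false , false
slotBits (mid _ _) = false , false , true
slotBits (last _)  = false , true  , false
slotBits (off _)   = false , false , false

bitsOf-slot : ∀ {a c i} → a < c → (s : Slot a c i) → bitsOf a c i ≡ slotBits s
bitsOf-slot {a} l (first refl)
  rewrite ≡ᵇ-true {a} refl | ≡ᵇ-false (<⇒≢ l) | <ᵇ-false {a} ≤-refl = refl
bitsOf-slot l (mid p q)
  rewrite ≡ᵇ-false (<⇒≢ p ∘ sym) | ≡ᵇ-false (<⇒≢ q) | <ᵇ-true p | <ᵇ-true q = refl
bitsOf-slot {c = c} l (last refl)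
  rewrite ≡ᵇ-false (<⇒≢ l ∘ sym) | ≡ᵇ-true {c} refl | <ᵇ-true l | <ᵇ-false {c} ≤-refl = refl
bitsOf-slot l (off (inj₁ p))
  rewrite ≡ᵇ-false (<⇒≢ p) | ≡ᵇ-false (<⇒≢ (<-trans p l)) | <ᵇ-false (<⇒≤ p) = refl
bitsOf-slot {a} {c} {i} l (off (inj₂ p))
  rewrite ≡ᵇ-false (<⇒≢ (<-trans l p) ∘ sym) | ≡ᵇ-false (<⇒≢ p ∘ sym) | <ᵇ-true (<-trans l p) | <ᵇ-false (<⇒≤ p) = refl

drooped-row : ∀ {b d j} (s : Slot b d j) t → drooped (false , false , false) (slotBits s) t ≡ t
drooped-row (first _) t = refl
drooped-row (mid _ _) t = refl
drooped-row (last _)  t = refl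
drooped-row (off _)   t = refl

drooped-col : ∀ {a c i} (s : Slot a c i) t → drooped (slotBits s) (false , false , false) t ≡ t
drooped-col (first _) t = refl
drooped-col (mid _ _) t = refl
drooped-col (last _)  t = refl
drooped-col (off _)   t = refl

downTest rightTest : Grid → ℕ → ℕ → ℕ → Bool
downTest  G a b x = not (eqTile (G (a + x) b) tCross)
rightTest G a b y = not (eqTile (G a (b + y)) tCross)

minDroop-just : ∀ {n G a b G₁ i₁ j₁} → minDroop n G (suc a) (suc b) ≡ just (G₁ , i₁ , j₁) →
  se (G (suc a) (suc b)) ≡ true × Σ ℕ λ x → Σ ℕ λ y →
  smallest (downTest G (suc a) (suc b)) (n ∸ suc a) ≡ just x ×
  smallest (rightTest G (suc a) (suc b)) (n ∸ suc b) ≡ just y ×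
  i₁ ≡ suc (a + x) × j₁ ≡ suc (b + y) ×
  (∀ i j → G₁ (suc i) (suc j) ≡ drooped (bitsOf a (a + x) i) (bitsOf b (b + y) j) (G (suc i) (suc j)))
minDroop-just {n} {G} {a} {b} e with se (G (suc a) (suc b)) in es
... | true with smallest (downTest G (suc a) (suc b)) (n ∸ suc a) in ex
              | smallest (rightTest G (suc a) (suc b)) (n ∸ suc b) in ey
minDroop-just refl | true | just x | just y = refl , x , y , refl , refl , refl , refl , λ i j → refl

minDroop-intro : ∀ {n G a b x y} → se (G (suc a) (suc b)) ≡ true →
  smallest (downTest G (suc a) (suc b)) (n ∸ suc a) ≡ just x →
  smallest (rightTest G (suc a) (suc b)) (n ∸ suc b) ≡ just y →
  Σ Grid λ G₁ → minDroop n G (suc a) (suc b) ≡ just (G₁ , suc (a + x) , suc (b + y)) ×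
  (∀ i j → G₁ (suc i) (suc j) ≡ drooped (bitsOf a (a + x) i) (bitsOf b (b + y) j) (G (suc i) (suc j)))
minDroop-intro {n} {G} {a} {b} es ex ey with se (G (suc a) (suc b))
minDroop-intro {n} {G} {a} {b} refl ex ey | .true with smallest (downTest G (suc a) (suc b)) (n ∸ suc a)
              | smallest (rightTest G (suc a) (suc b)) (n ∸ suc b)
minDroop-intro refl refl refl | .true | just x | just y = _ , refl , λ i j → refl

record Arm (n : ℕ) (T : ℕ → Tile) (a c : ℕ) : Set where
  field
    a<c    : a < c
    c<n    : c < n
    inside : ∀ {i} → a < i → i < c → T i ≡ tCross
    end    : T c ≢ tCross

private
  isX-false : ∀ {t} → not (eqTile t tCross) ≡ false → t ≡ tCross
  isX-false {t} e with eqTile t tCross in q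
  ... | true = eqTile-sound t tCross q

  isX-true : ∀ {t} → not (eqTile t tCross) ≡ true → t ≢ tCross
  isX-true () refl

smallest⇒arm : ∀ {n a x} (T : ℕ → Tile) → a < n →
  smallest (λ x → not (eqTile (T (a + x)) tCross)) (n ∸ suc a) ≡ just x → Arm n T a (a + x)
smallest⇒arm {n} {a} {x} T l e with first-spec _ (n ∸ suc a) 1 x (trans (cong (firstWith _) (sym (range1≡ (n ∸ suc a)))) e)
... | 1≤x , s≤s x≤ , t , f = record
  { a<c    = m<m+n a 1≤x
  ; c<n    = subst (suc (a + x) ≤_) (m+[n∸m]≡n l) (+-monoʳ-≤ (suc a) x≤)
  ; inside = λ {i} p q → subst (λ k → T k ≡ tCross) (m+[n∸m]≡n (<⇒≤ p))
      (isX-false (f (i ∸ a) (m<n⇒0<n∸m p) (+-cancelˡ-< a (i ∸ a) x (subst (_< a + x) (sym (m+[n∸m]≡n (<⇒≤ p))) q))))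
  ; end    = isX-true t
  }

arm⇒smallest : ∀ {n a c} (T : ℕ → Tile) → Arm n T a c →
  smallest (λ x → not (eqTile (T (a + x)) tCross)) (n ∸ suc a) ≡ just (c ∸ a)
arm⇒smallest {n} {a} {c} T A = trans (cong (firstWith _) (range1≡ (n ∸ suc a)))
  (first-intro _ (n ∸ suc a) 1 (c ∸ a) (m<n⇒0<n∸m a<c) (s≤s (≤-pred bound))
    (cong not (not-true λ q → end (trans (cong T (sym reach)) (eqTile-sound _ _ q))))
    λ x p q → cong not (eqTile-≡ (inside (m<m+n a p) (subst (a + x <_) reach (+-monoʳ-< a q)))))
  where
  open Arm A
  reach : a + (c ∸ a) ≡ c
  reach = m+[n∸m]≡n (<⇒≤ a<c)
  bound : suc (c ∸ a) ≤ suc (n ∸ suc a)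
  bound = subst (suc (c ∸ a) ≤_) (m∸n≡1+m∸1+n (<-trans a<c c<n)) (∸-monoˡ-< c<n (<⇒≤ a<c))

cell-SE : ∀ {t W S N E} → Cell t W S N E → se t ≡ true → (t ≡ tR ⊎ t ≡ tBump) × Σ ℕ λ p → S ≡ suc p × E ≡ suc p
cell-SE relb _ = inj₁ refl , _ , refl , refl
cell-SE bump _ = inj₂ refl , _ , refl , refl

cell-WN : ∀ {t W S N E} → Cell t W S N E → wn t ≡ true → (t ≡ tJ ⊎ t ≡ tBump) × Σ ℕ λ p → W ≡ suc p × N ≡ suc p
cell-WN jelb _ = inj₁ refl , _ , refl , refl
cell-WN bump _ = inj₂ refl , _ , refl , refl

cell-W,N : ∀ {t W S N E u v} → Cell t W S N E → W ≡ suc u → N ≡ suc v → u ≢ v → t ≢ tBump → t ≡ tCross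
cell-W,N cross _ _ _ _ = refl
cell-W,N jelb refl refl h _ = ⊥-elim (h refl)
cell-W,N bump _ _ _ h = ⊥-elim (h refl)

cell-E,S : ∀ {t W S N E u v} → Cell t W S N E → E ≡ suc u → S ≡ suc v → u ≢ v → t ≢ tBump → t ≡ tCross
cell-E,S cross _ _ _ _ = refl
cell-E,S relb refl refl h _ = ⊥-elim (h refl)
cell-E,S bump _ _ _ h = ⊥-elim (h refl)

cell-N⁺ : ∀ {t W S N E p} → Cell t W S N E → N ≡ suc p → t ≢ tCross → t ≢ tBump → (t ≡ tVer ⊎ t ≡ tJ) × E ≡ 0
cell-N⁺ ver   _ _ _ = inj₁ refl , refl
cell-N⁺ jelb  _ _ _ = inj₂ refl , refl
cell-N⁺ cross _ h _ = ⊥-elim (h refl)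
cell-N⁺ bump  _ _ h = ⊥-elim (h refl)

cell-W⁺ : ∀ {t W S N E p} → Cell t W S N E → W ≡ suc p → t ≢ tCross → t ≢ tBump → (t ≡ tHor ⊎ t ≡ tJ) × S ≡ 0
cell-W⁺ hor   _ _ _ = inj₁ refl , refl
cell-W⁺ jelb  _ _ _ = inj₂ refl , refl
cell-W⁺ cross _ h _ = ⊥-elim (h refl)
cell-W⁺ bump  _ _ h = ⊥-elim (h refl)

cell-S⁺ : ∀ {t W S N E p} → Cell t W S N E → S ≡ suc p → t ≢ tCross → t ≢ tBump → (t ≡ tVer ⊎ t ≡ tR) × W ≡ 0
cell-S⁺ ver   _ _ _ = inj₁ refl , refl
cell-S⁺ relb  _ _ _ = inj₂ refl , refl
cell-S⁺ cross _ h _ = ⊥-elim (h refl)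
cell-S⁺ bump  _ _ h = ⊥-elim (h refl)

cell-E⁺ : ∀ {t W S N E p} → Cell t W S N E → E ≡ suc p → t ≢ tCross → t ≢ tBump → (t ≡ tHor ⊎ t ≡ tR) × N ≡ 0
cell-E⁺ hor   _ _ _ = inj₁ refl , refl
cell-E⁺ relb  _ _ _ = inj₂ refl , refl
cell-E⁺ cross _ h _ = ⊥-elim (h refl)
cell-E⁺ bump  _ _ h = ⊥-elim (h refl)

cell-W⁰N⁺ : ∀ {t W S N E v} → Cell t W S N E → W ≡ 0 → N ≡ suc v → t ≡ tVer × E ≡ 0
cell-W⁰N⁺ ver _ _ = refl , refl

cell-N⁰W⁺ : ∀ {t W S N E v} → Cell t W S N E → N ≡ 0 → W ≡ suc v → t ≡ tHor × S ≡ 0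
cell-N⁰W⁺ hor _ _ = refl , refl

cell-E⁰S⁺ : ∀ {t W S N E v} → Cell t W S N E → E ≡ 0 → S ≡ suc v → t ≡ tVer × W ≡ 0
cell-E⁰S⁺ ver _ _ = refl , refl

cell-S⁰E⁺ : ∀ {t W S N E v} → Cell t W S N E → S ≡ 0 → E ≡ suc v → t ≡ tHor × N ≡ 0
cell-S⁰E⁺ hor _ _ = refl , refl

cell-W⁰N⁰ : ∀ {t W S N E} → Cell t W S N E → W ≡ 0 → N ≡ 0 → t ≡ tBlank ⊎ t ≡ tR
cell-W⁰N⁰ blank _ _ = inj₁ refl
cell-W⁰N⁰ relb  _ _ = inj₂ refl

cell-E⁰S⁰ : ∀ {t W S N E} → Cell t W S N E → E ≡ 0 → S ≡ 0 → t ≡ tBlank ⊎ t ≡ tJ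
cell-E⁰S⁰ blank _ _ = inj₁ refl
cell-E⁰S⁰ jelb  _ _ = inj₂ refl

cell-cross-W⁺ : ∀ {t W S N E} → t ≡ tCross → Cell t W S N E → Σ ℕ λ u → W ≡ suc u
cell-cross-W⁺ refl cross = _ , refl

cell-cross-S⁺ : ∀ {t W S N E} → t ≡ tCross → Cell t W S N E → Σ ℕ λ u → S ≡ suc u
cell-cross-S⁺ refl cross = _ , refl

module ForwardDroop {n : ℕ} {G : Grid} {H V : Labels} (W : Valid n G H V) (good : Good n G H V)
  {a b : ℕ} (only : OnlyBump n G a b) (a<n : a < n) (b<n : b < n) (isSE : se (G (suc a) (suc b)) ≡ true)
  {c d : ℕ} (down : Arm n (λ i → G (suc i) (suc b)) a c) (across : Arm n (λ j → G (suc a) (suc j)) b d) where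

  private
    module D = Arm down
    module A = Arm across

    corner : (G (suc a) (suc b) ≡ tR ⊎ G (suc a) (suc b) ≡ tBump) × Σ ℕ λ p → V (suc a) b ≡ suc p × H a (suc b) ≡ suc p
    corner = cell-SE (cell W a<n b<n) isSE

    p : ℕ
    p = proj₁ (proj₂ corner)

    notBump : ∀ {i j} → i < n → j < n → ¬ (i ≡ a × j ≡ b) → G (suc i) (suc j) ≢ tBump
    notBump i<n j<n h e = h (only i<n j<n e)

    vLeft′ : ∀ {i} → a < i → i ≤ c → V i b ≡ suc p
    vLeft′ {suc i} (s≤s l) k with m≤n⇒m<n∨m≡n l
    ... | inj₂ refl = proj₁ (proj₂ (proj₂ corner))
    ... | inj₁ l′ = trans (sym (cell-cross-N (D.inside l′ k) (cell W (<-trans k D.c<n) b<n))) (vLeft′ l′ (<⇒≤ k))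

    hTop′ : ∀ {j} → b < j → j ≤ d → H a j ≡ suc p
    hTop′ {suc j} (s≤s l) k with m≤n⇒m<n∨m≡n l
    ... | inj₂ refl = proj₂ (proj₂ (proj₂ corner))
    ... | inj₁ l′ = trans (cell-cross-E (A.inside l′ k) (cell W a<n (<-trans k A.c<n))) (hTop′ l′ (<⇒≤ k))

    west : ∀ {i} → a < i → i < c → Σ ℕ λ u → H i b ≡ suc u × u < p
    west {i} l k with cell-cross-W⁺ (D.inside l k) (cell W (<-trans k D.c<n) b<n)
    ... | u , e = u , e , ≤-pred (subst₂ _<_ e (vLeft′ (m≤n⇒m≤1+n l) k) (good (<-trans k D.c<n) b<n (D.inside l k)))

    south : ∀ {j} → b < j → j < d → Σ ℕ λ v → V (suc a) j ≡ suc v × p < v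
    south {j} l k with cell-cross-S⁺ (A.inside l k) (cell W a<n (<-trans k A.c<n))
    ... | v , e = v , e , ≤-pred (subst₂ _<_ (hTop′ l (<⇒≤ k)) e (good a<n (<-trans k A.c<n) (A.inside l k)))

    mutual
      inner : ∀ {i j} → a < i → i < c → b < j → j < d → G (suc i) (suc j) ≡ tCross
      inner {i} {j} l k m o with west l k | south m o
      -- The west label is the pipe `u` from the left column, the north label the pipe `v` from the
      -- top row, and `u < p < v`. Among the tiles with both edges occupied, a j-elbow would make
      -- the labels equal and a bump is excluded.
      ... | u , eu , u<p | v , ev , p<v = cell-W,N (cell W (<-trans k D.c<n) (<-trans o A.c<n))
              (trans (rowE l k m (<⇒≤ o)) eu) (trans (colS m o l (<⇒≤ k)) ev) (<⇒≢ (<-trans u<p p<v))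
              (notBump (<-trans k D.c<n) (<-trans o A.c<n) λ { (refl , _) → <-irrefl refl l })

      rowE : ∀ {i j} → a < i → i < c → b < j → j ≤ d → H i j ≡ H i b
      rowE {i} {suc j} l k (s≤s m) o with m≤n⇒m<n∨m≡n m
      ... | inj₂ refl = cell-cross-E (D.inside l k) (cell W (<-trans k D.c<n) b<n)
      ... | inj₁ m′ = trans (cell-cross-E (inner l k m′ o) (cell W (<-trans k D.c<n) (<-trans o A.c<n))) (rowE l k m′ (<⇒≤ o))

      colS : ∀ {i j} → b < j → j < d → a < i → i ≤ c → V i j ≡ V (suc a) j
      colS {suc i} {j} m o (s≤s l) k with m≤n⇒m<n∨m≡n l
      ... | inj₂ refl = refl
      ... | inj₁ l′ = trans (sym (cell-cross-N (inner l′ k m o) (cell W (<-trans k D.c<n) (<-trans o A.c<n)))) (colS m o l′ (<⇒≤ k))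

    -- The end of the arm is neither cross nor bump, so `p` uses it alone and the east edge is
    -- empty. Each further cell of the bottom row then has an empty west and an occupied north edge,
    -- hence is vertical and passes the empty edge on.
    blF : (G (suc c) (suc b) ≡ tVer ⊎ G (suc c) (suc b) ≡ tJ) × H c (suc b) ≡ 0
    blF = cell-N⁺ (cell W D.c<n b<n) (vLeft′ D.a<c ≤-refl) D.end (notBump D.c<n b<n λ { (refl , _) → <-irrefl refl D.a<c })

    trF : (G (suc a) (suc d) ≡ tHor ⊎ G (suc a) (suc d) ≡ tJ) × V (suc a) d ≡ 0
    trF = cell-W⁺ (cell W a<n A.c<n) (hTop′ A.a<c ≤-refl) A.end (notBump a<n A.c<n λ { (_ , refl) → <-irrefl refl A.a<c })

    mutual
      hBot′ : ∀ {j} → b < j → j ≤ d → H c j ≡ 0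
      hBot′ {suc j} (s≤s l) k with m≤n⇒m<n∨m≡n l
      ... | inj₂ refl = proj₂ blF
      ... | inj₁ l′ = proj₂ (botF l′ k)

      botF : ∀ {j} → b < j → j < d → G (suc c) (suc j) ≡ tVer × H c (suc j) ≡ 0
      botF l k = cell-W⁰N⁺ (cell W D.c<n (<-trans k A.c<n)) (hBot′ l (<⇒≤ k))
        (trans (colS l k D.a<c ≤-refl) (proj₁ (proj₂ (south l k))))

    mutual
      vRight′ : ∀ {i} → a < i → i ≤ c → V i d ≡ 0
      vRight′ {suc i} (s≤s l) k with m≤n⇒m<n∨m≡n l
      ... | inj₂ refl = proj₂ trF
      ... | inj₁ l′ = proj₂ (rightF l′ k)

      rightF : ∀ {i} → a < i → i < c → G (suc i) (suc d) ≡ tHor × V (suc i) d ≡ 0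
      rightF l k = cell-N⁰W⁺ (cell W (<-trans k D.c<n) A.c<n) (vRight′ l (<⇒≤ k))
        (trans (rowE l k A.a<c ≤-refl) (proj₁ (proj₂ (west l k))))

    brF : G (suc c) (suc d) ≡ tBlank ⊎ G (suc c) (suc d) ≡ tR
    brF = cell-W⁰N⁰ (cell W D.c<n A.c<n) (hBot′ A.a<c ≤-refl) (vRight′ D.a<c ≤-refl)

  pipe-label : ℕ
  pipe-label = p

  forward-strips : Strips a b c d (suc p) 0 H V
  forward-strips = record { hTop = hTop′ ; hBot = hBot′ ; vLeft = vLeft′ ; vRight = vRight′ }

  forward-droop : ∀ {G₁} → (∀ i j → G₁ (suc i) (suc j) ≡ drooped (bitsOf a c i) (bitsOf b d j) (G (suc i) (suc j))) →
    Droop n G G₁ a b c d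
  forward-droop {G₁} new = record
    { a<c = D.a<c ; c<n = D.c<n ; b<d = A.a<c ; d<n = A.c<n
    ; tl = tl′ (proj₁ corner) ; tr = tr′ (proj₁ trF) ; bl = bl′ (proj₁ blF) ; br = br′ brF
    ; topT   = λ l k → A.inside l k , at (first refl) (mid l k) (A.inside l k)
    ; leftT  = λ l k → D.inside l k , at (mid l k) (first refl) (D.inside l k)
    ; botT   = λ l k → proj₁ (botF l k) , at (last refl) (mid l k) (proj₁ (botF l k))
    ; rightT = λ l k → proj₁ (rightF l k) , at (mid l k) (last refl) (proj₁ (rightF l k))
    ; innerT = λ l k m o → inner l k m o , at (mid l k) (mid m o) (inner l k m o)
    ; rowT   = λ {i} {j} _ _ x → sym (trans (at (off x) (slot b d j) refl) (drooped-row (slot b d j) _))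
    ; colT   = λ {i} {j} _ _ x → sym (trans (at (slot a c i) (off x) refl) (drooped-col (slot a c i) _))
    }
    where
    at : ∀ {i j t} (s : Slot a c i) (s' : Slot b d j) → G (suc i) (suc j) ≡ t →
      G₁ (suc i) (suc j) ≡ drooped (slotBits s) (slotBits s') t
    at {i} {j} s s' refl = trans (new i j)
      (cong₂ (λ x y → drooped x y (G (suc i) (suc j))) (bitsOf-slot D.a<c s) (bitsOf-slot A.a<c s'))
    tl′ : G (suc a) (suc b) ≡ tR ⊎ G (suc a) (suc b) ≡ tBump → TL (G (suc a) (suc b)) (G₁ (suc a) (suc b))
    tl′ (inj₁ e) = subst₂ TL (sym e) (sym (at (first refl) (first refl) e)) relb
    tl′ (inj₂ e) = subst₂ TL (sym e) (sym (at (first refl) (first refl) e)) bump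
    tr′ : G (suc a) (suc d) ≡ tHor ⊎ G (suc a) (suc d) ≡ tJ → TR (G (suc a) (suc d)) (G₁ (suc a) (suc d))
    tr′ (inj₁ e) = subst₂ TR (sym e) (sym (at (first refl) (last refl) e)) hor
    tr′ (inj₂ e) = subst₂ TR (sym e) (sym (at (first refl) (last refl) e)) jelb
    bl′ : G (suc c) (suc b) ≡ tVer ⊎ G (suc c) (suc b) ≡ tJ → BL (G (suc c) (suc b)) (G₁ (suc c) (suc b))
    bl′ (inj₁ e) = subst₂ BL (sym e) (sym (at (last refl) (first refl) e)) ver
    bl′ (inj₂ e) = subst₂ BL (sym e) (sym (at (last refl) (first refl) e)) jelb
    br′ : G (suc c) (suc d) ≡ tBlank ⊎ G (suc c) (suc d) ≡ tR → BR (G (suc c) (suc d)) (G₁ (suc c) (suc d))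
    br′ (inj₁ e) = subst₂ BR (sym e) (sym (at (last refl) (last refl) e)) blank
    br′ (inj₂ e) = subst₂ BR (sym e) (sym (at (last refl) (last refl) e)) relb

record DroopResult (n : ℕ) (G : Grid) (H V : Labels) (a b : ℕ) (G₁ : Grid) (i₁ j₁ : ℕ) : Set where
  field
    c d p  : ℕ
    i₁≡    : i₁ ≡ suc c
    j₁≡    : j₁ ≡ suc d
    droop  : Droop n G G₁ a b c d
    strips : Strips a b c d (suc p) 0 H V

minDroop⇒droop : ∀ {n G H V a b G₁ i₁ j₁} → Valid n G H V → Good n G H V → OnlyBump n G a b → a < n → b < n →
  minDroop n G (suc a) (suc b) ≡ just (G₁ , i₁ , j₁) → DroopResult n G H V a b G₁ i₁ j₁
minDroop⇒droop {n} {G} {H} {V} {a} {b} {G₁} W good only a<n b<n e = result (minDroop-just {n} {G} {a} {b} e)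
  where
  result : ∀ {i₁ j₁} → se (G (suc a) (suc b)) ≡ true × (Σ ℕ λ x → Σ ℕ λ y →
    smallest (downTest G (suc a) (suc b)) (n ∸ suc a) ≡ just x ×
    smallest (rightTest G (suc a) (suc b)) (n ∸ suc b) ≡ just y ×
    i₁ ≡ suc (a + x) × j₁ ≡ suc (b + y) ×
    (∀ i j → G₁ (suc i) (suc j) ≡ drooped (bitsOf a (a + x) i) (bitsOf b (b + y) j) (G (suc i) (suc j)))) →
    DroopResult n G H V a b G₁ i₁ j₁
  result (s , x , y , ex , ey , p , q , new) = record
    { c = a + x ; d = b + y ; p = F.pipe-label ; i₁≡ = p ; j₁≡ = q
    ; droop = F.forward-droop new ; strips = F.forward-strips }
    where
    module F = ForwardDroop W good only a<n b<n s
      (smallest⇒arm (λ i → G (suc i) (suc b)) a<n ex) (smallest⇒arm (λ j → G (suc a) (suc j)) b<n ey)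

-- The computed grid `G₂` may differ from `G₁` outside the square, where `Droop` says nothing.
-- Inside, the two slots of a cell select the field of the record to compare with `drooped`.
droop⇒minDroop : ∀ {n G G₁ a b c d} → Droop n G G₁ a b c d →
  Σ Grid λ G₂ → minDroop n G (suc a) (suc b) ≡ just (G₂ , suc c , suc d) ×
  (∀ {i j} → i < n → j < n → G₂ (suc i) (suc j) ≡ G₁ (suc i) (suc j))
droop⇒minDroop {n} {G} {G₁} {a} {b} {c} {d} D = finish (m+[n∸m]≡n (<⇒≤ a<c)) (m+[n∸m]≡n (<⇒≤ b<d))
    (minDroop-intro {n} {G} {a} {b} (isSE tl) (arm⇒smallest (λ i → G (suc i) (suc b)) down) (arm⇒smallest (λ j → G (suc a) (suc j)) across))
  where
  open Droop D
  isSE : ∀ {t t₁} → TL t t₁ → se t ≡ true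
  isSE relb = refl
  isSE bump = refl
  down : Arm n (λ i → G (suc i) (suc b)) a c
  down = record { a<c = a<c ; c<n = c<n ; inside = λ l k → proj₁ (leftT l k) ; end = proj₁ (BL-tiles bl) }
  across : Arm n (λ j → G (suc a) (suc j)) b d
  across = record { a<c = b<d ; c<n = d<n ; inside = λ l k → proj₁ (topT l k) ; end = proj₁ (TR-tiles tr) }
  DT : Bits → Bits → Tile → Tile → Set
  DT x y t t₁ = drooped x y t ≡ t₁
  tl′ : ∀ {t t₁} → TL t t₁ → DT (true , false , false) (true , false , false) t t₁
  tl′ relb = refl
  tl′ bump = refl
  tr′ : ∀ {t t₁} → TR t t₁ → DT (true , false , false) (false , true , false) t t₁
  tr′ hor  = refl
  tr′ jelb = refl
  bl′ : ∀ {t t₁} → BL t t₁ → DT (false , true , false) (true , false , false) t t₁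
  bl′ ver  = refl
  bl′ jelb = refl
  br′ : ∀ {t t₁} → BR t t₁ → DT (false , true , false) (false , true , false) t t₁
  br′ blank = refl
  br′ relb  = refl
  via : ∀ x y {i j t t₁} → G (suc i) (suc j) ≡ t × G₁ (suc i) (suc j) ≡ t₁ → DT x y t t₁ →
    DT x y (G (suc i) (suc j)) (G₁ (suc i) (suc j))
  via x y (refl , refl) e = e
  tiles : ∀ {i j} → i < n → j < n → (s : Slot a c i) (s' : Slot b d j) →
    DT (slotBits s) (slotBits s') (G (suc i) (suc j)) (G₁ (suc i) (suc j))
  tiles p q (first refl) (first refl) = tl′ tl
  tiles p q (first refl) (mid l k)    = via (true , false , false) (false , false , true) (topT l k) refl
  tiles p q (first refl) (last refl)  = tr′ tr
  tiles p q (mid l k)    (first refl) = via (false , false , true) (true , false , false) (leftT l k) refl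
  tiles p q (mid l k)    (mid m o)    = via (false , false , true) (false , false , true) (innerT l k m o) refl
  tiles p q (mid l k)    (last refl)  = via (false , false , true) (false , true , false) (rightT l k) refl
  tiles p q (last refl)  (first refl) = bl′ bl
  tiles p q (last refl)  (mid l k)    = via (false , true , false) (false , false , true) (botT l k) refl
  tiles p q (last refl)  (last refl)  = br′ br
  tiles p q (off x)      s'           = trans (drooped-row s' _) (rowT p q x)
  tiles p q s@(first _)  (off x)      = trans (drooped-col s _) (colT p q x)
  tiles p q s@(mid _ _)  (off x)      = trans (drooped-col s _) (colT p q x)
  tiles p q s@(last _)   (off x)      = trans (drooped-col s _) (colT p q x)
  finish : ∀ {c' d'} → c' ≡ c → d' ≡ d →
    (Σ Grid λ G₂ → minDroop n G (suc a) (suc b) ≡ just (G₂ , suc c' , suc d') ×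
      (∀ i j → G₂ (suc i) (suc j) ≡ drooped (bitsOf a c' i) (bitsOf b d' j) (G (suc i) (suc j)))) →
    Σ Grid λ G₂ → minDroop n G (suc a) (suc b) ≡ just (G₂ , suc c , suc d) ×
      (∀ {i j} → i < n → j < n → G₂ (suc i) (suc j) ≡ G₁ (suc i) (suc j))
  finish refl refl (G₂ , e , new) = G₂ , e , λ {i} {j} p q → trans (new i j) (trans
    (cong₂ (λ x y → drooped x y (G (suc i) (suc j))) (bitsOf-slot a<c (slot a c i)) (bitsOf-slot b<d (slot b d j)))
    (tiles p q (slot a c i) (slot b d j)))

-- Undoing a min-droop.

record BackArm (T : ℕ → Tile) (L : ℕ → ℕ) (a c p : ℕ) : Set where
  field
    a<c    : a < c
    inside : ∀ {i} → a < i → i < c → T i ≡ tCross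
    end    : T a ≢ tCross
    labels : ∀ {i} → a < i → i ≤ c → L i ≡ suc p

-- Going back from the corner through crosses the pipe keeps its label, and on the border the label
-- is 0, so a cell that is not a cross comes before the border.
backArm : ∀ {p} (T : ℕ → Tile) (L : ℕ → ℕ) c → (∀ {i} → i < c → T i ≡ tCross → L i ≡ L (suc i)) →
  L 0 ≡ 0 → L c ≡ suc p → Σ ℕ λ a → BackArm T L a c p
backArm {p} T L c step L0 Lc = go c ≤-refl (λ l k → ⊥-elim (<⇒≱ k l)) (λ l k → trans (cong L (≤-antisym k l)) Lc)
  where
  go : ∀ i → i ≤ c → (∀ {k} → i ≤ k → k < c → T k ≡ tCross) → (∀ {k} → i ≤ k → k ≤ c → L k ≡ suc p) →
    Σ ℕ λ a → BackArm T L a c p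
  go zero    l X Y = ⊥-elim (0≢1+n (trans (sym L0) (Y z≤n z≤n)))
  go (suc i) l X Y = decide (eqTile (T i) tCross) refl
    where
    decide : ∀ b → eqTile (T i) tCross ≡ b → Σ ℕ λ a → BackArm T L a c p
    decide false e = i , record
      { a<c = l ; inside = X ; end = λ f → false≢true (trans (sym e) (eqTile-≡ f)) ; labels = Y }
    decide true e = go i (<⇒≤ l) X′ Y′
      where
      X′ : ∀ {k} → i ≤ k → k < c → T k ≡ tCross
      X′ m o with m≤n⇒m<n∨m≡n m
      ... | inj₁ m′ = X m′ o
      ... | inj₂ refl = eqTile-sound (T i) tCross e
      Y′ : ∀ {k} → i ≤ k → k ≤ c → L k ≡ suc p
      Y′ m o with m≤n⇒m<n∨m≡n m
      ... | inj₁ m′ = Y m′ o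
      ... | inj₂ refl = trans (step l (eqTile-sound (T i) tCross e)) (Y ≤-refl l)

-- The inverse of `drooped` on the tiles that occur: on the sides the old tile is known, and at each
-- corner one segment of the new tile distinguishes the two possible old ones.
undrooped : Bits → Bits → Tile → Tile
undrooped (iA , iC , iM) (jB , jD , jM) t =
  if iA ∧ jB then (if wn t then tBump else tR)
  else if jB ∧ iM then tCross
  else if iA ∧ jM then tCross
  else if iC ∧ jB then (if we t then tJ else tVer)
  else if iA ∧ jD then (if sn t then tJ else tHor)
  else if iC ∧ jM then tVer
  else if jD ∧ iM then tHor
  else if iC ∧ jD then (if se t then tR else tBlank)
  else t

undrooped-row : ∀ {b d j} (s : Slot b d j) t → undrooped (false , false , false) (slotBits s) t ≡ t
undrooped-row (first _) t = refl
undrooped-row (mid _ _) t = refl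
undrooped-row (last _)  t = refl
undrooped-row (off _)   t = refl

undrooped-col : ∀ {a c i} (s : Slot a c i) t → undrooped (slotBits s) (false , false , false) t ≡ t
undrooped-col (first _) t = refl
undrooped-col (mid _ _) t = refl
undrooped-col (last _)  t = refl
undrooped-col (off _)   t = refl

module BackwardDroop {n : ℕ} {G₁ : Grid} {H V : Labels} (W : Valid n G₁ H V) (good : Good n G₁ H V)
  {c d : ℕ} (only : OnlyBump n G₁ c d) (c<n : c < n) (d<n : d < n) (isWN : wn (G₁ (suc c) (suc d)) ≡ true) where

  private
    corner : (G₁ (suc c) (suc d) ≡ tJ ⊎ G₁ (suc c) (suc d) ≡ tBump) × Σ ℕ λ p → H c d ≡ suc p × V c d ≡ suc p
    corner = cell-WN (cell W c<n d<n) isWN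

    p : ℕ
    p = proj₁ (proj₂ corner)

    up : Σ ℕ λ a → BackArm (λ i → G₁ (suc i) (suc d)) (λ i → V i d) a c p
    up = backArm _ _ c (λ l x → cell-cross-N x (cell W (<-trans l c<n) d<n)) (top W d<n) (proj₂ (proj₂ (proj₂ corner)))

    back : Σ ℕ λ b → BackArm (λ j → G₁ (suc c) (suc j)) (λ j → H c j) b d p
    back = backArm _ _ d (λ l x → sym (cell-cross-E x (cell W c<n (<-trans l d<n)))) (left W c<n) (proj₁ (proj₂ (proj₂ corner)))

  a b : ℕ
  a = proj₁ up
  b = proj₁ back

  private
    module U = BackArm (proj₂ up)
    module B = BackArm (proj₂ back)

    a<n : a < n
    a<n = <-trans U.a<c c<n
    b<n : b < n
    b<n = <-trans B.a<c d<n

    notBump : ∀ {i j} → i < n → j < n → ¬ (i ≡ c × j ≡ d) → G₁ (suc i) (suc j) ≢ tBump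
    notBump i<n j<n h e = h (only i<n j<n e)

    west : ∀ {i} → a < i → i < c → Σ ℕ λ u → H i d ≡ suc u × u < p
    west {i} l k with cell-cross-W⁺ (U.inside l k) (cell W (<-trans k c<n) d<n)
    ... | u , e = u , e , ≤-pred (subst₂ _<_ e (U.labels (m≤n⇒m≤1+n l) k) (good (<-trans k c<n) d<n (U.inside l k)))

    south : ∀ {j} → b < j → j < d → Σ ℕ λ v → V c j ≡ suc v × p < v
    south {j} l k with cell-cross-S⁺ (B.inside l k) (cell W c<n (<-trans k d<n))
    ... | v , e = v , trans (cell-cross-N (B.inside l k) (cell W c<n (<-trans k d<n))) e ,
                  ≤-pred (subst₂ _<_ (B.labels l (<⇒≤ k)) e (good c<n (<-trans k d<n) (B.inside l k)))

    less : ∀ k {x y} → suc k + x ≡ y → x < y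
    less k refl = s≤s (m≤n+m _ k)

    mutual
      -- The induction starts at the corner `(c , d)`, so cells are measured by their distances to
      -- the bottom row and the right column. Here it is the labels on the east and south edges,
      -- again `u < p < v`, that force the cross.
      inner : ∀ k₁ k₂ {i j} → k₁ + suc i ≡ c → k₂ + suc j ≡ d → a < i → b < j → G₁ (suc i) (suc j) ≡ tCross
      inner k₁ k₂ {i} {j} e f l m = cell-E,S (cell W (<-trans i<c c<n) (<-trans j<d d<n))
          (trans (rowW k₁ k₂ e f l (m≤n⇒m≤1+n m)) (proj₁ (proj₂ (west l i<c))))
          (trans (colN k₁ k₂ e f (m≤n⇒m≤1+n l) m) (proj₁ (proj₂ (south m j<d))))
          (<⇒≢ (<-trans (proj₂ (proj₂ (west l i<c))) (proj₂ (proj₂ (south m j<d)))))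
          (notBump (<-trans i<c c<n) (<-trans j<d d<n) λ { (refl , _) → <-irrefl refl i<c })
        where
        i<c : i < c
        i<c = less k₁ (trans (sym (+-suc k₁ i)) e)
        j<d : j < d
        j<d = less k₂ (trans (sym (+-suc k₂ j)) f)

      rowW : ∀ k₁ k₂ {i j} → k₁ + suc i ≡ c → k₂ + j ≡ d → a < i → b < j → H i j ≡ H i d
      rowW k₁ zero     e refl l m = refl
      rowW k₁ (suc k₂) {i} {j} e f l m =
        trans (sym (cell-cross-E (inner k₁ k₂ e f′ l m) (cell W (<-trans (less k₁ (trans (sym (+-suc k₁ i)) e)) c<n) (<-trans (less k₂ f) d<n))))
              (rowW k₁ k₂ e f′ l (m≤n⇒m≤1+n m))
        where
        f′ : k₂ + suc j ≡ d
        f′ = trans (+-suc k₂ j) f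

      colN : ∀ k₁ k₂ {i j} → k₁ + i ≡ c → k₂ + suc j ≡ d → a < i → b < j → V i j ≡ V c j
      colN zero     k₂ refl f l m = refl
      colN (suc k₁) k₂ {i} {j} e f l m =
        trans (cell-cross-N (inner k₁ k₂ e′ f l m) (cell W (<-trans (less k₁ e) c<n) (<-trans (less k₂ (trans (sym (+-suc k₂ j)) f)) d<n)))
              (colN k₁ k₂ e′ f (m≤n⇒m≤1+n l) m)
        where
        e′ : k₁ + suc i ≡ c
        e′ = trans (+-suc k₁ i) e

    gap : ∀ {x y} → x < y → (y ∸ suc x) + suc x ≡ y
    gap l = m∸n+n≡m l

    innerF : ∀ {i j} → a < i → i < c → b < j → j < d → G₁ (suc i) (suc j) ≡ tCross
    innerF l k m o = inner _ _ (gap k) (gap o) l m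

    trF : (G₁ (suc a) (suc d) ≡ tVer ⊎ G₁ (suc a) (suc d) ≡ tR) × H a d ≡ 0
    trF = cell-S⁺ (cell W a<n d<n) (U.labels ≤-refl U.a<c) U.end (notBump a<n d<n λ { (e , _) → <⇒≢ U.a<c e })

    blF : (G₁ (suc c) (suc b) ≡ tHor ⊎ G₁ (suc c) (suc b) ≡ tR) × V c b ≡ 0
    blF = cell-E⁺ (cell W c<n b<n) (B.labels ≤-refl B.a<c) B.end (notBump c<n b<n λ { (_ , e) → <⇒≢ B.a<c e })

    mutual
      hTop′ : ∀ k {j} → k + j ≡ d → b < j → H a j ≡ 0
      hTop′ zero    refl l = proj₂ trF
      hTop′ (suc k) e    l = proj₂ (topF k e l)

      topF : ∀ k {j} → suc k + j ≡ d → b < j → G₁ (suc a) (suc j) ≡ tVer × H a j ≡ 0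
      topF k {j} e l = cell-E⁰S⁺ (cell W a<n (<-trans j<d d<n)) (hTop′ k (trans (+-suc k j) e) (m≤n⇒m≤1+n l))
          (trans (colN _ k (gap U.a<c) (trans (+-suc k j) e) ≤-refl l) (proj₁ (proj₂ (south l j<d))))
        where
        j<d : j < d
        j<d = less k e

    mutual
      vLeft′ : ∀ k {i} → k + i ≡ c → a < i → V i b ≡ 0
      vLeft′ zero    refl l = proj₂ blF
      vLeft′ (suc k) e    l = proj₂ (leftF k e l)

      leftF : ∀ k {i} → suc k + i ≡ c → a < i → G₁ (suc i) (suc b) ≡ tHor × V i b ≡ 0
      leftF k {i} e l = cell-S⁰E⁺ (cell W (<-trans i<c c<n) b<n) (vLeft′ k (trans (+-suc k i) e) (m≤n⇒m≤1+n l))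
          (trans (rowW k _ (trans (+-suc k i) e) (gap B.a<c) l ≤-refl) (proj₁ (proj₂ (west l i<c))))
        where
        i<c : i < c
        i<c = less k e

    gap′ : ∀ {x y} → x < y → suc (y ∸ suc x) + x ≡ y
    gap′ {x} {y} l = trans (sym (+-suc (y ∸ suc x) x)) (gap l)

    tlF : G₁ (suc a) (suc b) ≡ tBlank ⊎ G₁ (suc a) (suc b) ≡ tJ
    tlF = cell-E⁰S⁰ (cell W a<n b<n) (hTop′ _ (gap B.a<c) ≤-refl) (vLeft′ _ (gap U.a<c) ≤-refl)

  undroop : Grid
  undroop i j = undrooped (bitsOf (suc a) (suc c) i) (bitsOf (suc b) (suc d) j) (G₁ i j)

  pipe-label : ℕ
  pipe-label = p

  backward-strips : Strips a b c d 0 (suc p) H V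
  backward-strips = record
    { hTop   = λ l k → hTop′ _ (m∸n+n≡m k) l
    ; hBot   = B.labels
    ; vLeft  = λ l k → vLeft′ _ (m∸n+n≡m k) l
    ; vRight = U.labels
    }

  backward-droop : Droop n undroop G₁ a b c d
  backward-droop = record
    { a<c = U.a<c ; c<n = c<n ; b<d = B.a<c ; d<n = d<n
    ; tl = tl′ tlF ; tr = tr′ (proj₁ trF) ; bl = bl′ (proj₁ blF) ; br = br′ (proj₁ corner)
    ; topT   = λ l k → at (first refl) (mid l k) refl , proj₁ (topF _ (gap′ k) l)
    ; leftT  = λ l k → at (mid l k) (first refl) refl , proj₁ (leftF _ (gap′ k) l)
    ; botT   = λ l k → at (last refl) (mid l k) refl , B.inside l k
    ; rightT = λ l k → at (mid l k) (last refl) refl , U.inside l k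
    ; innerT = λ l k m o → at (mid l k) (mid m o) (innerF l k m o) , innerF l k m o
    ; rowT   = λ {i} {j} _ _ x → trans (at (off x) (slot b d j) refl) (undrooped-row (slot b d j) _)
    ; colT   = λ {i} {j} _ _ x → trans (at (slot a c i) (off x) refl) (undrooped-col (slot a c i) _)
    }
    where
    at : ∀ {i j t} (s : Slot a c i) (s' : Slot b d j) → G₁ (suc i) (suc j) ≡ t →
      undroop (suc i) (suc j) ≡ undrooped (slotBits s) (slotBits s') t
    at {i} {j} s s' refl =
      cong₂ (λ x y → undrooped x y (G₁ (suc i) (suc j))) (bitsOf-slot U.a<c s) (bitsOf-slot B.a<c s')
    tl′ : G₁ (suc a) (suc b) ≡ tBlank ⊎ G₁ (suc a) (suc b) ≡ tJ → TL (undroop (suc a) (suc b)) (G₁ (suc a) (suc b))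
    tl′ (inj₁ e) = subst₂ TL (sym (at (first refl) (first refl) e)) (sym e) relb
    tl′ (inj₂ e) = subst₂ TL (sym (at (first refl) (first refl) e)) (sym e) bump
    tr′ : G₁ (suc a) (suc d) ≡ tVer ⊎ G₁ (suc a) (suc d) ≡ tR → TR (undroop (suc a) (suc d)) (G₁ (suc a) (suc d))
    tr′ (inj₂ e) = subst₂ TR (sym (at (first refl) (last refl) e)) (sym e) hor
    tr′ (inj₁ e) = subst₂ TR (sym (at (first refl) (last refl) e)) (sym e) jelb
    bl′ : G₁ (suc c) (suc b) ≡ tHor ⊎ G₁ (suc c) (suc b) ≡ tR → BL (undroop (suc c) (suc b)) (G₁ (suc c) (suc b))
    bl′ (inj₂ e) = subst₂ BL (sym (at (last refl) (first refl) e)) (sym e) ver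
    bl′ (inj₁ e) = subst₂ BL (sym (at (last refl) (first refl) e)) (sym e) jelb
    br′ : G₁ (suc c) (suc d) ≡ tJ ⊎ G₁ (suc c) (suc d) ≡ tBump → BR (undroop (suc c) (suc d)) (G₁ (suc c) (suc d))
    br′ (inj₁ e) = subst₂ BR (sym (at (last refl) (last refl) e)) (sym e) blank
    br′ (inj₂ e) = subst₂ BR (sym (at (last refl) (last refl) e)) (sym e) relb

-- Finite sums, and equality of grids on the square.

sumFrom-update : ∀ n j x {f g} → j ≤ x → x < j + n → (∀ y → j ≤ y → y < j + n → y ≢ x → f y ≡ g y) →
  sumFrom j n f + g x ≡ sumFrom j n g + f x
sumFrom-update zero    j x p q h = ⊥-elim (<-irrefl refl (<-≤-trans q (subst (_≤ x) (sym (+-identityʳ j)) p)))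
sumFrom-update (suc n) j x {f} {g} p q h with m≤n⇒m<n∨m≡n p
... | inj₂ refl =
  trans (cong (λ s → f j + s + g j) (sumFrom-cong (suc j) n λ y u v → h y (<⇒≤ u) (subst (y <_) (sym (+-suc j n)) v) (<⇒≢ u ∘ sym)))
        (exchange (f j) (sumFrom (suc j) n g) (g j))
  where
  exchange : ∀ a s b → a + s + b ≡ b + s + a
  exchange = solve-∀
... | inj₁ l =
  trans (+-assoc (f j) _ _) (trans (cong₂ _+_ (h j ≤-refl (m<m+n j (s≤s z≤n)) (<⇒≢ l))
    (sumFrom-update n (suc j) x l (subst (x <_) (+-suc j n) q) λ y u v → h y (<⇒≤ u) (subst (y <_) (sym (+-suc j n)) v)))
    (sym (+-assoc (g j) _ _)))

sumFrom-+ : ∀ n j (f g : ℕ → ℕ) → sumFrom j n (λ x → f x + g x) ≡ sumFrom j n f + sumFrom j n g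
sumFrom-+ zero    j f g = refl
sumFrom-+ (suc n) j f g = trans (cong (f j + g j +_) (sumFrom-+ n (suc j) f g)) (shuffle (f j) (g j) _ _)
  where
  shuffle : ∀ a b c d → a + b + (c + d) ≡ a + c + (b + d)
  shuffle = solve-∀

sumFrom-point : ∀ n x {f} → x < n → (∀ y → y < n → y ≢ x → f y ≡ 0) → sumFrom 0 n f ≡ f x
sumFrom-point n x {f} l h = trans (sym (+-identityʳ _))
  (trans (sumFrom-update n 0 x {f} {λ _ → 0} z≤n l λ y _ v w → h y v w) (cong (_+ f x) (sumFrom-0 0 n λ _ _ _ → refl)))

sumFrom-≤ : ∀ n j {f g} → (∀ x → j ≤ x → x < j + n → f x ≤ g x) → sumFrom j n f ≤ sumFrom j n g
sumFrom-≤ zero    j h = z≤n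
sumFrom-≤ (suc n) j h = +-mono-≤ (h j ≤-refl (m<m+n j (s≤s z≤n)))
  (sumFrom-≤ n (suc j) λ x u v → h x (<⇒≤ u) (subst (x <_) (sym (+-suc j n)) v))

sumFrom-< : ∀ n j x {f g} → (∀ x → j ≤ x → x < j + n → f x ≤ g x) → j ≤ x → x < j + n → f x < g x →
  sumFrom j n f < sumFrom j n g
sumFrom-< zero    j x h p q l = ⊥-elim (<-irrefl refl (<-≤-trans q (subst (_≤ x) (sym (+-identityʳ j)) p)))
sumFrom-< (suc n) j x h p q l with m≤n⇒m<n∨m≡n p
... | inj₂ refl = +-mono-<-≤ l (sumFrom-≤ n (suc j) λ x u v → h x (<⇒≤ u) (subst (x <_) (sym (+-suc j n)) v))
... | inj₁ k = +-mono-≤-< (h j ≤-refl (m<m+n j (s≤s z≤n)))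
  (sumFrom-< n (suc j) x (λ x u v → h x (<⇒≤ u) (subst (x <_) (sym (+-suc j n)) v)) k (subst (x <_) (+-suc j n) q) l)

count-range : ∀ n (p : ℕ → Bool) → countᵇ p (range1 n) ≡ sumFrom 0 n (λ j → ind (p (suc j)))
count-range n p = trans (cong (countᵇ p) (range1≡ n)) (go n 0)
  where
  go : ∀ n j → countᵇ p (listFrom (suc j) n (λ x → x)) ≡ sumFrom j n (λ j → ind (p (suc j)))
  go zero    j = refl
  go (suc n) j = trans (count-∷ p (suc j) _) (cong (ind (p (suc j)) +_) (go n (suc j)))

-- Grids are functions on all pairs of numbers while only the square carries meaning, so equality of
-- grids is replaced by pointwise equality there.
record Agree (n : ℕ) (G G' : Grid) : Set where
  constructor agree
  field
    agrees : ∀ {i j} → i < n → j < n → G (suc i) (suc j) ≡ G' (suc i) (suc j)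
open Agree public

agree-sym : ∀ {n G G'} → Agree n G G' → Agree n G' G
agree-sym A = agree λ p q → sym (agrees A p q)

agree-trans : ∀ {n G G' G''} → Agree n G G' → Agree n G' G'' → Agree n G G''
agree-trans A B = agree λ p q → trans (agrees A p q) (agrees B p q)

valid-agree : ∀ {n G G' H V} → Agree n G G' → Valid n G H V → Valid n G' H V
valid-agree {H = H} {V} A W = record
  { cell   = λ {i} {j} p q → subst (λ t → Cell t (H i j) (V (suc i) j) (V i j) (H i (suc j))) (agrees A p q) (cell W p q)
  ; left = left W ; bottom = bottom W ; top = top W ; right = right W }

good-agree : ∀ {n G G' H V} → Agree n G G' → Good n G H V → Good n G' H V
good-agree A g p q x = g p q (trans (agrees A p q) x)

only-agree : ∀ {n G G' i j} → Agree n G G' → OnlyBump n G i j → OnlyBump n G' i j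
only-agree A o p q x = o p q (trans (agrees A p q) x)

droop-agree : ∀ {n G G' G₁ a b c d} → Agree n G G' → Droop n G G₁ a b c d → Droop n G' G₁ a b c d
droop-agree {G₁ = G₁} {a} {b} {c} {d} A D = record
  { a<c = a<c ; c<n = c<n ; b<d = b<d ; d<n = d<n
  ; tl = subst (λ t → TL t (G₁ (suc a) (suc b))) (agrees A a<n b<n) tl ; tr = subst (λ t → TR t (G₁ (suc a) (suc d))) (agrees A a<n d<n) tr
  ; bl = subst (λ t → BL t (G₁ (suc c) (suc b))) (agrees A c<n b<n) bl ; br = subst (λ t → BR t (G₁ (suc c) (suc d))) (agrees A c<n d<n) br
  ; topT   = λ l k → trans (sym (agrees A a<n (<-trans k d<n))) (proj₁ (topT l k)) , proj₂ (topT l k)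
  ; leftT  = λ l k → trans (sym (agrees A (<-trans k c<n) b<n)) (proj₁ (leftT l k)) , proj₂ (leftT l k)
  ; botT   = λ l k → trans (sym (agrees A c<n (<-trans k d<n))) (proj₁ (botT l k)) , proj₂ (botT l k)
  ; rightT = λ l k → trans (sym (agrees A (<-trans k c<n) d<n)) (proj₁ (rightT l k)) , proj₂ (rightT l k)
  ; innerT = λ l k m o → trans (sym (agrees A (<-trans k c<n) (<-trans o d<n))) (proj₁ (innerT l k m o)) , proj₂ (innerT l k m o)
  ; rowT   = λ p q x → trans (sym (agrees A p q)) (rowT p q x)
  ; colT   = λ p q x → trans (sym (agrees A p q)) (colT p q x)
  }
  where open Droop D

module _ {n : ℕ} {G₁ G₁' : Grid} (A : Agree n G₁ G₁') where

  private
    TL-det : ∀ {t t' s s'} → TL t s → TL t' s' → s ≡ s' → t ≡ t'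
    TL-det relb relb _ = refl
    TL-det bump bump _ = refl
    TL-det relb bump ()
    TL-det bump relb ()

    TR-det : ∀ {t t' s s'} → TR t s → TR t' s' → s ≡ s' → t ≡ t'
    TR-det hor  hor  _ = refl
    TR-det jelb jelb _ = refl
    TR-det hor  jelb ()
    TR-det jelb hor  ()

    BL-det : ∀ {t t' s s'} → BL t s → BL t' s' → s ≡ s' → t ≡ t'
    BL-det ver  ver  _ = refl
    BL-det jelb jelb _ = refl
    BL-det ver  jelb ()
    BL-det jelb ver  ()

    BR-det : ∀ {t t' s s'} → BR t s → BR t' s' → s ≡ s' → t ≡ t'
    BR-det blank blank _ = refl
    BR-det relb  relb  _ = refl
    BR-det blank relb ()
    BR-det relb  blank ()

  -- In each zone the new tile leaves one old tile: at a corner the two cases have different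
  -- results, on the sides and inside the old tile is prescribed, outside nothing changes.
  droop-source : ∀ {G G' a b c d} → Droop n G G₁ a b c d → Droop n G' G₁' a b c d → Agree n G G'
  droop-source {G} {G'} {a} {b} {c} {d} D D' = agree source
    where
    source : ∀ {i j} → i < n → j < n → G (suc i) (suc j) ≡ G' (suc i) (suc j)
    source {i} {j} p q with zone a b c d i j
    ... | zTL refl refl = TL-det (Droop.tl D) (Droop.tl D') (agrees A p q)
    ... | zTR refl refl = TR-det (Droop.tr D) (Droop.tr D') (agrees A p q)
    ... | zBL refl refl = BL-det (Droop.bl D) (Droop.bl D') (agrees A p q)
    ... | zBR refl refl = BR-det (Droop.br D) (Droop.br D') (agrees A p q)
    ... | zTop refl l k = trans (proj₁ (Droop.topT D l k)) (sym (proj₁ (Droop.topT D' l k)))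
    ... | zLeft l k refl = trans (proj₁ (Droop.leftT D l k)) (sym (proj₁ (Droop.leftT D' l k)))
    ... | zInner l k m o = trans (proj₁ (Droop.innerT D l k m o)) (sym (proj₁ (Droop.innerT D' l k m o)))
    ... | zRight l k refl = trans (proj₁ (Droop.rightT D l k)) (sym (proj₁ (Droop.rightT D' l k)))
    ... | zBot refl l k = trans (proj₁ (Droop.botT D l k)) (sym (proj₁ (Droop.botT D' l k)))
    ... | zRow x = trans (Droop.rowT D p q x) (trans (agrees A p q) (sym (Droop.rowT D' p q x)))
    ... | zCol x = trans (Droop.colT D p q x) (trans (agrees A p q) (sym (Droop.colT D' p q x)))

  -- Above and to the left of the new corner lie crosses up to the far corners of the rectangle.
  droop-corner : ∀ {G G' a b a' b' c d} → Droop n G G₁ a b c d → Droop n G' G₁' a' b' c d → a ≡ a' × b ≡ b'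
  droop-corner {a = a} {b} {a'} {b'} D D' = rows , cols
    where
    module D = Droop D
    module D' = Droop D'
    rows : a ≡ a'
    rows with <-cmp a a'
    ... | tri≈ _ e _ = e
    ... | tri< l _ _ = ⊥-elim (proj₁ (proj₂ (TR-tiles D'.tr)) (trans (sym (agrees A D'.a<n D.d<n)) (proj₂ (D.rightT l D'.a<c))))
    ... | tri> _ _ l = ⊥-elim (proj₁ (proj₂ (TR-tiles D.tr)) (trans (agrees A D.a<n D.d<n) (proj₂ (D'.rightT l D.a<c))))
    cols : b ≡ b'
    cols with <-cmp b b'
    ... | tri≈ _ e _ = e
    ... | tri< l _ _ = ⊥-elim (proj₁ (proj₂ (BL-tiles D'.bl)) (trans (sym (agrees A D.c<n D'.b<n)) (proj₂ (D.botT l D'.b<d))))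
    ... | tri> _ _ l = ⊥-elim (proj₁ (proj₂ (BL-tiles D.bl)) (trans (agrees A D.c<n D.b<n) (proj₂ (D'.botT l D.b<d))))

-- Elbows along a row.

-- Column `d` bounds a search towards the left: `d = n` describes the elbow with which an insertion
-- starts, the column of a j-elbow the one from which it continues.
record NextR (G : Grid) (i j d : ℕ) : Set where
  constructor nextR
  field
    j<d  : j < d
    isR  : G (suc i) (suc j) ≡ tR
    none : ∀ {x} → j < x → x < d → G (suc i) (suc x) ≢ tR

nextR-agree : ∀ {n G G' i j d} → Agree n G G' → i < n → d ≤ n → NextR G i j d → NextR G' i j d
nextR-agree A p q (nextR l r h) = nextR l (trans (sym (agrees A p (<-≤-trans l q))) r)
  λ u v e → h u v (trans (agrees A p (<-≤-trans v q)) e)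

mutual
  goLeft : Grid → ℕ → ℕ → ℕ → Maybe ℕ
  goLeft = _

  maxRElbow-go : ∀ G i m → maxRElbow G i (suc (suc m)) ≡
    (if eqTile (G i (suc m)) tR then just (suc m) else goLeft G i (suc (suc m)) (suc m))
  maxRElbow-go G i m with suc (suc m)
  ... | b with suc m
  ...   | c = refl

private
  go-spec : ∀ G i b d {m} → goLeft G (suc i) b (suc d) ≡ just m → Σ ℕ λ j → m ≡ suc j × NextR G i j d
  go-spec G i b (suc d) e with eqTile (G (suc i) (suc d)) tR in q
  go-spec G i b (suc d) refl | true = d , refl , nextR ≤-refl (eqTile-sound _ _ q) λ u v → ⊥-elim (<⇒≱ u (≤-pred v))
  go-spec G i b (suc d) e | false with go-spec G i b d e
  ... | j , f , nextR l r h = j , f , nextR (m≤n⇒m≤1+n l) r last′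
    where
    last′ : ∀ {x} → j < x → x < suc d → G (suc i) (suc x) ≢ tR
    last′ u (s≤s v) with m≤n⇒m<n∨m≡n v
    ... | inj₁ w = h u w
    ... | inj₂ refl = λ f → false≢true (trans (sym q) (eqTile-≡ f))

  go-intro : ∀ G i b d {j} → NextR G i j d → goLeft G (suc i) b (suc d) ≡ just (suc j)
  go-intro G i b (suc d) {j} (nextR (s≤s l) r h) with m≤n⇒m<n∨m≡n l
  ... | inj₂ refl rewrite eqTile-≡ r = refl
  ... | inj₁ k rewrite not-true (λ q → h k ≤-refl (eqTile-sound (G (suc i) (suc d)) tR q)) =
    go-intro G i b d (nextR k r λ u v → h u (m≤n⇒m≤1+n v))

maxRElbow-spec : ∀ G i d {m} → maxRElbow G (suc i) (suc d) ≡ just m → Σ ℕ λ j → m ≡ suc j × NextR G i j d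
maxRElbow-spec G i (suc d) e = go-spec G i (suc (suc d)) (suc d) (trans (sym (maxRElbow-go G (suc i) d)) e)

maxRElbow-intro : ∀ G i d {j} → NextR G i j d → maxRElbow G (suc i) (suc d) ≡ just (suc j)
maxRElbow-intro G i (suc d) r = trans (maxRElbow-go G (suc i) d) (go-intro G i (suc (suc d)) (suc d) r)

module _ {n : ℕ} {G : Grid} {H V : Labels} (W : Valid n G H V) {i : ℕ} (i<n : i < n) where

  private
    cell-W⁰ : ∀ {t W S N E} → Cell t W S N E → W ≡ 0 → t ≢ tR → E ≡ 0
    cell-W⁰ blank _ _ = refl
    cell-W⁰ ver   _ _ = refl
    cell-W⁰ relb  _ h = ⊥-elim (h refl)

  emptyRun : ∀ {x} y → H i x ≡ 0 → x ≤ y → y ≤ n → (∀ {z} → x ≤ z → z < y → G (suc i) (suc z) ≢ tR) → H i y ≡ 0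
  emptyRun y e l k h with m≤n⇒m<n∨m≡n l
  ... | inj₂ refl = e
  emptyRun (suc y) e l k h | inj₁ (s≤s l′) =
    cell-W⁰ (cell W i<n k) (emptyRun y e l′ (<⇒≤ k) λ u v → h u (m≤n⇒m≤1+n v)) (h l′ ≤-refl)

  private
    cell-J : ∀ {t W S N E} → t ≡ tJ → Cell t W S N E → E ≡ 0 × (Σ ℕ λ u → W ≡ suc u)
    cell-J refl jelb = refl , _ , refl

  -- A j-elbow empties the row up to the next r-elbow, so a second j-elbow before that one would
  -- have nothing on its west edge.
  nextJ-unique : ∀ {j d d'} → NextR G i j d → NextR G i j d' → d < n → d' < n →
    G (suc i) (suc d) ≡ tJ → G (suc i) (suc d') ≡ tJ → d ≡ d'
  nextJ-unique {j} {d} {d'} (nextR l _ h) (nextR l' _ h') p p' e e' with <-cmp d d'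
  ... | tri≈ _ f _ = f
  ... | tri< k _ _ = ⊥-elim (0≢1+n (trans (sym (emptyRun d' (proj₁ (cell-J e (cell W i<n p))) k (<⇒≤ p')
                       λ u v → h' (<-trans l u) v)) (proj₂ (proj₂ (cell-J e' (cell W i<n p'))))))
  ... | tri> _ _ k = ⊥-elim (0≢1+n (trans (sym (emptyRun d (proj₁ (cell-J e' (cell W i<n p'))) k (<⇒≤ p)
                       λ u v → h (<-trans l' u) v)) (proj₂ (proj₂ (cell-J e (cell W i<n p))))))

  -- After such a j-elbow the row would stay empty up to the right border, where every row has an
  -- exit. This separates the start of an insertion from a step that follows a j-elbow.
  lastR-noJ : ∀ {j d} → NextR G i j n → j < d → d < n → G (suc i) (suc d) ≢ tJ
  lastR-noJ (nextR _ _ h) l p e = 0≢1+n (trans (sym (emptyRun n (proj₁ (cell-J e (cell W i<n p))) p ≤-refl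
    λ u v → h (<-trans l u) v)) (proj₂ (right W i<n)))

  private
    data Onward (p : ℕ) (t : Tile) (E : ℕ) : Set where
      on   : t ≢ tR → E ≡ suc p → Onward p t E
      turn : t ≡ tJ → Onward p t E

    onward : ∀ {t W S N E p} → Cell t W S N E → W ≡ suc p → t ≢ tBump → Onward p t E
    onward hor   e _ = on (λ ()) e
    onward cross e _ = on (λ ()) e
    onward jelb  _ _ = turn refl
    onward bump  _ h = ⊥-elim (h refl)

  -- Pipe `p` is followed east from its r-elbow through horizontal tiles and crosses, none of which
  -- is an r-elbow. The two outcomes decide whether the r-elbow was reached from a j-elbow or starts
  -- the insertion.
  rightRun : ∀ {b p} → OnlyBump n G i b → b < n → G (suc i) (suc b) ≡ tR → H i (suc b) ≡ suc p →
    (Σ ℕ λ d → d < n × NextR G i b d × G (suc i) (suc d) ≡ tJ × H i d ≡ suc p) ⊎ (NextR G i b n × H i n ≡ suc p)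
  rightRun {b} {p} o b<n r e = go (n ∸ suc b) {suc b} (m∸n+n≡m b<n) ≤-refl e λ u v → ⊥-elim (<⇒≱ u (≤-pred v))
    where
    go : ∀ k {x} → k + x ≡ n → b < x → H i x ≡ suc p → (∀ {y} → b < y → y < x → G (suc i) (suc y) ≢ tR) →
      (Σ ℕ λ d → d < n × NextR G i b d × G (suc i) (suc d) ≡ tJ × H i d ≡ suc p) ⊎ (NextR G i b n × H i n ≡ suc p)
    go zero    refl l f h = inj₂ (nextR l r h , f)
    go (suc k) {x} q l f h = decide (onward (cell W i<n x<n) f λ g → <⇒≢ l (sym (proj₂ (o i<n x<n g))))
      where
      x<n : x < n
      x<n = subst (x <_) q (s≤s (m≤n+m x k))
      decide : Onward p (G (suc i) (suc x)) (H i (suc x)) →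
        (Σ ℕ λ d → d < n × NextR G i b d × G (suc i) (suc d) ≡ tJ × H i d ≡ suc p) ⊎ (NextR G i b n × H i n ≡ suc p)
      decide (turn t) = inj₁ (x , x<n , nextR l r h , t , f)
      decide (on t g) = go k (trans (+-suc k x) q) (m≤n⇒m≤1+n l) g h′
        where
        h′ : ∀ {y} → b < y → y < suc x → G (suc i) (suc y) ≢ tR
        h′ u (s≤s v) with m≤n⇒m<n∨m≡n v
        ... | inj₁ w = h u w
        ... | inj₂ refl = t

-- Rows of horizontal edges, and blanks.

-- Each east edge in use counts its row index. Columns form the outer sum because in every column
-- touched by a droop exactly one edge moves, from row `a` to row `c`.
eastWeight : ℕ → Grid → ℕ
eastWeight n G = sumFrom 0 n λ j → sumFrom 0 n λ i → if segE (G (suc i) (suc j)) then i else 0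

eastWeight-labels : ∀ {n G H V} → Valid n G H V →
  eastWeight n G ≡ (sumFrom 0 n λ j → sumFrom 0 n λ i → if occupied (H i (suc j)) then i else 0)
eastWeight-labels {n} W = sumFrom-cong 0 n λ j _ q → sumFrom-cong 0 n λ i _ p →
  cong (λ b → if b then i else 0) (cell-segE (cell W p q))

-- A droop moves horizontal edges downwards.
droop-eastWeight : ∀ {n G G₁ a b c d p H V H₁ V₁} → Relabelled n G G₁ a b c d p H V H₁ V₁ →
  Valid n G H V → Valid n G₁ H₁ V₁ → eastWeight n G < eastWeight n G₁
droop-eastWeight {n} {a = a} {b} {c} {d} {p} {H} {V} {H₁} {V₁} R W W₁ = subst₂ _<_ (sym (eastWeight-labels W)) (sym (eastWeight-labels W₁))
  (sumFrom-< n 0 b (λ j _ q → column j) z≤n b<n (columnStrict ≤-refl b<d))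
  where
  open Relabelled R
  open Droop droop
  module S = Strips strips
  module S₁ = Strips strips₁
  f f₁ : ℕ → ℕ → ℕ
  f  j i = if occupied (H  i (suc j)) then i else 0
  f₁ j i = if occupied (H₁ i (suc j)) then i else 0
  off′ : ∀ {j i} → (b < suc j → suc j ≤ d → i ≢ a × i ≢ c) → f j i ≡ f₁ j i
  off′ {j} {i} h = cong (λ x → if occupied x then i else 0) (sym (hOff h))
  columnStrict : ∀ {j} → b ≤ j → j < d → sumFrom 0 n (f j) < sumFrom 0 n (f₁ j)
  columnStrict {j} l k = less (sumFrom 0 n (f j)) (sumFrom 0 n m) (sumFrom 0 n (f₁ j)) a<c
      (trans (cong (sumFrom 0 n (f j) +_) (sym m-a)) (trans (sumFrom-update n 0 a z≤n a<n fm) (cong (sumFrom 0 n m +_) fa)))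
      (trans (cong (sumFrom 0 n m +_) (sym f₁c)) (trans (sumFrom-update n 0 c z≤n c<n mf) (cong (sumFrom 0 n (f₁ j) +_) m-c)))
    where
    m : ℕ → ℕ
    m i = if i ≡ᵇ a then f₁ j i else f j i
    fa : f j a ≡ a
    fa = cong (λ x → if occupied x then a else 0) (S.hTop (s≤s l) k)
    f₁c : f₁ j c ≡ c
    f₁c = cong (λ x → if occupied x then c else 0) (S₁.hBot (s≤s l) k)
    m-a : m a ≡ 0
    m-a = trans (cong (λ x → if x then f₁ j a else f j a) (≡ᵇ-true {a} refl))
                (cong (λ x → if occupied x then a else 0) (S₁.hTop (s≤s l) k))
    m-c : m c ≡ 0
    m-c = trans (cong (λ x → if x then f₁ j c else f j c) (≡ᵇ-false (<⇒≢ a<c ∘ sym)))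
                (cong (λ x → if occupied x then c else 0) (S.hBot (s≤s l) k))
    fm : ∀ y → 0 ≤ y → y < n → y ≢ a → f j y ≡ m y
    fm y _ _ h = sym (cong (λ x → if x then f₁ j y else f j y) (≡ᵇ-false h))
    mf : ∀ y → 0 ≤ y → y < n → y ≢ c → m y ≡ f₁ j y
    mf y _ _ h with y ≟ a
    ... | yes refl = cong (λ x → if x then f₁ j a else f j a) (≡ᵇ-true {a} refl)
    ... | no  q = trans (cong (λ x → if x then f₁ j y else f j y) (≡ᵇ-false q)) (off′ λ _ _ → q , h)
    less : ∀ x y z → a < c → x + 0 ≡ y + a → y + c ≡ z + 0 → x < z
    less x y z l e e' = subst₂ _<_ (sym (trans (sym (+-identityʳ x)) e)) (trans e' (+-identityʳ z)) (+-monoʳ-< y l)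
  column : ∀ j → sumFrom 0 n (f j) ≤ sumFrom 0 n (f₁ j)
  column j with b ≤? j | j <? d
  ... | yes l | yes k = <⇒≤ (columnStrict l k)
  ... | no  l | _     = ≤-reflexive (sumFrom-cong 0 n λ i _ _ → off′ λ u _ → ⊥-elim (l (≤-pred u)))
  ... | yes _ | no  k = ≤-reflexive (sumFrom-cong 0 n λ i _ _ → off′ λ _ v → ⊥-elim (k v))

isBlank : Tile → Bool
isBlank t = eqTile t tBlank

blanks : ℕ → Grid → ℕ → ℕ
blanks n G i = sumFrom 0 n λ j → ind (isBlank (G (suc i) (suc j)))

-- The elbow about to be drooped (M = tR), or just created (M = tJ), counts as one more blank of its row.
markedBlanks : Tile → ℕ → Grid → ℕ → ℕ → ℕ → ℕ
markedBlanks M n G x y i = blanks n G i + ind ((i ≡ᵇ x) ∧ eqTile (G (suc x) (suc y)) M)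

-- The marks absorb the two places where blanks change: an r-elbow at the top left corner turns into
-- a blank, and a blank at the bottom right corner into a j-elbow. With them the count agrees cell
-- by cell.
droop-blanks : ∀ {n G G₁ a b c d} → Droop n G G₁ a b c d → ∀ {i} → i < n →
  markedBlanks tR n G a b i ≡ markedBlanks tJ n G₁ c d i
droop-blanks {n} {G} {G₁} {a} {b} {c} {d} D {i} i<n =
  trans (sym (expand G tR a b b<n)) (trans (sumFrom-cong 0 n λ j _ q → cells q) (expand G₁ tJ c d d<n))
  where
  open Droop D
  mark : Grid → Tile → ℕ → ℕ → ℕ → ℕ
  mark G M x y j = ind ((i ≡ᵇ x) ∧ ((j ≡ᵇ y) ∧ eqTile (G (suc x) (suc y)) M))
  expand : ∀ G M x y → y < n →
    sumFrom 0 n (λ j → ind (isBlank (G (suc i) (suc j))) + mark G M x y j) ≡ markedBlanks M n G x y i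
  expand G M x y l = trans (sumFrom-+ n 0 _ (mark G M x y)) (cong (blanks n G i +_)
    (trans (sumFrom-point n y l λ z _ h → away z h)
           (cong (λ e → ind ((i ≡ᵇ x) ∧ (e ∧ eqTile (G (suc x) (suc y)) M))) (≡ᵇ-true {y} refl))))
    where
    away : ∀ z → z ≢ y → mark G M x y z ≡ 0
    away z h rewrite ≡ᵇ-false h with i ≡ᵇ x
    ... | true  = refl
    ... | false = refl
  noI : ∀ G M x y {j} → i ≢ x → mark G M x y j ≡ 0
  noI G M x y h rewrite ≡ᵇ-false h = refl
  noJ : ∀ G M x y {j} → j ≢ y → mark G M x y j ≡ 0
  noJ G M x y h rewrite ≡ᵇ-false h with i ≡ᵇ x
  ... | true  = refl
  ... | false = refl
  plain : ∀ {j t t₁} → G (suc i) (suc j) ≡ t → G₁ (suc i) (suc j) ≡ t₁ → ind (isBlank t) ≡ ind (isBlank t₁) →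
    mark G tR a b j ≡ 0 → mark G₁ tJ c d j ≡ 0 →
    ind (isBlank (G (suc i) (suc j))) + mark G tR a b j ≡ ind (isBlank (G₁ (suc i) (suc j))) + mark G₁ tJ c d j
  plain refl refl e m m₁ = cong₂ _+_ e (trans m (sym m₁))
  atTL : ∀ {t t₁} → TL t t₁ → ind (isBlank t) + ind (eqTile t tR) ≡ ind (isBlank t₁) + 0
  atTL relb = refl
  atTL bump = refl
  atBR : ∀ {t t₁} → BR t t₁ → ind (isBlank t) + 0 ≡ ind (isBlank t₁) + ind (eqTile t₁ tJ)
  atBR blank = refl
  atBR relb  = refl
  blankTR : ∀ {t t₁} → TR t t₁ → ind (isBlank t) ≡ ind (isBlank t₁)
  blankTR hor  = refl
  blankTR jelb = refl
  blankBL : ∀ {t t₁} → BL t t₁ → ind (isBlank t) ≡ ind (isBlank t₁)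
  blankBL ver  = refl
  blankBL jelb = refl
  self : ∀ G M x y → i ≡ x → mark G M x y y ≡ ind (eqTile (G (suc x) (suc y)) M)
  self G M x y refl rewrite ≡ᵇ-true {i} refl | ≡ᵇ-true {y} refl = refl
  cells : ∀ {j} → j < n →
    ind (isBlank (G (suc i) (suc j))) + mark G tR a b j ≡ ind (isBlank (G₁ (suc i) (suc j))) + mark G₁ tJ c d j
  cells {j} j<n with zone a b c d i j
  ... | zTL refl refl = trans (cong (ind (isBlank (G (suc a) (suc b))) +_) (self G tR a b refl))
      (trans (atTL tl) (cong (ind (isBlank (G₁ (suc a) (suc b))) +_) (sym (noI G₁ tJ c d {b} (<⇒≢ a<c)))))
  ... | zBR refl refl = trans (cong (ind (isBlank (G (suc c) (suc d))) +_) (noI G tR a b {d} (<⇒≢ a<c ∘ sym)))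
      (trans (atBR br) (cong (ind (isBlank (G₁ (suc c) (suc d))) +_) (sym (self G₁ tJ c d refl))))
  ... | zTop refl l k = plain (proj₁ (topT l k)) (proj₂ (topT l k)) refl (noJ G tR a b (<⇒≢ l ∘ sym)) (noJ G₁ tJ c d (<⇒≢ k))
  ... | zTR refl refl = plain refl refl (blankTR tr) (noJ G tR a b (<⇒≢ b<d ∘ sym)) (noI G₁ tJ c d {j} (<⇒≢ a<c))
  ... | zLeft l k refl = plain (proj₁ (leftT l k)) (proj₂ (leftT l k)) refl (noI G tR a b {j} (<⇒≢ l ∘ sym)) (noI G₁ tJ c d {j} (<⇒≢ k))
  ... | zInner l k m o = plain (proj₁ (innerT l k m o)) (proj₂ (innerT l k m o)) refl (noI G tR a b {j} (<⇒≢ l ∘ sym)) (noI G₁ tJ c d {j} (<⇒≢ k))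
  ... | zRight l k refl = plain (proj₁ (rightT l k)) (proj₂ (rightT l k)) refl (noI G tR a b {j} (<⇒≢ l ∘ sym)) (noI G₁ tJ c d {j} (<⇒≢ k))
  ... | zBL refl refl = plain refl refl (blankBL bl) (noI G tR a b {j} (<⇒≢ a<c ∘ sym)) (noJ G₁ tJ c d (<⇒≢ b<d))
  ... | zBot refl l k = plain (proj₁ (botT l k)) (proj₂ (botT l k)) refl (noJ G tR a b (<⇒≢ l ∘ sym)) (noJ G₁ tJ c d (<⇒≢ k))
  ... | zRow x = plain refl (sym (rowT i<n j<n x)) refl (noI G tR a b {j} (outA x)) (noI G₁ tJ c d {j} (outC x))
    where
    outA : i < a ⊎ c < i → i ≢ a
    outA (inj₁ l) = <⇒≢ l
    outA (inj₂ l) = <⇒≢ (<-trans a<c l) ∘ sym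
    outC : i < a ⊎ c < i → i ≢ c
    outC (inj₁ l) = <⇒≢ (<-trans l a<c)
    outC (inj₂ l) = <⇒≢ l ∘ sym
  ... | zCol x = plain refl (sym (colT i<n j<n x)) refl (noJ G tR a b (outB x)) (noJ G₁ tJ c d (outD x))
    where
    outB : j < b ⊎ d < j → j ≢ b
    outB (inj₁ l) = <⇒≢ l
    outB (inj₂ l) = <⇒≢ (<-trans b<d l) ∘ sym
    outD : j < b ⊎ d < j → j ≢ d
    outD (inj₁ l) = <⇒≢ (<-trans l b<d)
    outD (inj₂ l) = <⇒≢ l ∘ sym

-- Bumps during an insertion: swapping and stopping.

sameCell? : ∀ i j a b → Dec (i ≡ a × j ≡ b)
sameCell? i j a b with i ≟ a | j ≟ b
... | yes e | yes f = yes (e , f)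
... | no  p | _     = no (p ∘ proj₁)
... | yes _ | no  q = no (q ∘ proj₂)

setCell-same : ∀ G a b t → setCell G a b t a b ≡ t
setCell-same G a b t rewrite ≡ᵇ-true {a} refl | ≡ᵇ-true {b} refl = refl

setCell-other : ∀ G a b t i j → ¬ (i ≡ a × j ≡ b) → setCell G a b t i j ≡ G i j
setCell-other G a b t i j h with i ≟ a | j ≟ b
... | yes e | yes f = ⊥-elim (h (e , f))
... | no  p | _ rewrite ≡ᵇ-false p = refl
... | yes refl | no q rewrite ≡ᵇ-true {a} refl | ≡ᵇ-false q = refl

suc-pair : ∀ {i j a b : ℕ} → ¬ (i ≡ a × j ≡ b) → ¬ (suc i ≡ suc a × suc j ≡ suc b)
suc-pair h (e , f) = h (suc-injective e , suc-injective f)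

-- Cross and bump use the same four edges, so a change between them preserves the matching of
-- segments, the blanks and `eastWeight`; only the labels have to be found anew.
data Like : Tile → Tile → Set where
  same : ∀ {t} → Like t t
  x→b  : Like tCross tBump
  b→x  : Like tBump tCross

like-≡ : ∀ {t t'} → t ≡ t' → Like t t'
like-≡ refl = same

like-segs : ∀ {t t'} → Like t t' → (segW t ≡ segW t' × segE t ≡ segE t') × (segS t ≡ segS t' × segN t ≡ segN t')
like-segs same = (refl , refl) , (refl , refl)
like-segs x→b  = (refl , refl) , (refl , refl)
like-segs b→x  = (refl , refl) , (refl , refl)

like-seven : ∀ {t t'} → Like t t' → Seven t → Seven t'
like-seven same s = s
like-seven x→b  s = bump
like-seven b→x  s = cross

like-blank : ∀ {t t'} → Like t t' → isBlank t ≡ isBlank t'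
like-blank same = refl
like-blank x→b  = refl
like-blank b→x  = refl

AlikeGrids : ℕ → Grid → Grid → Set
AlikeGrids n G G' = ∀ {i j} → i < n → j < n → Like (G (suc i) (suc j)) (G' (suc i) (suc j))

alike-matched : ∀ {n G G'} → AlikeGrids n G G' → Matched n G → Matched n G'
alike-matched {n} {G} {G'} L M = record
  { seven   = λ p q → like-seven (L p q) (seven M p q)
  ; matchH  = λ p q → trans (sym (proj₂ (proj₁ (like-segs (L p (<⇒≤ q)))))) (trans (matchH M p q) (proj₁ (proj₁ (like-segs (L p q)))))
  ; matchV  = λ p q → trans (sym (proj₁ (proj₂ (like-segs (L (<⇒≤ p) q))))) (trans (matchV M p q) (proj₂ (proj₂ (like-segs (L p q)))))
  ; leftM   = λ p → trans (sym (proj₁ (proj₁ (like-segs (L p (≤-trans (s≤s z≤n) p)))))) (leftM M p)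
  ; rightM  = λ p → rightCase n p L M
  ; topM    = λ p → trans (sym (proj₂ (proj₂ (like-segs (L (≤-trans (s≤s z≤n) p) p))))) (topM M p)
  ; bottomM = λ p → bottomCase n p L M
  }
  where
  rightCase : ∀ n {i} → i < n → AlikeGrids n G G' → Matched n G → segE (G' (suc i) n) ≡ true
  rightCase (suc m) p L M = trans (sym (proj₂ (proj₁ (like-segs (L p ≤-refl))))) (rightM M p)
  bottomCase : ∀ n {j} → j < n → AlikeGrids n G G' → Matched n G → segS (G' n (suc j)) ≡ true
  bottomCase (suc m) p L M = trans (sym (proj₁ (proj₂ (like-segs (L ≤-refl p))))) (bottomM M p)

alike-valid : ∀ {n G G' H V} → AlikeGrids n G G' → Valid n G H V → Σ Labels λ H' → Σ Labels λ V' → Valid n G' H' V'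
alike-valid L W = matched⇒valid (alike-matched L (valid⇒matched W))

alike-eastWeight : ∀ {n G G'} → AlikeGrids n G G' → eastWeight n G ≡ eastWeight n G'
alike-eastWeight {n} L = sumFrom-cong 0 n λ j _ q → sumFrom-cong 0 n λ i _ p →
  cong (λ b → if b then i else 0) (proj₂ (proj₁ (like-segs (L p q))))

alike-blanks : ∀ {n G G' i} → AlikeGrids n G G' → i < n → blanks n G i ≡ blanks n G' i
alike-blanks {n} L p = sumFrom-cong 0 n λ j _ q → cong ind (like-blank (L p q))

crossCount-update : ∀ G G' {n a b} → a < n → b < n →
  (∀ {i j} → i < n → j < n → ¬ (i ≡ a × j ≡ b) → G' (suc i) (suc j) ≡ G (suc i) (suc j)) →
  crossCount n G' + ind (isCross (G (suc a) (suc b))) ≡ crossCount n G + ind (isCross (G' (suc a) (suc b)))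
crossCount-update G G' {n} {a} {b} p q h =
  combine (crossCount n G') (crossCount n G) (row G a) (row G' a) (ind (isCross (G (suc a) (suc b)))) (ind (isCross (G' (suc a) (suc b))))
    (sumFrom-update n 0 a {row G'} {row G} z≤n p λ i _ l k → sumFrom-cong 0 n λ j _ m → cong (ind ∘ isCross) (h l m (k ∘ proj₁)))
    (sumFrom-update n 0 b {λ j → ind (isCross (G' (suc a) (suc j)))} {λ j → ind (isCross (G (suc a) (suc j)))} z≤n q λ j _ l k → cong (ind ∘ isCross) (h p l (k ∘ proj₂)))
  where
  row : Grid → ℕ → ℕ
  row G i = sumFrom 0 n λ j → ind (isCross (G (suc i) (suc j)))
  combine : ∀ S' S r r' g g' → S' + r ≡ S + r' → r' + g ≡ r + g' → S' + g ≡ S + g'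
  combine S' S r r' g g' e f = +-cancelʳ-≡ r (S' + g) (S + g') (trans (c₁ S' g r) (trans (cong (_+ g) e)
    (trans (+-assoc S r' g) (trans (cong (S +_) f) (c₂ S r g')))))
    where
    c₁ : ∀ S' g r → S' + g + r ≡ S' + r + g
    c₁ = solve-∀
    c₂ : ∀ S r g' → S + (r + g') ≡ S + g' + r
    c₂ = solve-∀

listFrom-injective : ∀ {A : Set} {f g : ℕ → A} n j → listFrom j n f ≡ listFrom j n g → ∀ {x} → j ≤ x → x < j + n → f x ≡ g x
listFrom-injective zero    j e p q = ⊥-elim (<-irrefl refl (<-≤-trans q (subst (_≤ _) (sym (+-identityʳ j)) p)))
listFrom-injective {f = f} {g} (suc n) j e {x} p q with m≤n⇒m<n∨m≡n p
... | inj₁ l = listFrom-injective n (suc j) (tl≡ e) l (subst (x <_) (+-suc j n) q)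
  where
  tl≡ : ∀ {A : Set} {x y : A} {xs ys : List A} → x ∷ xs ≡ y ∷ ys → xs ≡ ys
  tl≡ refl = refl
... | inj₂ refl = hd≡ e
  where
  hd≡ : ∀ {A : Set} {x y : A} {xs ys : List A} → x ∷ xs ≡ y ∷ ys → x ≡ y
  hd≡ refl = refl

-- A grid reached while inserting into a bumpless pipe dream of ρ; at most (i , j) is a bump.
record State (n : ℕ) (ρ : List ℕ) (G : Grid) (i j : ℕ) : Set where
  field
    H V   : Labels
    valid : Valid n G H V
    good  : Good n G H V
    only  : OnlyBump n G i j
    exits : exitList n H ≡ ρ
    i<n   : i < n
    j<n   : j < n

-- The label form of `IsBPD`: `good` stands for crossing at most once, `exits` for the exit rows.
-- For a permutation `ρ`, `isBPD⇒bpd` and `bpd⇒isBPD` convert between the two.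
record Bpd (n : ℕ) (ρ : List ℕ) (G : Grid) : Set where
  field
    H V    : Labels
    valid  : Valid n G H V
    good   : Good n G H V
    noBump : ∀ {i j} → i < n → j < n → G (suc i) (suc j) ≢ tBump
    exits  : exitList n H ≡ ρ

bpd-agree : ∀ {n ρ G G'} → Agree n G G' → Bpd n ρ G → Bpd n ρ G'
bpd-agree A B = record
  { H = H ; V = V ; valid = valid-agree A valid ; good = good-agree {V = V} A good
  ; noBump = λ p q e → noBump p q (trans (agrees A p q) e) ; exits = exits }
  where open Bpd B

state-agree : ∀ {n ρ G G' i j} → Agree n G G' → State n ρ G i j → State n ρ G' i j
state-agree A S = record
  { H = H ; V = V ; valid = valid-agree A valid ; good = good-agree {V = V} A good
  ; only = only-agree A only ; exits = exits ; i<n = i<n ; j<n = j<n }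
  where open State S

bpd⇒state : ∀ {n ρ G i j} → Bpd n ρ G → i < n → j < n → State n ρ G i j
bpd⇒state B p q = record
  { H = H ; V = V ; valid = valid ; good = good ; only = λ l k e → ⊥-elim (noBump l k e)
  ; exits = exits ; i<n = p ; j<n = q }
  where open Bpd B

state⇒bpd : ∀ {n ρ G i j} → State n ρ G i j → G (suc i) (suc j) ≢ tBump → Bpd n ρ G
state⇒bpd {G = G} S h = record
  { H = H ; V = V ; valid = valid ; good = good ; noBump = none ; exits = exits }
  where
  open State S
  none : ∀ {i' j'} → i' < _ → j' < _ → G (suc i') (suc j') ≢ tBump
  none p q e with only p q e
  ... | refl , refl = h e

state-move : ∀ {n ρ G i j} → State n ρ G i j → G (suc i) (suc j) ≢ tBump → ∀ {i' j'} → i' < n → j' < n → State n ρ G i' j'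
state-move S h = bpd⇒state (state⇒bpd S h)

record Drooped (n : ℕ) (ρ : List ℕ) (G : Grid) (a b : ℕ) (G₁ : Grid) (i₁ j₁ : ℕ) : Set where
  field
    c d   : ℕ
    i₁≡   : i₁ ≡ suc c
    j₁≡   : j₁ ≡ suc d
    droop : Droop n G G₁ a b c d
    state : State n ρ G₁ c d

abstract
  droop-state : ∀ {n ρ G a b G₁ i₁ j₁} → State n ρ G a b → minDroop n G (suc a) (suc b) ≡ just (G₁ , i₁ , j₁) →
    Drooped n ρ G a b G₁ i₁ j₁
  droop-state {n} {ρ} {G} {a} {b} {G₁} {i₁} {j₁} S e = build (minDroop⇒droop valid good only i<n j<n e)
    where
    open State S
    build : DroopResult n G H V a b G₁ i₁ j₁ → Drooped n ρ G a b G₁ i₁ j₁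
    build R = finish (relabel⇒ (DroopResult.droop R) (DroopResult.strips R))
      where
      open DroopResult R using (c; d; p; droop)
      finish : (Σ Labels λ H₁ → Σ Labels λ V₁ → Relabelled n G G₁ a b c d p H V H₁ V₁) → Drooped n ρ G a b G₁ i₁ j₁
      finish (H₁ , V₁ , L) = record
        { c = c ; d = d ; i₁≡ = DroopResult.i₁≡ R ; j₁≡ = DroopResult.j₁≡ R ; droop = droop
        ; state = record
          { H = H₁ ; V = V₁ ; valid = valid⇒ L valid ; good = good⇒ L valid good ; only = onlyBump⇒ droop only
          ; exits = trans (listFrom-cong 0 n λ r _ _ → exits-same L r) exits
          ; i<n = Droop.c<n droop ; j<n = Droop.d<n droop } }

cell-bump : ∀ {t W S N E} → t ≡ tBump → Cell t W S N E → (Σ ℕ λ u → W ≡ suc u) × (Σ ℕ λ v → S ≡ suc v)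
cell-bump refl bump = (_ , refl) , (_ , refl)

module SwapStep {n : ℕ} {ρ : List ℕ} {G : Grid} {i j : ℕ} (S : State n ρ G i j) (isB : G (suc i) (suc j) ≡ tBump) where
  open State S

  private
    labels : (Σ ℕ λ u → H i j ≡ suc u) × (Σ ℕ λ v → V (suc i) j ≡ suc v)
    labels = cell-bump isB (cell valid i<n j<n)

  abstract
    u v : ℕ
    u = proj₁ (proj₁ labels)
    v = proj₁ (proj₂ labels)
    eu : H i j ≡ suc u
    eu = proj₂ (proj₁ labels)
    ev : V (suc i) j ≡ suc v
    ev = proj₂ (proj₂ labels)

  open Pipes valid using (Crossing)

  swapped : ℕ → ℕ → Grid
  swapped x y = crossBumpSwap G (suc i) (suc j) (suc x) (suc y)

  module _ {x y : ℕ} (X : Crossing x y v u) where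

    private
      x<n : x < n
      x<n = case X of λ { (inj₁ c) → row< c ; (inj₂ c) → row< c }
      y<n : y < n
      y<n = case X of λ { (inj₁ c) → col< c ; (inj₂ c) → col< c }
      isX′ : G (suc x) (suc y) ≡ tCross
      isX′ = case X of λ { (inj₁ c) → isX c ; (inj₂ c) → isX c }

      differ : ¬ (i ≡ x × j ≡ y)
      differ (refl , refl) = case trans (sym isB) isX′ of λ ()

      mid′ : Grid
      mid′ = setCell G (suc i) (suc j) tCross

      isBump : swapped x y (suc x) (suc y) ≡ tBump
      isBump = setCell-same mid′ (suc x) (suc y) tBump

      isCross′ : swapped x y (suc i) (suc j) ≡ tCross
      isCross′ = trans (setCell-other mid′ (suc x) (suc y) tBump _ _ (suc-pair differ)) (setCell-same G (suc i) (suc j) tCross)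

      others : ∀ {i' j'} → ¬ (i' ≡ i × j' ≡ j) → ¬ (i' ≡ x × j' ≡ y) → swapped x y (suc i') (suc j') ≡ G (suc i') (suc j')
      others h k = trans (setCell-other mid′ (suc x) (suc y) tBump _ _ (suc-pair k)) (setCell-other G (suc i) (suc j) tCross _ _ (suc-pair h))

    swap-alike : AlikeGrids n G (swapped x y)
    swap-alike {i'} {j'} p q with sameCell? i' j' i j | sameCell? i' j' x y
    ... | yes (refl , refl) | _ = subst₂ Like (sym isB) (sym isCross′) b→x
    ... | no h | yes (refl , refl) = subst₂ Like (sym isX′) (sym isBump) x→b
    ... | no h | no k = like-≡ (sym (others h k))

    private
      newLabels : Σ Labels λ H' → Σ Labels λ V' → Valid n (swapped x y) H' V'
      newLabels = alike-valid swap-alike valid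
      H' V' : Labels
      H' = proj₁ newLabels
      V' = proj₁ (proj₂ newLabels)
      valid' : Valid n (swapped x y) H' V'
      valid' = proj₂ (proj₂ newLabels)

      flipX : Crossing x y v u → CrossAt n G H V x y u v ⊎ CrossAt n G H V x y v u
      flipX (inj₁ c) = inj₂ c
      flipX (inj₂ c) = inj₁ c

      module C = CrossBumpSwap valid valid' good i<n j<n isB eu ev (flipX X) isCross′ isBump (λ _ _ → others)

      exits' : exitList n H' ≡ ρ
      exits' = trans (listFrom-cong 0 n λ r _ l → C.swap-exits l) exits

      -- The count passes through `mid′`, which has a cross at both cells and thus one more than the
      -- grids before and after the swap.
      countMid : crossCount n mid′ ≡ suc (crossCount n G)
      countMid = trans (sym (+-identityʳ _)) (trans (cong (λ t → crossCount n mid′ + ind (isCross t)) (sym isB))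
        (trans (crossCount-update G mid′ i<n j<n λ _ _ h → setCell-other G (suc i) (suc j) tCross _ _ (suc-pair h))
        (trans (cong (λ t → crossCount n G + ind (isCross t)) (setCell-same G (suc i) (suc j) tCross)) (+-comm _ 1))))

      countSame : crossCount n (swapped x y) ≡ crossCount n G
      countSame = suc-injective (trans (+-comm 1 _) (trans (cong (λ t → crossCount n (swapped x y) + ind (isCross t)) (sym midX))
        (trans (crossCount-update mid′ (swapped x y) x<n y<n λ _ _ h → setCell-other mid′ (suc x) (suc y) tBump _ _ (suc-pair h))
        (trans (cong (λ t → crossCount n mid′ + ind (isCross t)) isBump) (trans (+-identityʳ _) countMid)))))
        where
        midX : mid′ (suc x) (suc y) ≡ tCross
        midX = trans (setCell-other G (suc i) (suc j) tCross _ _ λ { (e , f) → differ (suc-injective (sym e) , suc-injective (sym f)) }) isX′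

      good' : Good n (swapped x y) H' V'
      good' = Inversions.count⇒good valid' (trans countSame (trans (Inversions.good⇒count valid good)
                (cong inv (trans exits (sym exits')))))

      only' : OnlyBump n (swapped x y) x y
      only' {i'} {j'} p q e with sameCell? i' j' x y | sameCell? i' j' i j
      ... | yes f | _ = f
      ... | no h | yes (refl , refl) = case trans (sym isCross′) e of λ ()
      ... | no h | no k = ⊥-elim (k (only p q (trans (sym (others k h)) e)))

    abstract
      swap-state : State n ρ (swapped x y) x y
      swap-state = record
        { H = H' ; V = V' ; valid = valid' ; good = good' ; only = only' ; exits = exits' ; i<n = x<n ; j<n = y<n }

      swap-isBump : swapped x y (suc x) (suc y) ≡ tBump
      swap-isBump = isBump

      -- The swap undoes itself: the crossing found from the new bump is the cell of the old one. So
      -- a bump whose pipes cross is traced to its origin by the same move that the algorithm makes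
      -- forwards.
      swap-bumpCross : bumpCross n (swapped x y) (suc x) (suc y) ≡ just (suc i , suc j)
      swap-bumpCross = Pipes.bumpCross-crossing valid' x<n y<n isBump (proj₁ C.swap-bump) (proj₂ C.swap-bump) good' (C.swap-cross)

      swap-WN : State.H swap-state x y ≡ V (suc i) j
      swap-WN = trans (proj₁ C.swap-bump) (sym ev)

      swap-back : Agree n (crossBumpSwap (swapped x y) (suc x) (suc y) (suc i) (suc j)) G
      swap-back = agree source
        where
        back : Grid
        back = setCell (swapped x y) (suc x) (suc y) tCross
        source : ∀ {i' j'} → i' < n → j' < n →
          crossBumpSwap (swapped x y) (suc x) (suc y) (suc i) (suc j) (suc i') (suc j') ≡ G (suc i') (suc j')
        source {i'} {j'} p q with sameCell? i' j' i j | sameCell? i' j' x y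
        ... | yes (refl , refl) | _ = trans (setCell-same back (suc i) (suc j) tBump) (sym isB)
        ... | no h | yes (refl , refl) = trans (setCell-other back (suc i) (suc j) tBump (suc x) (suc y) (suc-pair h))
            (trans (setCell-same (swapped x y) (suc x) (suc y) tCross) (sym isX′))
        ... | no h | no k = trans (setCell-other back (suc i) (suc j) tBump (suc i') (suc j') (suc-pair h))
            (trans (setCell-other (swapped x y) (suc x) (suc y) tCross (suc i') (suc j') (suc-pair k)) (others h k))

      swap-exits-same : ∀ {r} → r < n → State.H swap-state r n ≡ H r n
      swap-exits-same = C.swap-exits

module StopStep {n : ℕ} (G : Grid) {i j : ℕ} (i<n : i < n) (j<n : j < n) where

  stopped : Grid
  stopped = setCell G (suc i) (suc j) tCross

  module _ (isB : G (suc i) (suc j) ≡ tBump) where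

    stop-alike : AlikeGrids n G stopped
    stop-alike {i'} {j'} p q with sameCell? i' j' i j
    ... | yes (refl , refl) = subst₂ Like (sym isB) (sym (setCell-same G (suc i) (suc j) tCross)) b→x
    ... | no h = like-≡ (sym (setCell-other G (suc i) (suc j) tCross (suc i') (suc j') (suc-pair h)))

    stop-count : crossCount n stopped ≡ suc (crossCount n G)
    stop-count = trans (sym (+-identityʳ _)) (trans (cong (λ t → crossCount n stopped + ind (isCross t)) (sym isB))
      (trans (crossCount-update G stopped i<n j<n λ _ _ h → setCell-other G (suc i) (suc j) tCross _ _ (suc-pair h))
      (trans (cong (λ t → crossCount n G + ind (isCross t)) (setCell-same G (suc i) (suc j) tCross)) (+-comm _ 1))))

    stop-bpd : ∀ {ρ σ} → State n ρ G i j → permOf n stopped ≡ σ → inv σ ≡ suc (inv ρ) → Bpd n σ stopped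
    stop-bpd {ρ} {σ} S e f = build (alike-valid stop-alike (State.valid S))
      where
      open State S
      noBump′ : ∀ {i' j'} → i' < n → j' < n → stopped (suc i') (suc j') ≢ tBump
      noBump′ {i'} {j'} p q g with sameCell? i' j' i j
      ... | yes (refl , refl) = case trans (sym (setCell-same G (suc i) (suc j) tCross)) g of λ ()
      ... | no h = h (only p q (trans (sym (setCell-other G (suc i) (suc j) tCross (suc i') (suc j') (suc-pair h))) g))
      build : (Σ Labels λ H' → Σ Labels λ V' → Valid n stopped H' V') → Bpd n σ stopped
      build (H' , V' , W) = record
        { H = H' ; V = V' ; valid = W ; noBump = noBump′ ; exits = ex
        ; good = Inversions.count⇒good W (trans stop-count (trans (cong suc (trans (Inversions.good⇒count valid good) (cong inv exits)))
                   (trans (sym f) (cong inv (sym ex)))))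
        }
        where
        ex : exitList n H' ≡ σ
        ex = trans (sym (Pipes.permOf-exits W)) e

-- The same labels are valid for both grids, and they determine the value of `bumpCross`: the unique
-- crossing of the two pipes if there is one, `nothing` otherwise.
bumpCross-agree : ∀ {n ρ G G' i j} → State n ρ G i j → G (suc i) (suc j) ≡ tBump → Agree n G G' →
  bumpCross n G (suc i) (suc j) ≡ bumpCross n G' (suc i) (suc j)
bumpCross-agree {n} {ρ} {G} {G'} {i} {j} S isB A = compare (bumpCross n G' (suc i) (suc j)) refl
  where
  open State S
  open SwapStep S isB using (u; v; eu; ev)
  W' : Valid n G' H V
  W' = valid-agree A valid
  isB' : G' (suc i) (suc j) ≡ tBump
  isB' = trans (sym (agrees A i<n j<n)) isB
  fwd : ∀ {x y a b} → CrossAt n G H V x y a b → CrossAt n G' H V x y a b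
  fwd (crossAt p q x e f) = crossAt p q (trans (sym (agrees A p q)) x) e f
  bwd : ∀ {x y a b} → CrossAt n G' H V x y a b → CrossAt n G H V x y a b
  bwd (crossAt p q x e f) = crossAt p q (trans (agrees A p q) x) e f
  both : ∀ {x y} → Pipes.Crossing W' x y v u → Pipes.Crossing valid x y v u
  both (inj₁ c) = inj₁ (bwd c)
  both (inj₂ c) = inj₂ (bwd c)
  both' : ∀ {x y} → Pipes.Crossing valid x y v u → Pipes.Crossing W' x y v u
  both' (inj₁ c) = inj₁ (fwd c)
  both' (inj₂ c) = inj₂ (fwd c)
  compare : ∀ m → bumpCross n G' (suc i) (suc j) ≡ m → bumpCross n G (suc i) (suc j) ≡ m
  compare (just z) e = found (Pipes.bumpCross-just W' i<n j<n isB' eu ev e)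
    where
    found : (Σ ℕ λ x → Σ ℕ λ y → z ≡ (suc x , suc y) × Pipes.Crossing W' x y v u) → bumpCross n G (suc i) (suc j) ≡ just z
    found (x , y , refl , X) = Pipes.bumpCross-crossing valid i<n j<n isB eu ev good (both X)
  compare nothing e = absent (bumpCross n G (suc i) (suc j)) refl
    where
    absent : ∀ m → bumpCross n G (suc i) (suc j) ≡ m → bumpCross n G (suc i) (suc j) ≡ nothing
    absent nothing  f = f
    absent (just z) f = ⊥-elim (found (Pipes.bumpCross-just valid i<n j<n isB eu ev f))
      where
      found : (Σ ℕ λ x → Σ ℕ λ y → z ≡ (suc x , suc y) × Pipes.Crossing valid x y v u) → ⊥
      found (x , y , _ , X) = Pipes.bumpCross-nothing W' i<n j<n isB' eu ev e (both' X)

swap-agree : ∀ {n G G'} a b a' b' → Agree n G G' → Agree n (crossBumpSwap G a b a' b') (crossBumpSwap G' a b a' b')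
swap-agree {n} {G} {G'} a b a' b' A = agree λ {i} {j} p q →
  cong (λ t → if (suc i ≡ᵇ a') ∧ (suc j ≡ᵇ b') then tBump else (if (suc i ≡ᵇ a) ∧ (suc j ≡ᵇ b) then tCross else t)) (agrees A p q)

-- Histories of insertions and their uniqueness.

-- How the insertion continues after a min-droop ending at (c , d), and where the next one starts.
data Link (n : ℕ) : Grid → ℕ → ℕ → Grid → ℕ → ℕ → Set where
  jLink : ∀ {G c d j} → G (suc c) (suc d) ≡ tJ → NextR G c j d → Link n G c d G c j
  sLink : ∀ {G c d x y} → G (suc c) (suc d) ≡ tBump → bumpCross n G (suc c) (suc d) ≡ just (suc x , suc y) →
    Link n G c d (crossBumpSwap G (suc c) (suc d) (suc x) (suc y)) x y
  gLink : ∀ {G c d} → G (suc c) (suc d) ≡ tBump → bumpCross n G (suc c) (suc d) ≡ nothing → Link n G c d G c d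

-- The history of an insertion: from the last r-elbow of row `b` of `D` it has arrived at a grid
-- where the next min-droop is due at `(i , j)`. It grows at its end, the opposite of `InsLoop`,
-- because predecessors are compared there.
data Rev (n : ℕ) : Grid → ℕ → ℕ → Grid → ℕ → Set where
  start : ∀ {D b j} → NextR D b j n → Rev n D b j D b
  step  : ∀ {G i j D b G₁ c d G' i' j'} → Rev n G i j D b → Droop n G G₁ i j c d → Link n G₁ c d G' i' j' →
          Rev n G' i' j' D b

droop-state′ : ∀ {n ρ G G₁ a b c d} → State n ρ G a b → Droop n G G₁ a b c d → State n ρ G₁ c d
droop-state′ {n} {ρ} {G} {G₁} {a} {b} {c} {d} S D = via (droop⇒minDroop D)
  where
  via : (Σ Grid λ G₂ → minDroop n G (suc a) (suc b) ≡ just (G₂ , suc c , suc d) ×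
      (∀ {i j} → i < n → j < n → G₂ (suc i) (suc j) ≡ G₁ (suc i) (suc j))) → State n ρ G₁ c d
  via (G₂ , e , h) = finish (droop-state S e)
    where
    finish : Drooped n ρ G a b G₂ (suc c) (suc d) → State n ρ G₁ c d
    finish record { i₁≡ = refl ; j₁≡ = refl ; state = S₂ } = state-agree (agree h) S₂

module _ {n : ℕ} {ρ : List ℕ} where

  private
    crossing-at : ∀ {G c d z} (S : State n ρ G c d) (isB : G (suc c) (suc d) ≡ tBump) → bumpCross n G (suc c) (suc d) ≡ just z →
      Σ ℕ λ x → Σ ℕ λ y → z ≡ (suc x , suc y) × Pipes.Crossing (State.valid S) x y (SwapStep.v S isB) (SwapStep.u S isB)
    crossing-at S isB e = Pipes.bumpCross-just (State.valid S) (State.i<n S) (State.j<n S) isB (SwapStep.eu S isB) (SwapStep.ev S isB) e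

    crossing-at′ : ∀ {G c d x y} (S : State n ρ G c d) (isB : G (suc c) (suc d) ≡ tBump) →
      bumpCross n G (suc c) (suc d) ≡ just (suc x , suc y) →
      Pipes.Crossing (State.valid S) x y (SwapStep.v S isB) (SwapStep.u S isB)
    crossing-at′ {x = x} {y} S isB e = get (crossing-at S isB e)
      where
      get : (Σ ℕ λ x' → Σ ℕ λ y' → _≡_ {A = ℕ × ℕ} (suc x , suc y) (suc x' , suc y') ×
              Pipes.Crossing (State.valid S) x' y' (SwapStep.v S isB) (SwapStep.u S isB)) →
        Pipes.Crossing (State.valid S) x y (SwapStep.v S isB) (SwapStep.u S isB)
      get (_ , _ , refl , X) = X

    notBump-J : ∀ {t : Tile} → t ≡ tJ → t ≢ tBump
    notBump-J refl ()

  link-state : ∀ {G₁ c d G i j} → State n ρ G₁ c d → Link n G₁ c d G i j → State n ρ G i j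
  link-state S (jLink e (nextR l _ _)) = state-move S (notBump-J e) (State.i<n S) (<-trans l (State.j<n S))
  link-state S (gLink e _) = S
  link-state S (sLink e f) = SwapStep.swap-state S e (crossing-at′ S e f)

  rev-state : ∀ {G i j D b} → Bpd n ρ D → b < n → Rev n G i j D b → State n ρ G i j
  rev-state B b<n (start (nextR l _ _)) = bpd⇒state B b<n l
  rev-state B b<n (step R D L) = link-state (droop-state′ (rev-state B b<n R) D) L

  private
    marked-none : ∀ {M n G x y i} → eqTile (G (suc x) (suc y)) M ≡ false → markedBlanks M n G x y i ≡ blanks n G i
    marked-none {x = x} {i = i} e rewrite e with i ≡ᵇ x
    ... | true  = +-identityʳ _
    ... | false = +-identityʳ _

    marked-one : ∀ {M n G x y i} → eqTile (G (suc x) (suc y)) M ≡ true → markedBlanks M n G x y i ≡ blanks n G i + ind (i ≡ᵇ x)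
    marked-one {x = x} {i = i} e rewrite e with i ≡ᵇ x
    ... | true  = refl
    ... | false = refl

  link-blanks : ∀ {G₁ c d G i j r} → State n ρ G₁ c d → r < n → Link n G₁ c d G i j →
    markedBlanks tJ n G₁ c d r ≡ markedBlanks tR n G i j r
  link-blanks {G₁} {c} {d} {j = j} {r} S l (jLink e (nextR _ f _)) =
    trans (marked-one {tJ} {n} {G₁} {c} {d} {r} (eqTile-≡ e)) (sym (marked-one {tR} {n} {G₁} {c} {j} {r} (eqTile-≡ f)))
  link-blanks {G₁} {c} {d} {r = r} S l (gLink e _) =
    trans (marked-none {tJ} {n} {G₁} {c} {d} {r} (cong (λ t → eqTile t tJ) e)) (sym (marked-none {tR} {n} {G₁} {c} {d} {r} (cong (λ t → eqTile t tR) e)))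
  link-blanks {G₁} {c} {d} {G} {i} {j} {r} S l (sLink e f) =
    trans (marked-none {tJ} {n} {G₁} {c} {d} {r} (cong (λ t → eqTile t tJ) e)) (trans
      (alike-blanks {n} {G₁} {G} {r} (SwapStep.swap-alike S e (crossing-at′ S e f)) l)
      (sym (marked-none {tR} {n} {G} {i} {j} {r} (cong (λ t → eqTile t tR) (SwapStep.swap-isBump S e (crossing-at′ S e f))))))

  -- An invariant of the whole run. At the start the r-elbow of row `b` stands for the extra blank.
  -- Drooping an r-elbow makes that blank real, drooping a bump leaves it alone; a blank filled by a
  -- j-elbow is replaced by that mark, which the link hands on to the next r-elbow of the row.
  rev-blanks : ∀ {G i j D b r} → Bpd n ρ D → b < n → r < n → Rev n G i j D b →
    markedBlanks tR n G i j r ≡ blanks n D r + ind (r ≡ᵇ b)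
  rev-blanks {D = D} {b} {r} B b<n l (start {j = j} (nextR _ e _)) = marked-one {tR} {n} {D} {b} {j} {r} (eqTile-≡ e)
  rev-blanks B b<n l (step R D L) = trans (sym (link-blanks (droop-state′ (rev-state B b<n R) D) l L))
    (trans (sym (droop-blanks D l)) (rev-blanks B b<n l R))

  record Final (D : Grid) (b : ℕ) (E : Grid) : Set where
    field
      {G₀ G₁}         : Grid
      {i₀ j₀ c d}     : ℕ
      rev             : Rev n G₀ i₀ j₀ D b
      droop           : Droop n G₀ G₁ i₀ j₀ c d
      isB             : G₁ (suc c) (suc d) ≡ tBump
      E≡              : E ≡ setCell G₁ (suc c) (suc d) tCross

  -- `InsLoop` says what remains to be done and `Rev` what has been done; each turn of the loop
  -- moves one step from the former to the latter. The local functions generalise the coordinates so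
  -- that `i₁≡` and `j₁≡` can be matched.
  run : ∀ {k G i j D b E} → Bpd n ρ D → b < n → Rev n G i j D b → InsLoop n k G (suc i) (suc j) E → Final D b E
  run {k} {G} {i} {j} {D} {b} B b<n R (jelbow {G1 = G₁} {i1} {j1} e t m L) = continue (droop-state (rev-state B b<n R) e) t m L
    where
    continue : ∀ {i1 j1 j2 E} → Drooped n ρ G i j G₁ i1 j1 → eqTile (G₁ i1 j1) tJ ≡ true → maxRElbow G₁ i1 j1 ≡ just j2 →
      InsLoop n k G₁ i1 j2 E → Final D b E
    continue record { c = c ; d = d ; i₁≡ = refl ; j₁≡ = refl ; droop = Dr } t m L with maxRElbow-spec G₁ c d m
    ... | j2 , refl , nx = run B b<n (step R Dr (jLink (eqTile-sound _ _ t) nx)) L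
  run {k} {G} {i} {j} {D} {b} B b<n R (bumpSwap {G1 = G₁} e t m L) = continue (droop-state (rev-state B b<n R) e) t m L
    where
    continue : ∀ {i1 j1 a' b' E} → Drooped n ρ G i j G₁ i1 j1 → eqTile (G₁ i1 j1) tBump ≡ true → bumpCross n G₁ i1 j1 ≡ just (a' , b') →
      InsLoop n k (crossBumpSwap G₁ i1 j1 a' b') a' b' E → Final D b E
    continue record { c = c ; d = d ; i₁≡ = refl ; j₁≡ = refl ; droop = Dr ; state = S } t m L =
      at (crossing-at S (eqTile-sound _ _ t) m) m L
      where
      at : ∀ {z E} → (Σ ℕ λ x → Σ ℕ λ y → z ≡ (suc x , suc y) ×
             Pipes.Crossing (State.valid S) x y (SwapStep.v S (eqTile-sound _ _ t)) (SwapStep.u S (eqTile-sound _ _ t))) →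
        bumpCross n G₁ (suc c) (suc d) ≡ just z →
        InsLoop n k (crossBumpSwap G₁ (suc c) (suc d) (proj₁ z) (proj₂ z)) (proj₁ z) (proj₂ z) E → Final D b E
      at (x , y , refl , _) m L = run B b<n (step R Dr (sLink (eqTile-sound _ _ t) m)) L
  run {k} {G} {i} {j} {D} {b} B b<n R (bumpGo {G1 = G₁} e t m _ _ L) = continue (droop-state (rev-state B b<n R) e) t m L
    where
    continue : ∀ {i1 j1 E} → Drooped n ρ G i j G₁ i1 j1 → eqTile (G₁ i1 j1) tBump ≡ true → bumpCross n G₁ i1 j1 ≡ nothing →
      InsLoop n k G₁ i1 j1 E → Final D b E
    continue record { i₁≡ = refl ; j₁≡ = refl ; droop = Dr } t m L = run B b<n (step R Dr (gLink (eqTile-sound _ _ t) m)) L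
  run {k} {G} {i} {j} {D} {b} B b<n R (bumpStop {G1 = G₁} e t m _ _) = finish (droop-state (rev-state B b<n R) e) t
    where
    finish : ∀ {i1 j1} → Drooped n ρ G i j G₁ i1 j1 → eqTile (G₁ i1 j1) tBump ≡ true → Final D b (setCell G₁ i1 j1 tCross)
    finish record { i₁≡ = refl ; j₁≡ = refl ; droop = Dr } t = record { rev = R ; droop = Dr ; isB = eqTile-sound _ _ t ; E≡ = refl }

  final-state : ∀ {D b E} → Bpd n ρ D → b < n → (F : Final D b E) → State n ρ (Final.G₁ F) (Final.c F) (Final.d F)
  final-state B b<n F = droop-state′ (rev-state B b<n (Final.rev F)) (Final.droop F)

  insert⇒final : ∀ {k D b E} → Bpd n ρ D → b < n → Insert n D (suc b) k E → Final D b E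
  insert⇒final {D = D} {b} B b<n (j , e , L) with maxRElbow-spec D b n e
  ... | j' , refl , nx = run B b<n (start nx) L

  final-bpd : ∀ {D b E σ} → Bpd n ρ D → b < n → Final D b E → permOf n E ≡ σ → inv σ ≡ suc (inv ρ) → Bpd n σ E
  final-bpd B b<n F@record { E≡ = refl ; G₁ = G₁ ; isB = isB } e f =
    StopStep.stop-bpd G₁ (State.i<n S) (State.j<n S) isB S e f
    where
    S = final-state B b<n F

  final-blanks : ∀ {D b E r} → Bpd n ρ D → b < n → Final D b E → r < n → blanks n E r ≡ blanks n D r + ind (r ≡ᵇ b)
  final-blanks {r = r} B b<n F@record { E≡ = refl ; G₁ = G₁ ; c = c ; d = d ; isB = isB ; droop = Dr ; rev = R } l =
    trans (sym (alike-blanks {n} {G₁} {setCell G₁ (suc c) (suc d) tCross} {r} (StopStep.stop-alike G₁ (State.i<n S) (State.j<n S) isB) l))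
   (trans (sym (marked-none {tJ} {n} {G₁} {c} {d} {r} (cong (λ t → eqTile t tJ) isB))) (trans (sym (droop-blanks Dr l)) (rev-blanks B b<n l R)))
    where
    S = final-state B b<n F

  private
    R≢Bump : ∀ {t t' : Tile} → t ≡ t' → t ≡ tR → t' ≢ tBump
    R≢Bump refl refl ()

    just-injective′ : ∀ {a b a' b' : ℕ} → _≡_ {A = Maybe (ℕ × ℕ)} (just (suc a , suc b)) (just (suc a' , suc b')) → a ≡ a' × b ≡ b'
    just-injective′ refl = refl , refl

  -- The tile at `(i , j)` and the value of `bumpCross` there tell the three kinds apart. Within a
  -- kind, `nextJ-unique` finds the j-elbow, and `swap-bumpCross` with `swap-back` recovers the grid
  -- before a swap.
  link-unique : ∀ {G₁ c d G G₁' c' d' G' i j} → State n ρ G₁ c d → State n ρ G₁' c' d' →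
    Link n G₁ c d G i j → Link n G₁' c' d' G' i j → Agree n G G' → c ≡ c' × d ≡ d' × Agree n G₁ G₁'
  link-unique S S' (jLink e r) (jLink e' r') A
    with nextJ-unique (State.valid S) (State.i<n S) r (nextR-agree (agree-sym A) (State.i<n S) (<⇒≤ (State.j<n S')) r') (State.j<n S) (State.j<n S')
           e (trans (agrees A (State.i<n S) (State.j<n S')) e')
  ... | refl = refl , refl , A
  link-unique S S' (jLink e (nextR l r _)) (gLink e' _) A = ⊥-elim (R≢Bump (agrees A (State.i<n S) (<-trans l (State.j<n S))) r e')
  link-unique S S' (gLink e _) (jLink e' (nextR l r _)) A = ⊥-elim (R≢Bump (sym (agrees A (State.i<n S) (<-trans l (State.j<n S')))) r e)
  link-unique S S' (gLink _ _) (gLink _ _) A = refl , refl , A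
  link-unique S S' (jLink e (nextR l r _)) (sLink e' f') A = ⊥-elim (R≢Bump (agrees A (State.i<n S) (<-trans l (State.j<n S))) r
    (SwapStep.swap-isBump S' e' (crossing-at′ S' e' f')))
  link-unique S S' (sLink e f) (jLink e' (nextR l r _)) A = ⊥-elim (R≢Bump (sym (agrees A (State.i<n S') (<-trans l (State.j<n S')))) r
    (SwapStep.swap-isBump S e (crossing-at′ S e f)))
  link-unique S S' (gLink e f) (sLink e' f') A = case trans (sym f) (trans (bumpCross-agree S e A) (SwapStep.swap-bumpCross S' e' (crossing-at′ S' e' f'))) of λ ()
  link-unique S S' (sLink e f) (gLink e' f') A = case trans (sym f') (trans (bumpCross-agree S' e' (agree-sym A)) (SwapStep.swap-bumpCross S e (crossing-at′ S e f))) of λ ()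
  link-unique {c = c} {d} {c' = c'} {d'} S S' (sLink e f) (sLink e' f') A =
    finish (just-injective′ {c} {d} {c'} {d'} (trans (sym (SwapStep.swap-bumpCross S e (crossing-at′ S e f)))
           (trans (bumpCross-agree (SwapStep.swap-state S e (crossing-at′ S e f)) (SwapStep.swap-isBump S e (crossing-at′ S e f)) A)
                  (SwapStep.swap-bumpCross S' e' (crossing-at′ S' e' f')))))
           (SwapStep.swap-back S e (crossing-at′ S e f)) (SwapStep.swap-back S' e' (crossing-at′ S' e' f')) {A}
    where
    finish : ∀ {c c' d d' G₁ G₁' G G' a b} → c ≡ c' × d ≡ d' → Agree n (crossBumpSwap G a b (suc c) (suc d)) G₁ →
      Agree n (crossBumpSwap G' a b (suc c') (suc d')) G₁' → {A : Agree n G G'} → c ≡ c' × d ≡ d' × Agree n G₁ G₁'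
    finish (refl , refl) P P' {A} = refl , refl , agree-trans (agree-sym P) (agree-trans (swap-agree _ _ _ _ A) P')

  private
    start-no-link : ∀ {D b j G₁ c d G} → Bpd n ρ D → b < n → NextR D b j n → State n ρ G₁ c d → Link n G₁ c d G b j → Agree n D G → ⊥
    start-no-link B b<n r S (jLink e (nextR l _ _)) A =
      lastR-noJ (Bpd.valid B) b<n r l (State.j<n S) (trans (agrees A b<n (State.j<n S)) e)
    start-no-link B b<n (nextR l r _) S (gLink e _) A = R≢Bump (agrees A b<n l) r e
    start-no-link B b<n (nextR l r _) S (sLink e f) A = R≢Bump (agrees A b<n l) r (SwapStep.swap-isBump S e (crossing-at′ S e f))

  -- The last link determines where its droop ended, `droop-corner` where that droop began, and
  -- `droop-source` the grid before it. A start can only be matched with a start, by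
  -- `start-no-link`.
  rev-unique : ∀ {G i j D b G' D' b'} → Bpd n ρ D → b < n → Bpd n ρ D' → b' < n → Rev n G i j D b → Rev n G' i j D' b' →
    Agree n G G' → Agree n D D' × b ≡ b'
  rev-unique B b<n B' b'<n (start r) (start r') A = A , refl
  rev-unique B b<n B' b'<n (start r) (step R' D' L') A = ⊥-elim (start-no-link B b<n r (droop-state′ (rev-state B' b'<n R') D') L' A)
  rev-unique B b<n B' b'<n (step R D L) (start r') A = ⊥-elim (start-no-link B' b'<n r' (droop-state′ (rev-state B b<n R) D) L (agree-sym A))
  rev-unique B b<n B' b'<n (step R D L) (step R' D' L') A =
    peel R R' D D' (link-unique (droop-state′ (rev-state B b<n R) D) (droop-state′ (rev-state B' b'<n R') D') L L' A)
    where
    peel : ∀ {G i j G' i' j' G₁ G₁' c d c' d'} → Rev n G i j _ _ → Rev n G' i' j' _ _ →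
      Droop n G G₁ i j c d → Droop n G' G₁' i' j' c' d' → c ≡ c' × d ≡ d' × Agree n G₁ G₁' → _
    peel R R' D D' (refl , refl , A₁) = corner (droop-corner A₁ D D') D D' A₁ R R'
      where
      corner : ∀ {G i j G' i' j' G₁ G₁' c d} → i ≡ i' × j ≡ j' → Droop n G G₁ i j c d → Droop n G' G₁' i' j' c d →
        Agree n G₁ G₁' → Rev n G i j _ _ → Rev n G' i' j' _ _ → _
      corner (refl , refl) D D' A₁ R R' = rev-unique B b<n B' b'<n R R' (droop-source A₁ D D')

-- The last step of an insertion.

cell-X : ∀ {t W S N E} → t ≡ tCross → Cell t W S N E → (Σ ℕ λ u → W ≡ suc u) × (Σ ℕ λ v → S ≡ suc v)
cell-X refl cross = (_ , refl) , (_ , refl)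

-- `H` and `V` label the finished grid `E`, `H₁` the grid just before its last bump became a cross.
-- The exits of the two pipes crossing at `(c , d)` are interchanged between the two grids.
record Exchanged (n : ℕ) (E : Grid) (H V H₁ : Labels) (c d : ℕ) : Set where
  field
    u v   : ℕ
    at    : CrossAt n E H V c d u v
    u≢v   : u ≢ v
    exit₁ : ∀ {r} → r < n → H r n ≡ suc u → H₁ r n ≡ suc v
    exit₂ : ∀ {r} → r < n → H r n ≡ suc v → H₁ r n ≡ suc u
    other : ∀ {r w} → r < n → w ≢ u → w ≢ v → H r n ≡ suc w → H₁ r n ≡ suc w

module _ {n : ℕ} {ρ : List ℕ} where

  final-exchanged : ∀ {G₁ E c d H V} (S : State n ρ G₁ c d) → G₁ (suc c) (suc d) ≡ tBump → E ≡ setCell G₁ (suc c) (suc d) tCross →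
    Valid n E H V → Exchanged n E H V (State.H S) c d
  final-exchanged {G₁} {c = c} {d} {H} {V} S isB refl W = build (cell-X isX′ (cell W i<n j<n))
    where
    open State S using (i<n; j<n)
    E : Grid
    E = setCell G₁ (suc c) (suc d) tCross
    isX′ : E (suc c) (suc d) ≡ tCross
    isX′ = setCell-same G₁ (suc c) (suc d) tCross
    same′ : ∀ {i' j'} → i' < n → j' < n → ¬ (i' ≡ c × j' ≡ d) → bit (G₁ (suc i') (suc j')) ≡ bit (E (suc i') (suc j'))
    same′ _ _ h = cong bit (sym (setCell-other G₁ (suc c) (suc d) tCross _ _ (suc-pair h)))
    build : (Σ ℕ λ u → H c d ≡ suc u) × (Σ ℕ λ v → V (suc c) d ≡ suc v) → Exchanged n E H V (State.H S) c d
    build ((u , eu) , (v , ev)) = record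
      { u = u ; v = v ; at = crossAt i<n j<n isX′ eu ev ; u≢v = Frontier.distinct W i<n j<n eu ev
      ; exit₁ = T.toggle-exit₁ ; exit₂ = T.toggle-exit₂ ; other = λ l p q e → T.toggle-exit-other l p q e }
      where
      module T = Toggle W (State.valid S) i<n j<n eu ev same′ (trans (cong bit isB) (cong (not ∘ bit) (sym isX′)))

  -- Both insertions removed a crossing of the same two pipes, hence the same one.
  final-same-cell : ∀ {σ E E' H₁ H₁' c d c' d'} (B : Bpd n σ E) (A : Agree n E E') →
    Exchanged n E (Bpd.H B) (Bpd.V B) H₁ c d → Exchanged n E' (Bpd.H B) (Bpd.V B) H₁' c' d' →
    (∀ {r} → r < n → H₁ r n ≡ H₁' r n) → c ≡ c' × d ≡ d'
  final-same-cell {E = E} {E'} {H₁} {H₁'} {c} {d} {c'} {d'} B A X X' ex =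
    Pipes.crossings-unique valid good (inj₁ X.at) (pair in-u in-v)
    where
    open Bpd B
    module X = Exchanged X
    module X' = Exchanged X'
    at' : CrossAt n E H V c' d' X'.u X'.v
    at' = crossAt (row< X'.at) (col< X'.at) (trans (agrees A (row< X'.at) (col< X'.at)) (isX X'.at)) (fromW X'.at) (fromS X'.at)
    -- The two grids before the last step have the same exits, so a pipe whose exit differs from `E`
    -- in one of them cannot be fixed in the other.
    moved : ∀ {w w̄} → w ≢ w̄ → w < n → (∀ {r} → r < n → H r n ≡ suc w → H₁ r n ≡ suc w̄) → w ≡ X'.u ⊎ w ≡ X'.v
    moved {w} {w̄} ne l f with w ≟ X'.u | w ≟ X'.v
    ... | yes e | _ = inj₁ e
    ... | no _ | yes e = inj₂ e
    ... | no p | no q = ⊥-elim (fixed (Frontier.exit-exists valid l))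
      where
      fixed : (Σ ℕ λ r → r < n × H r n ≡ suc w) → ⊥
      fixed (r , l , e) = ne (suc-injective (trans (sym (X'.other l p q e)) (trans (sym (ex l)) (f l e))))
    in-u : X.u ≡ X'.u ⊎ X.u ≡ X'.v
    in-u = moved X.u≢v (Frontier.H-range valid (row< X.at) (<⇒≤ (col< X.at)) (fromW X.at)) X.exit₁
    in-v : X.v ≡ X'.u ⊎ X.v ≡ X'.v
    in-v = moved (X.u≢v ∘ sym) (Frontier.V-range valid (row< X.at) (col< X.at) (fromS X.at)) X.exit₂
    pair : X.u ≡ X'.u ⊎ X.u ≡ X'.v → X.v ≡ X'.u ⊎ X.v ≡ X'.v → Pipes.Crossing valid c' d' X.u X.v
    pair (inj₁ p) (inj₁ q) = ⊥-elim (X.u≢v (trans p (sym q)))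
    pair (inj₂ p) (inj₂ q) = ⊥-elim (X.u≢v (trans p (sym q)))
    pair (inj₁ p) (inj₂ q) = inj₁ (subst₂ (CrossAt n E H V c' d') (sym p) (sym q) at')
    pair (inj₂ p) (inj₁ q) = inj₂ (subst₂ (CrossAt n E H V c' d') (sym q) (sym p) at')

  final-unique : ∀ {σ D b E D' b' E'} → Bpd n ρ D → b < n → Bpd n ρ D' → b' < n → Bpd n σ E →
    Final {n} {ρ} D b E → Final {n} {ρ} D' b' E' → Agree n E E' → Agree n D D' × b ≡ b'
  final-unique {D = D} {b} {E} {D'} {b'} {E'} B b<n B' b'<n BE F F' A =
    finish (final-same-cell BE A (final-exchanged S F.isB F.E≡ (Bpd.valid BE))
              (final-exchanged S' F'.isB F'.E≡ (valid-agree A (Bpd.valid BE)))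
              (λ l → listFrom-injective n 0 (trans (State.exits S) (sym (State.exits S'))) z≤n l))
           F.rev F'.rev F.droop F'.droop F.isB F'.isB (subst₂ (Agree n) F.E≡ F'.E≡ A)
    where
    module F = Final F
    module F' = Final F'
    S = final-state B b<n F
    S' = final-state B' b'<n F'
    corner : ∀ {G i j G' i' j' G₁ G₁' c d} → i ≡ i' × j ≡ j' → Droop n G G₁ i j c d → Droop n G' G₁' i' j' c d →
      Agree n G₁ G₁' → Rev n G i j D b → Rev n G' i' j' D' b' → Agree n D D' × b ≡ b'
    corner (refl , refl) Dr Dr' A₁ R R' = rev-unique B b<n B' b'<n R R' (droop-source A₁ Dr Dr')
    finish : ∀ {G i j G' i' j' G₁ G₁' c d c' d'} → c ≡ c' × d ≡ d' → Rev n G i j D b → Rev n G' i' j' D' b' →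
      Droop n G G₁ i j c d → Droop n G' G₁' i' j' c' d' → G₁ (suc c) (suc d) ≡ tBump → G₁' (suc c') (suc d') ≡ tBump →
      Agree n (setCell G₁ (suc c) (suc d) tCross) (setCell G₁' (suc c') (suc d') tCross) → Agree n D D' × b ≡ b'
    finish {G₁ = G₁} {G₁'} {c} {d} (refl , refl) R R' Dr Dr' isB isB' A = corner (droop-corner A₁ Dr Dr') Dr Dr' A₁ R R'
      where
      A₁ : Agree n G₁ G₁'
      A₁ = agree cells
        where
        cells : ∀ {i j} → i < n → j < n → G₁ (suc i) (suc j) ≡ G₁' (suc i) (suc j)
        cells {i} {j} p q with sameCell? i j c d
        ... | yes (refl , refl) = trans isB (sym isB')
        ... | no h = trans (sym (setCell-other G₁ (suc c) (suc d) tCross (suc i) (suc j) (suc-pair h)))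
                    (trans (agrees A p q) (setCell-other G₁' (suc c) (suc d) tCross (suc i) (suc j) (suc-pair h)))

TL-tile : ∀ {t t₁} → TL t t₁ → t ≡ tR ⊎ t ≡ tBump
TL-tile relb = inj₁ refl
TL-tile bump = inj₂ refl

cell-R : ∀ {t W S N E} → t ≡ tR → Cell t W S N E → Σ ℕ λ p → E ≡ suc p × S ≡ suc p
cell-R refl relb = _ , refl , refl

-- Running an insertion backwards.

module Backward (n k : ℕ) (ρ : List ℕ) (E : Grid) where

  -- What the forward loop is already known to do from `(a , b)`. It is asserted for every grid
  -- agreeing with `G`, since the grid that `minDroop` computes is controlled only on the square.
  PreRun : Grid → ℕ → ℕ → Set
  PreRun G a b = ∀ G₂ → Agree n G₂ G → Σ Grid λ E' → Agree n E' E × InsLoop n k G₂ (suc a) (suc b) E'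

  -- The same knowledge half a step later: a droop has ended at `(c , d)` but its origin is still
  -- open, so every loop whose min-droop leads here can be completed.
  PostRun : Grid → ℕ → ℕ → Set
  PostRun G₁ c d = ∀ G₂ → Agree n G₂ G₁ → Σ Grid λ E' → Agree n E' E ×
    (∀ {G i j} → minDroop n G i j ≡ just (G₂ , suc c , suc d) → InsLoop n k G i j E')

  Source : Set
  Source = Σ Grid λ D → Σ ℕ λ b → Bpd n ρ D × b < k × b < n ×
    (∀ D' → Agree n D' D → Σ Grid λ E' → Agree n E' E × Insert n D' (suc b) k E')

  -- The drooping pipe leaves from one of the first `k` rows: it enters `(i , j)` from the west when
  -- its droop has ended there, from the south when a droop is to begin there. Rows count from 0, so
  -- `r < k` is the test `r ≤ k` of the algorithm.
  ExitsW ExitsS : ∀ {G i j} → State n ρ G i j → Set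
  ExitsW {G} {i} {j} S = ∀ {r} → r < n → State.H S r n ≡ State.H S i j → r < k
  ExitsS {G} {i} {j} S = ∀ {r} → r < n → State.H S r n ≡ State.V S (suc i) j → r < k

  -- The recursive call of `backward` at measure `m`, handed to the case lemmas so that the
  -- well-founded recursion stays in one place.
  Continue : ℕ → Set
  Continue m = ∀ {G c d} (S : State n ρ G c d) → eastWeight n G ≡ m → wn (G (suc c) (suc d)) ≡ true →
    ExitsW S → PostRun G c d → Source

  private
    from-R : ∀ {G a b} (S : State n ρ G a b) → G (suc a) (suc b) ≡ tR → ExitsS S → PreRun G a b →
      Continue (eastWeight n G) → Source
    from-R {G} {a} {b} S isR ex pre rec = go (cell-R isR (cell valid i<n j<n))
      where
      open State S
      notB : G (suc a) (suc b) ≢ tBump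
      notB e = case trans (sym isR) e of λ ()
      go : (Σ ℕ λ p → H a (suc b) ≡ suc p × V (suc a) b ≡ suc p) → Source
      go (p , e , f) = run′ (rightRun valid i<n only j<n isR e)
        where
        run′ : (Σ ℕ λ d → d < n × NextR G a b d × G (suc a) (suc d) ≡ tJ × H a d ≡ suc p) ⊎ (NextR G a b n × H a n ≡ suc p) → Source
        -- No j-elbow follows, so the pipe leaves along row `a` itself, and the exit invariant
        -- becomes the bound `a < k` on the letter.
        run′ (inj₂ (nx , g)) = G , a , state⇒bpd S notB , ex i<n (trans g (sym f)) , i<n , λ D' A →
          proj₁ (pre D' A) , proj₁ (proj₂ (pre D' A)) ,
          suc b , maxRElbow-intro D' a n (nextR-agree (agree-sym A) i<n ≤-refl nx) , proj₂ (proj₂ (pre D' A))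
        run′ (inj₁ (d , d<n , nx , isJ , g)) = rec (state-move S notB i<n d<n) refl (cong wn isJ)
          (λ l h → ex l (trans h (trans g (sym f)))) λ G₂ A →
          proj₁ (pre G₂ A) , proj₁ (proj₂ (pre G₂ A)) , λ m →
          jelbow m (eqTile-≡ (trans (agrees A i<n d<n) isJ))
            (maxRElbow-intro G₂ a d (nextR-agree (agree-sym A) i<n (<⇒≤ d<n) nx)) (proj₂ (proj₂ (pre G₂ A)))

    from-crossing : ∀ {G a b} (S : State n ρ G a b) (isB : G (suc a) (suc b) ≡ tBump) → ExitsS S → PreRun G a b →
      Continue (eastWeight n G) → ∀ {x y} → Pipes.Crossing (State.valid S) x y (SwapStep.v S isB) (SwapStep.u S isB) → Source
    from-crossing {G} {a} {b} S isB ex pre rec {x} {y} X = rec S' (sym (alike-eastWeight {n} {G} {G'} (SwapStep.swap-alike S isB X))) (cong wn isB')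
        (λ l h → ex l (trans (sym (SwapStep.swap-exits-same S isB X l)) (trans h (SwapStep.swap-WN S isB X)))) post
      where
      G' : Grid
      G' = SwapStep.swapped S isB x y
      S' : State n ρ G' x y
      S' = SwapStep.swap-state S isB X
      isB' : G' (suc x) (suc y) ≡ tBump
      isB' = SwapStep.swap-isBump S isB X
      post : PostRun G' x y
      post G₂ A = proj₁ r , proj₁ (proj₂ r) , λ m →
          bumpSwap m (eqTile-≡ (trans (agrees A (State.i<n S') (State.j<n S')) isB'))
            (trans (sym (bumpCross-agree S' isB' (agree-sym A))) (SwapStep.swap-bumpCross S isB X)) (proj₂ (proj₂ r))
        where
        r = pre (crossBumpSwap G₂ (suc x) (suc y) (suc a) (suc b))
              (agree-trans (swap-agree (suc x) (suc y) (suc a) (suc b) A) (SwapStep.swap-back S isB X))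

    -- Pipe `u` of the preceding droop turns north here and `v` turns east. If `u` left below `v`,
    -- they would cross later, against `bumpCross`; so `u` leaves above `v` and inherits the exit
    -- bound, while the bound for `v` is what `bumpGo` tests.
    from-touching : ∀ {G a b} (S : State n ρ G a b) → G (suc a) (suc b) ≡ tBump → ExitsS S → PreRun G a b →
      Continue (eastWeight n G) → bumpCross n G (suc a) (suc b) ≡ nothing → Source
    from-touching {G} {a} {b} S isB ex pre rec e = rec S refl (cong wn isB) exW post
      where
      open State S
      open SwapStep S isB using (u; v; eu; ev)
      exitV : Σ ℕ λ r → r < n × H r n ≡ suc v
      exitV = Frontier.exit-exists valid (Frontier.V-range valid i<n j<n ev)
      r : ℕ
      r = proj₁ exitV
      r<k : r < k
      r<k = ex (proj₁ (proj₂ exitV)) (trans (proj₂ (proj₂ exitV)) (sym ev))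
      exW : ExitsW S
      exW {r'} l h with <-cmp r' r
      ... | tri< q _ _ = <-trans q r<k
      ... | tri≈ _ refl _ = r<k
      ... | tri> _ _ q = ⊥-elim (contra (Order.crossed-after valid i<n j<n eu ev l (proj₁ (proj₂ exitV)) (trans h eu) (proj₂ (proj₂ exitV)) q))
        where
        contra : (Σ ℕ λ i' → Σ ℕ λ j' → CrossAt n G H V i' j' u v) → ⊥
        contra (_ , _ , X) = Pipes.bumpCross-nothing valid i<n j<n isB eu ev e (inj₂ X)
      post : PostRun G a b
      post G₂ A = proj₁ q , proj₁ (proj₂ q) , λ m →
          bumpGo m (eqTile-≡ isB₂) (trans (sym (bumpCross-agree S isB (agree-sym A))) e)
            (Pipes.seExit-label (valid-agree (agree-sym A) valid) i<n j<n (cong se isB₂) ev (proj₁ (proj₂ exitV)) (proj₂ (proj₂ exitV)))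
            r<k (proj₂ (proj₂ q))
        where
        q = pre G₂ A
        isB₂ : G₂ (suc a) (suc b) ≡ tBump
        isB₂ = trans (agrees A i<n j<n) isB

    from-pre : ∀ {G a b} (S : State n ρ G a b) → G (suc a) (suc b) ≡ tR ⊎ G (suc a) (suc b) ≡ tBump → ExitsS S → PreRun G a b →
      Continue (eastWeight n G) → Source
    from-pre S (inj₁ isR) ex pre rec = from-R S isR ex pre rec
    from-pre {G} {a} {b} S (inj₂ isB) ex pre rec = decide (bumpCross n G (suc a) (suc b)) refl
      where
      open State S
      decide : ∀ m → bumpCross n G (suc a) (suc b) ≡ m → Source
      decide nothing  e = from-touching S isB ex pre rec e
      decide (just z) e = found (Pipes.bumpCross-just valid i<n j<n isB (SwapStep.eu S isB) (SwapStep.ev S isB) e)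
        where
        found : (Σ ℕ λ x → Σ ℕ λ y → z ≡ (suc x , suc y) × Pipes.Crossing valid x y (SwapStep.v S isB) (SwapStep.u S isB)) → Source
        found (x , y , _ , X) = from-crossing S isB ex pre rec X

  -- One turn of the loop: the droop ending at `(c , d)` is undone, and the tile at its origin
  -- chooses the link by which that origin was reached. Undoing strictly lowers `eastWeight`, and
  -- the links keep it.
  backward : ∀ {G₁ c d} → Acc _<_ (eastWeight n G₁) → (S : State n ρ G₁ c d) → wn (G₁ (suc c) (suc d)) ≡ true →
    ExitsW S → PostRun G₁ c d → Source
  backward {G₁} {c} {d} (acc rs) S isWN ex post = undo (relabel⇐ B.backward-droop B.backward-strips)
    where
    open State S
    module B = BackwardDroop valid good only i<n j<n isWN
    Dr : Droop n B.undroop G₁ B.a B.b c d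
    Dr = B.backward-droop
    pre : PreRun B.undroop B.a B.b
    pre G₂ A = go (droop⇒minDroop (droop-agree (agree-sym A) Dr))
      where
      go : (Σ Grid λ G₃ → minDroop n G₂ (suc B.a) (suc B.b) ≡ just (G₃ , suc c , suc d) ×
             (∀ {i j} → i < n → j < n → G₃ (suc i) (suc j) ≡ G₁ (suc i) (suc j))) →
        Σ Grid λ E' → Agree n E' E × InsLoop n k G₂ (suc B.a) (suc B.b) E'
      go (G₃ , e , h) = proj₁ r , proj₁ (proj₂ r) , proj₂ (proj₂ r) e
        where
        r = post G₃ (agree h)
    undo : (Σ Labels λ H₀ → Σ Labels λ V₀ → Relabelled n B.undroop G₁ B.a B.b c d B.pipe-label H₀ V₀ H V) → Source
    undo (H₀ , V₀ , R) = from-pre S₀ (TL-tile (Droop.tl Dr)) exS pre λ S' w wn′ ex' post' →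
        backward (rs (subst (_< eastWeight n G₁) (sym w) (droop-eastWeight R valid₀ valid))) S' wn′ ex' post'
      where
      valid₀ : Valid n B.undroop H₀ V₀
      valid₀ = valid⇐ R valid
      S₀ : State n ρ B.undroop B.a B.b
      S₀ = record
        { H = H₀ ; V = V₀ ; valid = valid₀ ; good = good⇐ R valid₀ good ; only = onlyBump⇐ Dr only
        ; exits = trans (listFrom-cong 0 n λ r _ _ → sym (exits-same R r)) exits
        ; i<n = Droop.a<n Dr ; j<n = Droop.b<n Dr }
      exS : ExitsS S₀
      -- Before the droop the pipe enters the upper left corner from the south, afterwards the lower
      -- right corner from the west; both edges carry the same label.
      exS {r} l h = ex l (trans (exits-same R r) (trans h (trans (Strips.vLeft (Relabelled.strips R) ≤-refl (Droop.a<c Dr))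
        (sym (Strips.hBot (Relabelled.strips₁ R) (Droop.b<d Dr) ≤-refl)))))

-- Inversions under a transposition, and the start of the backward run.

count-listFrom : ∀ (p : ℕ → Bool) f n j → countᵇ p (listFrom j n f) ≡ sumFrom j n (λ r → ind (p (f r)))
count-listFrom p f zero    j = refl
count-listFrom p f (suc n) j = trans (count-∷ p (f j) (listFrom (suc j) n f)) (cong (ind (p (f j)) +_) (count-listFrom p f n (suc j)))

ind-<ᵇ-mono : ∀ {a b c d} → b ≤ a → c ≤ d → ind (a <ᵇ c) ≤ ind (b <ᵇ d)
ind-<ᵇ-mono {a} {b} {c} {d} p q with a <? c
... | no h rewrite <ᵇ-false (≮⇒≥ h) = z≤n
... | yes h rewrite <ᵇ-true h | <ᵇ-true (≤-<-trans p (<-≤-trans h q)) = ≤-refl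

private
  count-below : ℕ → List ℕ → ℕ
  count-below x = countᵇ (λ y → y <ᵇ x)

  count-below-mono : ∀ {f g : ℕ → ℕ} x n j → (∀ r → f r ≤ g r) → count-below x (listFrom j n g) ≤ count-below x (listFrom j n f)
  count-below-mono {f} {g} x n j h = subst₂ _≤_ (sym (count-listFrom (λ y → y <ᵇ x) g n j)) (sym (count-listFrom (λ y → y <ᵇ x) f n j))
    (sumFrom-≤ n j λ r _ _ → ind-<ᵇ-mono {g r} {f r} {x} {x} (h r) ≤-refl)

-- This is `inv (y ∷ g ...) ≤ inv (x ∷ f ...)` with the heads unfolded: exchanging a head `x` with
-- an entry `y ≤ x` further right creates no inversions.
inv-raise : ∀ n j β {x y} f g → j ≤ β → β < j + n → y ≤ x → f β ≡ y → g β ≡ x → (∀ r → r ≢ β → g r ≡ f r) →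
  count-below y (listFrom j n g) + inv (listFrom j n g) ≤ count-below x (listFrom j n f) + inv (listFrom j n f)
inv-raise zero    j β f g p q y≤x ef eg h = ⊥-elim (<-irrefl refl (<-≤-trans q (subst (_≤ β) (sym (+-identityʳ j)) p)))
inv-raise (suc n) j β {x} {y} f g p q y≤x ef eg h with m≤n⇒m<n∨m≡n p
... | inj₁ l
  rewrite count-∷ (λ z → z <ᵇ y) (g j) (listFrom (suc j) n g) | count-∷ (λ z → z <ᵇ x) (f j) (listFrom (suc j) n f) | h j (<⇒≢ l) =
  combine (ind (f j <ᵇ y)) (ind (f j <ᵇ x)) _ _ _ _ _ _
    (ind-<ᵇ-mono {f j} {f j} {y} {x} ≤-refl y≤x) (count-below-mono (f j) n (suc j) f≤g)
    (inv-raise n (suc j) β f g l (subst (β <_) (+-suc j n) q) y≤x ef eg h)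
  where
  f≤g : ∀ r → f r ≤ g r
  f≤g r with r ≟ β
  ... | yes refl = subst₂ _≤_ (sym ef) (sym eg) y≤x
  ... | no  k = ≤-reflexive (sym (h r k))
  combine : ∀ a a' b b' c c' d d' → a ≤ a' → c ≤ c' → b + d ≤ b' + d' → a + b + (c + d) ≤ a' + b' + (c' + d')
  combine a a' b b' c c' d d' u v w = subst₂ _≤_ (shuffle a c b d) (shuffle a' c' b' d') (+-mono-≤ (+-mono-≤ u v) w)
    where
    shuffle : ∀ a c b d → a + c + (b + d) ≡ a + b + (c + d)
    shuffle = solve-∀
... | inj₂ refl
  rewrite count-∷ (λ z → z <ᵇ y) (g j) (listFrom (suc j) n g) | count-∷ (λ z → z <ᵇ x) (f j) (listFrom (suc j) n f) | ef | eg
        | listFrom-cong (suc j) n {g} {f} (λ r u _ → h r (<⇒≢ u ∘ sym)) | <ᵇ-false y≤x =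
  subst₂ _≤_ refl (shuffle (ind (y <ᵇ x)) (count-below x (listFrom (suc j) n f)) (count-below y (listFrom (suc j) n f)) (inv (listFrom (suc j) n f)))
    (m≤n+m _ (ind (y <ᵇ x)))
  where
  shuffle : ∀ e a b c → e + (b + (a + c)) ≡ e + a + (b + c)
  shuffle = solve-∀

private
  count-two : ∀ (p : ℕ → Bool) n j α β f g → j ≤ α → α < β → β < j + n → g α ≡ f β → g β ≡ f α →
    (∀ r → r ≢ α → r ≢ β → g r ≡ f r) → countᵇ p (listFrom j n g) ≡ countᵇ p (listFrom j n f)
  count-two p n j α β f g l α<β k eα eβ h = trans (count-listFrom p g n j) (trans
    (+-cancelʳ-≡ (F α + F β) (sumFrom j n G) (sumFrom j n F) (combine (sumFrom j n G) (sumFrom j n M) (sumFrom j n F) (F α) (F β)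
      (subst₂ (λ a b → sumFrom j n G + a ≡ sumFrom j n M + b) Mα (cong (ind ∘ p) eα)
        (sumFrom-update n j α l (<-trans α<β k) λ r _ _ ne → sym (M-other r ne)))
      (subst₂ (λ a b → sumFrom j n M + a ≡ sumFrom j n F + b) refl Mβ
        (sumFrom-update n j β (≤-trans l (<⇒≤ α<β)) k mf))))
    (sym (count-listFrom p f n j)))
    where
    F G M : ℕ → ℕ
    F r = ind (p (f r))
    G r = ind (p (g r))
    M r = if r ≡ᵇ α then F r else G r
    Mα : M α ≡ F α
    Mα = cong (λ b → if b then F α else G α) (≡ᵇ-true {α} refl)
    M-other : ∀ r → r ≢ α → M r ≡ G r
    M-other r ne = cong (λ b → if b then F r else G r) (≡ᵇ-false ne)
    Mβ : M β ≡ F α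
    Mβ = trans (M-other β (<⇒≢ α<β ∘ sym)) (cong (ind ∘ p) eβ)
    mf : ∀ r → j ≤ r → r < j + n → r ≢ β → M r ≡ F r
    mf r _ _ ne with r ≟ α
    ... | yes refl = Mα
    ... | no  q = trans (M-other r q) (cong (ind ∘ p) (h r q ne))
    combine : ∀ S M T a b → S + a ≡ M + b → M + b ≡ T + a → S + (a + b) ≡ T + (a + b)
    combine S M T a b e e' = trans (sym (+-assoc S a b)) (trans (cong (_+ b) (trans e e')) (+-assoc T a b))

-- Before `α` the words coincide and the entries behind are only permuted; from `α` on it is
-- `inv-raise`. Read contrapositively, it shows that a cover exchanges an ascent.
inv-transpose : ∀ n j α β f g → j ≤ α → α < β → β < j + n → f β ≤ f α → g α ≡ f β → g β ≡ f α →
  (∀ r → r ≢ α → r ≢ β → g r ≡ f r) → inv (listFrom j n g) ≤ inv (listFrom j n f)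
inv-transpose zero    j α β f g l α<β k d eα eβ h = ⊥-elim (<-irrefl refl (<-≤-trans (<-trans α<β k) (subst (_≤ α) (sym (+-identityʳ j)) l)))
inv-transpose (suc n) j α β f g l α<β k d eα eβ h with m≤n⇒m<n∨m≡n l
... | inj₁ j<α rewrite h j (<⇒≢ j<α) (<⇒≢ (<-trans j<α α<β)) =
  +-mono-≤ (≤-reflexive (count-two _ n (suc j) α β f g j<α α<β (subst (β <_) (+-suc j n) k) eα eβ h))
           (inv-transpose n (suc j) α β f g j<α α<β (subst (β <_) (+-suc j n) k) d eα eβ h)
... | inj₂ refl rewrite eα = subst (λ L → count-below (f β) L + inv L ≤ count-below (f j) (listFrom (suc j) n f) + inv (listFrom (suc j) n f))
    (listFrom-cong (suc j) n λ r u _ → g′-other r (<⇒≢ u ∘ sym))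
    (inv-raise n (suc j) β f g′ α<β (subst (β <_) (+-suc j n) k) d refl (trans (g′-other β (<⇒≢ α<β ∘ sym)) eβ) g′-f)
  where
  -- `g` and `f` also differ at the head position `j`, outside the remaining word. Correcting this
  -- leaves `β` as the only difference, as `inv-raise` demands for all arguments.
  g′ : ℕ → ℕ
  g′ r = if r ≡ᵇ j then f j else g r
  g′-other : ∀ r → r ≢ j → g′ r ≡ g r
  g′-other r ne = cong (λ b → if b then f j else g r) (≡ᵇ-false ne)
  g′-f : ∀ r → r ≢ β → g′ r ≡ f r
  g′-f r ne with r ≟ j
  ... | yes refl = cong (λ b → if b then f j else g j) (≡ᵇ-true {j} refl)
  ... | no  q = trans (g′-other r q) (h r q ne)

nth-list : ∀ xs → xs ≡ listFrom 0 (length xs) (λ r → nth xs (suc r))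
nth-list []       = refl
nth-list (x ∷ xs) = cong (x ∷_) (trans (nth-list xs) (shift (length xs) 0))
  where
  shift : ∀ n j → listFrom j n (λ r → nth xs (suc r)) ≡ listFrom (suc j) n (λ r → nth (x ∷ xs) (suc r))
  shift zero    j = refl
  shift (suc n) j = cong (nth xs (suc j) ∷_) (shift n (suc j))

length-listFrom : ∀ {A : Set} n j (f : ℕ → A) → length (listFrom j n f) ≡ n
length-listFrom zero    j f = refl
length-listFrom (suc n) j f = cong suc (length-listFrom n (suc j) f)

swapIndex : ℕ → ℕ → ℕ → ℕ
swapIndex a b i = if i ≡ᵇ a then b else (if i ≡ᵇ b then a else i)

swapAt-list : ∀ ρ a b → swapAt ρ a b ≡ listFrom 0 (length ρ) (λ r → nth ρ (swapIndex a b (suc r)))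
swapAt-list ρ a b = map-range1 (λ i → nth ρ (swapIndex a b i)) (length ρ)

length-swapAt : ∀ ρ a b → length (swapAt ρ a b) ≡ length ρ
length-swapAt ρ a b = trans (cong length (swapAt-list ρ a b)) (length-listFrom (length ρ) 0 _)

module CoverStep {n k : ℕ} {ρ σ : List ℕ} {E : Grid} (lenρ : length ρ ≡ n) (B : Bpd n σ E)
  {α β : ℕ} (α<k : α < k) (k≤β : k ≤ β) (β<n : β < n) (σ≡ : σ ≡ swapAt ρ (suc α) (suc β)) (cover : inv σ ≡ suc (inv ρ)) where
  open Bpd B
  open Backward n k ρ E

  private
    α<β : α < β
    α<β = <-≤-trans α<k k≤β
    α<n : α < n
    α<n = <-trans α<β β<n

    f : ℕ → ℕ
    f r = nth ρ (suc r)

    ρ≡ : ρ ≡ listFrom 0 n f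
    ρ≡ = subst (λ m → ρ ≡ listFrom 0 m f) lenρ (nth-list ρ)

    exit-value : ∀ {r} → r < n → H r n ≡ nth ρ (swapIndex (suc α) (suc β) (suc r))
    exit-value l = listFrom-injective n 0 (trans exits (trans σ≡ (trans (swapAt-list ρ (suc α) (suc β))
      (cong (λ m → listFrom 0 m (λ r → nth ρ (swapIndex (suc α) (suc β) (suc r)))) lenρ)))) z≤n l

    at-α : H α n ≡ f β
    at-α = trans (exit-value α<n) (cong (λ b → nth ρ (if b then suc β else (if α ≡ᵇ β then suc α else suc α))) (≡ᵇ-true {α} refl))

    at-β : H β n ≡ f α
    at-β = trans (exit-value β<n) (trans (cong (λ b → nth ρ (if b then suc β else (if β ≡ᵇ β then suc α else suc β))) (≡ᵇ-false (<⇒≢ α<β ∘ sym)))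
      (cong (λ b → nth ρ (if b then suc α else suc β)) (≡ᵇ-true {β} refl)))

    at-other : ∀ {r} → r < n → r ≢ α → r ≢ β → H r n ≡ f r
    at-other {r} l p q = trans (exit-value l) (trans (cong (λ b → nth ρ (if b then suc β else (if r ≡ᵇ β then suc α else suc r))) (≡ᵇ-false p))
      (cong (λ b → nth ρ (if b then suc α else suc r)) (≡ᵇ-false q)))

    ascent : f α < f β
    ascent = ≰⇒> λ d → <⇒≱ (≤-reflexive (sym cover)) (subst₂ (λ L L' → inv L ≤ inv L') (sym σ≡′) (sym ρ≡)
        (inv-transpose n 0 α β f g z≤n α<β β<n d g-α g-β g-other))
      where
      g : ℕ → ℕ
      g r = nth ρ (swapIndex (suc α) (suc β) (suc r))
      σ≡′ : σ ≡ listFrom 0 n g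
      σ≡′ = trans σ≡ (trans (swapAt-list ρ (suc α) (suc β)) (cong (λ m → listFrom 0 m g) lenρ))
      g-α : g α ≡ f β
      g-α = trans (sym (exit-value α<n)) at-α
      g-β : g β ≡ f α
      g-β = trans (sym (exit-value β<n)) at-β
      g-other : ∀ r → r ≢ α → r ≢ β → g r ≡ f r
      g-other r p q = trans (cong (λ b → nth ρ (if b then suc β else (if r ≡ᵇ β then suc α else suc r))) (≡ᵇ-false p))
        (cong (λ b → nth ρ (if b then suc α else suc r)) (≡ᵇ-false q))

    -- In `E` pipe `u` leaves from row `β` and `v` from row `α`; with a bump in place of their cross
    -- the exits are those of `ρ`. Crosses and inversions both drop by one, which keeps the grid
    -- good, and `u`, entering the bump from the west, now leaves from row `α < k`.
    from-crossing-at : ∀ {u v x y} → H β n ≡ suc u → H α n ≡ suc v → CrossAt n E H V x y u v → Source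
    from-crossing-at {u} {v} {x} {y} eβ eα (crossAt x<n y<n isX′ eu ev) = build (alike-valid alike valid)
      where
      G₁ : Grid
      G₁ = setCell E (suc x) (suc y) tBump
      isB : G₁ (suc x) (suc y) ≡ tBump
      isB = setCell-same E (suc x) (suc y) tBump
      others : ∀ {i j} → ¬ (i ≡ x × j ≡ y) → G₁ (suc i) (suc j) ≡ E (suc i) (suc j)
      others h = setCell-other E (suc x) (suc y) tBump _ _ (suc-pair h)
      alike : AlikeGrids n E G₁
      alike {i} {j} p q with sameCell? i j x y
      ... | yes (refl , refl) = subst₂ Like (sym isX′) (sym isB) x→b
      ... | no h = like-≡ (sym (others h))
      only′ : OnlyBump n G₁ x y
      only′ {i} {j} p q e with sameCell? i j x y
      ... | yes h = h
      ... | no h = ⊥-elim (noBump p q (trans (sym (others h)) e))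
      count : suc (crossCount n G₁) ≡ crossCount n E
      count = trans (+-comm 1 _) (trans (cong (λ t → crossCount n G₁ + ind (isCross t)) (sym isX′))
        (trans (crossCount-update E G₁ x<n y<n λ _ _ h → others h)
        (trans (cong (λ t → crossCount n E + ind (isCross t)) isB) (+-identityʳ _))))
      build : (Σ Labels λ H₁ → Σ Labels λ V₁ → Valid n G₁ H₁ V₁) → Source
      build (H₁ , V₁ , W₁) = backward (<-wellFounded _) S (cong wn isB) exitsW post
        where
        module T = Toggle valid W₁ x<n y<n eu ev (λ p q h → cong bit (others h)) (trans (cong bit isB) (cong (not ∘ bit) (sym isX′)))
        new-exit : ∀ r → r < n → H₁ r n ≡ f r
        new-exit r l with r ≟ α | r ≟ β
        ... | yes refl | _ = trans (T.toggle-exit₂ l eα) (trans (sym eβ) at-β)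
        ... | no _ | yes refl = trans (T.toggle-exit₁ l eβ) (trans (sym eα) at-α)
        ... | no p | no q = unmoved (right valid l)
          where
          unmoved : (Σ ℕ λ w → H r n ≡ suc w) → H₁ r n ≡ f r
          unmoved (w , e) = trans (T.toggle-exit-other l
            (λ { refl → q (Frontier.exit-injective valid l β<n e eβ) })
            (λ { refl → p (Frontier.exit-injective valid l α<n e eα) }) e) (trans (sym e) (at-other l p q))
        exits₁ : exitList n H₁ ≡ ρ
        exits₁ = trans (listFrom-cong 0 n λ r _ l → new-exit r l) (sym ρ≡)
        S : State n ρ G₁ x y
        S = record
          { H = H₁ ; V = V₁ ; valid = W₁ ; only = only′ ; exits = exits₁ ; i<n = x<n ; j<n = y<n
          ; good = Inversions.count⇒good W₁ (suc-injective (trans count (trans (Inversions.good⇒count valid good)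
                     (trans (cong inv exits) (trans cover (cong (suc ∘ inv) (sym exits₁))))))) }
        exit-u : H₁ α n ≡ suc u
        exit-u = T.toggle-exit₂ α<n eα
        exit-v : H₁ β n ≡ suc v
        exit-v = T.toggle-exit₁ β<n eβ
        exitsW : ExitsW S
        exitsW l e = subst (_< k) (Frontier.exit-injective W₁ α<n l exit-u (trans e T.toggle-west)) α<k
        -- With the exits of `ρ` the pipes `u < v` leave in increasing order. A crossing with `u`
        -- from the west would invert them, one with `v` from the west would be bad.
        no-crossing : ∀ {i j} → ¬ Pipes.Crossing W₁ i j v u
        no-crossing (inj₂ X) = <-asym α<β (Order.crossing-inverts W₁ (State.good S) X α<n β<n exit-u exit-v)
        no-crossing (inj₁ X) = <-asym (Order.good-< W₁ (State.good S) X) u<v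
          where
          u<v : u < v
          u<v = ≤-pred (subst₂ _<_ (trans (sym at-β) eβ) (trans (sym at-α) eα) ascent)
        not-found : bumpCross n G₁ (suc x) (suc y) ≡ nothing
        not-found = go (bumpCross n G₁ (suc x) (suc y)) refl
          where
          go : ∀ m → bumpCross n G₁ (suc x) (suc y) ≡ m → bumpCross n G₁ (suc x) (suc y) ≡ nothing
          go nothing  e = e
          go (just z) e = ⊥-elim (absurd (Pipes.bumpCross-just W₁ x<n y<n isB T.toggle-west T.toggle-south e))
            where
            absurd : (Σ ℕ λ i → Σ ℕ λ j → z ≡ (suc i , suc j) × Pipes.Crossing W₁ i j v u) → ⊥
            absurd (_ , _ , _ , X) = no-crossing X
        post : PostRun G₁ x y
        post G₂ A = setCell G₂ (suc x) (suc y) tCross , agree back , λ m →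
            bumpStop m (eqTile-≡ isB₂) (trans (sym (bumpCross-agree S isB (agree-sym A))) not-found)
              -- Pipe `v` turns east at the bump and leaves from row `β`, counted from 0; `k ≤ β` is
              -- the stopping condition `k < suc β`.
              (Pipes.seExit-label (valid-agree (agree-sym A) W₁) x<n y<n (cong se isB₂) T.toggle-south β<n exit-v) (s≤s k≤β)
          where
          isB₂ : G₂ (suc x) (suc y) ≡ tBump
          isB₂ = trans (agrees A x<n y<n) isB
          back : ∀ {i j} → i < n → j < n → setCell G₂ (suc x) (suc y) tCross (suc i) (suc j) ≡ E (suc i) (suc j)
          back {i} {j} p q with sameCell? i j x y
          ... | yes (refl , refl) = trans (setCell-same G₂ (suc x) (suc y) tCross) (sym isX′)
          ... | no h = trans (setCell-other G₂ (suc x) (suc y) tCross (suc i) (suc j) (suc-pair h)) (trans (agrees A p q) (others h))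

  source : Source
  source = go (right valid α<n) (right valid β<n)
    where
    go : (Σ ℕ λ v → H α n ≡ suc v) → (Σ ℕ λ u → H β n ≡ suc u) → Source
    go (v , eα) (u , eβ) = from (Order.inversion-crosses valid (≤-pred (subst₂ _<_ (trans (sym at-β) eβ) (trans (sym at-α) eα) ascent)) β<n α<n eβ eα α<β)
      where
      from : (Σ ℕ λ x → Σ ℕ λ y → CrossAt n E H V x y u v) → Source
      from (x , y , X) = from-crossing-at eβ eα X

-- Bumpless pipe dreams in label form, and the identity.

inGrid-true : ∀ {n i j} → i < n → j < n → inGrid n (suc i) (suc j) ≡ true
inGrid-true p q rewrite <ᵇ-true p | <ᵇ-true q = refl

<ᵇ-sound : ∀ {m n} → (m <ᵇ n) ≡ true → m < n
<ᵇ-sound {zero}  {suc n} _ = s≤s z≤n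
<ᵇ-sound {suc m} {suc n} e = s≤s (<ᵇ-sound e)

inGrid-cell : ∀ n i j → inGrid n i j ≡ true → Σ ℕ λ i' → Σ ℕ λ j' → i ≡ suc i' × j ≡ suc j' × i' < n × j' < n
inGrid-cell n (suc i) (suc j) e with ∧-true {i <ᵇ n} e
... | p , q = i , j , refl , refl , <ᵇ-sound p , <ᵇ-sound q
inGrid-cell n (suc i) zero e with ∧-true {i <ᵇ n} e
... | _ , ()

six : ∀ {t} → any (eqTile t) bpdTiles ≡ true → Seven t × t ≢ tBump
six {t} e with any-true⁻¹ (eqTile t) bpdTiles e
... | x , l , q with eqTile-sound t x q
...   | refl = which l
  where
  which : ∀ {t} → t ∈ bpdTiles → Seven t × t ≢ tBump
  which (here refl) = blank , λ ()
  which (there (here refl)) = hor , λ ()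
  which (there (there (here refl))) = ver , λ ()
  which (there (there (there (here refl)))) = cross , λ ()
  which (there (there (there (there (here refl))))) = relb , λ ()
  which (there (there (there (there (there (here refl)))))) = jelb , λ ()

seven-six : ∀ {t} → Seven t → t ≢ tBump → t ∈ bpdTiles
seven-six blank h = here refl
seven-six hor   h = there (here refl)
seven-six ver   h = there (there (here refl))
seven-six cross h = there (there (there (here refl)))
seven-six relb  h = there (there (there (there (here refl))))
seven-six jelb  h = there (there (there (there (there (here refl)))))
seven-six bump  h = ⊥-elim (h refl)

length-range1 : ∀ n → length (range1 n) ≡ n
length-range1 n = trans (cong length (range1≡ n)) (length-listFrom n 1 _)

nth-listFrom : ∀ {n f r} → r < n → nth (listFrom 0 n f) (suc r) ≡ f r
nth-listFrom {n} {f} l = listFrom-injective n 0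
  (sym (subst (λ m → listFrom 0 n f ≡ listFrom 0 m (λ r → nth (listFrom 0 n f) (suc r))) (length-listFrom n 0 f) (nth-list (listFrom 0 n f)))) z≤n l

isBPD⇒bpd : ∀ {n π G} → IsPerm n π → IsBPD n π G → Bpd n π G
isBPD⇒bpd {n} {π} {G} perm I = build (matched⇒valid M)
  where
  open IsBPD I
  tile6 : ∀ {i j} → i < n → j < n → Seven (G (suc i) (suc j)) × G (suc i) (suc j) ≢ tBump
  tile6 p q = six (sixTiles _ _ (inGrid-true p q))
  M : Matched n G
  M = record
    { seven   = λ p q → proj₁ (tile6 p q)
    ; matchH  = λ p q → matchEW _ _ (s≤s z≤n) p (s≤s z≤n) q
    ; matchV  = λ p q → matchSN _ _ (s≤s z≤n) p (s≤s z≤n) q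
    ; leftM   = λ p → leftBdry _ (s≤s z≤n) p
    ; rightM  = λ p → rightBdry _ (s≤s z≤n) p
    ; topM    = λ p → topBdry _ (s≤s z≤n) p
    ; bottomM = λ p → bottomBdry _ (s≤s z≤n) p
    }
  build : (Σ Labels λ H → Σ Labels λ V → Valid n G H V) → Bpd n π G
  build (H , V , W) = record
    { H = H ; V = V ; valid = W ; good = Pipes.crossOnce⇒good W crossOnce ; noBump = λ p q → proj₂ (tile6 p q)
    ; exits = trans (listFrom-cong 0 n λ r _ l → value l (right W l))
        (sym (subst (λ m → π ≡ listFrom 0 m (λ r → nth π (suc r))) (trans (↭-length perm) (length-range1 n)) (nth-list π))) }
    where
    value : ∀ {r} → r < n → (Σ ℕ λ c → H r n ≡ suc c) → H r n ≡ nth π (suc r)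
    value {r} l (c , e) = go (exits (suc c) (s≤s z≤n) (Frontier.H-range W l ≤-refl e))
      where
      go : (Σ ℕ λ r' → (exitRow n G (suc c) ≡ just r') × (nth π r' ≡ suc c)) → H r n ≡ nth π (suc r)
      go (r' , p , q) with trans (sym (Trace.exitRow-label W l e)) p
      ... | refl = trans e (sym q)

bpd⇒isBPD : ∀ {n π G} → Bpd n π G → IsBPD n π G
bpd⇒isBPD {n} {π} {G} B = record
  { sixTiles   = λ i j e → tiles i j (inGrid-cell n i j e)
  ; matchEW    = λ { (suc i) (suc j) _ p _ q → matchH M p q }
  ; matchSN    = λ { (suc i) (suc j) _ p _ q → matchV M p q }
  ; leftBdry   = λ { (suc i) _ p → leftM M p }
  ; rightBdry  = λ { (suc i) _ p → rightM M p }
  ; topBdry    = λ { (suc j) _ p → topM M p }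
  ; bottomBdry = λ { (suc j) _ p → bottomM M p }
  ; exits      = λ { (suc c) _ p → exit (Frontier.exit-exists valid p) }
  ; crossOnce  = Pipes.good⇒crossOnce valid good
  }
  where
  open Bpd B
  M : Matched n G
  M = valid⇒matched valid
  tiles : ∀ i j → (Σ ℕ λ i' → Σ ℕ λ j' → i ≡ suc i' × j ≡ suc j' × i' < n × j' < n) → any (eqTile (G i j)) bpdTiles ≡ true
  tiles _ _ (i' , j' , refl , refl , p , q) = any-true (eqTile (G (suc i') (suc j'))) (seven-six (seven M p q) (noBump p q)) (eqTile-refl (G (suc i') (suc j')))
  exit : ∀ {c} → (Σ ℕ λ r → r < n × H r n ≡ suc c) → Σ ℕ λ r → (exitRow n G (suc c) ≡ just r) × (nth π r ≡ suc c)
  exit (r , l , e) = suc r , Trace.exitRow-label valid l e , trans (cong (λ xs → nth xs (suc r)) (sym exits)) (trans (nth-listFrom l) e)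

idPerm-list : ∀ n → listFrom 0 n suc ≡ idPerm n
idPerm-list n = sym (applyUpTo≡listFrom suc suc n 0 λ x → cong suc (sym (+-identityʳ x)))

idBPD-tile : ∀ {n i j} → i < n → j < n → idBPD n (suc i) (suc j) ≡ gridI (suc i) (suc j)
idBPD-tile p q rewrite <ᵇ-true p | <ᵇ-true q = refl

data Side (i j : ℕ) : Set where
  diag  : i ≡ j → Side i j
  under : j < i → Side i j
  over  : i < j → Side i j

side : ∀ i j → Side i j
side i j with <-cmp i j
... | tri< l _ _ = over l
... | tri≈ _ e _ = diag e
... | tri> _ _ l = under l

sideTile : ∀ {i j} → Side i j → Tile
sideTile (diag _)  = tR
sideTile (under _) = tVer
sideTile (over _) = tHor

gridI-side : ∀ {i j} (s : Side i j) → gridI (suc i) (suc j) ≡ sideTile s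
gridI-side {i} (diag refl) rewrite ≡ᵇ-true {i} refl = refl
gridI-side (under l) rewrite ≡ᵇ-false (<⇒≢ l ∘ sym) | <ᵇ-true l = refl
gridI-side (over l) rewrite ≡ᵇ-false (<⇒≢ l) | <ᵇ-false (<⇒≤ l) = refl

private
  idH idV : Labels
  idH i j = if i <ᵇ j then suc i else 0
  idV i j = if j <ᵇ i then suc j else 0

  idCell : ∀ {i j} (s : Side i j) → Cell (sideTile s) (idH i j) (idV (suc i) j) (idV i j) (idH i (suc j))
  idCell {i} (diag refl) rewrite <ᵇ-false {i} ≤-refl | <ᵇ-true (n<1+n i) = relb
  idCell {i} {j} (under l) rewrite <ᵇ-false (<⇒≤ l) | <ᵇ-true l | <ᵇ-true (m≤n⇒m≤1+n l) | <ᵇ-false l = ver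
  idCell {i} {j} (over l) rewrite <ᵇ-true l | <ᵇ-true (m≤n⇒m≤1+n l) | <ᵇ-false (<⇒≤ l) | <ᵇ-false l = hor

  sideTile≢ : ∀ {i j} (s : Side i j) → sideTile s ≢ tCross × sideTile s ≢ tBump × sideTile s ≢ tBlank
  sideTile≢ (diag _)  = (λ ()) , (λ ()) , (λ ())
  sideTile≢ (under _) = (λ ()) , (λ ()) , (λ ())
  sideTile≢ (over _) = (λ ()) , (λ ()) , (λ ())

  idTile : ∀ {n i j} → i < n → j < n → idBPD n (suc i) (suc j) ≡ sideTile (side i j)
  idTile {i = i} {j} p q = trans (idBPD-tile p q) (gridI-side (side i j))

idBPD-bpd : ∀ n → Bpd n (idPerm n) (idBPD n)
idBPD-bpd n = record
  { H = idH ; V = idV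
  ; valid = record
    { cell   = λ {i} {j} p q → subst (λ t → Cell t (idH i j) (idV (suc i) j) (idV i j) (idH i (suc j))) (sym (idTile p q)) (idCell (side i j))
    ; left   = λ {i} _ → cong (λ b → if b then suc i else 0) (<ᵇ-false {i} z≤n)
    ; bottom = λ {j} l → cong (λ b → if b then suc j else 0) (<ᵇ-true l)
    ; top    = λ {j} _ → cong (λ b → if b then suc j else 0) (<ᵇ-false {j} z≤n)
    ; right  = λ {i} l → i , cong (λ b → if b then suc i else 0) (<ᵇ-true l)
    }
  ; good   = λ {i} {j} p q e → ⊥-elim (proj₁ (sideTile≢ (side i j)) (trans (sym (idTile p q)) e))
  ; noBump = λ {i} {j} p q e → proj₁ (proj₂ (sideTile≢ (side i j))) (trans (sym (idTile p q)) e)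
  ; exits  = trans (listFrom-cong 0 n λ r _ l → cong (λ b → if b then suc r else 0) (<ᵇ-true l)) (idPerm-list n)
  }

idBPD-blanks : ∀ n {r} → r < n → blanks n (idBPD n) r ≡ 0
idBPD-blanks n {r} l = sumFrom-0 0 n λ j _ q → cong ind (not-true λ e →
  proj₂ (proj₂ (sideTile≢ (side r j))) (trans (sym (idTile l q)) (eqTile-sound (idBPD n (suc r) (suc j)) tBlank e)))

private
  inv-idPerm : ∀ n → inv (idPerm n) ≡ 0
  inv-idPerm n = trans (cong inv (sym (Bpd.exits (idBPD-bpd n)))) (trans (sym (Inversions.good⇒count (Bpd.valid (idBPD-bpd n)) (Bpd.good (idBPD-bpd n))))
    (sumFrom-0 0 n λ i _ p → sumFrom-0 0 n λ j _ q → cong ind (not-true λ e →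
      proj₁ (sideTile≢ (side i j)) (trans (sym (idTile p q)) (eqTile-sound (idBPD n (suc i) (suc j)) tCross e)))))

-- Without crosses two pipes never share a cell, so row i must be the i-th row of the identity, from the bottom up.
idBPD-unique : ∀ {n D} → Bpd n (idPerm n) D → Agree n (idBPD n) D
idBPD-unique {n} {D} B = agree λ {i} {j} p q → trans (idTile p q) (sym (tiles (n ∸ suc i) (m∸n+n≡m p) q (side i j)))
  where
  open Bpd B
  noCross : ∀ {i j} → i < n → j < n → D (suc i) (suc j) ≢ tCross
  noCross {i} {j} p q e = 1+n≢0 (trans (cong ind (sym (eqTile-≡ e)))
    (sumFrom-0⁻¹ 0 n (sumFrom-0⁻¹ 0 n (trans (Inversions.good⇒count valid good) (trans (cong inv exits) (inv-idPerm n))) i z≤n p) j z≤n q))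

  Real : ℕ → Set
  Real x = Σ ℕ λ c → x ≡ suc c

  RowBelow : ℕ → Set
  RowBelow i = (∀ {j} → j < n → j ≤ i → Real (V (suc i) j)) × (∀ {j} → j < n → i < j → V (suc i) j ≡ 0)

  both : ∀ {t W S N E} → Cell t W S N E → Real W → Real S → t ≢ tCross → t ≢ tBump → ⊥
  both cross _ _ h _ = h refl
  both bump  _ _ _ h = h refl
  both hor _ (_ , ()) _ _
  both ver (_ , ()) _ _ _
  both blank (_ , ()) _ _ _
  both relb (_ , ()) _ _ _
  both jelb _ (_ , ()) _ _

  turn : ∀ {t W S N E} → Cell t W S N E → W ≡ 0 → Real S → (t ≡ tVer × Real N × E ≡ 0) ⊎ (t ≡ tR × N ≡ 0 × Real E)
  turn ver  _ r = inj₁ (refl , r , refl)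
  turn relb _ r = inj₂ (refl , refl , r)
  turn blank _ (_ , ())
  turn jelb () _
  turn hor  () _
  turn cross () _
  turn bump () _

  straight : ∀ {t W S N E} → Cell t W S N E → Real W → S ≡ 0 → (t ≡ tHor × N ≡ 0 × Real E) ⊎ (E ≡ 0)
  straight hor  r _ = inj₁ (refl , refl , r)
  straight jelb _ _ = inj₂ refl
  straight blank _ _ = inj₂ refl

  noR : ∀ {t W S N E} → Cell t W S N E → S ≡ 0 → t ≢ tR
  noR relb () refl
  noR blank _ ()
  noR hor   _ ()
  noR jelb  _ ()

  module Row {i : ℕ} (i<n : i < n) (R : RowBelow i) where
    -- To the right of column `i` no pipe comes from below, so an empty edge there is never filled
    -- again, while the row needs an exit.
    dead : ∀ {x} → x ≤ n → i < x → H i x ≡ 0 → ⊥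
    dead x≤n l e = 0≢1+n (trans (sym (emptyRun valid i<n n e x≤n ≤-refl
      λ u v → noR (cell valid i<n v) (proj₂ R v (<-≤-trans l u)))) (proj₂ (right valid i<n)))

    mutual
      west0 : ∀ {j} → j ≤ i → H i j ≡ 0
      west0 {zero}  l = left valid i<n
      west0 {suc j} l = proj₂ (proj₂ (isVer l))

      isVer : ∀ {j} → j < i → D (suc i) (suc j) ≡ tVer × Real (V i j) × H i (suc j) ≡ 0
      isVer {j} l = go (turn (cell valid i<n j<n) (west0 (<⇒≤ l)) (proj₁ R j<n (<⇒≤ l)))
        where
        j<n : j < n
        j<n = <-trans l i<n
        go : (D (suc i) (suc j) ≡ tVer × Real (V i j) × H i (suc j) ≡ 0) ⊎ (D (suc i) (suc j) ≡ tR × V i j ≡ 0 × Real (H i (suc j))) →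
          D (suc i) (suc j) ≡ tVer × Real (V i j) × H i (suc j) ≡ 0
        go (inj₁ x) = x
        -- A turn before column `i` would run into the next column, where a pipe also comes from
        -- below; the two would need a cross or a bump.
        go (inj₂ (_ , _ , r)) = ⊥-elim (both (cell valid i<n (≤-<-trans l i<n)) r (proj₁ R (≤-<-trans l i<n) l)
          (noCross i<n (≤-<-trans l i<n)) (noBump i<n (≤-<-trans l i<n)))

    isR : D (suc i) (suc i) ≡ tR × V i i ≡ 0 × Real (H i (suc i))
    isR = go (turn (cell valid i<n i<n) (west0 ≤-refl) (proj₁ R i<n ≤-refl))
      where
      go : (D (suc i) (suc i) ≡ tVer × Real (V i i) × H i (suc i) ≡ 0) ⊎ (D (suc i) (suc i) ≡ tR × V i i ≡ 0 × Real (H i (suc i))) →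
        D (suc i) (suc i) ≡ tR × V i i ≡ 0 × Real (H i (suc i))
      go (inj₁ (_ , _ , e)) = ⊥-elim (dead i<n ≤-refl e)
      go (inj₂ x) = x

    mutual
      west1 : ∀ {j} → i < j → j ≤ n → Real (H i j)
      west1 {suc j} (s≤s l) q with m≤n⇒m<n∨m≡n l
      ... | inj₂ refl = proj₂ (proj₂ isR)
      ... | inj₁ k = proj₂ (proj₂ (isHor k q))

      isHor : ∀ {j} → i < j → j < n → D (suc i) (suc j) ≡ tHor × V i j ≡ 0 × Real (H i (suc j))
      isHor {j} l q = go (straight (cell valid i<n q) (west1 l (<⇒≤ q)) (proj₂ R q l))
        where
        go : (D (suc i) (suc j) ≡ tHor × V i j ≡ 0 × Real (H i (suc j))) ⊎ (H i (suc j) ≡ 0) →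
          D (suc i) (suc j) ≡ tHor × V i j ≡ 0 × Real (H i (suc j))
        go (inj₁ x) = x
        go (inj₂ e) = ⊥-elim (dead q (m≤n⇒m≤1+n l) e)

  rowBelow : ∀ d {i} → d + suc i ≡ n → RowBelow i
  rowBelow zero    refl = (λ {j} q _ → j , bottom valid q) , λ q l → ⊥-elim (<⇒≱ l (≤-pred q))
  rowBelow (suc d) {i} e = real , none
    where
    e′ : d + suc (suc i) ≡ n
    e′ = trans (+-suc d (suc i)) e
    i<n : suc i < n
    i<n = subst (suc (suc i) ≤_) e′ (m≤n+m _ d)
    module N = Row i<n (rowBelow d e′)
    real : ∀ {j} → j < n → j ≤ i → Real (V (suc i) j)
    real q l = proj₁ (proj₂ (N.isVer (s≤s l)))
    none : ∀ {j} → j < n → i < j → V (suc i) j ≡ 0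
    none q l with m≤n⇒m<n∨m≡n l
    ... | inj₁ k = proj₁ (proj₂ (N.isHor k q))
    ... | inj₂ refl = proj₁ (proj₂ N.isR)

  tiles : ∀ d {i j} → d + suc i ≡ n → j < n → (s : Side i j) → D (suc i) (suc j) ≡ sideTile s
  tiles d {i} e q s = byside s {q}
    where
    module N = Row (subst (suc i ≤_) e (m≤n+m (suc i) d)) (rowBelow d e)
    byside : ∀ {j} → (s : Side i j) → {_ : j < n} → D (suc i) (suc j) ≡ sideTile s
    byside (diag refl)   = proj₁ N.isR
    byside (under l)     = proj₁ (N.isVer l)
    byside (over l) {q} = proj₁ (N.isHor l q)

-- Insertions along a chain.

bpd-permOf : ∀ {n σ G} → Bpd n σ G → permOf n G ≡ σ
bpd-permOf B = trans (Pipes.permOf-exits (Bpd.valid B)) (Bpd.exits B)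

concatMap≡product : ∀ {A B C : Set} (f : A → B → C) xs ys → concatMap (λ x → map (f x) ys) xs ≡ cartesianProductWith f xs ys
concatMap≡product f []       ys = refl
concatMap≡product f (x ∷ xs) ys = cong (map (f x) ys ++_) (concatMap≡product f xs ys)

consLetter : ℕ → ℕ → Biword → Biword
consLetter k b Q = (b , k) ∷ Q

biword-∷ : ∀ k ks {b Q} → b < k → Q ∈ allBiwords ks → ((suc b , k) ∷ Q) ∈ allBiwords (k ∷ ks)
biword-∷ k ks {b} {Q} p q = subst (((suc b , k) ∷ Q) ∈_) (sym (concatMap≡product (consLetter k) (range1 k) (allBiwords ks)))
  (∈-cartesianProductWith⁺ (consLetter k) (∈-applyUpTo⁺ suc p) q)

biword-∷⁻¹ : ∀ k ks {b k' Q} → ((b , k') ∷ Q) ∈ allBiwords (k ∷ ks) → Σ ℕ λ b' → b ≡ suc b' × b' < k × Q ∈ allBiwords ks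
biword-∷⁻¹ k ks {b} {k'} {Q} l
  with ∈-cartesianProductWith⁻ (consLetter k) (range1 k) (allBiwords ks) (subst (((b , k') ∷ Q) ∈_) (concatMap≡product (consLetter k) (range1 k) (allBiwords ks)) l)
... | _ , _ , p , q , refl with ∈-applyUpTo⁻ suc p
...   | b' , b'<k , refl = b' , refl , b'<k , q

-- `allBiwords` bounds the letter by its label, and `k < b' ≤ n` from the cover puts its row inside
-- the grid. The length condition of the cover makes the stopped grid reduced, and `final-blanks`
-- accounts for one blank per letter.
forward-chain : ∀ {n ρ c π D Q E} → ChainFrom n ρ c π → Bpd n ρ D → RecFrom n D Q E c → Q ∈ allBiwords (map proj₁ c) →
  Bpd n π E × (∀ {r} → r < n → blanks n E r ≡ blanks n D r + countᵇ (λ bk → proj₁ bk ≡ᵇ suc r) Q)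
forward-chain ch-nil B rec-nil _ = B , λ _ → sym (+-identityʳ _)
forward-chain {n} {ρ} {D = D} {E = E} (ch-cons {c = cs} {π} (a , b' , _ , _ , k<b' , b'≤n , _ , cover) ch) B (rec-cons {b = b} {k} {D1} {Q} I R) l
  with biword-∷⁻¹ k (map proj₁ cs) l
... | b₀ , refl , b₀<k , l' = proj₁ rest , λ {r} p → trans (proj₂ rest p) (trans (cong (_+ count r Q) (final-blanks B b₀<n F p))
      (trans (+-assoc (blanks n D r) _ _) (cong (blanks n D r +_) (sym (trans (count-∷ _ (suc b₀ , k) Q) (cong (λ x → ind x + count r Q) (≡ᵇ-sym b₀ r)))))))
  where
  count : ℕ → Biword → ℕ
  count r = countᵇ (λ bk → proj₁ bk ≡ᵇ suc r)
  ≡ᵇ-sym : ∀ m n → (m ≡ᵇ n) ≡ (n ≡ᵇ m)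
  ≡ᵇ-sym zero    zero    = refl
  ≡ᵇ-sym zero    (suc n) = refl
  ≡ᵇ-sym (suc m) zero    = refl
  ≡ᵇ-sym (suc m) (suc n) = ≡ᵇ-sym m n
  b₀<n : b₀ < n
  b₀<n = <-trans b₀<k (<-≤-trans k<b' b'≤n)
  F : Final {n} {ρ} D b₀ D1
  F = insert⇒final B b₀<n I
  rest : Bpd n π E × (∀ {r} → r < n → blanks n E r ≡ blanks n D1 r + count r Q)
  rest = forward-chain {c = cs} ch (final-bpd B b₀<n F refl cover) R l'

∷-parts : ∀ {A : Set} {x y : A} {xs ys : List A} → _≡_ {A = List A} (x ∷ xs) (y ∷ ys) → x ≡ y × xs ≡ ys
∷-parts refl = refl , refl

-- The second recording has its own chain `c'` and an equation, since the index `permOf n D1` of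
-- `rec-cons` cannot be unified with that of another grid. Uniqueness is pulled back from the last
-- insertion to the first.
chain-injective : ∀ {n ρ c π D Q E c' D' Q' E'} → ChainFrom n ρ c π → Bpd n ρ D → Bpd n ρ D' → RecFrom n D Q E c →
  RecFrom n D' Q' E' c' → c' ≡ c → Q ∈ allBiwords (map proj₁ c) → Q' ∈ allBiwords (map proj₁ c) → Agree n E E' → Agree n D D' × Q ≡ Q'
chain-injective ch-nil B B' rec-nil rec-nil _ _ _ A = A , refl
chain-injective {n} {ρ} {D = D} {D' = D'} (ch-cons {c = cs} (a , b' , _ , _ , k<b' , b'≤n , _ , cover) ch) B B'
  (rec-cons {b = b} {k} {D1} {Q} I R) (rec-cons {b = b''} {k'} {D1'} {Q'} I' R') e l l' A
  with biword-∷⁻¹ k (map proj₁ cs) l | biword-∷⁻¹ k (map proj₁ cs) l' | ∷-parts e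
... | b₀ , refl , b₀<k , m | b₁ , refl , b₁<k , m' | e₁ , e₂ = last-step (chain-injective {c = cs} ch B₁ (subst (λ τ → Bpd n τ D1') (cong proj₂ e₁) B₁') R R' e₂ m m' A)
  where
  below-n : ∀ {x} → x < k → x < n
  below-n p = <-trans p (<-≤-trans k<b' b'≤n)
  F : Final {n} {ρ} D b₀ D1
  F = insert⇒final B (below-n b₀<k) I
  F' : Final {n} {ρ} D' b₁ D1'
  F' = insert⇒final B' (below-n b₁<k) I'
  B₁ : Bpd n (permOf n D1) D1
  B₁ = final-bpd B (below-n b₀<k) F refl cover
  B₁' : Bpd n (permOf n D1') D1'
  B₁' = final-bpd B' (below-n b₁<k) F' refl (trans (cong (inv ∘ proj₂) e₁) cover)
  last-step : Agree n D1 D1' × Q ≡ Q' → Agree n D D' × (suc b₀ , k) ∷ Q ≡ (suc b₁ , k') ∷ Q'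
  last-step (A₁ , refl) = finish (final-unique B (below-n b₀<k) B' (below-n b₁<k) B₁ F F' A₁) (cong proj₁ e₁)
    where
    finish : ∀ {x y k k'} → Agree n D D' × x ≡ y → k' ≡ k → Agree n D D' × _≡_ {A = Biword} ((suc x , k) ∷ Q) ((suc y , k') ∷ Q)
    finish (A₀ , refl) refl = A₀ , refl

-- The chain is undone from its end: the recursive call comes first and `CoverStep` supplies the
-- insertion before it. Runs are given for all `D'` agreeing with `D`, so that the result applies to
-- `idBPD n` itself.
chain-surjective : ∀ {n ρ c π E} → ChainFrom n ρ c π → length ρ ≡ n → Bpd n π E → Σ Grid λ D → Σ Biword λ Q → Bpd n ρ D ×
  Q ∈ allBiwords (map proj₁ c) × (∀ D' → Agree n D' D → Σ Grid λ E' → Agree n E' E × RecFrom n D' Q E' c)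
chain-surjective {E = E} ch-nil len B = E , [] , B , here refl , λ D' A → D' , A , rec-nil
chain-surjective {n} {ρ} {E = E} (ch-cons {σ = σ} {k} {c} {π} (suc α , suc β , _ , α<k , s≤s k≤β , β<n , σ≡ , cover) ch) len B =
  extend (chain-surjective ch (trans (cong length σ≡) (trans (length-swapAt ρ (suc α) (suc β)) len)) B)
  where
  Result : Set
  Result = Σ Grid λ D → Σ Biword λ Q → Bpd n ρ D ×
    Q ∈ allBiwords (k ∷ map proj₁ c) × (∀ D' → Agree n D' D → Σ Grid λ E' → Agree n E' E × RecFrom n D' Q E' ((k , σ) ∷ c))
  extend : (Σ Grid λ D → Σ Biword λ Q → Bpd n σ D ×
    Q ∈ allBiwords (map proj₁ c) × (∀ D' → Agree n D' D → Σ Grid λ E' → Agree n E' E × RecFrom n D' Q E' c)) → Result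
  extend (D₁ , Q , B₁ , l , runs) = prepend (CoverStep.source len B₁ α<k k≤β β<n σ≡ cover)
    where
    prepend : Backward.Source n k ρ D₁ → Result
    prepend (D , b , B₀ , b<k , b<n , ins) = D , (suc b , k) ∷ Q , B₀ , biword-∷ k (map proj₁ c) b<k l , steps
      where
      steps : ∀ D' → Agree n D' D → Σ Grid λ E' → Agree n E' E × RecFrom n D' ((suc b , k) ∷ Q) E' ((k , σ) ∷ c)
      steps D' A = go (ins D' A)
        where
        go : (Σ Grid λ D₁' → Agree n D₁' D₁ × Insert n D' (suc b) k D₁') → Σ Grid λ E' → Agree n E' E × RecFrom n D' ((suc b , k) ∷ Q) E' ((k , σ) ∷ c)
        go (D₁' , A₁ , I) = proj₁ r , proj₁ (proj₂ r) , subst (λ τ → RecFrom n D' ((suc b , k) ∷ Q) (proj₁ r) ((k , τ) ∷ c))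
            (bpd-permOf (bpd-agree (agree-sym A₁) B₁)) (rec-cons I (proj₂ (proj₂ r)))
          where
          r = runs D₁' A₁

private
  J≢B : ∀ t → eqTile t tJ ≡ true → eqTile t tBump ≡ true → ⊥
  J≢B t e f = case trans (sym (eqTile-sound t tJ e)) (eqTile-sound t tBump f) of λ ()

  Point : Set
  Point = Maybe (Grid × ℕ × ℕ)

insLoop-deterministic : ∀ {n k G i j E E'} → InsLoop n k G i j E → InsLoop n k G i j E' → E ≡ E'
insLoop-deterministic {n} {k} {G} {i} {j} L L' = go L L'
  where
  same-droop : ∀ {G₁ i₁ j₁ G₂ i₂ j₂} → minDroop n G i j ≡ just (G₁ , i₁ , j₁) → minDroop n G i j ≡ just (G₂ , i₂ , j₂) →
    _≡_ {A = Point} (just (G₁ , i₁ , j₁)) (just (G₂ , i₂ , j₂))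
  same-droop e e' = trans (sym e) e'
  go : ∀ {E E'} → InsLoop n k G i j E → InsLoop n k G i j E' → E ≡ E'
  go (jelbow e t m L) (jelbow e' t' m' L') with same-droop e e'
  ... | refl with trans (sym m) m'
  ...   | refl = insLoop-deterministic L L'
  go (jelbow {G1 = G₁} {i1} {j1} e t _ _) (bumpSwap e' t' _ _) with same-droop e e'
  ... | refl = ⊥-elim (J≢B (G₁ i1 j1) t t')
  go (jelbow {G1 = G₁} {i1} {j1} e t _ _) (bumpGo e' t' _ _ _ _) with same-droop e e'
  ... | refl = ⊥-elim (J≢B (G₁ i1 j1) t t')
  go (jelbow {G1 = G₁} {i1} {j1} e t _ _) (bumpStop e' t' _ _ _) with same-droop e e'
  ... | refl = ⊥-elim (J≢B (G₁ i1 j1) t t')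
  go (bumpSwap e t _ _) (jelbow {G1 = G₁} {i1} {j1} e' t' _ _) with same-droop e e'
  ... | refl = ⊥-elim (J≢B (G₁ i1 j1) t' t)
  go (bumpGo e t _ _ _ _) (jelbow {G1 = G₁} {i1} {j1} e' t' _ _) with same-droop e e'
  ... | refl = ⊥-elim (J≢B (G₁ i1 j1) t' t)
  go (bumpStop e t _ _ _) (jelbow {G1 = G₁} {i1} {j1} e' t' _ _) with same-droop e e'
  ... | refl = ⊥-elim (J≢B (G₁ i1 j1) t' t)
  go (bumpSwap e _ m L) (bumpSwap e' _ m' L') with same-droop e e'
  ... | refl with trans (sym m) m'
  ...   | refl = insLoop-deterministic L L'
  go (bumpSwap e _ m _) (bumpGo e' _ m' _ _ _) with same-droop e e'
  ... | refl = case trans (sym m) m' of λ ()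
  go (bumpSwap e _ m _) (bumpStop e' _ m' _ _) with same-droop e e'
  ... | refl = case trans (sym m) m' of λ ()
  go (bumpGo e _ m _ _ _) (bumpSwap e' _ m' _) with same-droop e e'
  ... | refl = case trans (sym m) m' of λ ()
  go (bumpStop e _ m _ _) (bumpSwap e' _ m' _) with same-droop e e'
  ... | refl = case trans (sym m) m' of λ ()
  go (bumpGo e _ _ _ _ L) (bumpGo e' _ _ _ _ L') with same-droop e e'
  ... | refl = insLoop-deterministic L L'
  go (bumpGo e _ _ x p _) (bumpStop e' _ _ x' p') with same-droop e e'
  ... | refl with trans (sym x) x'
  ...   | refl = ⊥-elim (<⇒≱ p' p)
  go (bumpStop e _ _ x p) (bumpGo e' _ _ x' p' _) with same-droop e e'
  ... | refl with trans (sym x) x'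
  ...   | refl = ⊥-elim (<⇒≱ p p')
  go (bumpStop e _ _ _ _) (bumpStop e' _ _ _ _) with same-droop e e'
  ... | refl = refl

recFrom-deterministic : ∀ {n D Q E c E' c'} → RecFrom n D Q E c → RecFrom n D Q E' c' → E ≡ E'
recFrom-deterministic rec-nil rec-nil = refl
recFrom-deterministic (rec-cons (j , m , L) R) (rec-cons (j' , m' , L') R') with trans (sym m) m'
... | refl with insLoop-deterministic L L'
...   | refl = recFrom-deterministic R R'

-- Matching the two enumerations.

filtered-∈ : ∀ {A : Set} {P : A → Set} {xs ys x} → Filtered P xs ys → x ∈ ys → x ∈ xs × P x
filtered-∈ (f-keep p F) (here refl) = here refl , p
filtered-∈ (f-keep p F) (there l) with filtered-∈ F l
... | m , q = there m , q
filtered-∈ (f-drop p F) l with filtered-∈ F l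
... | m , q = there m , q

∈-filtered : ∀ {A : Set} {P : A → Set} {xs ys x} → Filtered P xs ys → x ∈ xs → P x → x ∈ ys
∈-filtered (f-keep p F) (here refl) q = here refl
∈-filtered (f-keep p F) (there l)   q = there (∈-filtered F l q)
∈-filtered (f-drop p F) (here refl) q = ⊥-elim (p q)
∈-filtered (f-drop p F) (there l)   q = ∈-filtered F l q

filtered-unique : ∀ {A : Set} {P : A → Set} {xs ys} → Filtered P xs ys → Unique xs → Unique ys
filtered-unique f-nil u = u
filtered-unique (f-keep p F) (a ∷ u) = All.tabulate (λ l → All.lookup a (proj₁ (filtered-∈ F l))) ∷ filtered-unique F u
filtered-unique (f-drop p F) (a ∷ u) = filtered-unique F u

filtered-map : ∀ {A B : Set} {P : B → Set} (f : A → B) xs {ys} → Filtered P (map f xs) ys →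
  Σ (List A) λ zs → ys ≡ map f zs × Filtered (P ∘ f) xs zs
filtered-map f []       f-nil = [] , refl , f-nil
filtered-map f (x ∷ xs) (f-keep p F) with filtered-map f xs F
... | zs , refl , F' = x ∷ zs , refl , f-keep p F'
filtered-map f (x ∷ xs) (f-drop p F) with filtered-map f xs F
... | zs , e , F' = zs , e , f-drop p F'

unique-remove : ∀ {A : Set} {y : A} ps {qs} → Unique (ps ++ y ∷ qs) → ¬ (y ∈ ps ++ qs) × Unique (ps ++ qs)
unique-remove [] (a ∷ u) = (λ l → All.lookup a l refl) , u
unique-remove {y = y} (p ∷ ps) {qs} (a ∷ u) with unique-remove ps u
... | y∉ , u' = absent , All.tabulate (λ l → All.lookup a (insert l)) ∷ u'
  where
  absent : ¬ (y ∈ p ∷ ps ++ qs)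
  absent (here refl) = All.lookup a (∈-++⁺ʳ ps (here refl)) refl
  absent (there l)   = y∉ l
  insert : ∀ {x} → x ∈ ps ++ qs → x ∈ ps ++ y ∷ qs
  insert l with ∈-++⁻ ps l
  ... | inj₁ m = ∈-++⁺ˡ m
  ... | inj₂ m = ∈-++⁺ʳ ps (there m)

-- The partner of the head is cut out of the second list. Functionality and injectivity of `R`
-- ensure that the partners of all other elements lie in what is left, so the hypotheses persist.
matching : ∀ {A B C : Set} (R : A → B → Set) (f : A → C) (g : B → C) xs ys → Unique xs → Unique ys →
  (∀ {x} → x ∈ xs → Σ B λ y → y ∈ ys × R x y) → (∀ {y} → y ∈ ys → Σ A λ x → x ∈ xs × R x y) →
  (∀ {x y y'} → x ∈ xs → y ∈ ys → y' ∈ ys → R x y → R x y' → y ≡ y') →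
  (∀ {x x' y} → x ∈ xs → x' ∈ xs → y ∈ ys → R x y → R x' y → x ≡ x') →
  (∀ {x y} → x ∈ xs → y ∈ ys → R x y → f x ≡ g y) → map f xs ↭ map g ys
matching R f g [] [] _ _ _ _ _ _ _ = ↭-refl
matching R f g [] (y ∷ ys) _ _ _ to-x _ _ _ with to-x (here refl)
... | _ , () , _
matching {A} {B} R f g (x ∷ xs) ys (x∉ ∷ ux) uy to-y to-x fun inj eq with to-y (here refl)
... | y , y∈ , r with ∈-∃++ y∈
...   | ps , qs , refl = ↭-trans
        (↭-trans (↭-reflexive (cong (_∷ map f xs) (eq (here refl) y∈ r))) (prep (g y)
          (matching R f g xs (ps ++ qs) ux (proj₂ removed) to-y′ to-x′
            (λ a b c → fun (there a) (widen b) (widen c)) (λ a b c → inj (there a) (there b) (widen c)) (λ a b → eq (there a) (widen b)))))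
        (↭-sym (↭-trans (↭-reflexive (map-++ g ps (y ∷ qs))) (↭-trans (↭-shift (g y) (map g ps) (map g qs))
          (prep (g y) (↭-reflexive (sym (map-++ g ps qs)))))))
  where
  removed : ¬ (y ∈ ps ++ qs) × Unique (ps ++ qs)
  removed = unique-remove ps uy
  widen : ∀ {z} → z ∈ ps ++ qs → z ∈ ps ++ y ∷ qs
  widen l with ∈-++⁻ ps l
  ... | inj₁ m = ∈-++⁺ˡ m
  ... | inj₂ m = ∈-++⁺ʳ ps (there m)
  narrow : ∀ {z} → z ∈ ps ++ y ∷ qs → z ≢ y → z ∈ ps ++ qs
  narrow l ne with ∈-++⁻ ps l
  ... | inj₁ m = ∈-++⁺ˡ m
  ... | inj₂ (here e) = ⊥-elim (ne e)
  ... | inj₂ (there m) = ∈-++⁺ʳ ps m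
  to-y′ : ∀ {z} → z ∈ xs → Σ B λ w → w ∈ ps ++ qs × R z w
  to-y′ z∈ with to-y (there z∈)
  ... | w , w∈ , r' = w , narrow w∈ (λ { refl → All.lookup x∉ z∈ (inj (here refl) (there z∈) y∈ r r') }) , r'
  to-x′ : ∀ {w} → w ∈ ps ++ qs → Σ A λ z → z ∈ xs × R z w
  to-x′ w∈ with to-x (widen w∈)
  ... | z , there z∈ , r' = z , z∈ , r'
  ... | z , here refl , r' = ⊥-elim (proj₁ removed (subst (_∈ ps ++ qs) (fun (here refl) (widen w∈) y∈ r' r) w∈))

tileLists-unique : ∀ m → Unique (allTileLists m)
tileLists-unique zero    = All.[] ∷ []
tileLists-unique (suc m) = subst Unique (sym (concatMap≡product _∷_ bpdTiles (allTileLists m)))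
  (cartesianProductWith⁺ _∷_ ∷-parts tiles-unique (tileLists-unique m))
  where
  tiles-unique : Unique bpdTiles
  tiles-unique = ((λ ()) All.∷ (λ ()) All.∷ (λ ()) All.∷ (λ ()) All.∷ (λ ()) All.∷ All.[]) ∷
    ((λ ()) All.∷ (λ ()) All.∷ (λ ()) All.∷ (λ ()) All.∷ All.[]) ∷ ((λ ()) All.∷ (λ ()) All.∷ (λ ()) All.∷ All.[]) ∷
    ((λ ()) All.∷ (λ ()) All.∷ All.[]) ∷ ((λ ()) All.∷ All.[]) ∷ All.[] ∷ []

biwords-unique : ∀ ks → Unique (allBiwords ks)
biwords-unique []       = All.[] ∷ []
biwords-unique (k ∷ ks) = subst Unique (sym (concatMap≡product (consLetter k) (range1 k) (allBiwords ks)))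
  (cartesianProductWith⁺ (consLetter k) (λ e → cong proj₁ (proj₁ (∷-parts e)) , proj₂ (∷-parts e))
    (applyUpTo⁺₁ suc k (λ l _ e → <⇒≢ l (suc-injective e))) (biwords-unique ks))

tileList-∈ : ∀ ts → (∀ {t} → t ∈ ts → t ∈ bpdTiles) → ts ∈ allTileLists (length ts)
tileList-∈ []       h = here refl
tileList-∈ (t ∷ ts) h = subst ((t ∷ ts) ∈_) (sym (concatMap≡product _∷_ bpdTiles (allTileLists (length ts))))
  (∈-cartesianProductWith⁺ _∷_ (h (here refl)) (tileList-∈ ts (h ∘ there)))

tileList-length : ∀ m {ts} → ts ∈ allTileLists m → length ts ≡ m
tileList-length zero    (here refl) = refl
tileList-length (suc m) {ts} l
  with ∈-cartesianProductWith⁻ _∷_ bpdTiles (allTileLists m) (subst (ts ∈_) (concatMap≡product _∷_ bpdTiles (allTileLists m)) l)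
... | _ , _ , _ , q , refl = cong suc (tileList-length m q)

nthT-listFrom : ∀ {f : ℕ → Tile} n j {m} → m < n → nthT (listFrom j n f) m ≡ f (m + j)
nthT-listFrom (suc n) j {zero}  _       = refl
nthT-listFrom {f} (suc n) j {suc m} (s≤s l) = trans (nthT-listFrom n (suc j) l) (cong f (+-suc m j))

nthT-injective : ∀ ts ts' → length ts ≡ length ts' → (∀ {m} → m < length ts → nthT ts m ≡ nthT ts' m) → ts ≡ ts'
nthT-injective []       []         _ _ = refl
nthT-injective (t ∷ ts) (t' ∷ ts') e h =
  cong₂ _∷_ (h {0} (s≤s z≤n)) (nthT-injective ts ts' (suc-injective e) λ l → h (s≤s l))

∈-listFrom : ∀ {A : Set} {f : ℕ → A} n j {x} → x ∈ listFrom j n f → Σ ℕ λ m → m < j + n × x ≡ f m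
∈-listFrom (suc n) j (here refl) = j , m<m+n j (s≤s z≤n) , refl
∈-listFrom (suc n) j (there l) with ∈-listFrom n (suc j) l
... | m , p , e = m , subst (m <_) (sym (+-suc j n)) p , e

toGrid-tile : ∀ {n ts i j} → i < n → j < n → toGrid n ts (suc i) (suc j) ≡ nthT ts (i * n + j)
toGrid-tile p q rewrite <ᵇ-true p | <ᵇ-true q = refl

index< : ∀ {n i j} → i < n → j < n → i * n + j < n * n
index< {n} {i} {j} p q = <-≤-trans (+-monoʳ-< (i * n) q) (≤-trans (≤-reflexive (+-comm (i * n) n)) (*-monoˡ-≤ n p))

toTiles : ∀ {n E} → (∀ {i j} → i < n → j < n → E (suc i) (suc j) ∈ bpdTiles) →
  Σ (List Tile) λ ts → ts ∈ allTileLists (n * n) × Agree n (toGrid n ts) E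
toTiles {zero}  h = [] , here refl , agree λ ()
toTiles {suc k} {E} h = ts , subst (λ m → ts ∈ allTileLists m) (length-listFrom (n * n) 0 f) (tileList-∈ ts member) , agree tiles
  where
  n : ℕ
  n = suc k
  f : ℕ → Tile
  -- Row-major order: quotient and remainder invert the index `i * n + j` of `toGrid`.
  f m = E (suc (m / n)) (suc (m % n))
  ts : List Tile
  ts = listFrom 0 (n * n) f
  row<n : ∀ {m} → m < n * n → m / n < n
  row<n {m} l = *-cancelʳ-< n (m / n) n (≤-<-trans (m/n*n≤m m n) l)
  member : ∀ {t} → t ∈ ts → t ∈ bpdTiles
  member l with ∈-listFrom (n * n) 0 l
  ... | m , p , refl = h (row<n p) (m%n<n m n)
  tiles : ∀ {i j} → i < n → j < n → toGrid n ts (suc i) (suc j) ≡ E (suc i) (suc j)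
  tiles {i} {j} p q = trans (toGrid-tile {n} {ts} p q) (trans (nthT-listFrom (n * n) 0 (index< p q))
    (cong₂ (λ a b → E (suc a) (suc b)) row col))
    where
    m : ℕ
    m = i * n + j + 0
    m≡ : m ≡ j + i * n
    m≡ = trans (+-identityʳ _) (+-comm (i * n) j)
    col : m % n ≡ j
    col = trans (cong (_% n) m≡) (trans ([m+kn]%n≡m%n j i n) (m<n⇒m%n≡m q))
    row : m / n ≡ i
    row = *-cancelʳ-≡ (m / n) i n (+-cancelˡ-≡ j (m / n * n) (i * n)
      (trans (cong (_+ m / n * n) (sym col)) (trans (sym (m≡m%n+[m/n]*n m n)) m≡)))

toGrid-injective : ∀ {n ts ts'} → length ts ≡ n * n → length ts' ≡ n * n → Agree n (toGrid n ts) (toGrid n ts') → ts ≡ ts'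
toGrid-injective {zero} {[]} {[]} _ _ _ = refl
toGrid-injective {suc k} {ts} {ts'} e e' A = nthT-injective ts ts' (trans e (sym e')) λ {m} l → at m (subst (m <_) e l)
  where
  n : ℕ
  n = suc k
  at : ∀ m → m < n * n → nthT ts m ≡ nthT ts' m
  at m l = subst (λ x → nthT ts x ≡ nthT ts' x) (trans (+-comm (m / n * n) (m % n)) (sym (m≡m%n+[m/n]*n m n)))
    (trans (sym (toGrid-tile {n} {ts} row<n (m%n<n m n))) (trans (agrees A row<n (m%n<n m n)) (toGrid-tile {n} {ts'} row<n (m%n<n m n))))
    where
    row<n : m / n < n
    row<n = *-cancelʳ-< n (m / n) n (≤-<-trans (m/n*n≤m m n) l)

wtD-blanks : ∀ n G → wtD n G ≡ listFrom 0 n (blanks n G)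
wtD-blanks n G = trans (map-range1 (λ i → countᵇ (λ j → eqTile (G i j) tBlank) (range1 n)) n)
  (listFrom-cong 0 n λ i _ _ → count-range n (λ j → eqTile (G (suc i) j) tBlank))

agree-blanks : ∀ {n G G' i} → Agree n G G' → i < n → blanks n G i ≡ blanks n G' i
agree-blanks {n} A p = sumFrom-cong 0 n λ j _ q → cong (ind ∘ isBlank) (agrees A p q)

theorem3p11 : (n : ℕ) (π : List ℕ) → IsPerm n π → (c : Chain) → MixedKChain n π c →
    (Ds : List Grid) (Qs : List Biword) →
    Filtered (IsBPD n π) (allGrids n) Ds →
    Filtered (λ Q → Σ Grid (λ D → Recording n Q D c)) (allBiwords (map proj₁ c)) Qs →
    map (wtD n) Ds ↭ map (wtQ n) Qs
theorem3p11 n π perm c chain Ds Qs FD FQ = conclude (filtered-map (toGrid n) (allTileLists (n * n)) FD)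
  where
  Records : Biword → List Tile → Set
  Records Q ts = Σ Grid λ E → Recording n Q E c × Agree n E (toGrid n ts)

  conclude : (Σ (List (List Tile)) λ Ts → Ds ≡ map (toGrid n) Ts × Filtered (IsBPD n π ∘ toGrid n) (allTileLists (n * n)) Ts) →
    map (wtD n) Ds ↭ map (wtQ n) Qs
  conclude (Ts , refl , FT) = ↭-sym (↭-trans
      (matching Records (wtQ n) (wtD n ∘ toGrid n) Qs Ts (filtered-unique FQ (biwords-unique (map proj₁ c)))
        (filtered-unique FT (tileLists-unique (n * n))) to-tiles to-word functional injective weight)
      (↭-reflexive (map-∘ Ts)))
    where
    word-∈ : ∀ {Q} → Q ∈ Qs → Q ∈ allBiwords (map proj₁ c)
    word-∈ l = proj₁ (filtered-∈ FQ l)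

    len : ∀ {ts} → ts ∈ Ts → length ts ≡ n * n
    len l = tileList-length (n * n) (proj₁ (filtered-∈ FT l))

    to-tiles : ∀ {Q} → Q ∈ Qs → Σ (List Tile) λ ts → ts ∈ Ts × Records Q ts
    to-tiles {Q} l = go (filtered-∈ FQ l)
      where
      go : Q ∈ allBiwords (map proj₁ c) × (Σ Grid λ D → Recording n Q D c) → Σ (List Tile) λ ts → ts ∈ Ts × Records Q ts
      go (m , E , R) = found (toTiles {n} {E} λ p q → seven-six (cell-seven (cell (Bpd.valid B) p q)) (Bpd.noBump B p q))
        where
        B : Bpd n π E
        B = proj₁ (forward-chain {c = c} chain (idBPD-bpd n) R m)
        found : (Σ (List Tile) λ ts → ts ∈ allTileLists (n * n) × Agree n (toGrid n ts) E) → Σ (List Tile) λ ts → ts ∈ Ts × Records Q ts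
        found (ts , k , A) = ts , ∈-filtered FT k (bpd⇒isBPD (bpd-agree (agree-sym A) B)) , E , R , agree-sym A

    to-word : ∀ {ts} → ts ∈ Ts → Σ Biword λ Q → Q ∈ Qs × Records Q ts
    to-word {ts} l = go (chain-surjective {c = c} chain (length-range1 n) (isBPD⇒bpd perm (proj₂ (filtered-∈ FT l))))
      where
      go : (Σ Grid λ D → Σ Biword λ Q → Bpd n (idPerm n) D × Q ∈ allBiwords (map proj₁ c) ×
             (∀ D' → Agree n D' D → Σ Grid λ E' → Agree n E' (toGrid n ts) × RecFrom n D' Q E' c)) → Σ Biword λ Q → Q ∈ Qs × Records Q ts
      go (D , Q , B , m , runs) = Q , ∈-filtered FQ m (proj₁ r , proj₂ (proj₂ r)) , proj₁ r , proj₂ (proj₂ r) , proj₁ (proj₂ r)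
        where
        r = runs (idBPD n) (idBPD-unique B)

    functional : ∀ {Q ts ts'} → Q ∈ Qs → ts ∈ Ts → ts' ∈ Ts → Records Q ts → Records Q ts' → ts ≡ ts'
    functional _ l l' (E , R , A) (E' , R' , A') with recFrom-deterministic R R'
    ... | refl = toGrid-injective {n} (len l) (len l') (agree-trans (agree-sym A) A')

    injective : ∀ {Q Q' ts} → Q ∈ Qs → Q' ∈ Qs → ts ∈ Ts → Records Q ts → Records Q' ts → Q ≡ Q'
    injective l l' _ (E , R , A) (E' , R' , A') = proj₂ (chain-injective {c = c} chain (idBPD-bpd n) (idBPD-bpd n) R R' refl
      (word-∈ l) (word-∈ l') (agree-trans A (agree-sym A')))

    weight : ∀ {Q ts} → Q ∈ Qs → ts ∈ Ts → Records Q ts → wtQ n Q ≡ wtD n (toGrid n ts)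
    -- The identity has no blanks, so the blanks of a row are counted by the letters naming that
    -- row.
    weight {Q} {ts} l _ (E , R , A) = trans (map-range1 (λ i → countᵇ (λ bk → proj₁ bk ≡ᵇ i) Q) n)
      (trans (listFrom-cong 0 n λ r _ p → sym (trans (sym (agree-blanks A p)) (trans (proj₂ (forward-chain {c = c} chain (idBPD-bpd n) R (word-∈ l)) p)
               (cong (_+ countᵇ (λ bk → proj₁ bk ≡ᵇ suc r) Q) (idBPD-blanks n p)))))
             (sym (wtD-blanks n (toGrid n ts))))
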